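{- A finite directed graph $\vec H$ is impartial if and only if it is a disjoint union of recursively bridge-mirrored digraphs.
   Context: A digraph $\vec H$ has a finite vertex set $V(H)$ and edge set $E(\vec H)$ of ordered pairs $(u,v)$; $H$ denotes its underlying undirected graph and $|H|$ its number of vertices. A digraph $\vec H$ is called impartial if there is some $n \ge |H|$ such that all $n$-vertex tournaments contain the same number of copies of $\vec H$ as subgraphs (with orientations respected). A digraph is recursively bridge-mirrored if it can be built by the following rules: (i) the tree with one vertex is recursively bridge-mirrored; (ii) if $\vec T$ is recursively bridge-mirrored, mark an arbitrary vertex of $\vec T$ as its root, take two identical copies of this rooted $\vec T$, and add a new directed edge from one root to the other; the result is recursively bridge-mirrored.
   Formalization: The digraph is assumed to have no loops and no pair of opposite edges; otherwise, e.g., a directed 2-cycle has no copy in any tournament and so is impartial, but is not a disjoint union of recursively bridge-mirrored digraphs. -}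

module Defs where

open import Data.Nat using (ℕ; zero; suc; _+_; _≤_)
open import Data.Bool using (Bool; true; false; _∧_; _∨_; not)
open import Data.Bool.Properties using () renaming (_≟_ to _≟ᵇ_)
open import Data.Fin using (Fin; zero; suc; splitAt; _≟_)
open import Data.Sum using (_⊎_; inj₁; inj₂)
open import Data.Product using (Σ; ∃; _×_; _,_)
open import Data.List using (List; []; _∷_; map; concatMap; filterᵇ; length; allFin; deduplicate)
open import Data.Bool.ListAction using (all; any)
open import Data.List.Relation.Unary.All using (All)
open import Data.Vec using (Vec; tabulate)
import Data.Vec.Properties as VecP
import Data.Product.Properties as ProdP
open import Relation.Nullary using (¬_)
open import Relation.Nullary.Decidable using (⌊_⌋)
open import Relation.Binary.PropositionalEquality using (_≡_; _≢_)

record Digraph : Set where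
  constructor mkDigraph
  field
    size : ℕ
    edge : Fin size → Fin size → Bool
open Digraph public

-- No loops and no pair of opposite edges (underlying graph simple);
-- only such digraphs can occur as subgraphs of tournaments.
IsOriented : Digraph → Set
IsOriented H =
  (∀ u → edge H u u ≡ false) ×
  (∀ u v → edge H u v ≡ true → edge H v u ≡ false)

record _≅_ (G H : Digraph) : Set where
  field
    to      : Fin (size G) → Fin (size H)
    from    : Fin (size H) → Fin (size G)
    from∘to : ∀ u → from (to u) ≡ u
    to∘from : ∀ v → to (from v) ≡ v
    edge-iso : ∀ u v → edge G u v ≡ edge H (to u) (to v)

_⊕_ : Digraph → Digraph → Digraph
G ⊕ H = mkDigraph (size G + size H) e
  where
  e : Fin (size G + size H) → Fin (size G + size H) → Bool
  e u v with splitAt (size G) u | splitAt (size G) v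
  ... | inj₁ a | inj₁ b = edge G a b
  ... | inj₂ a | inj₂ b = edge H a b
  ... | _      | _      = false

emptyDigraph : Digraph
emptyDigraph = mkDigraph 0 (λ ())

⨁ : List Digraph → Digraph
⨁ []       = emptyDigraph
⨁ (G ∷ Gs) = G ⊕ ⨁ Gs

singleVertex : Digraph
singleVertex = mkDigraph 1 (λ _ _ → false)

mirror : (T : Digraph) → Fin (size T) → Digraph
mirror T r = mkDigraph (size T + size T) e
  where
  e : Fin (size T + size T) → Fin (size T + size T) → Bool
  e u v with splitAt (size T) u | splitAt (size T) v
  ... | inj₁ a | inj₁ b = edge T a b
  ... | inj₂ a | inj₂ b = edge T a b
  ... | inj₁ a | inj₂ b = ⌊ a ≟ r ⌋ ∧ ⌊ b ≟ r ⌋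
  ... | inj₂ _ | inj₁ _ = false

data RecBridgeMirrored : Digraph → Set where
  rbm-single : RecBridgeMirrored singleVertex
  rbm-mirror : ∀ {T} → RecBridgeMirrored T → (r : Fin (size T)) →
               RecBridgeMirrored (mirror T r)

IsDisjointUnionOfRBM : Digraph → Set
IsDisjointUnionOfRBM H =
  Σ (List Digraph) λ Ts → All RecBridgeMirrored Ts × (H ≅ ⨁ Ts)

record Tournament (n : ℕ) : Set where
  field
    arc     : Fin n → Fin n → Bool
    arc-irr : ∀ u → arc u u ≡ false
    arc-tot : ∀ u v → u ≢ v → arc u v ≡ not (arc v u)
open Tournament public

-- Counting copies of H in a tournament T.
-- A copy of H in T is a subgraph (S, F) of T (S a vertex set, F ⊆ arcs of
-- T inside S) isomorphic to H; equivalently the image (S,F) of an injective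
-- edge-preserving map φ : V(H) → V(T).  We enumerate all maps, keep the
-- embeddings, take their image subgraphs and count the distinct ones.

allMaps : (k n : ℕ) → List (Fin k → Fin n)
allMaps zero    n = (λ ()) ∷ []
allMaps (suc k) n =
  concatMap (λ f → map (λ a → cons a f) (allFin n)) (allMaps k n)
  where
  cons : Fin n → (Fin k → Fin n) → Fin (suc k) → Fin n
  cons a f zero    = a
  cons a f (suc i) = f i

allPairs : (k : ℕ) → List (Fin k × Fin k)
allPairs k = concatMap (λ i → map (λ j → (i , j)) (allFin k)) (allFin k)

isEmbedding : (H : Digraph) {n : ℕ} → Tournament n → (Fin (size H) → Fin n) → Bool
isEmbedding H T φ =
  all (λ { (i , j) → ⌊ i ≟ j ⌋ ∨ not ⌊ φ i ≟ φ j ⌋ }) (allPairs (size H)) ∧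
  all (λ { (i , j) → not (edge H i j) ∨ arc T (φ i) (φ j) }) (allPairs (size H))

Subgraph : ℕ → Set
Subgraph n = Vec Bool n × Vec (Vec Bool n) n

image : (H : Digraph) {n : ℕ} → (Fin (size H) → Fin n) → Subgraph n
image H {n} φ =
  ( tabulate (λ a → any (λ i → ⌊ φ i ≟ a ⌋) (allFin (size H)))
  , tabulate (λ a → tabulate (λ b →
      any (λ { (i , j) → edge H i j ∧ ⌊ φ i ≟ a ⌋ ∧ ⌊ φ j ≟ b ⌋ })
          (allPairs (size H)))) )

copies : (H : Digraph) {n : ℕ} → Tournament n → List (Subgraph n)
copies H {n} T =
  deduplicate (ProdP.≡-dec (VecP.≡-dec _≟ᵇ_) (VecP.≡-dec (VecP.≡-dec _≟ᵇ_)))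
    (map (image H) (filterᵇ (isEmbedding H T) (allMaps (size H) n)))

numCopies : (H : Digraph) {n : ℕ} → Tournament n → ℕ
numCopies H T = length (copies H T)

Impartial : Digraph → Set
Impartial H = Σ ℕ λ n → size H ≤ n ×
  ((T T′ : Tournament n) → numCopies H T ≡ numCopies H T′)

{-# OPTIONS --safe #-}
-- Up to factors that do not depend on the tournament, the number of copies of H in a tournament is the sum over all
-- injections φ of ∏ (1 + X(φ u, φ v)) over the edges uv of H, where X is the skew matrix of signs of the tournament.
-- If H is bridge-mirrored, exchanging the two halves cancels the contribution of the bridge, and inductively that of
-- every edge.
--
-- Conversely, the sum is affine in each entry of X, so if it is constant on sign matrices, it is constant on all integer
-- skew matrices.  Averaging over such matrices shows that the homomorphism sum of H in any weighted skew kernel of mass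
-- W is W^|H|.  For kernels divisible by a large Λ this passes to the components of H, because their sums are divisors of
-- W^|H| that are known modulo Λ.  If a component with k vertices had k edges, inclusion-exclusion over the vertices of a
-- kernel with odd Λ would give 2^k ∣ k!; so the components are trees.
--
-- For a tree S there are kernels of mass 1 that see among the trees of size at most h only one centroid-rooted tree C.
-- The sums of S over multiples of such a kernel form a polynomial, in which reversing an edge is visible only modulo 4.
-- Modulo 2, a linear coefficient appears unless the centroid of S is an edge between two halves of the same shape; hence
-- the halves have the same property and no vertex has two equal branches.  If the orientations of the halves differ,
-- the congruence modulo 4 is a relation modulo 2 between products of sums of the trees obtained by cutting S at the
-- edges of disagreement.  These trees are pairwise different, so that the largest of them has an unmatched linear
-- coefficient, or all of them are symmetric and square roots modulo 2 lead to a smaller relation.  So the halves agree;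
-- the sum of each is a square root of 1 congruent to 1 modulo Λ, and induction applies.

module Submission where

open import Defs
open import Function.Bundles using (_⇔_)
open import Function using (_∘_; id)
open import Data.Bool using (Bool; true; false; if_then_else_; _∧_; _∨_; not)
open import Data.Bool.Properties using (∨-zeroʳ; ∧-zeroʳ)
open import Data.Nat as ℕ using (ℕ; zero; suc; _+_; _*_; _∸_; _^_; _≤_; _<_; z≤n; s≤s)
open import Data.Nat.Properties as ℕₚ using (≤-refl; ≤-trans; <-irrefl; <-cmp)
open import Data.Integer as ℤ using (ℤ; +_; -[1+_]; 0ℤ; 1ℤ; -1ℤ) renaming (_+_ to infixl 6 _⊹_; _*_ to infixl 7 _·_; -_ to infix 8 ⊖_)
open import Data.Integer.Properties as ℤₚ using ()
open import Data.Integer.Tactic.RingSolver using (solve-∀)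
open import Data.Fin as Fin using (Fin; zero; suc; splitAt; _↑ˡ_; _↑ʳ_; punchIn; punchOut)
open import Data.Fin.Properties as Finₚ using ()
open import Data.List using (cartesianProduct; List; []; _∷_; _++_; map; concatMap; length; allFin; tabulate; filterᵇ; deduplicate)
open import Data.List.Properties as Listₚ using ()
open import Data.List.Membership.Propositional using (_∈_; _∉_; find)
open import Data.List.Membership.Propositional.Properties using (∈-++⁺ˡ; ∈-++⁺ʳ; ∈-++⁻; ∈-map⁺; ∈-map⁻; ∈-∃++; ∈-allFin; ∈-tabulate⁻; ∈-tabulate⁺; ∈-insert; ∈-concatMap⁺; ∈-concatMap⁻; ∈-deduplicate⁺; ∈-deduplicate⁻)
open import Data.List.Relation.Unary.Any as Any using (Any; here; there)
open import Data.List.Relation.Unary.All as All using (All; []; _∷_)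
open import Data.List.Relation.Unary.All.Properties as Allₚ using ()
open import Data.List.Relation.Unary.AllPairs as AllPairs using (AllPairs; []; _∷_)
open import Data.List.Relation.Unary.AllPairs.Properties as AllPairsₚ using ()
open import Data.List.Relation.Unary.Unique.Propositional using (Unique)
open import Data.List.Relation.Unary.Unique.Propositional.Properties as Uniqueₚ using ()
open import Data.List.Relation.Binary.Permutation.Propositional using (_↭_; ↭-refl; ↭-sym; ↭-trans; ↭-prep; ↭-swap; ↭-reflexive)
open import Data.List.Relation.Binary.Permutation.Propositional.Properties using (∈-resp-↭; All-resp-↭; ↭-length; shift; ++⁺ˡ; ++-comm) renaming (++⁺ to ++⁺↭)
open import Data.Product using (_×_; _,_; proj₁; proj₂; ∃-syntax)
open import Data.Sum using (_⊎_; inj₁; inj₂; [_,_])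
open import Data.Empty using (⊥; ⊥-elim)
open import Data.Unit using (⊤; tt)
open import Relation.Nullary using (¬_; Dec; yes; no; contradiction)
open import Relation.Nullary.Decidable using (⌊_⌋; _×-dec_; _⊎-dec_; ¬?)
open import Relation.Binary using (tri<; tri≈; tri>; DecidableEquality)
open import Relation.Binary.PropositionalEquality using (_≡_; _≢_; refl; sym; trans; cong; cong₂; subst)
open import Induction.WellFounded using (Acc; acc)
open import Data.Nat.Induction using (<-wellFounded)
open import Data.List.Membership.DecPropositional ℕ._≟_ using (_∈?_)
open import Data.Bool.ListAction using (all; any)
import Data.Bool.Properties as Boolₚ
import Data.Vec as Vec
import Data.Vec.Properties as Vecₚ
import Data.Product.Properties as Prodₚ
open import Data.List.Relation.Unary.Unique.DecPropositional.Properties using (deduplicate-!)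
open import Data.Nat.Tactic.RingSolver using () renaming (solve-∀ to ℕ-solve)
open import Function.Bundles using (mk⇔)

-- The obstacle is skewness. Exchanging the halves of a tree whose central edge joins two halves of
-- one shape changes the sign of its multilinear functional, so this functional is 0 for every
-- kernel. Kernels can single out only trees with a preferred root, and `CanC` is chosen such that a
-- tree has none exactly when it splits into two halves of one shape. Symmetric trees are reached
-- only indirectly: their sums are squares modulo 2, and a polynomial over the field with two
-- elements is a square exactly when its coefficients of odd degree vanish. For this reason
-- congruences are stated between polynomials in the multiplicity of the detecting kernel; evenness
-- of all values would say nothing about coefficients.
--
-- The modulus Λ = 2 h^h + 1 has three tasks. It exceeds 2 h^h, so a divisor of m^(a+b) is
-- determined by its residue; it does not divide 2, so the sign of a square root of 1 is determined;
-- it is odd, so 1 + Λ and 1 - Λ are even.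

private variable
  X₁ X₂ X₃ : Set

-- Finite sums and products

∑ : List X₁ → (X₁ → ℤ) → ℤ
∑ []       f = 0ℤ
∑ (x ∷ xs) f = f x ⊹ ∑ xs f

∏ : List X₁ → (X₁ → ℤ) → ℤ
∏ []       f = 1ℤ
∏ (x ∷ xs) f = f x · ∏ xs f

∑-cong∈ : (xs : List X₁) {f g : X₁ → ℤ} → (∀ x → x ∈ xs → f x ≡ g x) → ∑ xs f ≡ ∑ xs g
∑-cong∈ []       h = refl
∑-cong∈ (x ∷ xs) h = cong₂ _⊹_ (h x (here refl)) (∑-cong∈ xs (λ y y∈ → h y (there y∈)))

∑-cong : (xs : List X₁) {f g : X₁ → ℤ} → (∀ x → f x ≡ g x) → ∑ xs f ≡ ∑ xs g
∑-cong xs h = ∑-cong∈ xs (λ x _ → h x)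

∑-zero : (xs : List X₁) → ∑ xs (λ _ → 0ℤ) ≡ 0ℤ
∑-zero []       = refl
∑-zero (x ∷ xs) = trans (ℤₚ.+-identityˡ _) (∑-zero xs)

∑-vanish : (xs : List X₁) {f : X₁ → ℤ} → (∀ x → x ∈ xs → f x ≡ 0ℤ) → ∑ xs f ≡ 0ℤ
∑-vanish xs h = trans (∑-cong∈ xs h) (∑-zero xs)

interchange : ∀ a b c d → (a ⊹ b) ⊹ (c ⊹ d) ≡ (a ⊹ c) ⊹ (b ⊹ d)
interchange = solve-∀

∑-+ : (xs : List X₁) (f g : X₁ → ℤ) → ∑ xs (λ x → f x ⊹ g x) ≡ ∑ xs f ⊹ ∑ xs g
∑-+ []       f g = refl
∑-+ (x ∷ xs) f g = trans (cong (f x ⊹ g x ⊹_) (∑-+ xs f g)) (interchange (f x) (g x) _ _)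

∑-* : (xs : List X₁) (c : ℤ) (f : X₁ → ℤ) → ∑ xs (λ x → c · f x) ≡ c · ∑ xs f
∑-* []       c f = sym (ℤₚ.*-zeroʳ c)
∑-* (x ∷ xs) c f = trans (cong (c · f x ⊹_) (∑-* xs c f)) (sym (ℤₚ.*-distribˡ-+ c _ _))

∑-*ʳ : (xs : List X₁) (c : ℤ) (f : X₁ → ℤ) → ∑ xs (λ x → f x · c) ≡ ∑ xs f · c
∑-*ʳ xs c f = trans (∑-cong xs (λ x → ℤₚ.*-comm (f x) c)) (trans (∑-* xs c f) (ℤₚ.*-comm c _))

∑-neg : (xs : List X₁) (f : X₁ → ℤ) → ∑ xs (λ x → ⊖ f x) ≡ ⊖ ∑ xs f
∑-neg []       f = refl
∑-neg (x ∷ xs) f = trans (cong (⊖ f x ⊹_) (∑-neg xs f)) (sym (ℤₚ.neg-distrib-+ (f x) _))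

∑-swap : (xs : List X₁) (ys : List X₂) (f : X₁ → X₂ → ℤ) →
         ∑ xs (λ x → ∑ ys (f x)) ≡ ∑ ys (λ y → ∑ xs (λ x → f x y))
∑-swap []       ys f = sym (∑-zero ys)
∑-swap (x ∷ xs) ys f = trans (cong (∑ ys (f x) ⊹_) (∑-swap xs ys f)) (sym (∑-+ ys (f x) _))

∑-++ : (xs ys : List X₁) (f : X₁ → ℤ) → ∑ (xs ++ ys) f ≡ ∑ xs f ⊹ ∑ ys f
∑-++ []       ys f = sym (ℤₚ.+-identityˡ _)
∑-++ (x ∷ xs) ys f = trans (cong (f x ⊹_) (∑-++ xs ys f)) (sym (ℤₚ.+-assoc (f x) _ _))

∑-map : (h : X₁ → X₂) (xs : List X₁) (f : X₂ → ℤ) → ∑ (map h xs) f ≡ ∑ xs (f ∘ h)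
∑-map h []       f = refl
∑-map h (x ∷ xs) f = cong (f (h x) ⊹_) (∑-map h xs f)

∑-concatMap : (h : X₁ → List X₂) (xs : List X₁) (f : X₂ → ℤ) →
              ∑ (concatMap h xs) f ≡ ∑ xs (λ x → ∑ (h x) f)
∑-concatMap h []       f = refl
∑-concatMap h (x ∷ xs) f = trans (∑-++ (h x) _ f) (cong (∑ (h x) f ⊹_) (∑-concatMap h xs f))

∑-↭ : {xs ys : List X₁} → xs ↭ ys → (f : X₁ → ℤ) → ∑ xs f ≡ ∑ ys f
∑-↭ _↭_.refl         f = refl
∑-↭ (_↭_.prep x p)   f = cong (f x ⊹_) (∑-↭ p f)
∑-↭ (_↭_.swap x y p) f = trans (cong (λ z → f x ⊹ (f y ⊹ z)) (∑-↭ p f)) (lem (f x) (f y) _)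
  where
  lem : ∀ a b c → a ⊹ (b ⊹ c) ≡ b ⊹ (a ⊹ c)
  lem = solve-∀
∑-↭ (_↭_.trans p q)  f = trans (∑-↭ p f) (∑-↭ q f)

∑∑-* : (xs : List X₁) (ys : List X₂) (f : X₁ → ℤ) (g : X₂ → ℤ) →
       ∑ xs (λ x → ∑ ys (λ y → f x · g y)) ≡ ∑ xs f · ∑ ys g
∑∑-* xs ys f g = trans (∑-cong xs (λ x → ∑-* ys (f x) g)) (∑-*ʳ xs _ f)

∏-cong∈ : (xs : List X₁) {f g : X₁ → ℤ} → (∀ x → x ∈ xs → f x ≡ g x) → ∏ xs f ≡ ∏ xs g
∏-cong∈ []       h = refl
∏-cong∈ (x ∷ xs) h = cong₂ _·_ (h x (here refl)) (∏-cong∈ xs (λ y y∈ → h y (there y∈)))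

∏-++ : (xs ys : List X₁) (f : X₁ → ℤ) → ∏ (xs ++ ys) f ≡ ∏ xs f · ∏ ys f
∏-++ []       ys f = sym (ℤₚ.*-identityˡ _)
∏-++ (x ∷ xs) ys f = trans (cong (f x ·_) (∏-++ xs ys f)) (sym (ℤₚ.*-assoc (f x) _ _))

∏-map : (h : X₁ → X₂) (xs : List X₁) (f : X₂ → ℤ) → ∏ (map h xs) f ≡ ∏ xs (f ∘ h)
∏-map h []       f = refl
∏-map h (x ∷ xs) f = cong (f (h x) ·_) (∏-map h xs f)

∏-one : (xs : List X₁) → ∏ xs (λ _ → 1ℤ) ≡ 1ℤ
∏-one []       = refl
∏-one (x ∷ xs) = trans (ℤₚ.*-identityˡ _) (∏-one xs)

∏-zero : (xs : List X₁) {f : X₁ → ℤ} {x : X₁} → x ∈ xs → f x ≡ 0ℤ → ∏ xs f ≡ 0ℤ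
∏-zero (x ∷ xs) (here refl) e rewrite e = refl
∏-zero (x ∷ xs) {f} (there m) e = trans (cong (f x ·_) (∏-zero xs m e)) (ℤₚ.*-zeroʳ (f x))

∏-↭ : {xs ys : List X₁} → xs ↭ ys → (f : X₁ → ℤ) → ∏ xs f ≡ ∏ ys f
∏-↭ _↭_.refl         f = refl
∏-↭ (_↭_.prep x p)   f = cong (f x ·_) (∏-↭ p f)
∏-↭ (_↭_.swap x y p) f = trans (cong (λ z → f x · (f y · z)) (∏-↭ p f)) (lem (f x) (f y) _)
  where
  lem : ∀ a b c → a · (b · c) ≡ b · (a · c)
  lem = solve-∀
∏-↭ (_↭_.trans p q)  f = trans (∏-↭ p f) (∏-↭ q f)

𝟙 : Bool → ℤ
𝟙 true  = 1ℤ
𝟙 false = 0ℤ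

-- Lists without repetition

unique-⊆-split : {xs ys : List X₁} → Unique xs → (∀ {x} → x ∈ xs → x ∈ ys) → ∃[ zs ] (ys ↭ xs ++ zs)
unique-⊆-split {xs = []} {ys} u s = ys , ↭-refl
unique-⊆-split {xs = x ∷ xs} {ys} (x∉ ∷ u) s with ∈-∃++ (s (here refl))
... | as , bs , refl with unique-⊆-split {ys = as ++ bs} u sub
  where
  sub : ∀ {z} → z ∈ xs → z ∈ as ++ bs
  sub z∈ with ∈-++⁻ as (s (there z∈))
  ... | inj₁ m         = ∈-++⁺ˡ m
  ... | inj₂ (here refl) = contradiction refl (All.lookup x∉ z∈)
  ... | inj₂ (there m) = ∈-++⁺ʳ as m
... | zs , p = zs , ↭-trans (shift x as bs) (↭-prep x p)

unique-⊆⇒≤ : {xs ys : List X₁} → Unique xs → (∀ {x} → x ∈ xs → x ∈ ys) → length xs ≤ length ys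
unique-⊆⇒≤ {xs = xs} u s with unique-⊆-split u s
... | zs , p rewrite ↭-length p | Listₚ.length-++ xs {zs} = ℕₚ.m≤m+n _ _

-- Pigeonhole principle: nothing can remain of `ys` after the removal of `xs`. Bijectivity of
-- injective maps and equality of vertex or arc lists are derived from it below.
unique-⊆-full⇒↭ : {xs ys : List X₁} → Unique xs → (∀ {x} → x ∈ xs → x ∈ ys) → length ys ≤ length xs → ys ↭ xs
unique-⊆-full⇒↭ {xs = xs} u s le with unique-⊆-split u s
... | []     , p = ↭-trans p (↭-reflexive (Listₚ.++-identityʳ xs))
... | z ∷ zs , p = contradiction (subst (_≤ length xs) (trans (↭-length p) (trans (Listₚ.length-++ xs) (ℕₚ.+-suc _ _))) le)
                     (ℕₚ.<⇒≱ (s≤s (ℕₚ.m≤m+n _ _)))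

unique-++ : {xs ys : List X₁} → Unique xs → Unique ys → (∀ {x} → x ∈ xs → x ∈ ys → ⊥) → Unique (xs ++ ys)
unique-++ {xs = []}     []      v d = v
unique-++ {xs = x ∷ xs} (a ∷ u) v d =
  Allₚ.++⁺ a (All.tabulate (λ y∈ e → d (here refl) (subst (_∈ _) (sym e) y∈))) ∷ unique-++ u v (λ p q → d (there p) q)

unique-++⁻ : (xs : List X₁) {ys : List X₁} → Unique (xs ++ ys) → Unique xs × Unique ys × (∀ {x} → x ∈ xs → x ∈ ys → ⊥)
unique-++⁻ []       u = [] , u , (λ ())
unique-++⁻ (x ∷ xs) (a ∷ u) with unique-++⁻ xs u
... | u₁ , u₂ , d = Allₚ.++⁻ˡ xs a ∷ u₁ , u₂ ,
      λ { (here refl) q → All.lookup (Allₚ.++⁻ʳ xs a) q refl ; (there p) q → d p q }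

unique-↭ : {xs ys : List X₁} → xs ↭ ys → Unique xs → Unique ys
unique-↭ _↭_.refl         u = u
unique-↭ (_↭_.prep x p)   (a ∷ u) = All-resp-↭ p a ∷ unique-↭ p u
unique-↭ (_↭_.swap x y p) ((xy ∷ a) ∷ b ∷ u) =
  ((λ e → xy (sym e)) ∷ All-resp-↭ p b) ∷ All-resp-↭ p a ∷ unique-↭ p u
unique-↭ (_↭_.trans p q)  u = unique-↭ q (unique-↭ p u)

yes! : ∀ {ℓ} {A : Set ℓ} (d : Dec A) → A → ⌊ d ⌋ ≡ true
yes! (yes _) a = refl
yes! (no n)  a = contradiction a n

no! : ∀ {ℓ} {A : Set ℓ} (d : Dec A) → ¬ A → ⌊ d ⌋ ≡ false
no! (yes a) n = contradiction a n
no! (no _)  n = refl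

yes⁻ : ∀ {ℓ} {A : Set ℓ} (d : Dec A) → ⌊ d ⌋ ≡ true → A
yes⁻ (yes a) e = a

-- Codes of rooted shapes

-- A code is the sorted list of the codes of the children.

data Code : Set where
  nil  : Code
  cons : Code → Code → Code

data _<ᶜ_ : Code → Code → Set where
  nil< : ∀ {a b} → nil <ᶜ cons a b
  fst< : ∀ {a b c d} → a <ᶜ c → cons a b <ᶜ cons c d
  snd< : ∀ {a b d} → b <ᶜ d → cons a b <ᶜ cons a d

<ᶜ-irrefl : ∀ {a} → ¬ (a <ᶜ a)
<ᶜ-irrefl (fst< p) = <ᶜ-irrefl p
<ᶜ-irrefl (snd< p) = <ᶜ-irrefl p

<ᶜ-trans : ∀ {a b c} → a <ᶜ b → b <ᶜ c → a <ᶜ c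
<ᶜ-trans nil<     (fst< q) = nil<
<ᶜ-trans nil<     (snd< q) = nil<
<ᶜ-trans (fst< p) (fst< q) = fst< (<ᶜ-trans p q)
<ᶜ-trans (fst< p) (snd< q) = fst< p
<ᶜ-trans (snd< p) (fst< q) = fst< q
<ᶜ-trans (snd< p) (snd< q) = snd< (<ᶜ-trans p q)

data Cmp (a b : Code) : Set where
  lt : a <ᶜ b → Cmp a b
  eq : a ≡ b → Cmp a b
  gt : b <ᶜ a → Cmp a b

cmp : ∀ a b → Cmp a b
cmp nil        nil        = eq refl
cmp nil        (cons c d) = lt nil<
cmp (cons a b) nil        = gt nil<
cmp (cons a b) (cons c d) with cmp a c
... | lt p = lt (fst< p)
... | gt p = gt (fst< p)
... | eq refl with cmp b d
...   | lt p    = lt (snd< p)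
...   | gt p    = gt (snd< p)
...   | eq refl = eq refl

_≟ᶜ_ : DecidableEquality Code
a ≟ᶜ b with cmp a b
... | lt p = no λ { refl → <ᶜ-irrefl p }
... | eq e = yes e
... | gt p = no λ { refl → <ᶜ-irrefl p }

ins : Code → Code → Code
ins x nil = cons x nil
ins x (cons y l) with cmp x y
... | lt _ = cons x (cons y l)
... | eq _ = cons x (cons y l)
... | gt _ = cons y (ins x l)

-- Meant as a left inverse of `ins x`; on a list without `x` it may drop another entry. Since
-- `del-ins` and `ins-comm` hold for arbitrary lists, no invariant of sortedness has to be carried.
del : Code → Code → Code
del x nil = nil
del x (cons y l) with cmp x y
... | lt _ = l
... | eq _ = l
... | gt _ = cons y (del x l)

del-ins : ∀ x l → del x (ins x l) ≡ l
del-ins x nil with cmp x x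
... | lt _ = refl
... | eq _ = refl
... | gt p = contradiction p <ᶜ-irrefl
del-ins x (cons y l) with cmp x y in e
del-ins x (cons y l) | lt _ with cmp x x
... | lt _ = refl
... | eq _ = refl
... | gt p = contradiction p <ᶜ-irrefl
del-ins x (cons y l) | eq _ with cmp x x
... | lt _ = refl
... | eq _ = refl
... | gt p = contradiction p <ᶜ-irrefl
del-ins x (cons y l) | gt _ rewrite e = cong (cons y) (del-ins x l)

ins-cancelˡ : ∀ x {l m} → ins x l ≡ ins x m → l ≡ m
ins-cancelˡ x {l} {m} e = trans (sym (del-ins x l)) (trans (cong (del x) e) (del-ins x m))

ins-head : ∀ x y l → ¬ (y <ᶜ x) → ins x (cons y l) ≡ cons x (cons y l)
ins-head x y l n with cmp x y
... | lt _ = refl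
... | eq _ = refl
... | gt p = contradiction p n

ins-tail : ∀ x y l → y <ᶜ x → ins x (cons y l) ≡ cons y (ins x l)
ins-tail x y l p with cmp x y
... | lt q = contradiction (<ᶜ-trans p q) <ᶜ-irrefl
... | eq refl = contradiction p <ᶜ-irrefl
... | gt _ = refl

<⇒≯ : ∀ {a b} → a <ᶜ b → ¬ (b <ᶜ a)
<⇒≯ p q = <ᶜ-irrefl (<ᶜ-trans p q)

ins-comm< : ∀ x y l → x <ᶜ y → ins x (ins y l) ≡ ins y (ins x l)
ins-comm< x y nil p = trans (ins-head x y nil (<⇒≯ p)) (sym (ins-tail y x nil p))
ins-comm< x y (cons z l) p = go (cmp y z) (cmp x z)
  where
  low : ¬ (z <ᶜ y) → ¬ (z <ᶜ x) → ins x (ins y (cons z l)) ≡ ins y (ins x (cons z l))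
  low n n′ = trans (cong (ins x) (ins-head y z l n)) (trans (ins-head x y _ (<⇒≯ p))
    (sym (trans (cong (ins y) (ins-head x z l n′)) (trans (ins-tail y x _ p) (cong (cons x) (ins-head y z l n))))))
  mid : z <ᶜ y → ¬ (z <ᶜ x) → ins x (ins y (cons z l)) ≡ ins y (ins x (cons z l))
  mid q n′ = trans (cong (ins x) (ins-tail y z l q)) (trans (ins-head x z _ n′)
    (sym (trans (cong (ins y) (ins-head x z l n′)) (trans (ins-tail y x _ p) (cong (cons x) (ins-tail y z l q))))))
  go : Cmp y z → Cmp x z → ins x (ins y (cons z l)) ≡ ins y (ins x (cons z l))
  go (lt q)    c         = low (<⇒≯ q) (<⇒≯ (<ᶜ-trans p q))
  go (eq refl) c         = low <ᶜ-irrefl (<⇒≯ p)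
  go (gt q)    (lt r)    = mid q (<⇒≯ r)
  go (gt q)    (eq refl) = mid q <ᶜ-irrefl
  go (gt q)    (gt r)    = trans (cong (ins x) (ins-tail y z l q)) (trans (ins-tail x z _ r)
    (trans (cong (cons z) (ins-comm< x y l p))
      (sym (trans (cong (ins y) (ins-tail x z l r)) (ins-tail y z _ q)))))

ins-comm : ∀ x y l → ins x (ins y l) ≡ ins y (ins x l)
ins-comm x y l with cmp x y
... | lt p    = ins-comm< x y l p
... | eq refl = refl
... | gt p    = sym (ins-comm< y x l p)

data _∈ᶜ_ (x : Code) : Code → Set where
  hd : ∀ {l} → x ∈ᶜ cons x l
  tl : ∀ {y l} → x ∈ᶜ l → x ∈ᶜ cons y l

cnt : Code → Code → ℕ
cnt z nil = 0
cnt z (cons y l) = (if ⌊ z ≟ᶜ y ⌋ then 1 else 0) + cnt z l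

cnt-ins : ∀ z x l → cnt z (ins x l) ≡ (if ⌊ z ≟ᶜ x ⌋ then 1 else 0) + cnt z l
cnt-ins z x nil = refl
cnt-ins z x (cons y l) with cmp x y
... | lt _ = refl
... | eq _ = refl
... | gt _ rewrite cnt-ins z x l = lem (if ⌊ z ≟ᶜ y ⌋ then 1 else 0) (if ⌊ z ≟ᶜ x ⌋ then 1 else 0) (cnt z l)
  where
  lem : ∀ a b c → a + (b + c) ≡ b + (a + c)
  lem a b c = trans (sym (ℕₚ.+-assoc a b c)) (trans (cong (_+ c) (ℕₚ.+-comm a b)) (ℕₚ.+-assoc b a c))

cnt-self : ∀ x l → cnt x (ins x l) ≡ suc (cnt x l)
cnt-self x l = trans (cnt-ins x x l) (cong (λ b → (if b then 1 else 0) + cnt x l) (yes! (x ≟ᶜ x) refl))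

cnt-other : ∀ {z x} l → z ≢ x → cnt z (ins x l) ≡ cnt z l
cnt-other {z} {x} l n = trans (cnt-ins z x l) (cong (λ b → (if b then 1 else 0) + cnt z l) (no! (z ≟ᶜ x) n))

cnt>0⇒∈ : ∀ z l → 0 < cnt z l → z ∈ᶜ l
cnt>0⇒∈ z (cons y l) p with z ≟ᶜ y
... | yes refl = hd
... | no _     = tl (cnt>0⇒∈ z l p)

-- The multiplicity of `x` is positive on the left, and on the right the insertion of `y` does not
-- change it.
∈-ins-other : ∀ {x y} l m → ins x l ≡ ins y m → x ≢ y → x ∈ᶜ m
∈-ins-other {x} {y} l m e n =
  cnt>0⇒∈ x m (subst (0 <_) (trans (sym (cnt-self x l)) (trans (cong (cnt x) e) (cnt-other m n))) (s≤s z≤n))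

ins-cancelʳ : ∀ {x y} l → ins x l ≡ ins y l → x ≡ y
ins-cancelʳ {x} {y} l e with x ≟ᶜ y
... | yes p = p
... | no n  = contradiction (trans (sym (cnt-self x l)) (trans (cong (cnt x) e) (cnt-other l n))) (ℕₚ.1+n≢n)

∈-ins⁻ : ∀ {z x} l → z ∈ᶜ ins x l → (z ≡ x) ⊎ (z ∈ᶜ l)
∈-ins⁻ nil hd = inj₁ refl
∈-ins⁻ {z} {x} (cons y l) m with cmp x y
∈-ins⁻ (cons y l) hd     | lt _ = inj₁ refl
∈-ins⁻ (cons y l) (tl m) | lt _ = inj₂ m
∈-ins⁻ (cons y l) hd     | eq _ = inj₁ refl
∈-ins⁻ (cons y l) (tl m) | eq _ = inj₂ m
∈-ins⁻ (cons y l) hd     | gt _ = inj₂ hd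
∈-ins⁻ (cons y l) (tl m) | gt _ with ∈-ins⁻ l m
... | inj₁ e = inj₁ e
... | inj₂ k = inj₂ (tl k)

∈-ins-self : ∀ x l → x ∈ᶜ ins x l
∈-ins-self x l = cnt>0⇒∈ x _ (subst (0 <_) (sym (cnt-self x l)) (s≤s z≤n))

-- The number of vertices of a tree with this code: `nil` accounts for the root, and each `cons`
-- adds one branch.
csz : Code → ℕ
csz nil        = 1
csz (cons a b) = csz a + csz b

csz>0 : ∀ a → 0 < csz a
csz>0 nil        = s≤s z≤n
csz>0 (cons a b) = ℕₚ.≤-trans (csz>0 a) (ℕₚ.m≤m+n _ _)

csz-ins : ∀ x l → csz (ins x l) ≡ csz x + csz l
csz-ins x nil = refl
csz-ins x (cons y l) with cmp x y
... | lt _ = refl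
... | eq _ = refl
... | gt _ rewrite csz-ins x l =
  trans (sym (ℕₚ.+-assoc (csz y) (csz x) (csz l))) (trans (cong (_+ csz l) (ℕₚ.+-comm (csz y) (csz x))) (ℕₚ.+-assoc (csz x) _ _))

∈ᶜ⇒csz< : ∀ {x l} → x ∈ᶜ l → csz x < csz l
∈ᶜ⇒csz< {x} (hd {l}) = subst (_≤ csz x + csz l) (ℕₚ.+-comm (csz x) 1) (ℕₚ.+-monoʳ-≤ (csz x) (csz>0 l))
∈ᶜ⇒csz< (tl {y} m) = ℕₚ.≤-trans (∈ᶜ⇒csz< m) (ℕₚ.m≤n+m _ (csz y))

-- Rooted trees, reordering and rerooting

-- Rooted trees.  In join s A B the root of B becomes a child of the root of A.  The weight s is 1 for an edge
-- directed from A to B and -1 for an edge directed from B to A; weight 0 stands for a deleted edge.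

data Tr (X : Set) : Set where
  leaf : X → Tr X
  join : ℤ → Tr X → Tr X → Tr X

private variable
  V₀ W₀ : Set

rt : Tr V₀ → V₀
rt (leaf x)     = x
rt (join _ A _) = rt A

verts : Tr V₀ → List V₀
verts (leaf x)     = x ∷ []
verts (join _ A B) = verts A ++ verts B

sz : Tr V₀ → ℕ
sz (leaf _)     = 1
sz (join _ A B) = sz A + sz B

κ : Tr V₀ → Code
κ (leaf _)     = nil
κ (join _ A B) = ins (κ B) (κ A)

wt : Tr V₀ → ℤ
wt (leaf _)     = 1ℤ
wt (join s A B) = s · (wt A · wt B)

-- Keeps the shape alone, with weight 1 on every edge, so that sums of trees with different labels
-- and orientations can be compared.
sk : Tr V₀ → Tr ⊤
sk (leaf _)     = leaf tt
sk (join _ A B) = join 1ℤ (sk A) (sk B)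

csz-κ : (S : Tr V₀) → csz (κ S) ≡ sz S
csz-κ (leaf _) = refl
csz-κ (join _ A B) = trans (csz-ins (κ B) (κ A)) (trans (cong₂ _+_ (csz-κ B) (csz-κ A)) (ℕₚ.+-comm (sz B) (sz A)))

κ≡⇒sz≡ : (S : Tr V₀) (S′ : Tr W₀) → κ S ≡ κ S′ → sz S ≡ sz S′
κ≡⇒sz≡ S S′ e = trans (sym (csz-κ S)) (trans (cong csz e) (csz-κ S′))

sz>0 : (S : Tr V₀) → 0 < sz S
sz>0 (leaf _)     = s≤s z≤n
sz>0 (join _ A B) = ℕₚ.≤-trans (sz>0 A) (ℕₚ.m≤m+n _ _)

sz<joinˡ : (A : Tr V₀) (B : Tr W₀) → sz A < sz A + sz B
sz<joinˡ A B = subst (_≤ sz A + sz B) (ℕₚ.+-comm (sz A) 1) (ℕₚ.+-monoʳ-≤ (sz A) (sz>0 B))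

sz<joinʳ : (A : Tr V₀) (B : Tr W₀) → sz B < sz A + sz B
sz<joinʳ A B = subst (sz B <_) (ℕₚ.+-comm (sz B) (sz A)) (sz<joinˡ B A)

length-verts : (S : Tr V₀) → length (verts S) ≡ sz S
length-verts (leaf _)     = refl
length-verts (join _ A B) = trans (Listₚ.length-++ (verts A)) (cong₂ _+_ (length-verts A) (length-verts B))

rt∈verts : (S : Tr V₀) → rt S ∈ verts S
rt∈verts (leaf _)     = here refl
rt∈verts (join _ A B) = ∈-++⁺ˡ (rt∈verts A)

κ-sk : (S : Tr V₀) → κ (sk S) ≡ κ S
κ-sk (leaf _)     = refl
κ-sk (join _ A B) = cong₂ ins (κ-sk B) (κ-sk A)

sz-sk : (S : Tr V₀) → sz (sk S) ≡ sz S
sz-sk (leaf _)     = refl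
sz-sk (join _ A B) = cong₂ _+_ (sz-sk A) (sz-sk B)

infix 4 _≃_ _≈_

-- Reordering of children.
data _≃_ {V₀ : Set} : Tr V₀ → Tr V₀ → Set where
  ≃-refl  : ∀ {A} → A ≃ A
  ≃-trans : ∀ {A B C} → A ≃ B → B ≃ C → A ≃ C
  ≃-comm  : ∀ {s t A B C} → join s (join t A B) C ≃ join t (join s A C) B
  ≃-cong  : ∀ {s A A′ B B′} → A ≃ A′ → B ≃ B′ → join s A B ≃ join s A′ B′

-- Reordering of children and change of root.
data _≈_ {V₀ : Set} : Tr V₀ → Tr V₀ → Set where
  ≈-of    : ∀ {A B} → A ≃ B → A ≈ B
  ≈-rot   : ∀ {s A B} → join s A B ≈ join (⊖ s) B A
  ≈-trans : ∀ {A B C} → A ≈ B → B ≈ C → A ≈ C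

≃-sym : {A B : Tr V₀} → A ≃ B → B ≃ A
≃-sym ≃-refl        = ≃-refl
≃-sym (≃-trans p q) = ≃-trans (≃-sym q) (≃-sym p)
≃-sym ≃-comm        = ≃-comm
≃-sym (≃-cong p q)  = ≃-cong (≃-sym p) (≃-sym q)

≃-rt : {A B : Tr V₀} → A ≃ B → rt A ≡ rt B
≃-rt ≃-refl        = refl
≃-rt (≃-trans p q) = trans (≃-rt p) (≃-rt q)
≃-rt ≃-comm        = refl
≃-rt (≃-cong p q)  = ≃-rt p

≃-κ : {A B : Tr V₀} → A ≃ B → κ A ≡ κ B
≃-κ ≃-refl                      = refl
≃-κ (≃-trans p q)               = trans (≃-κ p) (≃-κ q)
≃-κ (≃-comm {A = A} {B} {C})    = ins-comm (κ C) (κ B) (κ A)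
≃-κ (≃-cong p q)                = cong₂ ins (≃-κ q) (≃-κ p)

≃-wt : {A B : Tr V₀} → A ≃ B → wt A ≡ wt B
≃-wt ≃-refl                          = refl
≃-wt (≃-trans p q)                   = trans (≃-wt p) (≃-wt q)
≃-wt (≃-comm {s} {t} {A} {B} {C})    = lem s t (wt A) (wt B) (wt C)
  where
  lem : ∀ s t a b c → s · ((t · (a · b)) · c) ≡ t · ((s · (a · c)) · b)
  lem = solve-∀
≃-wt (≃-cong {s} p q)                = cong (s ·_) (cong₂ _·_ (≃-wt p) (≃-wt q))

≃-verts : {A B : Tr V₀} → A ≃ B → verts A ↭ verts B
≃-verts ≃-refl                    = ↭-refl
≃-verts (≃-trans p q)             = ↭-trans (≃-verts p) (≃-verts q)
≃-verts (≃-comm {A = A} {B} {C})  =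
  ↭-trans (↭-reflexive (Listₚ.++-assoc (verts A) (verts B) (verts C)))
    (↭-trans (++⁺ˡ (verts A) (++-comm (verts B) (verts C)))
      (↭-reflexive (sym (Listₚ.++-assoc (verts A) (verts C) (verts B)))))
≃-verts (≃-cong p q)              = ++⁺↭ (≃-verts p) (≃-verts q)

≈-verts : {A B : Tr V₀} → A ≈ B → verts A ↭ verts B
≈-verts (≈-of p)               = ≃-verts p
≈-verts (≈-rot {A = A} {B})    = ++-comm (verts A) (verts B)
≈-verts (≈-trans p q)          = ↭-trans (≈-verts p) (≈-verts q)

≈-sz : {A B : Tr V₀} → A ≈ B → sz A ≡ sz B
≈-sz {A = A} {B} p = trans (sym (length-verts A)) (trans (↭-length (≈-verts p)) (length-verts B))

≃-sz : {A B : Tr V₀} → A ≃ B → sz A ≡ sz B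
≃-sz p = ≈-sz (≈-of p)

child-of-code : ∀ {x} (S : Tr V₀) → x ∈ᶜ κ S → ∃[ s ] ∃[ A ] ∃[ B ] (S ≃ join s A B) × κ B ≡ x
child-of-code (join s A B) m with ∈-ins⁻ (κ A) m
... | inj₁ e = s , A , B , ≃-refl , sym e
... | inj₂ k with child-of-code A k
...   | t , A′ , D , p , e = t , join s A′ B , D , ≃-trans (≃-cong p ≃-refl) ≃-comm , e

split-of-code : ∀ {s} (A B : Tr V₀) (S : Tr W₀) → κ (join s A B) ≡ κ S →
                ∃[ t ] ∃[ A′ ] ∃[ B′ ] (S ≃ join t A′ B′) × κ A ≡ κ A′ × κ B ≡ κ B′
split-of-code A B S e with child-of-code S (subst (κ B ∈ᶜ_) e (∈-ins-self (κ B) (κ A)))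
... | t , A′ , B′ , p , q = t , A′ , B′ , p ,
      ins-cancelˡ (κ B) (trans e (trans (≃-κ p) (cong (λ z → ins z (κ A′)) q))) , sym q

nil≢ins : ∀ {x l} → nil ≢ ins x l
nil≢ins {x} {l} e with subst (x ∈ᶜ_) (sym e) (∈-ins-self x l)
... | ()

-- The branch inserted last in `S` is located in `S′` by its code and moved to the end; recursion
-- then turns equality of codes into literal equality of skeletons.
decode : (S : Tr V₀) (S′ : Tr W₀) → κ S ≡ κ S′ → ∃[ S″ ] (S′ ≃ S″) × sk S″ ≡ sk S
decode (leaf _) (leaf y) e = leaf y , ≃-refl , refl
decode (leaf _) (join _ A B) e = contradiction e (nil≢ins {κ B} {κ A})
decode (join s A B) S′ e with split-of-code {s = s} A B S′ e
... | t , A′ , B′ , p , eA , eB with decode A A′ eA | decode B B′ eB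
... | A″ , pA , kA | B″ , pB , kB =
  join t A″ B″ , ≃-trans p (≃-cong pA pB) , cong₂ (join 1ℤ) kA kB

-- Identifies the two roots and keeps the label of `E`. In the traversals below, `E` accumulates
-- what has been passed and `B` is what lies ahead.
merge : Tr V₀ → Tr V₀ → Tr V₀
merge E (leaf _)     = E
merge E (join s A B) = join s (merge E A) B

merge-join : ∀ s (E C B : Tr V₀) → join s (merge E B) C ≃ merge (join s E C) B
merge-join s E C (leaf _)     = ≃-refl
merge-join s E C (join t A B) = ≃-trans ≃-comm (≃-cong (merge-join s E C A) ≃-refl)

merge-root : (B : Tr V₀) → merge (leaf (rt B)) B ≡ B
merge-root (leaf _)     = refl
merge-root (join s A B) = cong (λ z → join s z B) (merge-root A)

κ-merge-cancel : (E E′ B : Tr V₀) → κ (merge E B) ≡ κ (merge E′ B) → κ E ≡ κ E′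
κ-merge-cancel E E′ (leaf _)     e = e
κ-merge-cancel E E′ (join s A B) e = κ-merge-cancel E E′ A (ins-cancelˡ (κ B) e)

-- Rer E B R: R is the tree merge E B rerooted at some vertex of B.
data Rer {V : Set} : Tr V → Tr V → Tr V → Set where
  stop : ∀ {E x} → Rer E (leaf x) E
  stay : ∀ {E s A B R} → Rer (join s E B) A R → Rer E (join s A B) R
  down : ∀ {E s A B R} → Rer (join (⊖ s) (leaf (rt B)) (merge E A)) B R → Rer E (join s A B) R

descend-≈ : ∀ s (E A B : Tr V₀) → merge E (join s A B) ≈ merge (join (⊖ s) (leaf (rt B)) (merge E A)) B
descend-≈ s E A B = ≈-trans ≈-rot (≈-of (subst (λ z → join (⊖ s) z (merge E A) ≃ merge (join (⊖ s) (leaf (rt B)) (merge E A)) B)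
  (merge-root B) (merge-join (⊖ s) (leaf (rt B)) (merge E A) B)))

rer-≈ : {E B R : Tr V₀} → Rer E B R → merge E B ≈ R
rer-≈ stop = ≈-of ≃-refl
rer-≈ (stay {E} {s} {A} {B} r) = ≈-trans (≈-of (merge-join s E B A)) (rer-≈ r)
rer-≈ (down {E} {s} {A} {B} r) = ≈-trans (descend-≈ s E A B) (rer-≈ r)

rer-at : (E B : Tr V₀) → rt E ≡ rt B → ∀ {x} → x ∈ verts B → ∃[ R ] Rer E B R × rt R ≡ x
rer-at E (leaf x) e (here refl) = E , stop , e
rer-at E (join s A B) e m with ∈-++⁻ (verts A) m
... | inj₁ p with rer-at (join s E B) A e p
...   | R , r , q = R , stay r , q
rer-at E (join s A B) e m | inj₂ p with rer-at (join (⊖ s) (leaf (rt B)) (merge E A)) B refl p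
...   | R , r , q = R , down r , q

Reroot : Tr V₀ → Tr V₀ → Set
Reroot S R = Rer (leaf (rt S)) S R

reroot-≈ : {S R : Tr V₀} → Reroot S R → S ≈ R
reroot-≈ {S = S} {R} r = subst (_≈ R) (merge-root S) (rer-≈ r)

reroot-at : (S : Tr V₀) → ∀ {x} → x ∈ verts S → ∃[ R ] Reroot S R × rt R ≡ x
reroot-at S m = rer-at (leaf (rt S)) S refl m

-- Centroids and canonical roots

insAll : Code → Tr V₀ → Code
insAll c (leaf _)     = c
insAll c (join _ A B) = ins (κ B) (insAll c A)

insAll-ins : ∀ x c (B : Tr V₀) → insAll (ins x c) B ≡ ins x (insAll c B)
insAll-ins x c (leaf _)     = refl
insAll-ins x c (join _ A B) = trans (cong (ins (κ B)) (insAll-ins x c A)) (ins-comm (κ B) x (insAll c A))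

insAll-nil : (B : Tr V₀) → insAll nil B ≡ κ B
insAll-nil (leaf _)     = refl
insAll-nil (join _ A B) = cong (ins (κ B)) (insAll-nil A)

κ-insAll : (E B : Tr V₀) → κ (merge E B) ≡ insAll (κ E) B
κ-insAll E (leaf _)     = refl
κ-insAll E (join _ A B) = cong (ins (κ B)) (κ-insAll E A)

rer-cases : {E B R : Tr V₀} → Rer E B R →
  (κ R ≡ κ (merge E B) × rt R ≡ rt E) ⊎
  ∃[ s ] ∃[ U ] ∃[ D ] Rer (join s (leaf (rt D)) U) D R × κ (merge E B) ≡ ins (κ D) (κ U)
rer-cases stop = inj₁ (refl , refl)
rer-cases (stay {E} {s} {A} {B} r) with rer-cases r
... | inj₁ (e , q)               = inj₁ (trans e (sym (≃-κ (merge-join s E B A))) , q)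
... | inj₂ (t , U , D , q , e)   = inj₂ (t , U , D , q , trans (≃-κ (merge-join s E B A)) e)
rer-cases (down {E} {s} {A} {B} r) = inj₂ (⊖ s , merge E A , B , r , refl)

-- Seen from the new root, the branch `x` of `E` is either still a branch at the root or lies inside
-- the branch that points back to the old root, which is strictly larger.
rer-heavy : ∀ {x c} {E B R : Tr V₀} → Rer E B R → κ E ≡ ins x c →
  ∃[ x′ ] ∃[ c′ ] κ R ≡ ins x′ c′ × ((x′ ≡ x × c′ ≡ insAll c B) ⊎ (csz x < csz x′))
rer-heavy {x = x} {c} stop e = x , c , e , inj₁ (refl , refl)
rer-heavy {x = x} {c} (stay {E} {s} {A} {B} r) e
  with rer-heavy {x = x} {ins (κ B) c} r (trans (cong (ins (κ B)) e) (ins-comm (κ B) x c))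
... | x′ , c′ , q , inj₁ (a , b) = x′ , c′ , q , inj₁ (a , trans b (insAll-ins (κ B) c A))
... | x′ , c′ , q , inj₂ l       = x′ , c′ , q , inj₂ l
rer-heavy {x = x} {c} (down {E} {s} {A} {B} r) e
  with rer-heavy {x = κ (merge E A)} {nil} r refl
     | ∈ᶜ⇒csz< (subst (x ∈ᶜ_) (sym (trans (κ-insAll E A) (trans (cong (λ z → insAll z A) e) (insAll-ins x c A)))) (∈-ins-self x (insAll c A)))
... | x′ , c′ , q , inj₁ (a , b) | l = x′ , c′ , q , inj₂ (subst (λ z → csz x < csz z) (sym a) l)
... | x′ , c′ , q , inj₂ l′      | l = x′ , c′ , q , inj₂ (ℕₚ.<-trans l l′)

-- Code of a tree rooted at its centroid; if there are two centroids, at the one whose half has the larger code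
-- (the codes of the halves being different).
CanC : Code → Set
CanC k = ∀ x c → k ≡ ins x c → (2 * csz x < csz k) ⊎ (2 * csz x ≡ csz k × x <ᶜ c)

double : ∀ a b {n} → a + b ≡ n → 2 * a ≡ n → 2 * b ≡ n
double a b {n} e d = trans (cong (λ z → z + (z + 0)) (sym ab)) d
  where
  ab : a ≡ b
  ab = ℕₚ.+-cancelˡ-≡ a a b (trans (cong (a ℕ.+_) (sym (ℕₚ.+-identityʳ a))) (trans d (sym e)))

lighter : ∀ a b {n} → a + b ≡ n → 2 * a < n → n < 2 * b
lighter a b {n} e d = ℕₚ.≰⇒> λ q → ℕₚ.<-irrefl refl
  (ℕₚ.<-≤-trans (ℕₚ.+-mono-<-≤ d q) (ℕₚ.≤-reflexive (sym (trans (sym (ℕₚ.*-distribˡ-+ 2 a b))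
    (trans (cong (2 *_) e) (cong (n ℕ.+_) (ℕₚ.+-identityʳ n)))))))

heavier : ∀ a b {n} → a + b ≡ n → n < 2 * a → 2 * b < n
heavier a b {n} e d = ℕₚ.≰⇒> λ q → ℕₚ.<-irrefl refl
  (ℕₚ.<-≤-trans (ℕₚ.+-mono-<-≤ d q) (ℕₚ.≤-reflexive (trans (sym (ℕₚ.*-distribˡ-+ 2 a b))
    (trans (cong (2 *_) e) (cong (n ℕ.+_) (ℕₚ.+-identityʳ n))))))

-- If the root moved into a branch `D`, the remainder `U` would lie in a single branch of `R`.
-- Neither `D` nor that branch may exceed half of the tree, so both are exactly half, and then the
-- two canonicity conditions order the halves in opposite ways.
canonical-root-unique : ∀ {k} (S R : Tr V₀) → Reroot S R → CanC (κ S) → CanC k → κ R ≡ k → rt R ≡ rt S × κ R ≡ κ S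
canonical-root-unique {k = k} S R r canS canK e with rer-cases r
... | inj₁ (q , p) = p , trans q (cong κ (merge-root S))
... | inj₂ (s , U , D , r′ , q) with rer-heavy {x = κ U} {nil} r′ refl
...   | x′ , c′ , h , alt = ⊥-elim (clash (canS (κ D) (κ U) κS) alt)
  where
  κS : κ S ≡ ins (κ D) (κ U)
  κS = trans (cong κ (sym (merge-root S))) q
  sum : csz (κ D) + csz (κ U) ≡ csz (κ S)
  sum = trans (sym (csz-ins (κ D) (κ U))) (cong csz (sym κS))
  size-eq : csz k ≡ csz (κ S)
  size-eq = trans (cong csz (sym e)) (trans (csz-κ R) (trans (sym (≈-sz (reroot-≈ r))) (sym (csz-κ S))))
  cx : (2 * csz x′ < csz (κ S)) ⊎ (2 * csz x′ ≡ csz (κ S) × x′ <ᶜ c′)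
  cx = subst (λ z → (2 * csz x′ < z) ⊎ (2 * csz x′ ≡ z × x′ <ᶜ c′)) size-eq (canK x′ c′ (trans (sym e) h))
  small : 2 * csz x′ ≤ csz (κ S)
  small with cx
  ... | inj₁ l       = ℕₚ.<⇒≤ l
  ... | inj₂ (l , _) = ℕₚ.≤-reflexive l
  clash : (2 * csz (κ D) < csz (κ S)) ⊎ (2 * csz (κ D) ≡ csz (κ S) × κ D <ᶜ κ U) →
          (x′ ≡ κ U × c′ ≡ insAll nil D) ⊎ (csz (κ U) < csz x′) → ⊥
  clash (inj₁ l) (inj₁ (refl , _)) = ℕₚ.<⇒≱ (lighter (csz (κ D)) (csz (κ U)) sum l) small
  clash (inj₁ l) (inj₂ b) =
    ℕₚ.<⇒≱ (ℕₚ.<-trans (lighter (csz (κ D)) (csz (κ U)) sum l) (ℕₚ.*-monoʳ-< 2 b)) small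
  clash (inj₂ (d , _)) (inj₂ b) =
    ℕₚ.<⇒≱ (subst (_< 2 * csz x′) (double (csz (κ D)) (csz (κ U)) sum d) (ℕₚ.*-monoʳ-< 2 b)) small
  clash (inj₂ (d , o)) (inj₁ (refl , refl)) with cx
  ... | inj₁ l       = ℕₚ.<-irrefl (double (csz (κ D)) (csz (κ U)) sum d) l
  ... | inj₂ (_ , p) = <⇒≯ o (subst (κ U <ᶜ_) (insAll-nil D) p)

-- The dichotomy on which the converse rests: a `pos` tree has a detector (`detectOf`), while the
-- sum of a `neg` tree is a square modulo 2 (`mirror-square`).
data Canon {V : Set} (S : Tr V) : Set where
  pos : ∀ C → S ≈ C → CanC (κ C) → Canon S
  neg : ∀ s A B → S ≈ join s A B → κ A ≡ κ B → Canon S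

Light : ℕ → Code → Set
Light n k = ∀ x → x ∈ᶜ k → 2 * csz x < n

light-can : ∀ {n} k → n ≡ csz k → Light n k → CanC k
light-can k refl l x c refl = inj₁ (l x (∈-ins-self x c))

half-can : ∀ a b → csz a ≡ csz b → b <ᶜ a → CanC (ins b a)
half-can a b e o x c q with x ≟ᶜ b
... | yes refl = inj₂ (trans (cong (csz b ℕ.+_) (ℕₚ.+-identityʳ _)) (sym (trans (csz-ins b a) (cong (csz b ℕ.+_) e)))
                 , subst (b <ᶜ_) (ins-cancelˡ b q) o)
... | no n = inj₁ (subst (2 * csz x <_) (sym (trans (csz-ins b a) (trans (cong (ℕ._+ csz a) (sym e)) (cong (csz a ℕ.+_) (sym (ℕₚ.+-identityʳ _))))))
                 (ℕₚ.*-monoʳ-< 2 (∈ᶜ⇒csz< (∈-ins-other c a (sym q) n))))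

light-join : ∀ {n s} (E B : Tr V₀) → Light n (κ E) → 2 * sz B < n → Light n (κ (join s E B))
light-join E B l b x m with ∈-ins⁻ (κ E) m
... | inj₁ refl = subst (λ z → 2 * z < _) (sym (csz-κ B)) b
... | inj₂ k    = l x k

light-single : ∀ {n s} {y : V₀} (B : Tr V₀) → 2 * sz B < n → Light n (κ (join s (leaf y) B))
light-single {s = s} {y} B b = light-join {s = s} (leaf y) B (λ x ()) b

halve : ∀ {n} (A B : Tr V₀) → n ≡ sz A + sz B → 2 * sz B ≡ n → csz (κ A) ≡ csz (κ B)
halve {n = n} A B e d = trans (csz-κ A) (trans (ℕₚ.+-cancelʳ-≡ (sz B) (sz A) (sz B)
  (trans (sym e) (trans (sym d) (cong (sz B ℕ.+_) (ℕₚ.+-identityʳ _))))) (sym (csz-κ B)))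

canon-≈ : {S S′ : Tr V₀} → S ≈ S′ → Canon S′ → Canon S
canon-≈ p (pos C q c)       = pos C (≈-trans p q) c
canon-≈ p (neg s A B q e)   = neg s A B (≈-trans p q) e

-- Moves from the root into a branch with more than half of the vertices as long as there is one.
walk : ∀ n (E B : Tr V₀) → n ≡ sz (merge E B) → Light n (κ E) → Canon (merge E B)
walk n E (leaf x) e l = pos E (≈-of ≃-refl) (light-can (κ E) (trans e (sym (csz-κ E))) l)
walk n E (join s A B) e l with <-cmp (2 * sz B) n
... | tri< b _ _ = canon-≈ (≈-of (merge-join s E B A))
      (walk n (join s E B) A (trans e (≃-sz (merge-join s E B A))) (light-join {s = s} E B l b))
... | tri> _ _ b = canon-≈ (descend-≈ s E A B)
      (walk n (join (⊖ s) (leaf (rt B)) (merge E A)) B (trans e (≈-sz (descend-≈ s E A B)))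
        (light-single {s = ⊖ s} {rt B} (merge E A) (heavier (sz B) (sz (merge E A)) (trans (ℕₚ.+-comm (sz B) _) (sym e)) b)))
... | tri≈ _ b _ with cmp (κ B) (κ (merge E A))
...   | lt o  = pos (join s (merge E A) B) (≈-of ≃-refl) (half-can (κ (merge E A)) (κ B) (halve (merge E A) B e b) o)
...   | eq q  = neg s (merge E A) B (≈-of ≃-refl) (sym q)
...   | gt o  = pos (join (⊖ s) B (merge E A)) ≈-rot (half-can (κ B) (κ (merge E A)) (sym (halve (merge E A) B e b)) o)

-- Two `neg` trees collide whatever their halves are. Thus injectivity of the walk also says that
-- attaching branches of a given size to a fixed tree yields a symmetric tree for at most one code
-- of the branch.
Collide : {S S′ : Tr V₀} → Canon S → Canon S′ → Set
Collide (pos C _ _)     (pos C′ _ _)    = κ C ≡ κ C′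
Collide (neg _ _ _ _ _) (neg _ _ _ _ _) = ⊤
Collide _               _               = ⊥

collide-≈ : {S₁ S₂ S₃ S₄ : Tr V₀} {p : S₁ ≈ S₂} {q : S₃ ≈ S₄} (c : Canon S₂) (d : Canon S₄) →
            Collide (canon-≈ p c) (canon-≈ q d) → Collide c d
collide-≈ (pos _ _ _)     (pos _ _ _)     h = h
collide-≈ (neg _ _ _ _ _) (neg _ _ _ _ _) h = h

∉ᶜ-self : ∀ {x} → ¬ (x ∈ᶜ x)
∉ᶜ-self m = ℕₚ.<-irrefl refl (∈ᶜ⇒csz< m)

-- The path of the walk is decided by the sizes of the branches in `B` and by `n`, so it is the same
-- for `E` and `E′`, and each step changes the accumulated part in a cancellable way. If a tie is
-- broken differently for the two, a half becomes a branch of itself.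
walk-injective : ∀ n (E E′ B : Tr V₀) (e : n ≡ sz (merge E B)) (e′ : n ≡ sz (merge E′ B))
                 (l : Light n (κ E)) (l′ : Light n (κ E′)) →
                 Collide (walk n E B e l) (walk n E′ B e′ l′) → κ E ≡ κ E′
walk-injective n E E′ (leaf x) e e′ l l′ h = h
walk-injective n E E′ (join s A B) e e′ l l′ h with <-cmp (2 * sz B) n
... | tri< b _ _ = ins-cancelˡ (κ B) (walk-injective n (join s E B) (join s E′ B) A _ _ _ _ (collide-≈ (walk n _ A _ _) (walk n _ A _ _) h))
... | tri> _ _ b = κ-merge-cancel E E′ A
      (ins-cancelʳ nil (walk-injective n _ _ B _ _ _ _ (collide-≈ (walk n _ B _ _) (walk n _ B _ _) h)))
... | tri≈ _ b _ with cmp (κ B) (κ (merge E A)) | cmp (κ B) (κ (merge E′ A))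
...   | lt o | lt o′ = κ-merge-cancel E E′ A (ins-cancelˡ (κ B) h)
...   | lt o | gt o′ = contradiction (∈-ins-other (κ (merge E A)) (κ B) h (λ q → <ᶜ-irrefl (subst (_<ᶜ κ B) (sym q) o′))) ∉ᶜ-self
...   | eq q | eq q′ = κ-merge-cancel E E′ A (trans (sym q) q′)
...   | gt o | lt o′ = contradiction (∈-ins-other (κ (merge E′ A)) (κ B) (sym h) (λ q → <ᶜ-irrefl (subst (_<ᶜ κ B) (sym q) o))) ∉ᶜ-self
...   | gt o | gt o′ = κ-merge-cancel E E′ A (ins-cancelʳ (κ B) h)

canon : (S : Tr V₀) → Canon S
canon S = subst Canon (merge-root S) (walk (sz (merge (leaf (rt S)) S)) (leaf (rt S)) S refl (λ x ()))

-- Signed adjacency matrices of labelled trees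

δ : ℕ → ℕ → ℤ
δ x y = 𝟙 ⌊ x ℕ.≟ y ⌋

δ-≡ : ∀ {x y} → x ≡ y → δ x y ≡ 1ℤ
δ-≡ {x} {y} e = cong 𝟙 (yes! (x ℕ.≟ y) e)

δ-≢ : ∀ {x y} → x ≢ y → δ x y ≡ 0ℤ
δ-≢ {x} {y} n = cong 𝟙 (no! (x ℕ.≟ y) n)

-- The skew adjacency matrix. Entries of edges with the same labels would add up, whence the
-- recurring hypothesis that the labels are distinct.
adj : Tr ℕ → ℕ → ℕ → ℤ
adj (leaf _)     x y = 0ℤ
adj (join s A B) x y =
  s · (δ (rt A) x · δ (rt B) y ⊹ ⊖ (δ (rt A) y · δ (rt B) x)) ⊹ (adj A x y ⊹ adj B x y)

adj-skew : ∀ S x y → adj S x y ≡ ⊖ adj S y x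
adj-skew (leaf _) x y = refl
adj-skew (join s A B) x y rewrite adj-skew A x y | adj-skew B x y =
  lem s (δ (rt A) x) (δ (rt B) y) (δ (rt A) y) (δ (rt B) x) (adj A y x) (adj B y x)
  where
  lem : ∀ s a b c d e f → s · (a · b ⊹ ⊖ (c · d)) ⊹ (⊖ e ⊹ ⊖ f) ≡ ⊖ (s · (c · d ⊹ ⊖ (a · b)) ⊹ (e ⊹ f))
  lem = solve-∀

≃-adj : {A B : Tr ℕ} → A ≃ B → ∀ x y → adj A x y ≡ adj B x y
≃-adj ≃-refl        x y = refl
≃-adj (≃-trans p q) x y = trans (≃-adj p x y) (≃-adj q x y)
≃-adj (≃-comm {s} {t} {A} {B} {C}) x y =
  lem (s · (δ (rt A) x · δ (rt C) y ⊹ ⊖ (δ (rt A) y · δ (rt C) x))) (t · (δ (rt A) x · δ (rt B) y ⊹ ⊖ (δ (rt A) y · δ (rt B) x)))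
    (adj A x y) (adj B x y) (adj C x y)
  where
  lem : ∀ u v a b c → u ⊹ ((v ⊹ (a ⊹ b)) ⊹ c) ≡ v ⊹ ((u ⊹ (a ⊹ c)) ⊹ b)
  lem = solve-∀
≃-adj (≃-cong p q)  x y rewrite ≃-adj p x y | ≃-adj q x y | ≃-rt p | ≃-rt q = refl

≈-adj : {A B : Tr ℕ} → A ≈ B → ∀ x y → adj A x y ≡ adj B x y
≈-adj (≈-of p)      x y = ≃-adj p x y
≈-adj (≈-trans p q) x y = trans (≈-adj p x y) (≈-adj q x y)
≈-adj (≈-rot {s} {A} {B}) x y =
  lem s (δ (rt A) x) (δ (rt B) y) (δ (rt A) y) (δ (rt B) x) (adj A x y) (adj B x y)
  where
  lem : ∀ s a b c d e f → s · (a · b ⊹ ⊖ (c · d)) ⊹ (e ⊹ f) ≡ (⊖ s) · (d · c ⊹ ⊖ (b · a)) ⊹ (f ⊹ e)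
  lem = solve-∀

∈∉⇒≢ : ∀ {x y : ℕ} {xs} → x ∈ xs → y ∉ xs → x ≢ y
∈∉⇒≢ p q refl = q p

adj-out : ∀ S {x} y → x ∉ verts S → adj S x y ≡ 0ℤ
adj-out (leaf _)     y n = refl
adj-out (join s A B) {x} y n
  rewrite δ-≢ (∈∉⇒≢ (rt∈verts A) (n ∘ ∈-++⁺ˡ)) | δ-≢ (∈∉⇒≢ (rt∈verts B) (n ∘ ∈-++⁺ʳ (verts A)))
        | adj-out A y (n ∘ ∈-++⁺ˡ) | adj-out B y (n ∘ ∈-++⁺ʳ (verts A)) = lem s (δ (rt B) y) (δ (rt A) y)
  where
  lem : ∀ s a b → s · (0ℤ · a ⊹ ⊖ (b · 0ℤ)) ⊹ (0ℤ ⊹ 0ℤ) ≡ 0ℤ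
  lem = solve-∀

adj-outʳ : ∀ S x {y} → y ∉ verts S → adj S x y ≡ 0ℤ
adj-outʳ S x {y} n = trans (adj-skew S x y) (cong ⊖_ (adj-out S x n))

module _ (s : ℤ) (A B : Tr ℕ) (u : Unique (verts (join s A B))) where
  private
    disj : ∀ {x} → x ∈ verts A → x ∉ verts B
    disj = proj₂ (proj₂ (unique-++⁻ (verts A) u))

  adj-cross : adj (join s A B) (rt A) (rt B) ≡ s
  adj-cross rewrite δ-≡ {rt A} refl | δ-≡ {rt B} refl
    | δ-≢ (∈∉⇒≢ (rt∈verts A) (λ m → disj m (rt∈verts B)))
    | adj-outʳ A (rt A) (λ m → disj m (rt∈verts B))
    | adj-out B (rt B) (disj (rt∈verts A)) = lem s (δ (rt B) (rt A))
    where
    lem : ∀ s a → s · (1ℤ · 1ℤ ⊹ ⊖ (0ℤ · a)) ⊹ (0ℤ ⊹ 0ℤ) ≡ s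
    lem = solve-∀

  adj-inˡ : ∀ {a b} → a ∈ verts A → b ∈ verts A → adj (join s A B) a b ≡ adj A a b
  adj-inˡ {a} {b} p q
    rewrite δ-≢ {rt B} {a} (∈∉⇒≢ (rt∈verts B) (disj p)) | δ-≢ {rt B} {b} (∈∉⇒≢ (rt∈verts B) (disj q))
          | adj-out B b (disj p) = lem s (δ (rt A) a) (δ (rt A) b) (adj A a b)
    where
    lem : ∀ s a b c → s · (a · 0ℤ ⊹ ⊖ (b · 0ℤ)) ⊹ (c ⊹ 0ℤ) ≡ c
    lem = solve-∀

  adj-inʳ : ∀ {a b} → a ∈ verts B → b ∈ verts B → adj (join s A B) a b ≡ adj B a b
  adj-inʳ {a} {b} p q
    rewrite δ-≢ {rt A} {a} (∈∉⇒≢ (rt∈verts A) (λ m → disj m p)) | δ-≢ {rt A} {b} (∈∉⇒≢ (rt∈verts A) (λ m → disj m q))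
          | adj-out A b (λ m → disj m p) = lem s (δ (rt B) a) (δ (rt B) b) (adj B a b)
    where
    lem : ∀ s a b c → s · (0ℤ · b ⊹ ⊖ (0ℤ · a)) ⊹ (0ℤ ⊹ c) ≡ c
    lem = solve-∀

  adj-leave-A : ∀ {a b} → a ∈ verts A → b ≢ rt B → adj (join s A B) a b ≢ 0ℤ → b ∈ verts A
  adj-leave-A {a} {b} p n h with b ∈? verts A
  ... | yes q = q
  ... | no q  = contradiction zero-entry h
    where
    zero-entry : adj (join s A B) a b ≡ 0ℤ
    zero-entry rewrite δ-≢ {rt B} {a} (∈∉⇒≢ (rt∈verts B) (disj p)) | δ-≢ {rt B} {b} (n ∘ sym)
      | adj-outʳ A a q | adj-out B b (disj p) = lem s (δ (rt A) a) (δ (rt A) b)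
      where
      lem : ∀ s a b → s · (a · 0ℤ ⊹ ⊖ (b · 0ℤ)) ⊹ (0ℤ ⊹ 0ℤ) ≡ 0ℤ
      lem = solve-∀

  adj-leave-B : ∀ {a b} → a ∈ verts B → b ≢ rt A → adj (join s A B) a b ≢ 0ℤ → b ∈ verts B
  adj-leave-B {a} {b} p n h with b ∈? verts B
  ... | yes q = q
  ... | no q  = contradiction zero-entry h
    where
    zero-entry : adj (join s A B) a b ≡ 0ℤ
    zero-entry rewrite δ-≢ {rt A} {a} (∈∉⇒≢ (rt∈verts A) (λ m → disj m p)) | δ-≢ {rt A} {b} (n ∘ sym)
      | adj-outʳ B a q | adj-out A b (λ m → disj m p) = lem s (δ (rt B) a) (δ (rt B) b)
      where
      lem : ∀ s a b → s · (0ℤ · b ⊹ ⊖ (0ℤ · a)) ⊹ (0ℤ ⊹ 0ℤ) ≡ 0ℤ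
      lem = solve-∀

ep : (ℕ → ℕ → ℤ) → Tr ℕ → ℤ
ep f (leaf _)     = 1ℤ
ep f (join _ A B) = f (rt A) (rt B) · (ep f A · ep f B)

ep-cong : ∀ {f g} S → (∀ {a b} → a ∈ verts S → b ∈ verts S → f a b ≡ g a b) → ep f S ≡ ep g S
ep-cong (leaf _)     h = refl
ep-cong (join _ A B) h = cong₂ _·_ (h (∈-++⁺ˡ (rt∈verts A)) (∈-++⁺ʳ (verts A) (rt∈verts B)))
  (cong₂ _·_ (ep-cong A (λ p q → h (∈-++⁺ˡ p) (∈-++⁺ˡ q))) (ep-cong B (λ p q → h (∈-++⁺ʳ (verts A) p) (∈-++⁺ʳ (verts A) q))))

·-≢0ˡ : ∀ {a b} → a · b ≢ 0ℤ → a ≢ 0ℤ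
·-≢0ˡ {a} {b} h refl = h (ℤₚ.*-zeroˡ b)

·-≢0ʳ : ∀ {a b} → a · b ≢ 0ℤ → b ≢ 0ℤ
·-≢0ʳ {a} {b} h refl = h (ℤₚ.*-zeroʳ a)

ep-self : ∀ S → Unique (verts S) → ep (adj S) S ≡ wt S
ep-self (leaf _)     u = refl
ep-self (join s A B) u with unique-++⁻ (verts A) u
... | uA , uB , _ = cong₂ _·_ (adj-cross s A B u) (cong₂ _·_
  (trans (ep-cong A (adj-inˡ s A B u)) (ep-self A uA)) (trans (ep-cong B (adj-inʳ s A B u)) (ep-self B uB)))

-- A nonzero product puts every edge of `Z` on a nonzero entry. Such entries lead out of `P` only to
-- `bad`, which `Z` avoids, so `Z` stays in `P` once its root is there.
ep-spread : ∀ f (P : List ℕ) bad → (∀ {a b} → a ∈ P → b ≢ bad → f a b ≢ 0ℤ → b ∈ P) →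
            ∀ Z → rt Z ∈ P → bad ∉ verts Z → ep f Z ≢ 0ℤ → ∀ {v} → v ∈ verts Z → v ∈ P
ep-spread f P bad cl (leaf _)     r n h (here refl) = r
ep-spread f P bad cl (join _ A B) r n h m with ∈-++⁻ (verts A) m
... | inj₁ p = ep-spread f P bad cl A r (n ∘ ∈-++⁺ˡ) (·-≢0ˡ {ep f A} {ep f B} (·-≢0ʳ {f (rt A) (rt B)} h)) p
... | inj₂ p = ep-spread f P bad cl B
      (cl r (λ e → n (∈-++⁺ʳ (verts A) (subst (_∈ verts B) e (rt∈verts B)))) (·-≢0ˡ h))
      (n ∘ ∈-++⁺ʳ (verts A)) (·-≢0ʳ {ep f A} {ep f B} (·-≢0ʳ {f (rt A) (rt B)} h)) p

adj-first : ∀ s A B y → Unique (verts (join s A B)) → rt B ≢ y → adj (join s A B) (rt A) y ≡ adj A (rt A) y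
adj-first s A B y u n
  rewrite δ-≢ n | δ-≢ {rt B} {rt A} (∈∉⇒≢ (rt∈verts B) (proj₂ (proj₂ (unique-++⁻ (verts A) u)) (rt∈verts A)))
        | adj-out B y (proj₂ (proj₂ (unique-++⁻ (verts A) u)) (rt∈verts A)) =
  lem s (δ (rt A) (rt A)) (δ (rt A) y) (adj A (rt A) y)
  where
  lem : ∀ s a b c → s · (a · 0ℤ ⊹ ⊖ (b · 0ℤ)) ⊹ (c ⊹ 0ℤ) ≡ c
  lem = solve-∀

child-at : ∀ R y → Unique (verts R) → adj R (rt R) y ≢ 0ℤ → ∃[ s ] ∃[ A ] ∃[ B ] (R ≃ join s A B) × rt B ≡ y
child-at (leaf _)     y u h = contradiction refl h
child-at (join s A B) y u h = go (rt B ℕ.≟ y)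
  where
  go : Dec (rt B ≡ y) → ∃[ t ] ∃[ C ] ∃[ D ] (join s A B ≃ join t C D) × rt D ≡ y
  go (yes e) = s , A , B , ≃-refl , e
  go (no n) with child-at A y (proj₁ (unique-++⁻ (verts A) u)) (λ e → h (trans (adj-first s A B y u n) e))
  ... | t , C , D , p , e = t , join s C B , D , ≃-trans (≃-cong p ≃-refl) ≃-comm , e

+-squeeze : ∀ {a b c d} → a ≤ c → b ≤ d → a + b ≡ c + d → c ≤ a × d ≤ b
+-squeeze {a} {b} {c} {d} p q e =
  ℕₚ.+-cancelʳ-≤ d c a (ℕₚ.≤-trans (ℕₚ.≤-reflexive (sym e)) (ℕₚ.+-monoʳ-≤ a q)) ,
  ℕₚ.+-cancelˡ-≤ c d b (ℕₚ.≤-trans (ℕₚ.≤-reflexive (sym e)) (ℕₚ.+-monoˡ-≤ b p))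

-- The branch of S at a child of the root has to fill the branch of R at that child, because no edge of R leaves
-- that branch except the one to the root.
same-edges⇒same-code : ∀ S R → Unique (verts R) → verts S ↭ verts R → rt S ≡ rt R → ep (adj R) S ≢ 0ℤ →
                       κ S ≡ κ R × ep (adj R) S ≡ wt R
same-edges⇒same-code (leaf x) (leaf y) u p e h = refl , refl
same-edges⇒same-code (leaf x) (join s A B) u p e h =
  contradiction (trans (↭-length p) (length-verts (join s A B)))
    (ℕₚ.<⇒≢ (ℕₚ.≤-<-trans (sz>0 A) (sz<joinˡ A B)))
same-edges⇒same-code (join _ A B) R u p e h
  with child-at R (rt B) u (subst (λ z → adj R z (rt B) ≢ 0ℤ) e (·-≢0ˡ h))
... | s , A′ , B′ , m , eB =
  trans (cong₂ ins κB κA) (sym (≃-κ m)) ,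
  trans prod (trans (cong₂ _·_ cross (cong₂ _·_ (trans eqA wA) (trans eqB wB))) (sym (≃-wt m)))
  where
  R′ = join s A′ B′
  f = adj R′
  u′ : Unique (verts R′)
  u′ = unique-↭ (≃-verts m) u
  p′ : verts A ++ verts B ↭ verts A′ ++ verts B′
  p′ = ↭-trans p (≃-verts m)
  uS = unique-++⁻ (verts A) (unique-↭ (↭-sym p′) u′)
  rootA : rt A ≡ rt A′
  rootA = trans e (≃-rt m)
  prod : ep (adj R) (join 1ℤ A B) ≡ f (rt A) (rt B) · (ep f A · ep f B)
  prod = ep-cong (join 1ℤ A B) (λ {a} {b} _ _ → ≃-adj m a b)
  h′ : f (rt A) (rt B) · (ep f A · ep f B) ≢ 0ℤ
  h′ = subst (_≢ 0ℤ) prod h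
  hA : ep f A ≢ 0ℤ
  hA = ·-≢0ˡ {ep f A} {ep f B} (·-≢0ʳ {f (rt A) (rt B)} h′)
  hB : ep f B ≢ 0ℤ
  hB = ·-≢0ʳ {ep f A} {ep f B} (·-≢0ʳ {f (rt A) (rt B)} h′)
  subA : ∀ {v} → v ∈ verts A → v ∈ verts A′
  subA = ep-spread f (verts A′) (rt B′) (adj-leave-A s A′ B′ u′) A (subst (_∈ verts A′) (sym rootA) (rt∈verts A′))
    (λ q → proj₂ (proj₂ uS) q (subst (_∈ verts B) (sym eB) (rt∈verts B))) hA
  subB : ∀ {v} → v ∈ verts B → v ∈ verts B′
  subB = ep-spread f (verts B′) (rt A′) (adj-leave-B s A′ B′ u′) B (subst (_∈ verts B′) eB (rt∈verts B′))
    (λ q → proj₂ (proj₂ uS) (subst (_∈ verts A) rootA (rt∈verts A)) q) hB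
  lens = +-squeeze (unique-⊆⇒≤ (proj₁ uS) subA) (unique-⊆⇒≤ (proj₁ (proj₂ uS)) subB)
    (trans (sym (Listₚ.length-++ (verts A))) (trans (↭-length p′) (Listₚ.length-++ (verts A′))))
  pA = ↭-sym (unique-⊆-full⇒↭ (proj₁ uS) subA (proj₁ lens))
  pB = ↭-sym (unique-⊆-full⇒↭ (proj₁ (proj₂ uS)) subB (proj₂ lens))
  uR = unique-++⁻ (verts A′) u′
  eqA : ep f A ≡ ep (adj A′) A
  eqA = ep-cong A (λ q r → adj-inˡ s A′ B′ u′ (subA q) (subA r))
  eqB : ep f B ≡ ep (adj B′) B
  eqB = ep-cong B (λ q r → adj-inʳ s A′ B′ u′ (subB q) (subB r))
  cross : f (rt A) (rt B) ≡ s
  cross = trans (cong₂ f rootA (sym eB)) (adj-cross s A′ B′ u′)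
  recA = same-edges⇒same-code A A′ (proj₁ uR) pA rootA (subst (_≢ 0ℤ) eqA hA)
  recB = same-edges⇒same-code B B′ (proj₁ (proj₂ uR)) pB (sym eB) (subst (_≢ 0ℤ) eqB hB)
  κA = proj₁ recA
  κB = proj₁ recB
  wA = proj₂ recA
  wB = proj₂ recB

-- Weighted skew kernels and their homomorphism sums

record Kernel : Set₁ where
  field
    Ω    : Set
    pts  : List Ω
    w    : Ω → ℤ
    f    : Ω → Ω → ℤ
    skew : ∀ x y → f x y ≡ ⊖ f y x
open Kernel public

mass : Kernel → ℤ
mass K = ∑ (pts K) (w K)

-- Homomorphism sums: each edge contributes the factor c + s f(x,y).  The value c = 1 counts homomorphisms, c = 0 gives
-- the multilinear functionals attached to single trees.
gs : ℤ → (K : Kernel) → Tr V₀ → Ω K → ℤ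
br : ℤ → (K : Kernel) → ℤ → Tr V₀ → Ω K → ℤ
gs c K (leaf _)     x = 1ℤ
gs c K (join s A B) x = gs c K A x · br c K s B x
br c K s B x = ∑ (pts K) (λ y → w K y · ((c ⊹ s · f K x y) · gs c K B y))

hs : ℤ → Kernel → Tr V₀ → ℤ
hs c K S = ∑ (pts K) (λ x → w K x · gs c K S x)

Φ : Kernel → Tr V₀ → ℤ
Φ = hs 1ℤ

t : Kernel → Tr V₀ → ℤ
t = hs 0ℤ

≃-gs : ∀ c K {A B : Tr V₀} → A ≃ B → ∀ x → gs c K A x ≡ gs c K B x
≃-gs c K ≃-refl        x = refl
≃-gs c K (≃-trans p q) x = trans (≃-gs c K p x) (≃-gs c K q x)
≃-gs c K (≃-comm {s} {t} {A} {B} {C}) x = lem (gs c K A x) (br c K t B x) (br c K s C x)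
  where
  lem : ∀ a b c → a · b · c ≡ a · c · b
  lem = solve-∀
≃-gs c K (≃-cong {s} p q)  x =
  cong₂ _·_ (≃-gs c K p x) (∑-cong (pts K) (λ y → cong (λ z → w K y · ((c ⊹ s · f K x y) · z)) (≃-gs c K q y)))

pair : ℤ → Kernel → Tr V₀ → Tr W₀ → ℤ
pair c K A B = ∑ (pts K) (λ x → ∑ (pts K) (λ y → w K x · gs c K A x · (w K y · gs c K B y) · f K x y))

pair-skew : ∀ c K (A : Tr V₀) (B : Tr W₀) → pair c K A B ≡ ⊖ pair c K B A
pair-skew c K A B = trans (∑-swap (pts K) (pts K) _) (trans
  (∑-cong (pts K) (λ y → trans (∑-cong (pts K) (λ x → trans (cong (w K x · gs c K A x · (w K y · gs c K B y) ·_) (skew K x y))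
     (lem (w K x · gs c K A x) (w K y · gs c K B y) (f K y x)))) (∑-neg (pts K) _)))
  (∑-neg (pts K) _))
  where
  lem : ∀ a b f → a · b · ⊖ f ≡ ⊖ (b · a · f)
  lem = solve-∀

hs-join : ∀ c K s (A B : Tr V₀) → hs c K (join s A B) ≡ c · (hs c K A · hs c K B) ⊹ s · pair c K A B
hs-join c K s A B = trans (∑-cong (pts K) term) (trans (∑-+ (pts K) _ _) (cong₂ _⊹_ left right))
  where
  a b : Ω K → ℤ
  a x = w K x · gs c K A x
  b y = w K y · gs c K B y
  lem₁ : ∀ v g h → v · (g · h) ≡ (v · g) · h
  lem₁ = solve-∀
  lem₂ : ∀ u v c s f g → u · (v · ((c ⊹ s · f) · g)) ≡ c · (u · (v · g)) ⊹ s · (u · (v · g) · f)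
  lem₂ = solve-∀
  term : ∀ x → w K x · gs c K (join s A B) x ≡ c · ∑ (pts K) (λ y → a x · b y) ⊹ s · ∑ (pts K) (λ y → a x · b y · f K x y)
  term x = trans (lem₁ (w K x) (gs c K A x) (br c K s B x)) (trans (sym (∑-* (pts K) (a x) _))
    (trans (∑-cong (pts K) (λ y → lem₂ (a x) (w K y) c s (f K x y) (gs c K B y)))
      (trans (∑-+ (pts K) _ _) (cong₂ _⊹_ (∑-* (pts K) c _) (∑-* (pts K) s _)))))
  left : ∑ (pts K) (λ x → c · ∑ (pts K) (λ y → a x · b y)) ≡ c · (hs c K A · hs c K B)
  left = trans (∑-* (pts K) c _) (cong (c ·_) (∑∑-* (pts K) (pts K) a b))
  right : ∑ (pts K) (λ x → s · ∑ (pts K) (λ y → a x · b y · f K x y)) ≡ s · pair c K A B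
  right = ∑-* (pts K) s _

≈-hs : ∀ c K {A B : Tr V₀} → A ≈ B → hs c K A ≡ hs c K B
≈-hs c K (≈-of p)      = ∑-cong (pts K) (λ x → cong (w K x ·_) (≃-gs c K p x))
≈-hs c K (≈-trans p q) = trans (≈-hs c K p) (≈-hs c K q)
≈-hs c K (≈-rot {s} {A} {B}) = trans (hs-join c K s A B) (trans
  (trans (cong (λ z → c · (hs c K A · hs c K B) ⊹ s · z) (pair-skew c K A B)) (lem c (hs c K A) (hs c K B) s (pair c K B A)))
  (sym (hs-join c K (⊖ s) B A)))
  where
  lem : ∀ c a b s p → c · (a · b) ⊹ s · ⊖ p ≡ c · (b · a) ⊹ (⊖ s) · p
  lem = solve-∀

x≡-x⇒0 : ∀ {x} → x ≡ ⊖ x → x ≡ 0ℤ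
x≡-x⇒0 {+ zero}  e = refl
x≡-x⇒0 {+ suc n} ()
x≡-x⇒0 { -[1+ n ]} ()

-- The term of the bridge is a skew form evaluated at two equal arguments.
Φ-square : ∀ K s (A : Tr V₀) → Φ K (join s A A) ≡ Φ K A · Φ K A
Φ-square K s A = trans (hs-join 1ℤ K s A A) (trans (cong (λ z → 1ℤ · (Φ K A · Φ K A) ⊹ s · z) (x≡-x⇒0 (pair-skew 1ℤ K A A)))
  (lem (Φ K A) s))
  where
  lem : ∀ a s → 1ℤ · (a · a) ⊹ s · 0ℤ ≡ a · a
  lem = solve-∀

t-wt-gs : ∀ K (S : Tr V₀) x → gs 0ℤ K S x ≡ wt S · gs 0ℤ K (sk S) x
t-wt-gs K (leaf _)     x = refl
t-wt-gs K (join s A B) x rewrite t-wt-gs K A x = trans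
  (cong (wt A · gs 0ℤ K (sk A) x ·_) (trans (∑-cong (pts K) (λ y → trans (cong (λ z → w K y · ((0ℤ ⊹ s · f K x y) · z)) (t-wt-gs K B y))
      (lem₁ (w K y) s (f K x y) (wt B) (gs 0ℤ K (sk B) y)))) (∑-* (pts K) (s · wt B) _)))
  (lem₂ (wt A) (gs 0ℤ K (sk A) x) s (wt B) (br 0ℤ K 1ℤ (sk B) x))
  where
  lem₁ : ∀ v s f b g → v · ((0ℤ ⊹ s · f) · (b · g)) ≡ (s · b) · (v · ((0ℤ ⊹ 1ℤ · f) · g))
  lem₁ = solve-∀
  lem₂ : ∀ a g s b h → a · g · (s · b · h) ≡ s · (a · b) · (g · h)
  lem₂ = solve-∀

t-wt : ∀ K (S : Tr V₀) → t K S ≡ wt S · t K (sk S)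
t-wt K S = trans (∑-cong (pts K) (λ x → trans (cong (w K x ·_) (t-wt-gs K S x)) (lem (w K x) (wt S) (gs 0ℤ K (sk S) x)))) (∑-* (pts K) (wt S) _)
  where
  lem : ∀ a b c → a · (b · c) ≡ b · (a · c)
  lem = solve-∀

_⊎ᴷ_ : Kernel → Kernel → Kernel
K ⊎ᴷ L = record
  { Ω = Ω K ⊎ Ω L ; pts = map inj₁ (pts K) ++ map inj₂ (pts L) ; w = [ w K , w L ]
  ; f = ff ; skew = sk′ }
  where
  ff : Ω K ⊎ Ω L → Ω K ⊎ Ω L → ℤ
  ff (inj₁ x) (inj₁ y) = f K x y
  ff (inj₂ x) (inj₂ y) = f L x y
  ff _        _        = 0ℤ
  sk′ : ∀ x y → ff x y ≡ ⊖ ff y x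
  sk′ (inj₁ x) (inj₁ y) = skew K x y
  sk′ (inj₂ x) (inj₂ y) = skew L x y
  sk′ (inj₁ x) (inj₂ y) = refl
  sk′ (inj₂ x) (inj₁ y) = refl

∑-⊎ : ∀ K L (F : Ω (K ⊎ᴷ L) → ℤ) → ∑ (pts (K ⊎ᴷ L)) F ≡ ∑ (pts K) (F ∘ inj₁) ⊹ ∑ (pts L) (F ∘ inj₂)
∑-⊎ K L F = trans (∑-++ (map inj₁ (pts K)) _ F) (cong₂ _⊹_ (∑-map inj₁ (pts K) F) (∑-map inj₂ (pts L) F))

no-edge : ∀ v s g → v · ((0ℤ ⊹ s · 0ℤ) · g) ≡ 0ℤ
no-edge = solve-∀

gs-⊎ˡ : ∀ K L (S : Tr V₀) x → gs 0ℤ (K ⊎ᴷ L) S (inj₁ x) ≡ gs 0ℤ K S x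
gs-⊎ˡ K L (leaf _)     x = refl
gs-⊎ˡ K L (join s A B) x = cong₂ _·_ (gs-⊎ˡ K L A x) (trans (∑-⊎ K L _) (trans
  (cong₂ _⊹_ (∑-cong (pts K) (λ y → cong (λ z → w K y · ((0ℤ ⊹ s · f K x y) · z)) (gs-⊎ˡ K L B y)))
             (∑-vanish (pts L) (λ y _ → no-edge (w L y) s (gs 0ℤ (K ⊎ᴷ L) B (inj₂ y)))))
  (ℤₚ.+-identityʳ _)))

gs-⊎ʳ : ∀ K L (S : Tr V₀) x → gs 0ℤ (K ⊎ᴷ L) S (inj₂ x) ≡ gs 0ℤ L S x
gs-⊎ʳ K L (leaf _)     x = refl
gs-⊎ʳ K L (join s A B) x = cong₂ _·_ (gs-⊎ʳ K L A x) (trans (∑-⊎ K L _) (trans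
  (cong₂ _⊹_ (∑-vanish (pts K) (λ y _ → no-edge (w K y) s (gs 0ℤ (K ⊎ᴷ L) B (inj₁ y))))
             (∑-cong (pts L) (λ y → cong (λ z → w L y · ((0ℤ ⊹ s · f L x y) · z)) (gs-⊎ʳ K L B y))))
  (ℤₚ.+-identityˡ _)))

-- For c = 0 an edge between the summands contributes 0, and a tree is connected, so only maps into
-- one summand count.
t-⊎ : ∀ K L (S : Tr V₀) → t (K ⊎ᴷ L) S ≡ t K S ⊹ t L S
t-⊎ K L S = trans (∑-⊎ K L _) (cong₂ _⊹_ (∑-cong (pts K) (λ x → cong (w K x ·_) (gs-⊎ˡ K L S x)))
                                         (∑-cong (pts L) (λ x → cong (w L x ·_) (gs-⊎ʳ K L S x))))

-- Weights and matrix are negated together: a tree has one vertex more than it has edges, so its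
-- value changes sign exactly once.
negᴷ : Kernel → Kernel
negᴷ K = record K { w = λ x → ⊖ w K x ; f = λ x y → ⊖ f K x y ; skew = λ x y → cong ⊖_ (skew K x y) }

gs-neg : ∀ K (S : Tr V₀) x → gs 0ℤ (negᴷ K) S x ≡ gs 0ℤ K S x
gs-neg K (leaf _)     x = refl
gs-neg K (join s A B) x = cong₂ _·_ (gs-neg K A x) (∑-cong (pts K) (λ y →
  trans (cong (λ z → ⊖ w K y · ((0ℤ ⊹ s · ⊖ f K x y) · z)) (gs-neg K B y)) (lem (w K y) s (f K x y) (gs 0ℤ K B y))))
  where
  lem : ∀ v s f g → (⊖ v) · ((0ℤ ⊹ s · ⊖ f) · g) ≡ v · ((0ℤ ⊹ s · f) · g)
  lem = solve-∀

t-neg : ∀ K (S : Tr V₀) → t (negᴷ K) S ≡ ⊖ t K S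
t-neg K S = trans (∑-cong (pts K) (λ x → trans (cong (⊖ w K x ·_) (gs-neg K S x)) (sym (ℤₚ.neg-distribˡ-* (w K x) (gs 0ℤ K S x)))))
  (∑-neg (pts K) _)

pow : ℤ → ℕ → ℤ
pow a zero    = 1ℤ
pow a (suc n) = a · pow a n

pow-+ : ∀ a m n → pow a (m + n) ≡ pow a m · pow a n
pow-+ a zero    n = sym (ℤₚ.*-identityˡ _)
pow-+ a (suc m) n = trans (cong (a ·_) (pow-+ a m n)) (sym (ℤₚ.*-assoc a _ _))

scaleᴷ : ℤ → Kernel → Kernel
scaleᴷ a K = record K { w = λ x → a · w K x }

gs-scale : ∀ a K (S : Tr V₀) x → a · gs 0ℤ (scaleᴷ a K) S x ≡ pow a (sz S) · gs 0ℤ K S x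
gs-scale a K (leaf _)     x = cong (_· 1ℤ) (sym (ℤₚ.*-identityʳ a))
gs-scale a K (join s A B) x = trans (lem₁ a (gs 0ℤ K′ A x) (br 0ℤ K′ s B x)) (trans (cong₂ _·_ (gs-scale a K A x)
   (trans (∑-cong (pts K) (λ y → trans (lem₂ a (w K y) (0ℤ ⊹ s · f K x y) (gs 0ℤ K′ B y))
       (trans (cong (λ z → w K y · ((0ℤ ⊹ s · f K x y) · z)) (gs-scale a K B y))
            (lem₃ (w K y) (0ℤ ⊹ s · f K x y) (pow a (sz B)) (gs 0ℤ K B y))))) (∑-* (pts K) (pow a (sz B)) _)))
   (trans (lem₄ (pow a (sz A)) (gs 0ℤ K A x) (pow a (sz B)) (br 0ℤ K s B x))
     (cong (_· gs 0ℤ K (join s A B) x) (sym (pow-+ a (sz A) (sz B))))))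
  where
  K′ = scaleᴷ a K
  lem₁ : ∀ a g h → a · (g · h) ≡ (a · g) · h
  lem₁ = solve-∀
  lem₂ : ∀ a v e g → (a · v) · (e · g) ≡ v · (e · (a · g))
  lem₂ = solve-∀
  lem₃ : ∀ v e p g → v · (e · (p · g)) ≡ p · (v · (e · g))
  lem₃ = solve-∀
  lem₄ : ∀ p g q h → p · g · (q · h) ≡ p · q · (g · h)
  lem₄ = solve-∀

t-scale : ∀ a K (S : Tr V₀) → t (scaleᴷ a K) S ≡ pow a (sz S) · t K S
t-scale a K S = trans (∑-cong (pts K) (λ x → trans (lem a (w K x) (gs 0ℤ (scaleᴷ a K) S x)) (trans (cong (w K x ·_) (gs-scale a K S x)) (lem′ (w K x) (pow a (sz S)) (gs 0ℤ K S x)))))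
  (∑-* (pts K) (pow a (sz S)) _)
  where
  lem : ∀ a v g → a · v · g ≡ v · (a · g)
  lem = solve-∀
  lem′ : ∀ v p g → v · (p · g) ≡ p · (v · g)
  lem′ = solve-∀

pointᴷ : ℤ → Kernel
pointᴷ v = record { Ω = ⊤ ; pts = tt ∷ [] ; w = λ _ → v ; f = λ _ _ → 0ℤ ; skew = λ _ _ → refl }

t-point : ∀ v s (A B : Tr V₀) → t (pointᴷ v) (join s A B) ≡ 0ℤ
t-point v s A B = lem v (gs 0ℤ (pointᴷ v) A tt) s (gs 0ℤ (pointᴷ v) B tt)
  where
  lem : ∀ v a s b → v · (a · (v · ((0ℤ ⊹ s · 0ℤ) · b) ⊹ 0ℤ)) ⊹ 0ℤ ≡ 0ℤ
  lem = solve-∀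

-- Functionals on trees realised by divisible kernels

record Real (Λ : ℤ) (τ : Tr ⊤ → ℤ) : Set₁ where
  field
    ker  : Kernel
    div  : ∀ x y → ∃[ c ] f ker x y ≡ Λ · c
    val  : ∀ S → t ker S ≡ τ S
open Real public

module _ {Λ : ℤ} where
  real-ext : ∀ {τ σ} → (∀ S → τ S ≡ σ S) → Real Λ τ → Real Λ σ
  real-ext h R = record { ker = ker R ; div = div R ; val = λ S → trans (val R S) (h S) }

  real-+ : ∀ {τ σ} → Real Λ τ → Real Λ σ → Real Λ (λ S → τ S ⊹ σ S)
  real-+ R R′ = record
    { ker = ker R ⊎ᴷ ker R′
    ; div = λ { (inj₁ x) (inj₁ y) → div R x y ; (inj₂ x) (inj₂ y) → div R′ x y
              ; (inj₁ _) (inj₂ _) → 0ℤ , sym (ℤₚ.*-zeroʳ Λ) ; (inj₂ _) (inj₁ _) → 0ℤ , sym (ℤₚ.*-zeroʳ Λ) }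
    ; val = λ S → trans (t-⊎ (ker R) (ker R′) S) (cong₂ _⊹_ (val R S) (val R′ S)) }

  real-neg : ∀ {τ} → Real Λ τ → Real Λ (λ S → ⊖ τ S)
  real-neg R = record
    { ker = negᴷ (ker R)
    ; div = λ x y → ⊖ proj₁ (div R x y) , trans (cong ⊖_ (proj₂ (div R x y))) (ℤₚ.neg-distribʳ-* Λ (proj₁ (div R x y)))
    ; val = λ S → trans (t-neg (ker R) S) (cong ⊖_ (val R S)) }

  real-scale : ∀ a {τ} → Real Λ τ → Real Λ (λ S → pow a (sz S) · τ S)
  real-scale a R = record { ker = scaleᴷ a (ker R) ; div = div R
    ; val = λ S → trans (t-scale a (ker R) S) (cong (pow a (sz S) ·_) (val R S)) }

  real-0 : Real Λ (λ _ → 0ℤ)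
  real-0 = record { ker = record { Ω = ⊤ ; pts = [] ; w = λ _ → 0ℤ ; f = λ _ _ → 0ℤ ; skew = λ _ _ → refl }
                  ; div = λ _ _ → 0ℤ , sym (ℤₚ.*-zeroʳ Λ) ; val = λ _ → refl }

  real-× : ∀ n {τ} → Real Λ τ → Real Λ (λ S → (+ n) · τ S)
  real-× zero {τ} R = real-ext (λ S → sym (ℤₚ.*-zeroˡ (τ S))) real-0
  real-× (suc n) {τ} R = real-ext (λ S → sym (ℤₚ.suc-* (+ n) (τ S))) (real-+ R (real-× n R))

  real-⊖× : ∀ c {τ} → Real Λ τ → Real Λ (λ S → c · τ S)
  real-⊖× (+ n)      R = real-× n R
  real-⊖× -[1+ n ] {τ} R = real-ext (λ S → ℤₚ.neg-distribˡ-* (+ suc n) (τ S)) (real-neg (real-× (suc n) R))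

-- An isolated point corrects the mass to 1 and is invisible to every tree with an edge.
normᴷ : Kernel → Kernel
normᴷ K = K ⊎ᴷ pointᴷ (1ℤ ⊹ ⊖ mass K)

mass-norm : ∀ K → mass (normᴷ K) ≡ 1ℤ
mass-norm K = trans (∑-⊎ K (pointᴷ (1ℤ ⊹ ⊖ mass K)) (w (normᴷ K))) (lem (mass K))
  where
  lem : ∀ m → m ⊹ (1ℤ ⊹ ⊖ m ⊹ 0ℤ) ≡ 1ℤ
  lem = solve-∀

t-norm : ∀ K s (A B : Tr V₀) → t (normᴷ K) (join s A B) ≡ t K (join s A B)
t-norm K s A B = trans (t-⊎ K _ (join s A B)) (trans (cong (t K (join s A B) ⊹_) (t-point (1ℤ ⊹ ⊖ mass K) s A B)) (ℤₚ.+-identityʳ _))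

-- What impartiality of a digraph leaves for a tree component. With mass 1 the expected value does
-- not depend on the number of vertices.
ImpT : ℤ → Tr V₀ → Set₁
ImpT Λ S = ∀ K → (∀ x y → ∃[ c ] f K x y ≡ Λ · c) → mass K ≡ 1ℤ → Φ K S ≡ 1ℤ

≃-sk : {A B : Tr V₀} → A ≃ B → sk A ≃ sk B
≃-sk ≃-refl        = ≃-refl
≃-sk (≃-trans p q) = ≃-trans (≃-sk p) (≃-sk q)
≃-sk ≃-comm        = ≃-comm
≃-sk (≃-cong p q)  = ≃-cong (≃-sk p) (≃-sk q)

κ≡⇒hs≡ : ∀ c K (S : Tr V₀) (S′ : Tr W₀) → κ S ≡ κ S′ → hs c K (sk S) ≡ hs c K (sk S′)
κ≡⇒hs≡ c K S S′ e with decode S S′ e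
... | S″ , p , q = trans (cong (hs c K) (sym q)) (sym (≈-hs c K (≈-of (≃-sk p))))

data Units {V : Set} : Tr V → Set where
  leaf : ∀ {x} → Units (leaf x)
  join : ∀ {s A B} → s ≡ 1ℤ ⊎ s ≡ -1ℤ → Units A → Units B → Units (join s A B)

≃-units : {A B : Tr V₀} → A ≃ B → Units A → Units B
≃-units ≃-refl        u = u
≃-units (≃-trans p q) u = ≃-units q (≃-units p u)
≃-units ≃-comm        (join s (join t a b) c) = join t (join s a c) b
≃-units (≃-cong p q)  (join s a b) = join s (≃-units p a) (≃-units q b)

unit-neg : ∀ {s} → s ≡ 1ℤ ⊎ s ≡ -1ℤ → ⊖ s ≡ 1ℤ ⊎ ⊖ s ≡ -1ℤ
unit-neg (inj₁ refl) = inj₂ refl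
unit-neg (inj₂ refl) = inj₁ refl

unit-· : ∀ {s t} → s ≡ 1ℤ ⊎ s ≡ -1ℤ → t ≡ 1ℤ ⊎ t ≡ -1ℤ → s · t ≡ 1ℤ ⊎ s · t ≡ -1ℤ
unit-· (inj₁ refl) (inj₁ refl) = inj₁ refl
unit-· (inj₁ refl) (inj₂ refl) = inj₂ refl
unit-· (inj₂ refl) (inj₁ refl) = inj₂ refl
unit-· (inj₂ refl) (inj₂ refl) = inj₁ refl

≈-units : {A B : Tr V₀} → A ≈ B → Units A → Units B
≈-units (≈-of p)      u = ≃-units p u
≈-units (≈-trans p q) u = ≈-units q (≈-units p u)
≈-units ≈-rot         (join s a b) = join (unit-neg s) b a

units-sk : (S : Tr V₀) → Units (sk S)
units-sk (leaf _)     = leaf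
units-sk (join _ A B) = join (inj₁ refl) (units-sk A) (units-sk B)

wt-unit : {S : Tr V₀} → Units S → wt S ≡ 1ℤ ⊎ wt S ≡ -1ℤ
wt-unit leaf         = inj₁ refl
wt-unit (join s a b) = unit-· s (unit-· (wt-unit a) (wt-unit b))

unit-sq : ∀ {s} → s ≡ 1ℤ ⊎ s ≡ -1ℤ → s · s ≡ 1ℤ
unit-sq (inj₁ refl) = refl
unit-sq (inj₂ refl) = refl

-- Labellings and inclusion-exclusion

rel : Tr V₀ → List ℕ → List (Tr ℕ)
rel (leaf _)     ps = map leaf ps
rel (join s A B) ps = concatMap (λ A′ → map (join s A′) (rel B ps)) (rel A ps)

rel-sound : (S : Tr V₀) (ps : List ℕ) → ∀ {S′} → S′ ∈ rel S ps → κ S′ ≡ κ S × (∀ {x} → x ∈ verts S′ → x ∈ ps)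
rel-sound (leaf _) ps m with ∈-map⁻ leaf m
... | x , p , refl = refl , λ { (here refl) → p }
rel-sound (join s A B) ps m with find (∈-concatMap⁻ (λ A′ → map (join s A′) (rel B ps)) {xs = rel A ps} m)
... | A′ , pA , m′ with ∈-map⁻ (join s A′) m′
...   | B′ , pB , refl with rel-sound A ps pA | rel-sound B ps pB
...     | eA , iA | eB , iB = cong₂ ins eB eA , λ q → [ iA , iB ] (∈-++⁻ (verts A′) q)

rel-self : (S : Tr ℕ) (ps : List ℕ) → (∀ {x} → x ∈ verts S → x ∈ ps) → S ∈ rel S ps
rel-self (leaf x)     ps h = ∈-map⁺ leaf (h (here refl))
rel-self (join s A B) ps h = ∈-concatMap⁺ (λ A′ → map (join s A′) (rel B ps))
  (Any.map (λ { refl → ∈-map⁺ (join s A) (rel-self B ps (h ∘ ∈-++⁺ʳ (verts A))) }) (rel-self A ps (h ∘ ∈-++⁺ˡ)))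

module _ (K : Kernel) (ps : List ℕ) (w′ : ℕ → ℤ) (g : ℕ → ℕ → ℤ) (sg : ∀ x y → g x y ≡ ⊖ g y x) where
  private
    L : Kernel
    L = record { Ω = ℕ ; pts = ps ; w = w′ ; f = g ; skew = sg }

  -- The factor `φ` at the root stands for the edge to the parent; with it the induction passes from
  -- a tree to its branches.
  ∑-rel : (S : Tr V₀) (φ : ℕ → ℤ) →
          ∑ ps (λ x → w′ x · gs 0ℤ L (sk S) x · φ x) ≡ ∑ (rel S ps) (λ S′ → ∏ (verts S′) w′ · ep g S′ · φ (rt S′))
  ∑-rel (leaf _) φ = sym (trans (∑-map leaf ps _) (∑-cong ps (λ x → cong (λ z → z · 1ℤ · φ x) (ℤₚ.*-identityʳ (w′ x)))))
  ∑-rel (join s A B) φ = trans (∑-cong ps (λ x → lem₁ (w′ x) (gs 0ℤ L (sk A) x) (b x) (φ x)))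
    (trans (∑-rel A (λ x → b x · φ x)) (sym (trans (∑-concatMap (λ A′ → map (join s A′) (rel B ps)) (rel A ps) _)
      (∑-cong (rel A ps) (λ A′ → trans (∑-map (join s A′) (rel B ps) _) (trans (∑-cong (rel B ps) (λ B′ →
         trans (cong (λ z → z · (g (rt A′) (rt B′) · (ep g A′ · ep g B′)) · φ (rt A′)) (∏-++ (verts A′) (verts B′) w′))
           (lem₂ (∏ (verts A′) w′) (∏ (verts B′) w′) (g (rt A′) (rt B′)) (ep g A′) (ep g B′) (φ (rt A′)))))
         (trans (∑-* (rel B ps) (∏ (verts A′) w′ · ep g A′ · φ (rt A′)) _)
           (trans (cong (∏ (verts A′) w′ · ep g A′ · φ (rt A′) ·_) (sym (branch A′)))
             (lem₃ (∏ (verts A′) w′) (ep g A′) (φ (rt A′)) (b (rt A′)))))))))))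
    where
    b : ℕ → ℤ
    b = br 0ℤ L 1ℤ (sk B)
    lem₁ : ∀ v a b p → v · (a · b) · p ≡ v · a · (b · p)
    lem₁ = solve-∀
    lem₂ : ∀ pa pb g ea eb p → pa · pb · (g · (ea · eb)) · p ≡ (pa · ea · p) · (pb · eb · g)
    lem₂ = solve-∀
    lem₃ : ∀ pa ea p b → pa · ea · p · b ≡ pa · ea · (b · p)
    lem₃ = solve-∀
    lem₄ : ∀ v f a → v · ((0ℤ ⊹ 1ℤ · f) · a) ≡ v · a · f
    lem₄ = solve-∀
    branch : ∀ A′ → b (rt A′) ≡ ∑ (rel B ps) (λ B′ → ∏ (verts B′) w′ · ep g B′ · g (rt A′) (rt B′))
    branch A′ = trans (∑-cong ps (λ y → lem₄ (w′ y) (g (rt A′) y) (gs 0ℤ L (sk B) y))) (∑-rel B (g (rt A′)))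

  t-rel : (S : Tr V₀) → t L (sk S) ≡ ∑ (rel S ps) (λ S′ → ∏ (verts S′) w′ · ep g S′)
  t-rel S = trans (∑-cong ps (λ x → sym (ℤₚ.*-identityʳ _))) (trans (∑-rel S (λ _ → 1ℤ))
    (∑-cong (rel S ps) (λ S′ → ℤₚ.*-identityʳ _)))

-- Inclusion-exclusion over the Boolean values of a mask on ys.
upd : (ℕ → Bool) → ℕ → Bool → ℕ → Bool
upd a y b x = if ⌊ x ℕ.≟ y ⌋ then b else a x

upd-hit : ∀ a y b → upd a y b y ≡ b
upd-hit a y b = cong (λ z → if z then b else a y) (yes! (y ℕ.≟ y) refl)

upd-miss : ∀ a {x y} b → x ≢ y → upd a y b x ≡ a x
upd-miss a {x} {y} b n = cong (λ z → if z then b else a x) (no! (x ℕ.≟ y) n)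

Alt : List ℕ → ((ℕ → Bool) → ℤ) → (ℕ → Bool) → ℤ
Alt []       F a = F a
Alt (y ∷ ys) F a = Alt ys F (upd a y true) ⊹ ⊖ Alt ys F (upd a y false)

Alt-cong : ∀ ys {F G : (ℕ → Bool) → ℤ} → (∀ a → F a ≡ G a) → ∀ a → Alt ys F a ≡ Alt ys G a
Alt-cong []       h a = h a
Alt-cong (y ∷ ys) h a = cong₂ (λ u v → u ⊹ ⊖ v) (Alt-cong ys h _) (Alt-cong ys h _)

Alt-0 : ∀ ys a → Alt ys (λ _ → 0ℤ) a ≡ 0ℤ
Alt-0 []       a = refl
Alt-0 (y ∷ ys) a = cong₂ (λ u v → u ⊹ ⊖ v) (Alt-0 ys _) (Alt-0 ys _)

Alt-+ : ∀ ys (F G : (ℕ → Bool) → ℤ) a → Alt ys (λ b → F b ⊹ G b) a ≡ Alt ys F a ⊹ Alt ys G a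
Alt-+ []       F G a = refl
Alt-+ (y ∷ ys) F G a = trans (cong₂ (λ u v → u ⊹ ⊖ v) (Alt-+ ys F G _) (Alt-+ ys F G _))
  (lem (Alt ys F _) (Alt ys G _) (Alt ys F _) (Alt ys G _))
  where
  lem : ∀ p q r s → (p ⊹ q) ⊹ ⊖ (r ⊹ s) ≡ (p ⊹ ⊖ r) ⊹ (q ⊹ ⊖ s)
  lem = solve-∀

Alt-*ʳ : ∀ ys (F : (ℕ → Bool) → ℤ) c a → Alt ys (λ b → F b · c) a ≡ Alt ys F a · c
Alt-*ʳ []       F c a = refl
Alt-*ʳ (y ∷ ys) F c a = trans (cong₂ (λ u v → u ⊹ ⊖ v) (Alt-*ʳ ys F c _) (Alt-*ʳ ys F c _)) (lem (Alt ys F _) (Alt ys F _) c)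
  where
  lem : ∀ p r c → p · c ⊹ ⊖ (r · c) ≡ (p ⊹ ⊖ r) · c
  lem = solve-∀

Alt-∑ : {X : Set} (ys : List ℕ) (xs : List X) (F : X → (ℕ → Bool) → ℤ) (a : ℕ → Bool) →
        Alt ys (λ b → ∑ xs (λ x → F x b)) a ≡ ∑ xs (λ x → Alt ys (F x) a)
Alt-∑ ys []       F a = Alt-0 ys a
Alt-∑ ys (x ∷ xs) F a = trans (Alt-+ ys (F x) _ a) (cong (Alt ys (F x) a ⊹_) (Alt-∑ ys xs F a))

mono : List ℕ → (ℕ → Bool) → ℤ
mono xs a = ∏ xs (λ x → 𝟙 (a x))

Alt-mono-cong : ∀ ys xs a b → (∀ {x} → x ∈ xs → a x ≡ b x) → Alt ys (mono xs) a ≡ Alt ys (mono xs) b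
Alt-mono-cong []       xs a b h = ∏-cong∈ xs (λ x m → cong 𝟙 (h m))
Alt-mono-cong (y ∷ ys) xs a b h = cong₂ (λ u v → u ⊹ ⊖ v)
  (Alt-mono-cong ys xs _ _ (step true)) (Alt-mono-cong ys xs _ _ (step false))
  where
  step : ∀ c {x} → x ∈ xs → upd a y c x ≡ upd b y c x
  step c {x} m with x ℕ.≟ y
  ... | yes _ = refl
  ... | no _  = h m

Alt-mono-miss : ∀ ys xs a {y} → y ∈ ys → y ∉ xs → Alt ys (mono xs) a ≡ 0ℤ
Alt-mono-miss (y ∷ ys) xs a (here refl) n = trans (cong (λ z → Alt ys (mono xs) (upd a y true) ⊹ ⊖ z)
   (Alt-mono-cong ys xs (upd a y false) (upd a y true) (λ m → trans (upd-miss a false (∈∉⇒≢ m n)) (sym (upd-miss a true (∈∉⇒≢ m n))))))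
  (ℤₚ.+-inverseʳ (Alt ys (mono xs) (upd a y true)))
Alt-mono-miss (y ∷ ys) xs a (there m) n =
  cong₂ (λ u v → u ⊹ ⊖ v) (Alt-mono-miss ys xs _ m n) (Alt-mono-miss ys xs _ m n)

Alt-mono-dead : ∀ ys xs a {x} → x ∈ xs → x ∉ ys → a x ≡ false → Alt ys (mono xs) a ≡ 0ℤ
Alt-mono-dead []       xs a {x} m n e = ∏-zero xs m (cong 𝟙 e)
Alt-mono-dead (y ∷ ys) xs a {x} m n e = cong₂ (λ u v → u ⊹ ⊖ v)
  (Alt-mono-dead ys xs _ m (n ∘ there) (trans (upd-miss a true (n ∘ here)) e))
  (Alt-mono-dead ys xs _ m (n ∘ there) (trans (upd-miss a false (n ∘ here)) e))

Alt-mono-hit : ∀ ys xs a → Unique ys → (∀ {y} → y ∈ ys → y ∈ xs) → (∀ {x} → x ∈ xs → a x ≡ true) → Alt ys (mono xs) a ≡ 1ℤ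
Alt-mono-hit []       xs a u h e = trans (∏-cong∈ xs (λ x m → cong 𝟙 (e m))) (∏-one xs)
Alt-mono-hit (y ∷ ys) xs a (n ∷ u) h e = cong₂ (λ u v → u ⊹ ⊖ v)
  (Alt-mono-hit ys xs _ u (h ∘ there) keep)
  (Alt-mono-dead ys xs _ (h (here refl)) (λ m → All.lookup n m refl) (upd-hit a y false))
  where
  keep : ∀ {x} → x ∈ xs → upd a y true x ≡ true
  keep {x} m with x ℕ.≟ y
  ... | yes _ = refl
  ... | no _  = e m

covers : (ys xs : List ℕ) → Dec (All (_∈ xs) ys)
covers ys xs = All.all? (λ y → y ∈? xs) ys

-- If a vertex of `ys` does not occur in `xs`, its two values cancel. Otherwise every mask with a
-- false value on `ys` kills the monomial, and the all-true one gives 1.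
Alt-mono : ∀ ys xs → Unique ys → Alt ys (mono xs) (λ _ → true) ≡ 𝟙 ⌊ covers ys xs ⌋
Alt-mono ys xs u with covers ys xs
... | yes h = Alt-mono-hit ys xs _ u (All.lookup h) (λ _ → refl)
... | no n with find (Allₚ.¬All⇒Any¬ (λ y → y ∈? xs) ys n)
...   | y , m , k = Alt-mono-miss ys xs _ m k

·-cancelˡ0 : ∀ a {b} → a ≢ 0ℤ → a · b ≡ 0ℤ → b ≡ 0ℤ
·-cancelˡ0 a n e with ℤₚ.i*j≡0⇒i≡0∨j≡0 a e
... | inj₁ p = contradiction p n
... | inj₂ q = q

·-≢0 : ∀ {a b} → a ≢ 0ℤ → b ≢ 0ℤ → a · b ≢ 0ℤ
·-≢0 {a} {b} p q e = q (·-cancelˡ0 a p e)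

pow-≢0 : ∀ {a} n → a ≢ 0ℤ → pow a n ≢ 0ℤ
pow-≢0 zero    h ()
pow-≢0 (suc n) h = ·-≢0 h (pow-≢0 n h)

pow-2 : ∀ n → pow (+ 2) n ≡ + (2 ^ n)
pow-2 zero    = refl
pow-2 (suc n) = trans (cong ((+ 2) ·_) (pow-2 n)) (sym (ℤₚ.pos-* 2 (2 ^ n)))

pow-2-≢ : ∀ {m n} → m < n → pow (+ 2) m ⊹ ⊖ pow (+ 2) n ≢ 0ℤ
pow-2-≢ {m} {n} l e = ℕₚ.<⇒≢ (ℕₚ.^-monoʳ-< 2 (s≤s (s≤s z≤n)) l)
  (ℤₚ.+-injective (trans (sym (pow-2 m)) (trans (ℤₚ.i-j≡0⇒i≡j _ _ e) (pow-2 n))))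

∑-01 : {X : Set} (xs : List X) (F : X → ℤ) → (∀ x → x ∈ xs → F x ≡ 0ℤ ⊎ F x ≡ 1ℤ) →
       ∃[ n ] (∑ xs F ≡ + n) × (∀ {x} → x ∈ xs → F x ≡ 1ℤ → 0 < n)
∑-01 []       F h = 0 , refl , λ ()
∑-01 (x ∷ xs) F h with ∑-01 xs F (λ y m → h y (there m)) | h x (here refl)
... | n , e , p | inj₁ z = n , trans (cong₂ _⊹_ z e) (ℤₚ.+-identityˡ _) ,
      λ { (here refl) q → contradiction (trans (sym z) q) (λ ()) ; (there m) q → p m q }
... | n , e , p | inj₂ o = suc n , cong₂ _⊹_ o e , λ _ _ → s≤s z≤n

-- Kernels that detect one tree

-- For a tree C rooted canonically, with n ranging over ℕ, kernels of mass 1 on which a tree of size at most h has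
-- t-value n M χ, where χ is ±1 on the trees isomorphic to C and 0 on the others.
record Detect (Λ : ℤ) (h : ℕ) (C : Tr ℕ) : Set₁ where
  field
    M      : ℤ
    M≢0    : M ≢ 0ℤ
    kern   : ℕ → Kernel
    kdiv   : ∀ n x y → ∃[ c ] f (kern n) x y ≡ Λ · c
    kmass  : ∀ n → mass (kern n) ≡ 1ℤ
    χ      : {V : Set} → Tr V → ℤ
    t-kern : ∀ n {V : Set} s (A B : Tr V) → sz (join s A B) ≤ h → t (kern n) (sk (join s A B)) ≡ (+ n) · M · χ (join s A B)
    χ-iso  : ∀ {V : Set} (S : Tr V) → χ S ≢ 0ℤ → sz S ≡ sz C × ∃[ R ] Reroot C R × κ R ≡ κ S
    χ-unit : ∀ {V : Set} (S : Tr V) R → Reroot C R → κ R ≡ κ S → χ S ≡ 1ℤ ⊎ χ S ≡ -1ℤ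
open Detect public

module Detection (Λ : ℤ) (Λ≢0 : Λ ≢ 0ℤ) (h : ℕ) (C : Tr ℕ) (uC : Unique (verts C)) (unit : Units C) (wC : wt C ≡ 1ℤ) (can : CanC (κ C)) where

  c : ℕ
  c = sz C

  -- The mask selects the vertices of `C` that may be used, so the alternating sum over all masks
  -- keeps the maps that hit every vertex of `C`.
  K[_] : (ℕ → Bool) → Kernel
  K[ a ] = record { Ω = ℕ ; pts = verts C ; w = λ x → 𝟙 (a x) ; f = λ x y → Λ · adj C x y
                  ; skew = λ x y → trans (cong (Λ ·_) (adj-skew C x y)) (sym (ℤₚ.neg-distribʳ-* Λ (adj C y x))) }

  real-a : ∀ a → Real Λ (t K[ a ])
  real-a a = record { ker = K[ a ] ; div = λ x y → adj C x y , refl ; val = λ _ → refl }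

  real-alt : ∀ ys a → Real Λ (λ S → Alt ys (λ b → t K[ b ] S) a)
  real-alt []       a = real-a a
  real-alt (y ∷ ys) a = real-+ (real-alt ys _) (real-neg (real-alt ys _))

  ne : Tr V₀ → ℕ
  ne (leaf _)     = 0
  ne (join _ A B) = suc (ne A + ne B)

  suc-ne : (S : Tr V₀) → suc (ne S) ≡ sz S
  suc-ne (leaf _)     = refl
  suc-ne (join _ A B) = trans (sym (cong suc (ℕₚ.+-suc (ne A) (ne B)))) (cong₂ _+_ (suc-ne A) (suc-ne B))

  ep-scale : ∀ (g : ℕ → ℕ → ℤ) S → ep (λ x y → Λ · g x y) S ≡ pow Λ (ne S) · ep g S
  ep-scale g (leaf _)     = refl
  ep-scale g (join _ A B) rewrite ep-scale g A | ep-scale g B | pow-+ Λ (ne A) (ne B) =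
    lem Λ (g (rt A) (rt B)) (pow Λ (ne A)) (pow Λ (ne B)) (ep g A) (ep g B)
    where
    lem : ∀ l g p q a b → l · g · ((p · a) · (q · b)) ≡ l · (p · q) · (g · (a · b))
    lem = solve-∀

  -- Λ-normalised number of isomorphisms from S to C, counted with sign.
  isos : Tr V₀ → ℤ
  isos S = ∑ (rel S (verts C)) (λ S′ → 𝟙 ⌊ covers (verts C) (verts S′) ⌋ · ep (adj C) S′)

  τ : Tr V₀ → ℤ
  τ S = pow Λ (ne S) · isos S

  ne-rel : (S : Tr V₀) → ∀ {S′} → S′ ∈ rel S (verts C) → ne S′ ≡ ne S
  ne-rel S {S′} m = ℕₚ.suc-injective (trans (suc-ne S′) (trans (κ≡⇒sz≡ S′ S (proj₁ (rel-sound S _ m))) (sym (suc-ne S))))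

  alt-τ : (S : Tr V₀) → Alt (verts C) (λ b → t K[ b ] (sk S)) (λ _ → true) ≡ τ S
  alt-τ S = trans (Alt-cong (verts C) (λ b → t-rel (K[ b ]) (verts C) (λ x → 𝟙 (b x)) (λ x y → Λ · adj C x y) (skew K[ b ]) S) _)
    (trans (Alt-∑ (verts C) (rel S (verts C)) (λ S′ b → ∏ (verts S′) (λ x → 𝟙 (b x)) · ep (λ x y → Λ · adj C x y) S′) _)
    (trans (∑-cong∈ (rel S (verts C)) (λ S′ m → trans (Alt-*ʳ (verts C) (mono (verts S′)) _ _)
        (trans (cong₂ _·_ (Alt-mono (verts C) (verts S′) uC)
          (trans (ep-scale (adj C) S′) (cong (λ z → pow Λ z · ep (adj C) S′) (ne-rel S m))))
          (lem (𝟙 ⌊ covers (verts C) (verts S′) ⌋) (pow Λ (ne S)) (ep (adj C) S′)))))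
     (∑-* (rel S (verts C)) (pow Λ (ne S)) _)))
    where
    lem : ∀ a p e → a · (p · e) ≡ p · (a · e)
    lem = solve-∀

  -- A covering of the vertices of C with a nonzero contribution comes from a rerooting of C.
  covering : (S : Tr V₀) → ∀ {S′} → S′ ∈ rel S (verts C) → sz S ≡ c → ep (adj C) S′ ≢ 0ℤ → All (_∈ verts S′) (verts C) →
             ∃[ R ] Reroot C R × rt R ≡ rt S′ × κ R ≡ κ S × verts S′ ↭ verts C
  covering S {S′} m e n a with reroot-at C (proj₂ (rel-sound S (verts C) m) (rt∈verts S′))
  ... | R , r , q = R , r , q , trans (sym (proj₁ same)) (proj₁ (rel-sound S _ m)) , perm
    where
    perm : verts S′ ↭ verts C
    perm = unique-⊆-full⇒↭ uC (All.lookup a) (ℕₚ.≤-reflexive (trans (length-verts S′)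
      (trans (κ≡⇒sz≡ S′ S (proj₁ (rel-sound S _ m))) (trans e (sym (length-verts C))))))
    same = same-edges⇒same-code S′ R (unique-↭ (≈-verts (reroot-≈ r)) uC) (↭-trans perm (≈-verts (reroot-≈ r))) (sym q)
      (subst (_≢ 0ℤ) (ep-cong S′ (λ {x} {y} _ _ → ≈-adj (reroot-≈ r) x y)) n)

  isos-nonzero : (S : Tr V₀) → sz S ≡ c → isos S ≢ 0ℤ → ∃[ R ] Reroot C R × κ R ≡ κ S
  isos-nonzero S e n = search (rel S (verts C)) (λ m → m) n
    where
    term : Tr ℕ → ℤ
    term S′ = 𝟙 ⌊ covers (verts C) (verts S′) ⌋ · ep (adj C) S′
    search : ∀ xs → (∀ {x} → x ∈ xs → x ∈ rel S (verts C)) → ∑ xs term ≢ 0ℤ → ∃[ R ] Reroot C R × κ R ≡ κ S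
    search []       sub n = contradiction refl n
    search (S′ ∷ xs) sub n with term S′ ℤ.≟ 0ℤ
    ... | yes z = search xs (sub ∘ there) (λ q → n (cong₂ _⊹_ z q))
    ... | no k with covers (verts C) (verts S′)
    ...   | no _ = contradiction (ℤₚ.*-zeroˡ (ep (adj C) S′)) k
    ...   | yes a with covering S (sub (here refl)) e (·-≢0ʳ {1ℤ} k) a
    ...     | R , r , _ , q , _ = R , r , q

  -- A contributing map of `C` to itself fixes the canonical root, so its product is `wt C`, which
  -- is 1, and nothing cancels. An exchange of two equal halves would contribute -1; this is the
  -- reason for detecting canonical trees only.
  isos-C : isos C ≢ 0ℤ
  isos-C e with ∑-01 (rel C (verts C)) (λ S′ → 𝟙 ⌊ covers (verts C) (verts S′) ⌋ · ep (adj C) S′) bit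
    where
    bit : ∀ S′ → S′ ∈ rel C (verts C) → 𝟙 ⌊ covers (verts C) (verts S′) ⌋ · ep (adj C) S′ ≡ 0ℤ
                                       ⊎ 𝟙 ⌊ covers (verts C) (verts S′) ⌋ · ep (adj C) S′ ≡ 1ℤ
    bit S′ m with covers (verts C) (verts S′)
    ... | no _ = inj₁ (ℤₚ.*-zeroˡ (ep (adj C) S′))
    ... | yes a with ep (adj C) S′ ℤ.≟ 0ℤ
    ...   | yes z = inj₁ (cong (1ℤ ·_) z)
    ...   | no n with covering C m refl n a
    ...     | R , r , q , k , p = inj₂ (trans (ℤₚ.*-identityˡ _) (trans
              (proj₂ (same-edges⇒same-code S′ C uC p (trans (sym q) (proj₁ (canonical-root-unique C R r can can k))) n)) wC))
  ... | n , q , some = ℕₚ.<⇒≢ (some (rel-self C (verts C) (λ m → m)) (cong₂ _·_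
      (cong 𝟙 (yes! (covers (verts C) (verts C)) (All.tabulate (λ m → m)))) (trans (ep-self C uC) wC)))
      (ℤₚ.+-injective (trans (sym e) q))

  τ-small : (S : Tr V₀) → sz S < c → τ S ≡ 0ℤ
  τ-small S l = trans (cong (pow Λ (ne S) ·_) (∑-vanish (rel S (verts C)) none)) (ℤₚ.*-zeroʳ (pow Λ (ne S)))
    where
    none : ∀ S′ → S′ ∈ rel S (verts C) → 𝟙 ⌊ covers (verts C) (verts S′) ⌋ · ep (adj C) S′ ≡ 0ℤ
    none S′ m with covers (verts C) (verts S′)
    ... | no _  = ℤₚ.*-zeroˡ (ep (adj C) S′)
    ... | yes a = contradiction (ℕₚ.≤-trans (ℕₚ.≤-reflexive (sym (length-verts C))) (ℕₚ.≤-trans (unique-⊆⇒≤ uC (All.lookup a))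
        (ℕₚ.≤-reflexive (trans (length-verts S′) (κ≡⇒sz≡ S′ S (proj₁ (rel-sound S _ m))))))) (ℕₚ.<⇒≱ l)

  -- Kills the trees of size c + 1, …, c + k.
  kill : ℕ → ℕ → ℤ
  kill zero    n = 1ℤ
  kill (suc k) n = (pow (+ 2) n ⊹ ⊖ pow (+ 2) (c + suc k)) · kill k n

  kill-0 : ∀ k n → c < n → n ≤ c + k → kill k n ≡ 0ℤ
  kill-0 zero    n l m = contradiction (subst (n ≤_) (ℕₚ.+-identityʳ c) m) (ℕₚ.<⇒≱ l)
  kill-0 (suc k) n l m with n ℕ.≟ c + suc k
  ... | yes refl = trans (cong (_· kill k n) (ℤₚ.+-inverseʳ (pow (+ 2) n))) (ℤₚ.*-zeroˡ (kill k n))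
  ... | no p = trans (cong (D ·_) (kill-0 k n l (ℕₚ.≤-pred (subst (n <_) (ℕₚ.+-suc c k) (ℕₚ.≤∧≢⇒< m p))))) (ℤₚ.*-zeroʳ D)
    where
    D = pow (+ 2) n ⊹ ⊖ pow (+ 2) (c + suc k)

  kill-c : ∀ k → kill k c ≢ 0ℤ
  kill-c zero    ()
  kill-c (suc k) = ·-≢0 (pow-2-≢ (ℕₚ.m<m+n c (s≤s z≤n))) (kill-c k)

  -- Doubling the weights multiplies the value of a tree with n vertices by 2 ^ n. Subtracting a
  -- fixed multiple of the original functional leaves a factor that vanishes at one chosen size.
  real-kill : ∀ k {σ} → Real Λ σ → Real Λ (λ S → kill k (sz S) · σ S)
  real-kill zero    {σ} R = real-ext (λ S → sym (ℤₚ.*-identityˡ (σ S))) R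
  real-kill (suc k) {σ} R = real-ext (λ S → lem (pow (+ 2) (sz S)) (pow (+ 2) (c + suc k)) (kill k (sz S)) (σ S))
    (real-+ (real-scale (+ 2) (real-kill k R)) (real-⊖× (⊖ pow (+ 2) (c + suc k)) (real-kill k R)))
    where
    lem : ∀ p q k s → p · (k · s) ⊹ (⊖ q) · (k · s) ≡ (p ⊹ ⊖ q) · k · s
    lem = solve-∀

  RC : Real Λ (λ S → kill h (sz S) · Alt (verts C) (λ b → t K[ b ] S) (λ _ → true))
  RC = real-kill h (real-alt (verts C) (λ _ → true))

  v : Tr V₀ → ℤ
  v S = t (ker RC) (sk S)

  v-val : (S : Tr V₀) → v S ≡ kill h (sz S) · τ S
  v-val S = trans (val RC (sk S)) (cong₂ _·_ (cong (kill h) (sz-sk S)) (alt-τ S))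

  M₀ : ℤ
  M₀ = v C

  M₀≢0 : M₀ ≢ 0ℤ
  M₀≢0 e = ·-≢0 (kill-c h) (·-≢0 (pow-≢0 (ne C) Λ≢0) isos-C) (trans (sym (v-val C)) e)

  -- Rerooting preserves `t`, and `t` is `wt` times the value on the skeleton. Since `wt R` is a
  -- unit, it can be moved to the other side.
  v-iso : (S : Tr V₀) (R : Tr ℕ) → Reroot C R → κ R ≡ κ S → v S ≡ M₀ · wt R
  v-iso S R r e = trans (κ≡⇒hs≡ 0ℤ (ker RC) S R (sym e)) (trans (lem₁ (unit-sq (wt-unit (≈-units (reroot-≈ r) unit)))) (cong (_· wt R)
    (trans (sym (t-wt (ker RC) R)) (trans (sym (≈-hs 0ℤ (ker RC) (reroot-≈ r))) (trans (t-wt (ker RC) C)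
      (trans (cong (_· t (ker RC) (sk C)) wC) (ℤₚ.*-identityˡ _)))))))
    where
    lem₁ : wt R · wt R ≡ 1ℤ → t (ker RC) (sk R) ≡ wt R · t (ker RC) (sk R) · wt R
    lem₁ q = trans (sym (ℤₚ.*-identityˡ _)) (trans (cong (_· t (ker RC) (sk R)) (sym q)) (lem₂ (wt R) (t (ker RC) (sk R))))
      where
      lem₂ : ∀ a b → a · a · b ≡ a · b · a
      lem₂ = solve-∀

  v-nonzero : (S : Tr V₀) → sz S ≤ h → v S ≢ 0ℤ → sz S ≡ c × ∃[ R ] Reroot C R × κ R ≡ κ S
  v-nonzero S l n with <-cmp (sz S) c
  ... | tri< a _ _ = contradiction (trans (v-val S) (trans (cong (kill h (sz S) ·_) (τ-small S a)) (ℤₚ.*-zeroʳ (kill h (sz S))))) n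
  ... | tri> _ _ a = contradiction (trans (v-val S) (trans (cong (_· τ S) (kill-0 h (sz S) a (ℕₚ.≤-trans l (ℕₚ.m≤n+m h c)))) (ℤₚ.*-zeroˡ (τ S)))) n
  ... | tri≈ _ e _ = e , isos-nonzero S e (·-≢0ʳ {pow Λ (ne S)} (·-≢0ʳ {kill h (sz S)} (subst (_≢ 0ℤ) (v-val S) n)))

  X : Tr V₀ → ℤ
  X S with sz S ℕ.≤? h
  ... | no _ = 0ℤ
  ... | yes l with v S ℤ.≟ 0ℤ
  ...   | yes _ = 0ℤ
  ...   | no n  = wt (proj₁ (proj₂ (v-nonzero S l n)))

  v-X : (S : Tr V₀) → sz S ≤ h → v S ≡ M₀ · X S
  v-X S l with sz S ℕ.≤? h
  ... | no k = contradiction l k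
  ... | yes l with v S ℤ.≟ 0ℤ
  ...   | yes z = trans z (sym (ℤₚ.*-zeroʳ M₀))
  ...   | no n with v-nonzero S l n
  ...     | _ , R , r , e = v-iso S R r e

  X-iso : (S : Tr V₀) → X S ≢ 0ℤ → sz S ≡ c × ∃[ R ] Reroot C R × κ R ≡ κ S
  X-iso S k with sz S ℕ.≤? h
  ... | no _ = contradiction refl k
  ... | yes l with v S ℤ.≟ 0ℤ
  ...   | yes _ = contradiction refl k
  ...   | no n  = v-nonzero S l n

  X-unit : c ≤ h → (S : Tr V₀) (R : Tr ℕ) → Reroot C R → κ R ≡ κ S → X S ≡ 1ℤ ⊎ X S ≡ -1ℤ
  X-unit ch S R r e = subst (λ z → z ≡ 1ℤ ⊎ z ≡ -1ℤ) (sym same) (wt-unit (≈-units (reroot-≈ r) unit))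
    where
    szS : sz S ≤ h
    szS = subst (_≤ h) (trans (≈-sz (reroot-≈ r)) (κ≡⇒sz≡ R S e)) ch
    same : X S ≡ wt R
    same = ℤₚ.*-cancelˡ-≡ M₀ (X S) (wt R) {{ℤ.≢-nonZero M₀≢0}} (trans (sym (v-X S szS)) (v-iso S R r e))

  detect : c ≤ h → Detect Λ h C
  detect ch = record
    { M = M₀ ; M≢0 = M₀≢0
    -- `real-× n` is a disjoint union of n copies, which makes n the variable of the polynomials
    -- below; the isolated point of `normᴷ` restores mass 1.
    ; kern = λ n → normᴷ (ker (real-× n RC))
    ; kdiv = λ { n (inj₁ x) (inj₁ y) → div (real-× n RC) x y ; n (inj₁ _) (inj₂ _) → 0ℤ , sym (ℤₚ.*-zeroʳ Λ)
               ; n (inj₂ _) (inj₁ _) → 0ℤ , sym (ℤₚ.*-zeroʳ Λ) ; n (inj₂ _) (inj₂ _) → 0ℤ , sym (ℤₚ.*-zeroʳ Λ) }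
    ; kmass = λ n → mass-norm (ker (real-× n RC))
    ; χ = X
    ; t-kern = λ n s A B l → trans (t-norm (ker (real-× n RC)) 1ℤ (sk A) (sk B)) (trans (val (real-× n RC) (sk (join s A B)))
        (trans (cong ((+ n) ·_) (trans (sym (val RC (sk (join s A B)))) (v-X (join s A B) l))) (sym (ℤₚ.*-assoc (+ n) M₀ _))))
    ; χ-iso = X-iso
    ; χ-unit = X-unit ch }

-- Congruence modulo 2 of integer polynomials

addp : List ℤ → List ℤ → List ℤ
addp []      q       = q
addp (a ∷ p) []      = a ∷ p
addp (a ∷ p) (b ∷ q) = (a ⊹ b) ∷ addp p q

scalep : ℤ → List ℤ → List ℤ
scalep c = map (c ·_)

mulp : List ℤ → List ℤ → List ℤ
mulp []      q = []
mulp (a ∷ p) q = addp (scalep a q) (0ℤ ∷ mulp p q)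

hdp : List ℤ → ℤ
hdp []      = 0ℤ
hdp (a ∷ _) = a

tlp : List ℤ → List ℤ
tlp []      = []
tlp (_ ∷ p) = p

-- Substitutes the square of the variable, as the Frobenius map requires.
dbl : List ℤ → List ℤ
dbl []      = []
dbl (a ∷ p) = a ∷ 0ℤ ∷ dbl p

parity : ∀ a → ∃[ k ] (a ≡ (+ 2) · k ⊎ a ≡ 1ℤ ⊹ (+ 2) · k)
parity a = go ℤ.∣ a ∣ a refl
  where
  nat : ∀ n → ∃[ k ] (+ n ≡ (+ 2) · k ⊎ + n ≡ 1ℤ ⊹ (+ 2) · k)
  nat zero = 0ℤ , inj₁ refl
  nat (suc n) with nat n
  ... | k , inj₁ e = k , inj₂ (cong (1ℤ ⊹_) e)
  ... | k , inj₂ e = k ⊹ 1ℤ , inj₁ (trans (cong (1ℤ ⊹_) e) (lem k))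
    where
    lem : ∀ k → 1ℤ ⊹ (1ℤ ⊹ (+ 2) · k) ≡ (+ 2) · (k ⊹ 1ℤ)
    lem = solve-∀
  go : ∀ n a → ℤ.∣ a ∣ ≡ n → ∃[ k ] (a ≡ (+ 2) · k ⊎ a ≡ 1ℤ ⊹ (+ 2) · k)
  go n (+ m) e = nat m
  go n -[1+ m ] e with nat (suc m)
  ... | k , inj₁ q = ⊖ k , inj₁ (trans (cong ⊖_ q) (lem k))
    where
    lem : ∀ k → ⊖ ((+ 2) · k) ≡ (+ 2) · ⊖ k
    lem = solve-∀
  ... | k , inj₂ q = ⊖ (k ⊹ 1ℤ) , inj₂ (trans (cong ⊖_ q) (lem k))
    where
    lem : ∀ k → ⊖ (1ℤ ⊹ (+ 2) · k) ≡ 1ℤ ⊹ (+ 2) · ⊖ (k ⊹ 1ℤ)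
    lem = solve-∀

sq-parity : ∀ a → ∃[ b ] a · a ≡ a ⊹ (+ 2) · b
sq-parity a with parity a
... | k , inj₁ refl = (+ 2) · k · k ⊹ ⊖ k , lem k
  where
  lem : ∀ k → (+ 2) · k · ((+ 2) · k) ≡ (+ 2) · k ⊹ (+ 2) · ((+ 2) · k · k ⊹ ⊖ k)
  lem = solve-∀
... | k , inj₂ refl = (+ 2) · k · k ⊹ k , lem k
  where
  lem : ∀ k → (1ℤ ⊹ (+ 2) · k) · (1ℤ ⊹ (+ 2) · k) ≡ 1ℤ ⊹ (+ 2) · k ⊹ (+ 2) · ((+ 2) · k · k ⊹ k)
  lem = solve-∀

horner-zero : ∀ x → 0ℤ ≡ 0ℤ ⊹ x · (0ℤ ⊹ x · 0ℤ)
horner-zero = solve-∀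

opaque
  ev : ℤ → List ℤ → ℤ
  ev x []      = 0ℤ
  ev x (a ∷ p) = a ⊹ x · ev x p

  ev-[] : ∀ x → ev x [] ≡ 0ℤ
  ev-[] x = refl

  ev-∷ : ∀ x a p → ev x (a ∷ p) ≡ a ⊹ x · ev x p
  ev-∷ x a p = refl

  ev-addp : ∀ x p q → ev x (addp p q) ≡ ev x p ⊹ ev x q
  ev-addp x []      q       = sym (ℤₚ.+-identityˡ _)
  ev-addp x (a ∷ p) []      = sym (ℤₚ.+-identityʳ _)
  ev-addp x (a ∷ p) (b ∷ q) rewrite ev-addp x p q = lem a b x (ev x p) (ev x q)
    where
    lem : ∀ a b x p q → a ⊹ b ⊹ x · (p ⊹ q) ≡ (a ⊹ x · p) ⊹ (b ⊹ x · q)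
    lem = solve-∀

  ev-scalep : ∀ x c p → ev x (scalep c p) ≡ c · ev x p
  ev-scalep x c []      = sym (ℤₚ.*-zeroʳ c)
  ev-scalep x c (a ∷ p) rewrite ev-scalep x c p = lem c a x (ev x p)
    where
    lem : ∀ c a x p → c · a ⊹ x · (c · p) ≡ c · (a ⊹ x · p)
    lem = solve-∀

  ev-mulp : ∀ x p q → ev x (mulp p q) ≡ ev x p · ev x q
  ev-mulp x []      q = sym (ℤₚ.*-zeroˡ (ev x q))
  ev-mulp x (a ∷ p) q rewrite ev-addp x (scalep a q) (0ℤ ∷ mulp p q) | ev-scalep x a q | ev-mulp x p q = lem a x (ev x p) (ev x q)
    where
    lem : ∀ a x p q → a · q ⊹ (0ℤ ⊹ x · (p · q)) ≡ (a ⊹ x · p) · q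
    lem = solve-∀

  ev-hd : ∀ x p → ev x p ≡ hdp p ⊹ x · ev x (tlp p)
  ev-hd x []      = sym (trans (ℤₚ.+-identityˡ _) (ℤₚ.*-zeroʳ x))
  ev-hd x (a ∷ p) = refl

  -- Frobenius: p(x)^2 = p(x^2) modulo 2.
  ev-sq : ∀ p → ∃[ q ] ∀ x → ev x p · ev x p ≡ ev x (dbl p) ⊹ (+ 2) · ev x q
  ev-sq [] = [] , λ x → refl
  ev-sq (a ∷ p) with ev-sq p | sq-parity a
  ... | q , h | b , e = (b ∷ addp (scalep a p) (0ℤ ∷ q)) , λ x → trans (lem₁ a x (ev x p)) (trans
     (cong₂ (λ u v → u ⊹ (+ 2) · (a · (x · ev x p)) ⊹ x · (x · v)) e (h x))
     (trans (lem₂ a b x (ev x p) (ev x (dbl p)) (ev x q))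
       (cong (λ z → ev x (dbl (a ∷ p)) ⊹ (+ 2) · (b ⊹ x · z)) (sym (trans (ev-addp x (scalep a p) (0ℤ ∷ q))
          (cong (_⊹ (0ℤ ⊹ x · ev x q)) (ev-scalep x a p)))))))
    where
    lem₁ : ∀ a x p → (a ⊹ x · p) · (a ⊹ x · p) ≡ a · a ⊹ (+ 2) · (a · (x · p)) ⊹ x · (x · (p · p))
    lem₁ = solve-∀
    lem₂ : ∀ a b x p d q → a ⊹ (+ 2) · b ⊹ (+ 2) · (a · (x · p)) ⊹ x · (x · (d ⊹ (+ 2) · q))
                         ≡ (a ⊹ x · (0ℤ ⊹ x · d)) ⊹ (+ 2) · (b ⊹ x · (a · p ⊹ (0ℤ ⊹ x · q)))
    lem₂ = solve-∀

  ev-dbl : ∀ x p → ev x (dbl p) ≡ hdp p ⊹ x · (0ℤ ⊹ x · ev x (dbl (tlp p)))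
  ev-dbl x []      = horner-zero x
  ev-dbl x (a ∷ p) = refl

i-j≡0 : ∀ {i j} → i ≡ j → i ⊹ ⊖ j ≡ 0ℤ
i-j≡0 {i} refl = ℤₚ.+-inverseʳ i

+-solve : ∀ {a b} → a ⊹ b ≡ 0ℤ → a ≡ ⊖ b
+-solve {a} {b} e = trans (lem a b) (trans (cong (_⊹ ⊖ b) e) (ℤₚ.+-identityˡ _))
  where
  lem : ∀ a b → a ≡ (a ⊹ b) ⊹ ⊖ b
  lem = solve-∀

subtract-even : ∀ g p → g ≡ (g ⊹ (+ 2) · p) ⊹ (+ 2) · (-1ℤ · p)
subtract-even = solve-∀

add-evens : ∀ h p q → (h ⊹ (+ 2) · q) ⊹ (+ 2) · p ≡ h ⊹ (+ 2) · (q ⊹ p)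
add-evens = solve-∀

+-of-evens : ∀ g h p q → (g ⊹ (+ 2) · p) ⊹ (h ⊹ (+ 2) · q) ≡ g ⊹ h ⊹ (+ 2) · (p ⊹ q)
+-of-evens = solve-∀

even-·ʳ : ∀ g p f → (g ⊹ (+ 2) · p) · f ≡ g · f ⊹ (+ 2) · (p · f)
even-·ʳ = solve-∀

·-even-+ : ∀ g g′ q r → g · (g′ ⊹ (+ 2) · q) ⊹ (+ 2) · r ≡ g · g′ ⊹ (+ 2) · (r ⊹ g · q)
·-even-+ = solve-∀

horner-difference : ∀ a b x d e → a ⊹ ⊖ ((+ 2) · b) ⊹ x · (x · d ⊹ ⊖ ((+ 2) · e)) ≡ (a ⊹ x · (0ℤ ⊹ x · d)) ⊹ ⊖ ((+ 2) · (b ⊹ x · e))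
horner-difference = solve-∀

horner-difference-head : ∀ b x d e → ⊖ ((+ 2) · b) ⊹ x · (d ⊹ ⊖ ((+ 2) · e)) ≡ x · d ⊹ ⊖ ((+ 2) · (b ⊹ x · e))
horner-difference-head = solve-∀

horner-even : ∀ b x r → (+ 2) · b ⊹ x · ((+ 2) · r) ≡ (+ 2) · (b ⊹ x · r)
horner-even = solve-∀

cancel-even : ∀ d r → d ≡ (d ⊹ (+ 2) · r) ⊹ ⊖ ((+ 2) · r)
cancel-even = solve-∀

difference-squared : ∀ f c r → (f ⊹ ⊖ c) · (f ⊹ ⊖ c) ⊹ ⊖ ((+ 2) · r) ≡ f · f ⊹ ⊖ ((+ 2) · (c · f)) ⊹ c · c ⊹ ⊖ ((+ 2) · r)
difference-squared = solve-∀

difference-squared-even : ∀ f c q r → c · c ⊹ (+ 2) · q ⊹ ⊖ ((+ 2) · (c · f)) ⊹ c · c ⊹ ⊖ ((+ 2) · r) ≡ (+ 2) · (q ⊹ ((⊖ c) · (f ⊹ ⊖ c) ⊹ -1ℤ · r))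
difference-squared-even = solve-∀

regroup-difference : ∀ a c y → a ⊹ y ≡ c ⊹ (a ⊹ ⊖ c ⊹ y)
regroup-difference = solve-∀

move-difference : ∀ a c y → a ⊹ ⊖ c ⊹ y ≡ a ⊹ y ⊹ ⊖ c
move-difference = solve-∀

linear-shift : ∀ d q χ x e f → d ⊹ χ · (x · e) ≡ (d ⊹ (+ 2) · q) ⊹ χ · (x · (e ⊹ (+ 2) · f)) ⊹ ⊖ ((+ 2) · (q ⊹ χ · (x · f)))
linear-shift = solve-∀

linear-defect : ∀ c r q χ x f → c ⊹ (+ 2) · r ⊹ ⊖ ((+ 2) · (q ⊹ χ · (x · f))) ≡ c ⊹ (+ 2) · (r ⊹ (-1ℤ · q ⊹ (⊖ χ) · (0ℤ ⊹ x · f)))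
linear-defect = solve-∀

horner-linear-step : ∀ a c r x d χ e t → a ⊹ ⊖ c ⊹ ⊖ ((+ 2) · r) ⊹ x · (x · d ⊹ χ · e ⊹ ⊖ ((+ 2) · t))
  ≡ (a ⊹ x · (0ℤ ⊹ x · d)) ⊹ χ · (x · e) ⊹ ⊖ (c ⊹ (+ 2) · (r ⊹ x · t))
horner-linear-step = solve-∀

horner-linear-tail : ∀ χ e r x d f t → χ · e ⊹ ⊖ ((+ 2) · r) ⊹ x · (d ⊹ χ · (0ℤ ⊹ x · f) ⊹ ⊖ ((+ 2) · t))
  ≡ x · d ⊹ χ · (e ⊹ x · (0ℤ ⊹ x · f)) ⊹ ⊖ ((+ 2) · (r ⊹ x · t))
horner-linear-tail = solve-∀

module Mod2 (M : ℤ) (M≢0 : M ≢ 0ℤ) where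

  opaque
    at : ℕ → ℤ
    at n = (+ n) · M

    at-def : ∀ n → at n ≡ (+ n) · M
    at-def n = refl

    at-0 : at 0 ≡ 0ℤ
    at-0 = ℤₚ.*-zeroˡ M

    at≢0 : ∀ n → at (suc n) ≢ 0ℤ
    at≢0 n = ·-≢0 {+ suc n} {M} (λ ()) M≢0

    abs-at : ∀ n → ℤ.∣ at n ∣ ≡ n * ℤ.∣ M ∣
    abs-at n = ℤₚ.abs-* (+ n) M

  infix 4 _≡₂_

  -- Congruence of polynomials: the difference is twice an integer polynomial in `at n`, which is
  -- stronger than being even for every n. The variable and its square take values of equal parity,
  -- yet they are not congruent in this sense.
  record _≡₂_ (F G : ℕ → ℤ) : Set where
    constructor _,_
    field
      half : List ℤ
      diff : ∀ n → F n ≡ G n ⊹ (+ 2) · ev (at n) half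

  record IsP (F : ℕ → ℤ) : Set where
    constructor _,_
    field
      coeffs : List ℤ
      value  : ∀ n → F n ≡ ev (at n) coeffs

  -- At n = |a| the equation makes `a` a multiple of (|a| + 1) M, so `a` is 0. This takes the place
  -- of comparing coefficients, since polynomials are accessible only through their values at the
  -- multiples of `M`.
  constant-zero : ∀ a (F : ℕ → ℤ) → (∀ n → a ⊹ at (suc n) · F n ≡ 0ℤ) → a ≡ 0ℤ × (∀ n → F n ≡ 0ℤ)
  constant-zero a F h = a≡0 , λ n → ·-cancelˡ0 (at (suc n)) (at≢0 n) (trans (sym (ℤₚ.+-identityˡ _)) (trans (cong (_⊹ at (suc n) · F n) (sym a≡0)) (h n)))
    where
    m = ℤ.∣ a ∣
    big : ℤ.∣ F m ∣ ≡ 0 ⊎ 0 < ℤ.∣ F m ∣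
    big with ℤ.∣ F m ∣
    ... | zero  = inj₁ refl
    ... | suc _ = inj₂ (s≤s z≤n)
    posM : 0 < ℤ.∣ M ∣
    posM = ℕₚ.n≢0⇒n>0 (λ e → M≢0 (ℤₚ.∣i∣≡0⇒i≡0 e))
    size-a : m ≡ suc m * ℤ.∣ M ∣ * ℤ.∣ F m ∣
    size-a = trans (cong ℤ.∣_∣ (+-solve {a} {at (suc m) · F m} (h m))) (trans (ℤₚ.∣-i∣≡∣i∣ (at (suc m) · F m))
      (trans (ℤₚ.abs-* (at (suc m)) (F m)) (cong (_* ℤ.∣ F m ∣) (abs-at (suc m)))))
    a≡0 : a ≡ 0ℤ
    a≡0 with big
    ... | inj₁ z = ℤₚ.∣i∣≡0⇒i≡0 (trans size-a (trans (cong (suc m * ℤ.∣ M ∣ *_) z) (ℕₚ.*-zeroʳ (suc m * ℤ.∣ M ∣))))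
    ... | inj₂ p = contradiction (ℕₚ.≤-trans (ℕₚ.≤-reflexive (sym (trans (ℕₚ.*-identityʳ _) (ℕₚ.*-identityʳ (suc m)))))
        (ℕₚ.≤-trans (ℕₚ.*-mono-≤ (ℕₚ.*-monoʳ-≤ (suc m) posM) p) (ℕₚ.≤-reflexive (sym size-a)))) ℕₚ.1+n≰n

  ≡₂-refl : ∀ {F G} → (∀ n → F n ≡ G n) → F ≡₂ G
  ≡₂-refl {F} {G} h = [] , λ n → trans (h n) (sym (trans (cong (λ z → G n ⊹ (+ 2) · z) (ev-[] (at n))) (ℤₚ.+-identityʳ (G n))))

  ≡₂-sym : ∀ {F G} → F ≡₂ G → G ≡₂ F
  ≡₂-sym {F} {G} (p , h) = scalep -1ℤ p , λ n → trans (subtract-even (G n) (ev (at n) p))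
    (cong₂ (λ u v → u ⊹ (+ 2) · v) (sym (h n)) (sym (ev-scalep (at n) -1ℤ p)))

  ≡₂-trans : ∀ {F G H} → F ≡₂ G → G ≡₂ H → F ≡₂ H
  ≡₂-trans {F} {G} {H} (p , h) (q , k) = addp q p , λ n → trans (h n) (trans (cong (_⊹ (+ 2) · ev (at n) p) (k n))
    (trans (add-evens (H n) (ev (at n) p) (ev (at n) q)) (cong (λ z → H n ⊹ (+ 2) · z) (sym (ev-addp (at n) q p)))))

  ≡₂-+ : ∀ {F G F′ G′} → F ≡₂ G → F′ ≡₂ G′ → (λ n → F n ⊹ F′ n) ≡₂ (λ n → G n ⊹ G′ n)
  ≡₂-+ {F} {G} {F′} {G′} (p , h) (q , k) = addp p q , λ n → trans (cong₂ _⊹_ (h n) (k n))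
    (trans (+-of-evens (G n) (G′ n) (ev (at n) p) (ev (at n) q)) (cong (λ z → G n ⊹ G′ n ⊹ (+ 2) · z) (sym (ev-addp (at n) p q))))

  isP-ext : ∀ {F G} → (∀ n → G n ≡ F n) → IsP F → IsP G
  isP-ext h (p , k) = p , λ n → trans (h n) (k n)

  isP-+ : ∀ {F G} → IsP F → IsP G → IsP (λ n → F n ⊹ G n)
  isP-+ (p , h) (q , k) = addp p q , λ n → trans (cong₂ _⊹_ (h n) (k n)) (sym (ev-addp (at n) p q))

  isP-· : ∀ {F G} → IsP F → IsP G → IsP (λ n → F n · G n)
  isP-· (p , h) (q , k) = mulp p q , λ n → trans (cong₂ _·_ (h n) (k n)) (sym (ev-mulp (at n) p q))

  isP-neg : ∀ {F} → IsP F → IsP (λ n → ⊖ F n)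
  isP-neg (p , h) = scalep -1ℤ p , λ n → trans (cong ⊖_ (h n)) (trans (sym (ℤₚ.-1*i≡-i _)) (sym (ev-scalep (at n) -1ℤ p)))

  isP-const : ∀ c → IsP (λ _ → c)
  isP-const c = c ∷ [] , λ n → sym (trans (trans (ev-∷ (at n) c []) (cong (λ z → c ⊹ at n · z) (ev-[] (at n)))) (trans (cong (c ⊹_) (ℤₚ.*-zeroʳ (at n))) (ℤₚ.+-identityʳ c)))

  isP-∑ : {X : Set} (xs : List X) {F : X → ℕ → ℤ} → (∀ x → x ∈ xs → IsP (F x)) → IsP (λ n → ∑ xs (λ x → F x n))
  isP-∑ []       h = [] , λ n → sym (ev-[] (at n))
  isP-∑ (x ∷ xs) h = isP-+ (h x (here refl)) (isP-∑ xs (λ y m → h y (there m)))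

  even⇒≡₂ : ∀ {F G} P → IsP P → (∀ n → F n ≡ G n ⊹ (+ 2) · P n) → F ≡₂ G
  even⇒≡₂ {F} {G} P (p , h) e = p , λ n → trans (e n) (cong (λ z → G n ⊹ (+ 2) · z) (h n))

  ≡₂⇒even : ∀ {F G} → F ≡₂ G → ∃[ P ] IsP P × (∀ n → F n ≡ G n ⊹ (+ 2) · P n)
  ≡₂⇒even (p , h) = (λ n → ev (at n) p) , (p , λ _ → refl) , h

  ≡₂-· : ∀ {F G F′ G′} → IsP G → IsP F′ → F ≡₂ G → F′ ≡₂ G′ → (λ n → F n · F′ n) ≡₂ (λ n → G n · G′ n)
  ≡₂-· {F} {G} {F′} {G′} pG pF′ e e′ with ≡₂⇒even e | ≡₂⇒even e′
  ... | P , iP , h | Q , iQ , k = even⇒≡₂ (λ n → P n · F′ n ⊹ G n · Q n) (isP-+ (isP-· iP pF′) (isP-· pG iQ))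
    (λ n → trans (cong (_· F′ n) (h n)) (trans (even-·ʳ (G n) (P n) (F′ n)) (trans (cong (λ z → G n · z ⊹ (+ 2) · (P n · F′ n)) (k n))
       (·-even-+ (G n) (G′ n) (Q n) (P n · F′ n)))))

  module _ (a : ℤ) (p q : List ℤ) (h : ∀ n → ev (at (suc n)) (dbl (a ∷ p)) ≡ (+ 2) · ev (at (suc n)) q) where
    private
      x D U U₂ : ℕ → ℤ
      x n = at (suc n)
      D n = ev (x n) (dbl p)
      U n = ev (x n) (tlp q)
      U₂ n = ev (x n) (tlp (tlp q))
      first : a ⊹ ⊖ ((+ 2) · hdp q) ≡ 0ℤ × (∀ n → x n · D n ⊹ ⊖ ((+ 2) · U n) ≡ 0ℤ)
      first = constant-zero (a ⊹ ⊖ ((+ 2) · hdp q)) (λ n → x n · D n ⊹ ⊖ ((+ 2) · U n)) (λ n →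
        trans (horner-difference a (hdp q) (x n) (D n) (U n)) (trans
          (cong (λ z → (a ⊹ x n · (0ℤ ⊹ x n · D n)) ⊹ ⊖ ((+ 2) · z)) (sym (ev-hd (x n) q))) (i-j≡0 (trans (sym (ev-dbl (x n) (a ∷ p))) (h n)))))
      second : ⊖ ((+ 2) · hdp (tlp q)) ≡ 0ℤ × (∀ n → D n ⊹ ⊖ ((+ 2) · U₂ n) ≡ 0ℤ)
      second = constant-zero (⊖ ((+ 2) · hdp (tlp q))) (λ n → D n ⊹ ⊖ ((+ 2) · U₂ n)) (λ n →
        trans (horner-difference-head (hdp (tlp q)) (x n) (D n) (U₂ n)) (trans
          (cong (λ z → x n · D n ⊹ ⊖ ((+ 2) · z)) (sym (ev-hd (x n) (tlp q)))) (proj₂ first n)))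

    dbl-even-head : a ≡ (+ 2) · hdp q
    dbl-even-head = ℤₚ.i-j≡0⇒i≡j a ((+ 2) · hdp q) (proj₁ first)

    dbl-even-tail : ∀ n → ev (at (suc n)) (dbl p) ≡ (+ 2) · ev (at (suc n)) (tlp (tlp q))
    dbl-even-tail n = ℤₚ.i-j≡0⇒i≡j (D n) ((+ 2) · U₂ n) (proj₂ second n)

  dbl-even : ∀ p q → (∀ n → ev (at (suc n)) (dbl p) ≡ (+ 2) · ev (at (suc n)) q) → ∃[ r ] ∀ x → ev x p ≡ (+ 2) · ev x r
  dbl-even []      q h = [] , λ x → trans (ev-[] x) (cong ((+ 2) ·_) (sym (ev-[] x)))
  dbl-even (a ∷ p) q h = (hdp q ∷ proj₁ rec) , λ y → trans (ev-∷ y a p)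
    (trans (cong₂ (λ u v → u ⊹ y · v) (dbl-even-head a p q h) (proj₂ rec y))
      (trans (horner-even (hdp q) y (ev y (proj₁ rec))) (cong ((+ 2) ·_) (sym (ev-∷ y (hdp q) (proj₁ rec))))))
    where
    rec = dbl-even p (tlp (tlp q)) (dbl-even-tail a p q h)

  -- The square of F - c is even. By Frobenius it is congruent to F - c with the variable squared,
  -- so every coefficient of F - c is even.
  ≡₂-sqrt : ∀ {F} → IsP F → ∀ c → (λ n → F n · F n) ≡₂ (λ _ → c · c) → F ≡₂ (λ _ → c)
  ≡₂-sqrt {F} (p , h) c (q , k) = proj₁ half , λ n → trans (h n) (trans (ev-hd (at n) p)
    (trans (regroup-difference (hdp p) c (at n · ev (at n) (tlp p))) (cong (c ⊹_) (trans (sym (ev-∷ (at n) (hdp p ⊹ ⊖ c) (tlp p))) (proj₂ half (at n))))))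
    where
    p′ r w′ : List ℤ
    p′ = (hdp p ⊹ ⊖ c) ∷ tlp p
    r = proj₁ (ev-sq p′)
    w′ = addp q (addp (scalep (⊖ c) p′) (scalep -1ℤ r))
    p′-val : ∀ n → ev (at n) p′ ≡ F n ⊹ ⊖ c
    p′-val n = trans (ev-∷ (at n) (hdp p ⊹ ⊖ c) (tlp p)) (trans (move-difference (hdp p) c (at n · ev (at n) (tlp p))) (cong (_⊹ ⊖ c) (trans (sym (ev-hd (at n) p)) (sym (h n)))))
    w′-val : ∀ n → ev (at n) w′ ≡ ev (at n) q ⊹ ((⊖ c) · (F n ⊹ ⊖ c) ⊹ -1ℤ · ev (at n) r)
    w′-val n = trans (ev-addp (at n) q (addp (scalep (⊖ c) p′) (scalep -1ℤ r))) (cong (ev (at n) q ⊹_)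
      (trans (ev-addp (at n) (scalep (⊖ c) p′) (scalep -1ℤ r)) (cong₂ _⊹_
        (trans (ev-scalep (at n) (⊖ c) p′) (cong ((⊖ c) ·_) (p′-val n))) (ev-scalep (at n) -1ℤ r))))
    even : ∀ n → ev (at n) (dbl p′) ≡ (+ 2) · ev (at n) w′
    even n = trans (cancel-even (ev (at n) (dbl p′)) (ev (at n) r)) (trans
      (cong (_⊹ ⊖ ((+ 2) · ev (at n) r)) (trans (sym (proj₂ (ev-sq p′) (at n))) (cong₂ _·_ (p′-val n) (p′-val n))))
      (trans (difference-squared (F n) c (ev (at n) r)) (trans (cong (λ z → z ⊹ ⊖ ((+ 2) · (c · F n)) ⊹ c · c ⊹ ⊖ ((+ 2) · ev (at n) r)) (k n))
      (trans (difference-squared-even (F n) c (ev (at n) q) (ev (at n) r)) (cong ((+ 2) ·_) (sym (w′-val n)))))))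
    half = dbl-even p′ w′ (λ n → even (suc n))

  -- By Frobenius `Q` squared has only even powers modulo 2, and the linear coefficient of the other
  -- summand is `χ` times the constant term of `E`, that is 1 or -1.
  no-linear-term : ∀ {Q E : ℕ → ℤ} → IsP Q → IsP E → E 0 ≡ 1ℤ → ∀ χ c → (χ ≡ 1ℤ ⊎ χ ≡ -1ℤ) →
                   ¬ ((λ n → Q n · Q n ⊹ χ · (at n · (E n · E n))) ≡₂ (λ _ → c))
  no-linear-term {Q} {E} (q , hq) (e , he) e₀ χ c unit (r , k) with ev-sq q | ev-sq e
  ... | q′ , sq | e′ , se = unit-odd unit (hdp (tlp R)) (trans (cong (χ ·_) (sym hdp-e)) (ℤₚ.i-j≡0⇒i≡j _ _ (proj₁ second)))
    where
    R : List ℤ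
    R = addp r (addp (scalep -1ℤ q′) (scalep (⊖ χ) (0ℤ ∷ e′)))
    ev-R : ∀ x → ev x R ≡ ev x r ⊹ (-1ℤ · ev x q′ ⊹ (⊖ χ) · (0ℤ ⊹ x · ev x e′))
    ev-R x = trans (ev-addp x r _) (cong (ev x r ⊹_) (trans (ev-addp x (scalep -1ℤ q′) _)
      (cong₂ _⊹_ (ev-scalep x -1ℤ q′) (trans (ev-scalep x (⊖ χ) (0ℤ ∷ e′)) (cong ((⊖ χ) ·_) (ev-∷ x 0ℤ e′))))))
    hdp-e : hdp e ≡ 1ℤ
    hdp-e = trans (sym (trans (cong (λ z → hdp e ⊹ z · ev (at 0) (tlp e)) at-0) (trans (cong (hdp e ⊹_) (ℤₚ.*-zeroˡ (ev (at 0) (tlp e)))) (ℤₚ.+-identityʳ (hdp e)))))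
      (trans (sym (ev-hd (at 0) e)) (trans (sym (he 0)) e₀))
    eqn : ∀ n → let x = at (suc n) in ev x (dbl q) ⊹ χ · (x · ev x (dbl e)) ≡ c ⊹ (+ 2) · ev x R
    eqn n = trans (linear-shift (ev x (dbl q)) (ev x q′) χ x (ev x (dbl e)) (ev x e′))
      (trans (cong₂ (λ u v → u ⊹ χ · (x · v) ⊹ ⊖ ((+ 2) · (ev x q′ ⊹ χ · (x · ev x e′))))
        (sym (trans (cong₂ _·_ (hq (suc n)) (hq (suc n))) (sq x))) (sym (trans (cong₂ _·_ (he (suc n)) (he (suc n))) (se x))))
      (trans (cong (_⊹ ⊖ ((+ 2) · (ev x q′ ⊹ χ · (x · ev x e′)))) (k (suc n)))
      (trans (linear-defect c (ev x r) (ev x q′) χ x (ev x e′)) (cong (λ z → c ⊹ (+ 2) · z) (sym (ev-R x))))))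
      where
      x = at (suc n)
    D₁ D₂ : ℕ → ℤ
    D₁ n = ev (at (suc n)) (dbl (tlp q))
    D₂ n = ev (at (suc n)) (dbl (tlp e))
    first : ∀ n → at (suc n) · D₁ n ⊹ χ · (hdp e ⊹ at (suc n) · (0ℤ ⊹ at (suc n) · D₂ n)) ⊹ ⊖ ((+ 2) · ev (at (suc n)) (tlp R)) ≡ 0ℤ
    first = proj₂ (constant-zero (hdp q ⊹ ⊖ c ⊹ ⊖ ((+ 2) · hdp R)) _ (λ n → let x = at (suc n) in
      trans (horner-linear-step (hdp q) c (hdp R) x (D₁ n) χ (hdp e ⊹ x · (0ℤ ⊹ x · D₂ n)) (ev x (tlp R)))
        (trans (cong₂ (λ u v → u ⊹ χ · (x · v) ⊹ ⊖ (c ⊹ (+ 2) · (hdp R ⊹ x · ev x (tlp R)))) (sym (ev-dbl x q)) (sym (ev-dbl x e)))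
          (i-j≡0 (trans (eqn n) (cong (λ z → c ⊹ (+ 2) · z) (ev-hd x R)))))))
    second = constant-zero (χ · hdp e ⊹ ⊖ ((+ 2) · hdp (tlp R)))
      (λ n → D₁ n ⊹ χ · (0ℤ ⊹ at (suc n) · D₂ n) ⊹ ⊖ ((+ 2) · ev (at (suc n)) (tlp (tlp R)))) (λ n → let x = at (suc n) in
      trans (horner-linear-tail χ (hdp e) (hdp (tlp R)) x (D₁ n) (D₂ n) (ev x (tlp (tlp R))))
        (trans (cong (λ z → x · D₁ n ⊹ χ · (hdp e ⊹ x · (0ℤ ⊹ x · D₂ n)) ⊹ ⊖ ((+ 2) · z)) (sym (ev-hd x (tlp R)))) (first n)))
    odd-even : ∀ m → 1 ≢ 2 * m
    odd-even (suc m) p = contradiction (ℕₚ.suc-injective p) (λ z → ℕₚ.1+n≢0 (sym (trans z (ℕₚ.+-suc m (m + 0)))))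
    unit-odd : χ ≡ 1ℤ ⊎ χ ≡ -1ℤ → ∀ m → χ · 1ℤ ≢ (+ 2) · m
    unit-odd u m p = odd-even ℤ.∣ m ∣ (trans (sym (abs1 u)) (trans (cong ℤ.∣_∣ p) (ℤₚ.abs-* (+ 2) m)))
      where
      abs1 : χ ≡ 1ℤ ⊎ χ ≡ -1ℤ → ℤ.∣ χ · 1ℤ ∣ ≡ 1
      abs1 (inj₁ refl) = refl
      abs1 (inj₂ refl) = refl

edge-terms : ∀ p q c s F G → p · q · c · F ⊹ (s · (p · q) · G ⊹ 0ℤ) ≡ p · (q · (c · F ⊹ s · G))
edge-terms = solve-∀

distributeˡ : ∀ p F G → p · (F ⊹ G) ≡ p · F ⊹ p · G
distributeˡ = solve-∀

·-exchange : ∀ p c F → p · (c · F) ≡ c · (p · F)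
·-exchange = solve-∀

branch-terms : ∀ v s f g → v · ((1ℤ ⊹ s · f) · g) ≡ v · g ⊹ s · (v · ((0ℤ ⊹ 1ℤ · f) · g))
branch-terms = solve-∀

branch-expand : ∀ g t s b → g · (t ⊹ s · b) ≡ t · g ⊹ s · (g · b)
branch-expand = solve-∀

·-pull-third : ∀ v f q g → v · (f · (q · g)) ≡ q · (v · (f · g))
·-pull-third = solve-∀

horner-single : ∀ x c → 0ℤ ⊹ x · (c ⊹ x · 0ℤ) ≡ x · c
horner-single = solve-∀

collect-weights : ∀ a b s h → a · (s · (b · h)) ≡ s · (a · b) · h
collect-weights = solve-∀

flip-sum : ∀ v f g → v · ((1ℤ ⊹ 1ℤ · f) · g) ⊹ v · ((1ℤ ⊹ -1ℤ · f) · g) ≡ (+ 2) · (v · g)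
flip-sum = solve-∀

collectˡ : ∀ a b c → a · b ⊹ a · c ≡ a · (b ⊹ c)
collectˡ = solve-∀

flip-under : ∀ v e a b c z → a ⊹ b ≡ c · z → v · (e · a) ⊹ v · (e · b) ≡ c · (v · (e · z))
flip-under v e a b c z h = trans (lem₁ v e a b) (trans (cong (λ u → v · (e · u)) h) (lem₂ v e c z))
  where
  lem₁ : ∀ v e a b → v · (e · a) ⊹ v · (e · b) ≡ v · (e · (a ⊹ b))
  lem₁ = solve-∀
  lem₂ : ∀ v e c z → v · (e · (c · z)) ≡ c · (v · (e · z))
  lem₂ = solve-∀

-- Reversing and deleting an edge inside a tree

-- One-hole contexts, innermost frame first.
data Ctx (V : Set) : Set where
  top   : Ctx V
  left  : ℤ → Tr V → Ctx V → Ctx V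
  right : ℤ → Tr V → Ctx V → Ctx V

plug : Ctx V₀ → Tr V₀ → Tr V₀
plug top           Z = Z
plug (left s B C)  Z = plug C (join s Z B)
plug (right s A C) Z = plug C (join s A Z)

skC : Ctx V₀ → Ctx ⊤
skC top           = top
skC (left s B C)  = left 1ℤ (sk B) (skC C)
skC (right s A C) = right 1ℤ (sk A) (skC C)

sk-plug : (C : Ctx V₀) (Z : Tr V₀) → sk (plug C Z) ≡ plug (skC C) (sk Z)
sk-plug top           Z = refl
sk-plug (left s B C)  Z = sk-plug C (join s Z B)
sk-plug (right s A C) Z = sk-plug C (join s A Z)

sk-sk : (S : Tr V₀) → sk (sk S) ≡ sk S
sk-sk (leaf _)     = refl
sk-sk (join _ A B) = cong₂ (join 1ℤ) (sk-sk A) (sk-sk B)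

gs-plug : ∀ K (C : Ctx V₀) {Z₁ Z₂ Z₀ : Tr V₀} c → (∀ y → gs 1ℤ K Z₁ y ⊹ gs 1ℤ K Z₂ y ≡ c · gs 1ℤ K Z₀ y) →
          ∀ y → gs 1ℤ K (plug C Z₁) y ⊹ gs 1ℤ K (plug C Z₂) y ≡ c · gs 1ℤ K (plug C Z₀) y
gs-plug K top c h y = h y
gs-plug K (left s B C) {Z₁} {Z₂} {Z₀} c h = gs-plug K C c (λ y →
  trans (sym (ℤₚ.*-distribʳ-+ (br 1ℤ K s B y) (gs 1ℤ K Z₁ y) (gs 1ℤ K Z₂ y)))
    (trans (cong (_· br 1ℤ K s B y) (h y)) (ℤₚ.*-assoc c (gs 1ℤ K Z₀ y) (br 1ℤ K s B y))))
gs-plug K (right s A C) {Z₁} {Z₂} {Z₀} c h = gs-plug K C c (λ y →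
  trans (collectˡ (gs 1ℤ K A y) (br 1ℤ K s Z₁ y) (br 1ℤ K s Z₂ y)) (trans (cong (gs 1ℤ K A y ·_)
    (trans (sym (∑-+ (pts K) _ _)) (trans (∑-cong (pts K) (λ z →
      flip-under (w K z) (1ℤ ⊹ s · f K y z) (gs 1ℤ K Z₁ z) (gs 1ℤ K Z₂ z) c (gs 1ℤ K Z₀ z) (h z))) (∑-* (pts K) c _))))
    (·-exchange (gs 1ℤ K A y) c (br 1ℤ K s Z₀ y))))

-- The factors 1 + f and 1 - f of the two orientations add up to 2; this deletes the edge, and the
-- branch `B` splits off as a factor.
Φ-flip : ∀ K (C : Ctx V₀) A B → Φ K (plug C (join 1ℤ A B)) ⊹ Φ K (plug C (join -1ℤ A B)) ≡ (+ 2) · (Φ K B · Φ K (plug C A))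
Φ-flip K C A B = trans (sym (∑-+ (pts K) _ _)) (trans (∑-cong (pts K) (λ y →
   trans (sym (ℤₚ.*-distribˡ-+ (w K y) (gs 1ℤ K (plug C (join 1ℤ A B)) y) (gs 1ℤ K (plug C (join -1ℤ A B)) y)))
     (trans (cong (w K y ·_) (gs-plug K C ((+ 2) · Φ K B) base y)) (·-exchange (w K y) ((+ 2) · Φ K B) (gs 1ℤ K (plug C A) y)))))
  (trans (∑-* (pts K) ((+ 2) · Φ K B) _) (ℤₚ.*-assoc (+ 2) (Φ K B) (Φ K (plug C A)))))
  where
  base : ∀ y → gs 1ℤ K (join 1ℤ A B) y ⊹ gs 1ℤ K (join -1ℤ A B) y ≡ (+ 2) · Φ K B · gs 1ℤ K A y
  base y = trans (collectˡ (gs 1ℤ K A y) (br 1ℤ K 1ℤ B y) (br 1ℤ K -1ℤ B y)) (trans (cong (gs 1ℤ K A y ·_)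
    (trans (sym (∑-+ (pts K) _ _)) (trans (∑-cong (pts K) (λ z → flip-sum (w K z) (f K y z) (gs 1ℤ K B z))) (∑-* (pts K) (+ 2) _))))
    (ℤₚ.*-comm (gs 1ℤ K A y) ((+ 2) · Φ K B)))

-- One pair for every edge at which the orientations disagree: the two shapes left by deleting that
-- edge. The context supplies the surroundings of the upper one.
cuts : Ctx ⊤ → Tr V₀ → Tr V₀ → List (Tr ⊤ × Tr ⊤)
cuts C (join s A B) (join s′ A′ B′) =
  cuts (left 1ℤ (sk B) C) A A′ ++ (cuts (right 1ℤ (sk A) C) B B′ ++
    (if ⌊ s ℤ.≟ s′ ⌋ then [] else (plug C (sk A) , sk B) ∷ []))
cuts C _ _ = []

sz-plug : (C : Ctx V₀) (Z Z′ : Tr V₀) → sz Z ≡ sz Z′ → sz (plug C Z) ≡ sz (plug C Z′)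
sz-plug top           Z Z′ e = e
sz-plug (left s B C)  Z Z′ e = sz-plug C (join s Z B) (join s Z′ B) (cong (_+ sz B) e)
sz-plug (right s A C) Z Z′ e = sz-plug C (join s A Z) (join s A Z′) (cong (sz A ℕ.+_) e)

sz-plug-≤ : (C : Ctx V₀) (Z Z′ : Tr V₀) → sz Z ≤ sz Z′ → sz (plug C Z) ≤ sz (plug C Z′)
sz-plug-≤ top           Z Z′ e = e
sz-plug-≤ (left s B C)  Z Z′ e = sz-plug-≤ C (join s Z B) (join s Z′ B) (ℕₚ.+-monoˡ-≤ (sz B) e)
sz-plug-≤ (right s A C) Z Z′ e = sz-plug-≤ C (join s A Z) (join s A Z′) (ℕₚ.+-monoʳ-≤ (sz A) e)

sz≤plug : (C : Ctx V₀) (Z : Tr V₀) → sz Z ≤ sz (plug C Z)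
sz≤plug top           Z = ≤-refl
sz≤plug (left s B C)  Z = ≤-trans (ℕₚ.m≤m+n _ _) (sz≤plug C (join s Z B))
sz≤plug (right s A C) Z = ≤-trans (ℕₚ.m≤n+m _ _) (sz≤plug C (join s A Z))

join-inj : ∀ {s s′} {A A′ B B′ : Tr V₀} → join s A B ≡ join s′ A′ B′ → A ≡ A′ × B ≡ B′
join-inj refl = refl , refl

-- Homomorphism sums as polynomials in the multiplicity of the detector

module Phi {Λ : ℤ} {h : ℕ} {C₀ : Tr ℕ} (d : Detect Λ h C₀) where
  open Mod2 (M d) (M≢0 d) public

  private
    K : ℕ → Kernel
    K = kern d

  opaque
    φ : {V : Set} → Tr V → ℕ → ℤ
    φ S n = Φ (K n) S

    φ-def : ∀ {V : Set} (S : Tr V) n → φ S n ≡ Φ (K n) S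
    φ-def S n = refl

  -- The values of `t` on the detecting kernels as polynomials: the mass 1 for a single vertex, and
  -- χ times the variable for every other tree of size at most `h`.
  cl : {V : Set} → Tr V → List ℤ
  cl (leaf _)     = 1ℤ ∷ []
  cl (join s A B) = 0ℤ ∷ χ d (join s A B) ∷ []

  ev-1 : ∀ x → ev x (1ℤ ∷ []) ≡ 1ℤ
  ev-1 x = trans (ev-∷ x 1ℤ []) (trans (cong (λ z → 1ℤ ⊹ x · z) (ev-[] x)) (cong (1ℤ ⊹_) (ℤₚ.*-zeroʳ x)))

  ev-cl : ∀ x {V : Set} s (A B : Tr V) → ev x (cl (join s A B)) ≡ x · χ d (join s A B)
  ev-cl x s A B = trans (ev-∷ x 0ℤ (χ d (join s A B) ∷ [])) (trans (cong (λ z → 0ℤ ⊹ x · z)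
    (trans (ev-∷ x (χ d (join s A B)) []) (cong (λ z → χ d (join s A B) ⊹ x · z) (ev-[] x)))) (horner-single x (χ d (join s A B))))

  t-cl : ∀ n {V : Set} (S : Tr V) → sz S ≤ h → t (K n) (sk S) ≡ ev (at n) (cl S)
  t-cl n (leaf _) l = trans (trans (∑-cong (pts (K n)) (λ y → ℤₚ.*-identityʳ (w (K n) y))) (kmass d n)) (sym (ev-1 (at n)))
  t-cl n (join s A B) l = trans (t-kern d n s A B l) (trans (cong (_· χ d (join s A B)) (sym (at-def n))) (sym (ev-cl (at n) s A B)))

  -- Edge subsets of S: the tree is the component of the root, the polynomial collects the other components.
  D : {V : Set} → Tr V → List (List ℤ × Tr ⊤)
  D (leaf _)     = (1ℤ ∷ [] , leaf tt) ∷ []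
  D (join s A B) = concatMap (λ (p , R) → concatMap (λ (q , Q) →
    (mulp (mulp p q) (cl Q) , R) ∷ (scalep s (mulp p q) , join 1ℤ R Q) ∷ []) (D B)) (D A)

  D-size : {V : Set} (S : Tr V) → ∀ {p R} → (p , R) ∈ D S → sz R ≤ sz S
  D-size (leaf _) (here refl) = ≤-refl
  D-size (join s A B) m with find (∈-concatMap⁻ _ {xs = D A} m)
  ... | (p , R) , mA , m′ with find (∈-concatMap⁻ _ {xs = D B} m′)
  ...   | (q , Q) , mB , here refl         = ≤-trans (D-size A mA) (ℕₚ.m≤m+n _ _)
  ...   | (q , Q) , mB , there (here refl) = ℕₚ.+-mono-≤ (D-size A mA) (D-size B mB)

  L : {V : Set} → Tr V → ℕ → (Tr ⊤ → ℤ) → ℤ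
  L S n F = ∑ (D S) (λ (p , R) → ev (at n) p · F R)

  L-cong : {V : Set} (S : Tr V) → ∀ n {F G} → (∀ R → sz R ≤ sz S → F R ≡ G R) → L S n F ≡ L S n G
  L-cong S n e = ∑-cong∈ (D S) (λ (p , R) m → cong (ev (at n) p ·_) (e R (D-size S m)))

  L-+ : {V : Set} (S : Tr V) → ∀ n F G → L S n (λ R → F R ⊹ G R) ≡ L S n F ⊹ L S n G
  L-+ S n F G = trans (∑-cong (D S) (λ (p , R) → distributeˡ (ev (at n) p) (F R) (G R))) (∑-+ (D S) _ _)

  L-* : {V : Set} (S : Tr V) → ∀ n c F → L S n (λ R → c · F R) ≡ c · L S n F
  L-* S n c F = trans (∑-cong (D S) (λ (p , R) → ·-exchange (ev (at n) p) c (F R))) (∑-* (D S) c _)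

  L-0 : {V : Set} (S : Tr V) → ∀ n {F} → (∀ R → sz R ≤ sz S → F R ≡ 0ℤ) → L S n F ≡ 0ℤ
  L-0 S n e = ∑-vanish (D S) (λ (p , R) m → trans (cong (ev (at n) p ·_) (e R (D-size S m))) (ℤₚ.*-zeroʳ (ev (at n) p)))

  L-join : {V : Set} → ∀ s (A B : Tr V) n F →
           L (join s A B) n F ≡ L A n (λ R → L B n (λ Q → ev (at n) (cl Q) · F R ⊹ s · F (join 1ℤ R Q)))
  L-join s A B n F = trans (∑-concatMap _ (D A) _) (∑-cong (D A) (λ (p , R) → trans (∑-concatMap _ (D B) _)
    (trans (∑-cong (D B) (λ (q , Q) → trans
       (cong₂ (λ u v → u · F R ⊹ (v · F (join 1ℤ R Q) ⊹ 0ℤ))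
         (trans (ev-mulp (at n) (mulp p q) (cl Q)) (cong (_· ev (at n) (cl Q)) (ev-mulp (at n) p q)))
         (trans (ev-scalep (at n) s (mulp p q)) (cong (s ·_) (ev-mulp (at n) p q))))
       (edge-terms (ev (at n) p) (ev (at n) q) (ev (at n) (cl Q)) s (F R) (F (join 1ℤ R Q)))))
     (∑-* (D B) (ev (at n) p) _))))

  -- The product of the factors 1 + s f is expanded over edge subsets. Only the component of the
  -- root still depends on `y`; the others have been summed and sit in the coefficient.
  gs-L : {V : Set} (S : Tr V) → sz S ≤ h → ∀ n y → gs 1ℤ (K n) S y ≡ L S n (λ R → gs 0ℤ (K n) (sk R) y)
  gs-L (leaf _) l n y = sym (trans (ℤₚ.+-identityʳ _) (trans (ℤₚ.*-identityʳ _) (ev-1 (at n))))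
  gs-L (join s A B) l n y = trans (cong₂ _·_ (gs-L A lA n y) branch) (trans (sym (∑-*ʳ (D A) _ _))
    (trans (∑-cong (D A) (λ (p , R) → trans (ℤₚ.*-assoc (ev (at n) p) (gs 0ℤ (K n) (sk R) y) _)
      (cong (ev (at n) p ·_) (trans (sym (L-* B n (gs 0ℤ (K n) (sk R) y) _)) (L-cong B n (λ Q _ →
         branch-expand (gs 0ℤ (K n) (sk R) y) (ev (at n) (cl Q)) s (br 0ℤ (K n) 1ℤ (sk Q) y)))))))
     (sym (L-join s A B n (λ R → gs 0ℤ (K n) (sk R) y)))))
    where
    lA = ≤-trans (ℕₚ.m≤m+n (sz A) (sz B)) l
    lB = ≤-trans (ℕₚ.m≤n+m (sz B) (sz A)) l
    branch : br 1ℤ (K n) s B y ≡ L B n (λ Q → ev (at n) (cl Q) ⊹ s · br 0ℤ (K n) 1ℤ (sk Q) y)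
    branch = trans (∑-cong (pts (K n)) (λ z → trans (cong (λ u → w (K n) z · ((1ℤ ⊹ s · f (K n) y z) · u)) (gs-L B lB n z))
        (trans (cong (w (K n) z ·_) (sym (∑-* (D B) (1ℤ ⊹ s · f (K n) y z) _))) (trans (sym (∑-* (D B) (w (K n) z) _))
          (∑-cong (D B) (λ (q , Q) → ·-pull-third (w (K n) z) (1ℤ ⊹ s · f (K n) y z) (ev (at n) q) (gs 0ℤ (K n) (sk Q) z)))))))
      (trans (∑-swap (pts (K n)) (D B) _) (∑-cong∈ (D B) (λ (q , Q) m → trans (∑-* (pts (K n)) (ev (at n) q) _)
        (cong (ev (at n) q ·_) (trans (∑-cong (pts (K n)) (λ z → branch-terms (w (K n) z) s (f (K n) y z) (gs 0ℤ (K n) (sk Q) z)))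
          (trans (∑-+ (pts (K n)) _ _) (cong₂ _⊹_ (t-cl n Q (≤-trans (D-size B m) lB)) (∑-* (pts (K n)) s _))))))))

  φ-L : {V : Set} (S : Tr V) → sz S ≤ h → ∀ n → φ S n ≡ L S n (λ R → ev (at n) (cl R))
  φ-L S l n = trans (φ-def S n) (trans (∑-cong (pts (K n)) (λ y → trans (cong (w (K n) y ·_) (gs-L S l n y)) (sym (∑-* (D S) (w (K n) y) _))))
    (trans (∑-swap (pts (K n)) (D S) _) (∑-cong∈ (D S) (λ (p , R) m →
      trans (∑-cong (pts (K n)) (λ y → ·-exchange (w (K n) y) (ev (at n) p) (gs 0ℤ (K n) (sk R) y)))
        (trans (∑-* (pts (K n)) (ev (at n) p) _) (cong (ev (at n) p ·_) (t-cl n R (≤-trans (D-size S m) l))))))))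

  φ-≈ : {V : Set} {S S′ : Tr V} → S ≈ S′ → ∀ n → φ S n ≡ φ S′ n
  φ-≈ {S = S} {S′} p n = trans (φ-def S n) (trans (≈-hs 1ℤ (K n) p) (sym (φ-def S′ n)))

  φ-square : {V : Set} → ∀ s (A : Tr V) n → φ (join s A A) n ≡ φ A n · φ A n
  φ-square s A n = trans (φ-def (join s A A) n) (trans (Φ-square (K n) s A) (sym (cong₂ _·_ (φ-def A n) (φ-def A n))))

  φ-isP : {V : Set} (S : Tr V) → sz S ≤ h → IsP (φ S)
  φ-isP S l = isP-ext (φ-L S l) (isP-∑ (D S) (λ (p , R) _ → isP-· (p , λ _ → refl) (cl R , λ _ → refl)))

  -- At n = 0 every tree with an edge has value 0, so only the empty edge set remains. This provides
  -- the constant term 1 that `no-linear-term` relies on.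
  φ-0 : {V : Set} (S : Tr V) → sz S ≤ h → φ S 0 ≡ 1ℤ
  φ-0 S l = trans (φ-L S l 0) (go S)
    where
    zero-cl : ∀ {V : Set} s (A B : Tr V) → ev (at 0) (cl (join s A B)) ≡ 0ℤ
    zero-cl s A B = trans (ev-cl (at 0) s A B) (trans (cong (_· χ d (join s A B)) at-0) (ℤₚ.*-zeroˡ (χ d (join s A B))))
    go : {V : Set} (S : Tr V) → L S 0 (λ R → ev (at 0) (cl R)) ≡ 1ℤ
    go (leaf _) = trans (ℤₚ.+-identityʳ _) (cong₂ _·_ (ev-1 (at 0)) (ev-1 (at 0)))
    go (join s A B) = trans (L-join s A B 0 _) (trans (L-cong A 0 (λ R _ → trans
        (L-cong B 0 (λ Q _ → trans (cong (λ z → ev (at 0) (cl Q) · ev (at 0) (cl R) ⊹ s · z) (zero-cl 1ℤ R Q))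
           (trans (cong (ev (at 0) (cl Q) · ev (at 0) (cl R) ⊹_) (ℤₚ.*-zeroʳ s)) (trans (ℤₚ.+-identityʳ _) (ℤₚ.*-comm (ev (at 0) (cl Q)) (ev (at 0) (cl R)))))))
        (trans (L-* B 0 (ev (at 0) (cl R)) _) (trans (cong (ev (at 0) (cl R) ·_) (go B)) (ℤₚ.*-identityʳ _))))) (go A))

  L-full : {V : Set} (S : Tr V) → ∀ n {H : Tr ⊤ → ℤ} → (∀ R → sz R < sz S → H R ≡ 0ℤ) → L S n H ≡ wt S · H (sk S)
  L-full (leaf _) n {H} z = trans (ℤₚ.+-identityʳ _) (cong (_· H (leaf tt)) (ev-1 (at n)))
  L-full (join s A B) n {H} z = trans (L-join s A B n H) (trans (L-cong A n (λ R l → trans (L-cong B n (λ Q _ →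
       trans (cong (λ u → ev (at n) (cl Q) · u ⊹ s · H (join 1ℤ R Q)) (z R (ℕₚ.≤-<-trans l (sz<joinˡ A B))))
         (trans (cong (_⊹ s · H (join 1ℤ R Q)) (ℤₚ.*-zeroʳ (ev (at n) (cl Q)))) (ℤₚ.+-identityˡ _)))) (L-* B n s _)))
    (trans (L-full A n (λ R l → trans (cong (s ·_) (L-0 B n (λ Q l′ → z (join 1ℤ R Q) (ℕₚ.+-mono-<-≤ l l′)))) (ℤₚ.*-zeroʳ s)))
      (trans (cong (λ u → wt A · (s · u)) (L-full B n (λ Q l → z (join 1ℤ (sk A) Q) (subst (_< sz A + sz B) (cong (_+ sz Q) (sym (sz-sk A))) (ℕₚ.+-monoʳ-< (sz A) l)))))
        (collect-weights (wt A) (wt B) s (H (join 1ℤ (sk A) (sk B)))))))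

  tail : {V : Set} → Tr V → (Tr ⊤ → ℤ) → ℤ
  tail (leaf _)     F = 0ℤ
  tail (join s A B) F = wt (join s A B) · F (sk (join s A B))

  tail-0 : {V : Set} (S : Tr V) {F : Tr ⊤ → ℤ} → (∀ s R Q → sz R + sz Q ≤ sz S → F (join s R Q) ≡ 0ℤ) → tail S F ≡ 0ℤ
  tail-0 (leaf _)     z = refl
  tail-0 (join s A B) z = trans (cong (wt (join s A B) ·_) (z 1ℤ (sk A) (sk B) (ℕₚ.≤-reflexive (cong₂ _+_ (sz-sk A) (sz-sk B)))))
    (ℤₚ.*-zeroʳ (wt (join s A B)))

  light-cl : ∀ n s (R Q : Tr ⊤) → sz R + sz Q < sz C₀ → ev (at n) (cl (join s R Q)) ≡ 0ℤ
  light-cl n s R Q l with χ d (join s R Q) ℤ.≟ 0ℤ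
  ... | yes z = trans (ev-cl (at n) s R Q) (trans (cong (at n ·_) z) (ℤₚ.*-zeroʳ (at n)))
  ... | no k  = contradiction (proj₁ (χ-iso d (join s R Q) k)) (ℕₚ.<⇒≢ l)

  -- An edge subset other than the empty and the full one has a component with an edge that is too
  -- small to contribute: away from the root it is below the detected size, at the root `F` vanishes
  -- on it.
  L-low : {V : Set} (S : Tr V) → sz S ≤ sz C₀ → ∀ n {F : Tr ⊤ → ℤ} →
          (∀ s R Q → sz R + sz Q < sz S → F (join s R Q) ≡ 0ℤ) → L S n F ≡ F (leaf tt) ⊹ tail S F
  L-low (leaf _) l n {F} z = trans (ℤₚ.+-identityʳ _) (trans (cong (_· F (leaf tt)) (ev-1 (at n))) (trans (ℤₚ.*-identityˡ (F (leaf tt))) (sym (ℤₚ.+-identityʳ (F (leaf tt))))))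
  L-low (join s A B) l n {F} z = trans (L-join s A B n F) (trans (L-cong A n (λ R _ → trans (L-+ B n (λ Q → ev (at n) (cl Q) · F R) (λ Q → s · F (join 1ℤ R Q)))
      (cong₂ _⊹_ (trans (trans (L-cong B n (λ Q _ → ℤₚ.*-comm (ev (at n) (cl Q)) (F R))) (L-* B n (F R) _))
                   (trans (cong (F R ·_) closed) (ℤₚ.*-identityʳ (F R)))) (L-* B n s _))))
    (trans (L-+ A n F (λ R → s · L B n (λ Q → F (join 1ℤ R Q)))) (cong₂ _⊹_
      (trans (L-low A lA n {F} (λ s′ R Q k → z s′ R Q (ℕₚ.<-trans k (sz<joinˡ A B))))
         (trans (cong (F (leaf tt) ⊹_) (tail-0 A {F} (λ s′ R Q k → z s′ R Q (ℕₚ.≤-<-trans k (sz<joinˡ A B))))) (ℤₚ.+-identityʳ (F (leaf tt)))))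
      (trans (L-full A n (λ R k → trans (cong (s ·_) (L-0 B n (λ Q k′ → z 1ℤ R Q (ℕₚ.+-mono-<-≤ k k′)))) (ℤₚ.*-zeroʳ s)))
        (trans (cong (λ u → wt A · (s · u)) (L-full B n (λ Q k → z 1ℤ (sk A) Q (subst (_< sz A + sz B) (cong (_+ sz Q) (sym (sz-sk A))) (ℕₚ.+-monoʳ-< (sz A) k)))))
          (collect-weights (wt A) (wt B) s (F (join 1ℤ (sk A) (sk B)))))))))
    where
    lA = ≤-trans (ℕₚ.m≤m+n (sz A) (sz B)) l
    lB = ≤-trans (ℕₚ.m≤n+m (sz B) (sz A)) l
    closed : L B n (λ Q → ev (at n) (cl Q)) ≡ 1ℤ
    closed = trans (L-low B lB n {λ R → ev (at n) (cl R)} (λ s′ R Q k → light-cl n s′ R Q (ℕₚ.<-≤-trans k lB)))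
      (trans (cong₂ _⊹_ (ev-1 (at n)) (tail-0 B {λ R → ev (at n) (cl R)} (λ s′ R Q k → light-cl n s′ R Q (ℕₚ.≤-<-trans k (ℕₚ.<-≤-trans (sz<joinʳ A B) l)))))
        refl)

  φ-top : {V : Set} → ∀ s (A B : Tr V) → sz (join s A B) ≤ sz C₀ → sz (join s A B) ≤ h → ∀ n →
          φ (join s A B) n ≡ 1ℤ ⊹ wt (join s A B) · (at n · χ d (sk (join s A B)))
  φ-top s A B l l′ n = trans (φ-L (join s A B) l′ n) (trans (L-low (join s A B) l n {λ R → ev (at n) (cl R)} (λ s′ R Q k → light-cl n s′ R Q (ℕₚ.<-≤-trans k l)))
    (cong₂ (λ u v → u ⊹ wt (join s A B) · v) (ev-1 (at n)) (ev-cl (at n) 1ℤ (sk A) (sk B))))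

  φ-low : {V : Set} (S : Tr V) → sz S < sz C₀ → sz S ≤ h → ∀ n → φ S n ≡ 1ℤ
  φ-low S l l′ n = trans (φ-L S l′ n) (trans (L-low S (ℕₚ.<⇒≤ l) n {λ R → ev (at n) (cl R)} (λ s′ R Q k → light-cl n s′ R Q (ℕₚ.<-trans k l)))
    (cong₂ _⊹_ (ev-1 (at n)) (tail-0 S {λ R → ev (at n) (cl R)} (λ s′ R Q k → light-cl n s′ R Q (ℕₚ.≤-<-trans k l)))))

-- Orientations modulo 2 and modulo 4

erase : Tr V₀ → Tr ⊤
erase (leaf _)     = leaf tt
erase (join s A B) = join s (erase A) (erase B)

sk-erase : (S : Tr V₀) → sk (erase S) ≡ sk S
sk-erase (leaf _)     = refl
sk-erase (join s A B) = cong₂ (join 1ℤ) (sk-erase A) (sk-erase B)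

sz-erase : (S : Tr V₀) → sz (erase S) ≡ sz S
sz-erase (leaf _)     = refl
sz-erase (join s A B) = cong₂ _+_ (sz-erase A) (sz-erase B)

units-erase : {S : Tr V₀} → Units S → Units (erase S)
units-erase leaf         = leaf
units-erase (join s a b) = join s (units-erase a) (units-erase b)

gs-erase : ∀ c K (S : Tr V₀) x → gs c K (erase S) x ≡ gs c K S x
gs-erase c K (leaf _)     x = refl
gs-erase c K (join s A B) x = cong₂ _·_ (gs-erase c K A x)
  (∑-cong (pts K) (λ y → cong (λ z → w K y · ((c ⊹ s · f K x y) · z)) (gs-erase c K B y)))

hs-erase : ∀ c K (S : Tr V₀) → hs c K (erase S) ≡ hs c K S
hs-erase c K S = ∑-cong (pts K) (λ x → cong (w K x ·_) (gs-erase c K S x))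

sk-parts : (A B A′ B′ : Tr ⊤) {s s′ : ℤ} → sk (join s A B) ≡ sk (join s′ A′ B′) → sk A ≡ sk A′ × sk B ≡ sk B′
sk-parts A B A′ B′ e = join-inj e

sk⇒sz : (A : Tr V₀) (B : Tr W₀) → sk A ≡ sk B → sz A ≡ sz B
sk⇒sz A B e = trans (sym (sz-sk A)) (trans (cong sz e) (sz-sk B))

flip-difference : ∀ a b c → a ⊹ b ≡ (+ 2) · c → b ≡ a ⊹ (+ 2) · (c ⊹ ⊖ a)
flip-difference a b c e = trans (lem₁ a b) (trans (cong (λ z → z ⊹ ⊖ a) e) (lem₂ a c))
  where
  lem₁ : ∀ a b → b ≡ (a ⊹ b) ⊹ ⊖ a
  lem₁ = solve-∀
  lem₂ : ∀ a c → (+ 2) · c ⊹ ⊖ a ≡ a ⊹ (+ 2) · (c ⊹ ⊖ a)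
  lem₂ = solve-∀

flip-mod-4 : ∀ a b u b₀ v → a ≡ 1ℤ ⊹ (+ 2) · u → b ≡ b₀ ⊹ (+ 2) · v →
         a ⊹ (+ 2) · (b ⊹ ⊖ a) ≡ a ⊹ (+ 2) · (b₀ ⊹ -1ℤ ⊹ 0ℤ) ⊹ (+ 4) · (v ⊹ ⊖ u)
flip-mod-4 a b u b₀ v refl refl = lem u b₀ v
  where
  lem : ∀ u b₀ v → 1ℤ ⊹ (+ 2) · u ⊹ (+ 2) · (b₀ ⊹ (+ 2) · v ⊹ ⊖ (1ℤ ⊹ (+ 2) · u))
      ≡ 1ℤ ⊹ (+ 2) · u ⊹ (+ 2) · (b₀ ⊹ -1ℤ ⊹ 0ℤ) ⊹ (+ 4) · (v ⊹ ⊖ u)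
  lem = solve-∀

compose-mod-4 : ∀ a b c d p q r E₁ E₂ E₃ → b ≡ a ⊹ (+ 2) · E₁ ⊹ (+ 4) · p → c ≡ b ⊹ (+ 2) · E₂ ⊹ (+ 4) · q →
         d ≡ c ⊹ (+ 2) · E₃ ⊹ (+ 4) · r → d ≡ a ⊹ (+ 2) · (E₁ ⊹ (E₂ ⊹ E₃)) ⊹ (+ 4) · (p ⊹ (q ⊹ r))
compose-mod-4 a b c d p q r E₁ E₂ E₃ refl refl refl = lem a p q r E₁ E₂ E₃
  where
  lem : ∀ a p q r E₁ E₂ E₃ → a ⊹ (+ 2) · E₁ ⊹ (+ 4) · p ⊹ (+ 2) · E₂ ⊹ (+ 4) · q ⊹ (+ 2) · E₃ ⊹ (+ 4) · r
      ≡ a ⊹ (+ 2) · (E₁ ⊹ (E₂ ⊹ E₃)) ⊹ (+ 4) · (p ⊹ (q ⊹ r))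
  lem = solve-∀

trivial-mod-4 : ∀ a → a ≡ a ⊹ (+ 2) · 0ℤ ⊹ (+ 4) · 0ℤ
trivial-mod-4 = solve-∀

-- Since the square of 1 + 2q is 1 modulo 4, the congruence modulo 4 can be halved to a congruence
-- modulo 2.
square-mod-4 : ∀ x q S len p → x ≡ 1ℤ ⊹ (+ 2) · q → x · x ≡ 1ℤ ⊹ (+ 2) · (S ⊹ ⊖ len) ⊹ (+ 4) · p →
         S ≡ len ⊹ (+ 2) · (q ⊹ q · q ⊹ ⊖ p)
square-mod-4 x q S len p refl e = ℤₚ.*-cancelˡ-≡ (+ 2) _ _ (trans (lem₁ S len p) (trans
  (cong (λ z → z ⊹ ⊖ 1ℤ ⊹ (+ 2) · len ⊹ ⊖ ((+ 4) · p)) (sym e)) (lem₂ q len p)))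
  where
  lem₁ : ∀ S len p → (+ 2) · S ≡ 1ℤ ⊹ (+ 2) · (S ⊹ ⊖ len) ⊹ (+ 4) · p ⊹ ⊖ 1ℤ ⊹ (+ 2) · len ⊹ ⊖ ((+ 4) · p)
  lem₁ = solve-∀
  lem₂ : ∀ q len p → (1ℤ ⊹ (+ 2) · q) · (1ℤ ⊹ (+ 2) · q) ⊹ ⊖ 1ℤ ⊹ (+ 2) · len ⊹ ⊖ ((+ 4) · p)
       ≡ (+ 2) · (len ⊹ (+ 2) · (q ⊹ q · q ⊹ ⊖ p))
  lem₂ = solve-∀

∑-shift : {X : Set} (xs : List X) (F : X → ℤ) → ∑ xs (λ x → F x ⊹ -1ℤ) ≡ ∑ xs F ⊹ ⊖ (+ length xs)
∑-shift []       F = refl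
∑-shift (x ∷ xs) F rewrite ∑-shift xs F = trans (lem (F x) (∑ xs F) (+ length xs)) refl
  where
  lem : ∀ a b l → a ⊹ -1ℤ ⊹ (b ⊹ ⊖ l) ≡ a ⊹ b ⊹ ⊖ (1ℤ ⊹ l)
  lem = solve-∀

unit-cases : ∀ {s s′} → s ≡ 1ℤ ⊎ s ≡ -1ℤ → s′ ≡ 1ℤ ⊎ s′ ≡ -1ℤ → s ≡ s′ ⊎ (s ≡ 1ℤ × s′ ≡ -1ℤ ⊎ s ≡ -1ℤ × s′ ≡ 1ℤ)
unit-cases (inj₁ refl) (inj₁ refl) = inj₁ refl
unit-cases (inj₁ refl) (inj₂ refl) = inj₂ (inj₁ (refl , refl))
unit-cases (inj₂ refl) (inj₁ refl) = inj₂ (inj₂ (refl , refl))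
unit-cases (inj₂ refl) (inj₂ refl) = inj₁ refl

module Parity {Λ : ℤ} {h : ℕ} {C₀ : Tr ℕ} (d : Detect Λ h C₀) where
  open Phi d public

  flip-edge : (C : Ctx ⊤) (A B : Tr ⊤) → ∀ {s s′} → s ≡ 1ℤ × s′ ≡ -1ℤ ⊎ s ≡ -1ℤ × s′ ≡ 1ℤ → ∀ n →
              φ (plug C (join s′ A B)) n ≡ φ (plug C (join s A B)) n ⊹ (+ 2) · (φ B n · φ (plug C A) n ⊹ ⊖ φ (plug C (join s A B)) n)
  flip-edge C A B {s} {s′} o n = flip-difference (φ (plug C (join s A B)) n) (φ (plug C (join s′ A B)) n) (φ B n · φ (plug C A) n) (sum o)
    where
    base : φ (plug C (join 1ℤ A B)) n ⊹ φ (plug C (join -1ℤ A B)) n ≡ (+ 2) · (φ B n · φ (plug C A) n)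
    base = trans (cong₂ _⊹_ (φ-def (plug C (join 1ℤ A B)) n) (φ-def (plug C (join -1ℤ A B)) n))
      (trans (Φ-flip (kern d n) C A B) (cong ((+ 2) ·_) (sym (cong₂ _·_ (φ-def B n) (φ-def (plug C A) n)))))
    sum : s ≡ 1ℤ × s′ ≡ -1ℤ ⊎ s ≡ -1ℤ × s′ ≡ 1ℤ →
          φ (plug C (join s A B)) n ⊹ φ (plug C (join s′ A B)) n ≡ (+ 2) · (φ B n · φ (plug C A) n)
    sum (inj₁ (refl , refl)) = base
    sum (inj₂ (refl , refl)) = trans (ℤₚ.+-comm (φ (plug C (join -1ℤ A B)) n) (φ (plug C (join 1ℤ A B)) n)) base

  bound-hole : (C : Ctx ⊤) (A B : Tr ⊤) → ∀ {s} → sz (plug C (join s A B)) ≤ h → sz (plug C A) ≤ h × sz B ≤ h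
  bound-hole C A B {s} l = ≤-trans (sz-plug-≤ C A (join s A B) (ℕₚ.m≤m+n _ _)) l ,
    ≤-trans (ℕₚ.m≤n+m (sz B) (sz A)) (≤-trans (sz≤plug C (join s A B)) l)

  -- By `Φ-flip` the reversal of one edge changes the sum by twice a polynomial; the edges of `Z`
  -- are adjusted one after the other.
  parity-plug : (C : Ctx ⊤) (Z Z′ : Tr ⊤) → Units Z → Units Z′ → sk Z ≡ sk Z′ → sz (plug C Z) ≤ h →
                φ (plug C Z) ≡₂ φ (plug C Z′)
  parity-plug C (leaf _) (leaf _) u u′ e l = ≡₂-refl (λ _ → refl)
  parity-plug C (join s A B) (join s′ A′ B′) (join us uA uB) (join us′ uA′ uB′) e l with sk-parts A B A′ B′ {s} {s′} e
  ... | eA , eB = ≡₂-trans (parity-plug (left s B C) A A′ uA uA′ eA l)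
    (≡₂-trans (parity-plug (right s A′ C) B B′ uB uB′ eB l₁) (last (unit-cases us us′)))
    where
    l₁ : sz (plug C (join s A′ B)) ≤ h
    l₁ = subst (_≤ h) (sz-plug C (join s A B) (join s A′ B) (cong (_+ sz B) (sk⇒sz A A′ eA))) l
    l₂ : sz (plug C (join s A′ B′)) ≤ h
    l₂ = subst (_≤ h) (sz-plug C (join s A′ B) (join s A′ B′) (cong (sz A′ ℕ.+_) (sk⇒sz B B′ eB))) l₁
    last : s ≡ s′ ⊎ (s ≡ 1ℤ × s′ ≡ -1ℤ ⊎ s ≡ -1ℤ × s′ ≡ 1ℤ) → φ (plug C (join s A′ B′)) ≡₂ φ (plug C (join s′ A′ B′))
    last (inj₁ refl) = ≡₂-refl (λ _ → refl)
    last (inj₂ o)    = ≡₂-sym (even⇒≡₂ (λ n → φ B′ n · φ (plug C A′) n ⊹ ⊖ φ (plug C (join s A′ B′)) n) (isP-+ (isP-· (φ-isP B′ (proj₂ bd)) (φ-isP (plug C A′) (proj₁ bd)))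
      (isP-neg (φ-isP (plug C (join s A′ B′)) l₂))) (flip-edge C A′ B′ o))
      where
      bd = bound-hole C A′ B′ {s} l₂

  φ-parity : (S : Tr V₀) → Units S → sz S ≤ h → φ S ≡₂ φ (sk S)
  φ-parity S u l = ≡₂-trans (≡₂-refl (λ n → trans (φ-def S n) (trans (sym (hs-erase 1ℤ (kern d n) S)) (sym (φ-def (erase S) n)))))
    (parity-plug top (erase S) (sk S) (units-erase u) (units-sk S)
      (trans (sk-erase S) (sym (sk-sk S))) (subst (_≤ h) (sym (sz-erase S)) l))

  -- Modulo 2 orientations are invisible, so the second half can be reordered and reoriented into a
  -- copy of the first, and then `φ-square` applies.
  mirror-square : ∀ s (A B : Tr V₀) → Units (join s A B) → κ A ≡ κ B → sz (join s A B) ≤ h →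
                  φ (join s A B) ≡₂ (λ n → φ (sk A) n · φ (sk A) n)
  mirror-square s A B u e l with decode (sk A) (sk B) (trans (κ-sk A) (trans e (sym (κ-sk B))))
  ... | B″ , p , q = ≡₂-trans (φ-parity (join s A B) u l) (≡₂-trans
      (≡₂-refl (φ-≈ (≈-of (≃-cong ≃-refl p))))
      (≡₂-trans (φ-parity (join 1ℤ (sk A) B″) (join (inj₁ refl) (units-sk A) (≃-units p (units-sk B))) l″)
        (≡₂-refl (λ n → trans (cong₂ (λ x y → φ (join 1ℤ x y) n) (sk-sk A) (trans q (sk-sk A))) (φ-square 1ℤ (sk A) n)))))
    where
    l″ : sz (join 1ℤ (sk A) B″) ≤ h
    l″ = subst (_≤ h) (cong₂ _+_ (sym (sz-sk A)) (trans (sym (sz-sk B)) (≃-sz p))) l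

  Cuts : List (Tr ⊤ × Tr ⊤) → ℕ → ℤ
  Cuts xs n = ∑ xs (λ (F , G) → φ F n · φ G n ⊹ -1ℤ)

  record Diff₄ (F G : ℕ → ℤ) (xs : List (Tr ⊤ × Tr ⊤)) : Set where
    constructor diff₄
    field
      rest   : ℕ → ℤ
      restP  : IsP rest
      differ : ∀ n → G n ≡ F n ⊹ (+ 2) · Cuts xs n ⊹ (+ 4) · rest n

  diff₄-refl : ∀ {F} → Diff₄ F F []
  diff₄-refl {F} = diff₄ (λ _ → 0ℤ) (isP-const 0ℤ) (λ n → trivial-mod-4 (F n))

  diff₄-flip : ∀ {X Y P} G H → (∀ n → Y n ≡ X n ⊹ (+ 2) · (P n ⊹ ⊖ X n)) → X ≡₂ (λ _ → 1ℤ) →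
               P ≡₂ (λ n → φ G n · φ H n) → Diff₄ X Y ((G , H) ∷ [])
  diff₄-flip {X} {Y} {P} G H e (u , uE) (v , vE) = diff₄ (λ n → ev (at n) v ⊹ ⊖ ev (at n) u)
    (isP-+ (v , λ _ → refl) (isP-neg (u , λ _ → refl)))
    (λ n → trans (e n) (flip-mod-4 (X n) (P n) (ev (at n) u) (φ G n · φ H n) (ev (at n) v) (uE n) (vE n)))

  diff₄-trans : ∀ {F₁ F₂ F₃ F₄} xs ys zs → Diff₄ F₁ F₂ xs → Diff₄ F₂ F₃ ys → Diff₄ F₃ F₄ zs → Diff₄ F₁ F₄ (xs ++ (ys ++ zs))
  diff₄-trans {F₁} {F₂} {F₃} {F₄} xs ys zs (diff₄ p pP pE) (diff₄ q qP qE) (diff₄ r rP rE) =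
    diff₄ (λ n → p n ⊹ (q n ⊹ r n)) (isP-+ pP (isP-+ qP rP)) (λ n →
      trans (compose-mod-4 (F₁ n) (F₂ n) (F₃ n) (F₄ n) (p n) (q n) (r n) (Cuts xs n) (Cuts ys n) (Cuts zs n) (pE n) (qE n) (rE n))
        (cong (λ z → F₁ n ⊹ (+ 2) · z ⊹ (+ 4) · (p n ⊹ (q n ⊹ r n)))
          (sym (trans (∑-++ xs (ys ++ zs) _) (cong (Cuts xs n ⊹_) (∑-++ ys zs _))))))

  -- Edges are reversed one at a time. A reversal adds twice the difference between the product of
  -- the two cut trees and the current sum, so modulo 4 this difference matters only modulo 2. There
  -- the current sum is 1, by `one` and parity, and the cut trees may be replaced by their
  -- skeletons. `up` keeps all intermediate weights units.
  chain : (C : Ctx ⊤) (Z Z′ : Tr ⊤) → Units (plug C Z) → Units Z → Units Z′ → sk Z ≡ sk Z′ → sz (plug C Z) ≤ h →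
          φ (sk (plug C Z)) ≡₂ (λ _ → 1ℤ) → (∀ Y → Units Y → Units (plug C Y)) →
          Diff₄ (φ (plug C Z)) (φ (plug C Z′)) (cuts (skC C) Z Z′)
  chain C (leaf _) (leaf _) uC u u′ e l one up = diff₄-refl
  chain C (join s A B) (join s′ A′ B′) uC (join us uA uB) (join us′ uA′ uB′) e l one up with sk-parts A B A′ B′ {s} {s′} e
  ... | eA , eB = diff₄-trans (cuts (left 1ℤ (sk B) (skC C)) A A′) (cuts (right 1ℤ (sk A) (skC C)) B B′) cutE
      (chain (left s B C) A A′ uC uA uA′ eA l one (λ Y uY → up (join s Y B) (join us uY uB)))
      (subst (λ z → Diff₄ (φ (plug C (join s A′ B))) (φ (plug C (join s A′ B′))) (cuts (right 1ℤ z (skC C)) B B′)) (sym eA)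
        (chain (right s A′ C) B B′ (up (join s A′ B) (join us uA′ uB)) uB uB′ eB l₁
          (subst (λ z → φ z ≡₂ (λ _ → 1ℤ)) sk₁ one) (λ Y uY → up (join s A′ Y) (join us uA′ uY))))
      (last (s ℤ.≟ s′))
    where
    l₁ : sz (plug C (join s A′ B)) ≤ h
    l₁ = subst (_≤ h) (sz-plug C (join s A B) (join s A′ B) (cong (_+ sz B) (sk⇒sz A A′ eA))) l
    l₂ : sz (plug C (join s A′ B′)) ≤ h
    l₂ = subst (_≤ h) (sz-plug C (join s A′ B) (join s A′ B′) (cong (sz A′ ℕ.+_) (sk⇒sz B B′ eB))) l₁
    sk₁ : sk (plug C (join s A B)) ≡ sk (plug C (join s A′ B))
    sk₁ = trans (sk-plug C (join s A B)) (trans (cong (λ z → plug (skC C) (join 1ℤ z (sk B))) eA) (sym (sk-plug C (join s A′ B))))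
    sk₂ : sk (plug C (join s A B)) ≡ sk (plug C (join s A′ B′))
    sk₂ = trans (sk-plug C (join s A B)) (trans (cong₂ (λ z y → plug (skC C) (join 1ℤ z y)) eA eB) (sym (sk-plug C (join s A′ B′))))
    cutE : List (Tr ⊤ × Tr ⊤)
    cutE = if ⌊ s ℤ.≟ s′ ⌋ then [] else (plug (skC C) (sk A) , sk B) ∷ []
    bd : sz (plug C A′) ≤ h × sz B′ ≤ h
    bd = bound-hole C A′ B′ {s} l₂
    flipped : s ≡ s′ ⊎ (s ≡ 1ℤ × s′ ≡ -1ℤ ⊎ s ≡ -1ℤ × s′ ≡ 1ℤ) → s ≢ s′ →
              Diff₄ (φ (plug C (join s A′ B′))) (φ (plug C (join s′ A′ B′))) ((plug (skC C) (sk A) , sk B) ∷ [])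
    flipped (inj₁ same) ne = contradiction same ne
    flipped (inj₂ o)    ne = diff₄-flip (plug (skC C) (sk A)) (sk B) (flip-edge C A′ B′ o)
      (≡₂-trans (φ-parity (plug C (join s A′ B′)) (up (join s A′ B′) (join us uA′ uB′)) l₂) (subst (λ z → φ z ≡₂ (λ _ → 1ℤ)) sk₂ one))
      (≡₂-trans (≡₂-refl (λ n → ℤₚ.*-comm (φ B′ n) (φ (plug C A′) n)))
        (subst (λ z → (λ n → φ (plug C A′) n · φ B′ n) ≡₂ (λ n → φ z n · φ (sk B) n)) (trans (sk-plug C A′) (cong (plug (skC C)) (sym eA)))
          (subst (λ z → (λ n → φ (plug C A′) n · φ B′ n) ≡₂ (λ n → φ (sk (plug C A′)) n · φ z n)) (sym eB)
            (≡₂-· (φ-isP (sk (plug C A′)) (subst (_≤ h) (sym (sz-sk (plug C A′))) (proj₁ bd))) (φ-isP B′ (proj₂ bd))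
              (φ-parity (plug C A′) (up A′ uA′) (proj₁ bd)) (φ-parity B′ uB′ (proj₂ bd))))))
    last : (eq? : Dec (s ≡ s′)) → Diff₄ (φ (plug C (join s A′ B′))) (φ (plug C (join s′ A′ B′)))
             (if ⌊ eq? ⌋ then [] else (plug (skC C) (sk A) , sk B) ∷ [])
    last (yes refl) = diff₄-refl
    last (no ne)    = flipped (unit-cases us us′) ne

  half-odd : (A B : Tr V₀) → ∀ s → Units (join s A B) → κ A ≡ κ B → sz (join s A B) ≤ h →
             φ (join s A B) ≡₂ (λ _ → 1ℤ) → φ (sk A) ≡₂ (λ _ → 1ℤ)
  half-odd A B s u e l one = ≡₂-sqrt (φ-isP (sk A) (subst (_≤ h) (sym (sz-sk A)) (≤-trans (ℕₚ.m≤m+n _ _) l))) 1ℤ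
    (≡₂-trans (≡₂-sym (mirror-square s A B u e l)) one)

  square-defect : ∀ {X Y F} xs → (∀ n → X n ≡ 1ℤ) → (∀ n → Y n ≡ F n · F n) → IsP F → F ≡₂ (λ _ → 1ℤ) → Diff₄ X Y xs →
                  (λ n → ∑ xs (λ (F , G) → φ F n · φ G n)) ≡₂ (λ _ → + length xs)
  square-defect {X} {Y} {F} xs one sq Fp (q , qE) (diff₄ p pP pE) =
    even⇒≡₂ (λ n → ev (at n) q ⊹ ev (at n) q · ev (at n) q ⊹ ⊖ p n)
      (isP-+ (isP-+ qP (isP-· qP qP)) (isP-neg pP)) (λ n →
    square-mod-4 (F n) (ev (at n) q) (∑ xs (λ (F , G) → φ F n · φ G n)) (+ length xs) (p n) (qE n)
      (trans (sym (sq n)) (trans (pE n) (cong₂ (λ x y → x ⊹ (+ 2) · y ⊹ (+ 4) · p n) (one n)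
        (∑-shift xs (λ (F , G) → φ F n · φ G n))))))
    where
    qP : IsP (λ n → ev (at n) q)
    qP = q , λ _ → refl

  -- Reorienting the second half after the first turns the sum from 1 into the square of a
  -- polynomial congruent to 1 modulo 2, which is 1 modulo 4. The corrections collected by `chain`
  -- must therefore cancel modulo 2.
  cut-relation : ∀ s (T₁ T₂ : Tr ⊤) → Units (join s T₁ T₂) → sk T₁ ≡ sk T₂ → sz (join s T₁ T₂) ≤ h →
                 (∀ n → φ (join s T₁ T₂) n ≡ 1ℤ) →
                 (λ n → ∑ (cuts (right 1ℤ (sk T₁) top) T₂ T₁) (λ (F , G) → φ F n · φ G n))
                   ≡₂ (λ _ → + length (cuts (right 1ℤ (sk T₁) top) T₂ T₁))
  cut-relation s T₁ T₂ u@(join us u₁ u₂) e l one =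
    square-defect (cuts (right 1ℤ (sk T₁) top) T₂ T₁) one (φ-square s T₁) (φ-isP T₁ l₁)
      (≡₂-trans (φ-parity T₁ u₁ l₁) (half-odd T₁ T₂ s u κ-eq l (≡₂-refl one)))
      (chain (right s T₁ top) T₂ T₁ u u₂ u₁ (sym e) l (≡₂-trans (≡₂-sym (φ-parity (join s T₁ T₂) u l)) (≡₂-refl one)) (λ Y uY → join us u₁ uY))
    where
    l₁ : sz T₁ ≤ h
    l₁ = ≤-trans (ℕₚ.m≤m+n (sz T₁) (sz T₂)) l
    κ-eq : κ T₁ ≡ κ T₂
    κ-eq = trans (sym (κ-sk T₁)) (trans (cong κ e) (κ-sk T₂))

-- Trees whose sums are 1 modulo 2 for all detectors

lab : ℕ → Tr V₀ → Tr ℕ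
lab k (leaf _)     = leaf k
lab k (join _ A B) = join 1ℤ (lab k A) (lab (k + sz A) B)

lab-range : ∀ k (S : Tr V₀) {x} → x ∈ verts (lab k S) → k ≤ x × x < k + sz S
lab-range k (leaf _) (here refl) = ≤-refl , ℕₚ.≤-reflexive (ℕₚ.+-comm 1 k)
lab-range k (join _ A B) m with ∈-++⁻ (verts (lab k A)) m
... | inj₁ p = proj₁ (lab-range k A p) , ℕₚ.<-≤-trans (proj₂ (lab-range k A p)) (ℕₚ.+-monoʳ-≤ k (ℕₚ.m≤m+n (sz A) (sz B)))
... | inj₂ p = ≤-trans (ℕₚ.m≤m+n k (sz A)) (proj₁ (lab-range (k + sz A) B p)) ,
               ℕₚ.<-≤-trans (proj₂ (lab-range (k + sz A) B p)) (ℕₚ.≤-reflexive (ℕₚ.+-assoc k (sz A) (sz B)))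

lab-unique : ∀ k (S : Tr V₀) → Unique (verts (lab k S))
lab-unique k (leaf _)     = [] ∷ []
lab-unique k (join _ A B) = unique-++ (lab-unique k A) (lab-unique (k + sz A) B)
  (λ p q → ℕₚ.<⇒≱ (proj₂ (lab-range k A p)) (proj₁ (lab-range (k + sz A) B q)))

lab-units : ∀ k (S : Tr V₀) → Units (lab k S)
lab-units k (leaf _)     = leaf
lab-units k (join _ A B) = join (inj₁ refl) (lab-units k A) (lab-units (k + sz A) B)

lab-wt : ∀ k (S : Tr V₀) → wt (lab k S) ≡ 1ℤ
lab-wt k (leaf _) = refl
lab-wt k (join _ A B) rewrite lab-wt k A | lab-wt (k + sz A) B = refl

lab-κ : ∀ k (S : Tr V₀) → κ (lab k S) ≡ κ S
lab-κ k (leaf _)     = refl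
lab-κ k (join _ A B) = cong₂ ins (lab-κ (k + sz A) B) (lab-κ k A)

lab-sz : ∀ k (S : Tr V₀) → sz (lab k S) ≡ sz S
lab-sz k S = κ≡⇒sz≡ (lab k S) S (lab-κ k S)

opaque
  detectOf : ∀ {Λ} → Λ ≢ 0ℤ → ∀ h (C : Tr V₀) → CanC (κ C) → sz C ≤ h → Detect Λ h (lab 0 C)
  detectOf {Λ = Λ} n h C can l = Detection.detect Λ n h (lab 0 C) (lab-unique 0 C) (lab-units 0 C) (lab-wt 0 C)
    (subst CanC (sym (lab-κ 0 C)) can) (subst (_≤ h) (sym (lab-sz 0 C)) l)

rer-root : (E B : Tr V₀) → ∃[ R ] Rer E B R × κ R ≡ κ (merge E B)
rer-root E (leaf x) = E , stop , refl
rer-root E (join s A B) with rer-root (join s E B) A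
... | R , r , e = R , stay r , trans e (sym (≃-κ (merge-join s E B A)))

reroot-root : (S : Tr V₀) → ∃[ R ] Reroot S R × κ R ≡ κ S
reroot-root S with rer-root (leaf (rt S)) S
... | R , r , e = R , r , trans e (cong κ (merge-root S))

unit-≢0 : ∀ {s} → s ≡ 1ℤ ⊎ s ≡ -1ℤ → s ≢ 0ℤ
unit-≢0 (inj₁ refl) ()
unit-≢0 (inj₂ refl) ()

-- All detectors see S as 1 modulo 2.
PP : ℤ → ℕ → Tr V₀ → Set₁
PP Λ h S = ∀ C₀ (d : Detect Λ h C₀) → Mod2._≡₂_ (M d) (M≢0 d) (Phi.φ d (sk S)) (λ _ → 1ℤ)

-- The detector of a tree sees the tree itself only through the full edge set, which contributes a
-- linear term with coefficient 1 or -1.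
φ-canonical : ∀ {Λ} (n : Λ ≢ 0ℤ) h (C : Tr V₀) (can : CanC (κ C)) (l : sz C ≤ h) → Units C → 2 ≤ sz C →
              let d = detectOf n h C can l in
              ∃[ u ] (u ≡ 1ℤ ⊎ u ≡ -1ℤ) × (∀ k → Phi.φ d C k ≡ 1ℤ ⊹ u · Mod2.at (M d) (M≢0 d) k)
φ-canonical n h (leaf _) can l uC (s≤s ())
φ-canonical n h C@(join s A B) can l uC big with reroot-root (lab 0 C)
... | R , r , e = wt C · χ d (sk C) , unit-· (wt-unit uC) (χ-unit d (sk C) R r (trans e (trans (lab-κ 0 C) (sym (κ-sk C))))) ,
      λ k → trans (φ-top s A B (ℕₚ.≤-reflexive (sym (lab-sz 0 C))) l k)
        (cong (1ℤ ⊹_) (lem (wt C) (at k) (χ d (sk C))))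
  where
  d = detectOf n h C can l
  open Phi d
  lem : ∀ a b c → a · (b · c) ≡ a · c · b
  lem = solve-∀

sz1⇒leaf : (S : Tr V₀) → sz S ≤ 1 → ∃[ x ] S ≡ leaf x
sz1⇒leaf (leaf x)     l = x , refl
sz1⇒leaf (join s A B) l = contradiction (ℕₚ.+-mono-≤ (sz>0 A) (sz>0 B)) (ℕₚ.<⇒≱ (s≤s l))

module _ {Λ : ℤ} (n0 : Λ ≢ 0ℤ) (h : ℕ) where

  pos-not-PP : (S C : Tr V₀) → S ≈ C → CanC (κ C) → Units S → sz S ≤ h → 2 ≤ sz S → ¬ PP Λ h S
  pos-not-PP S C p can uS l big pp = go (φ-canonical n0 h C can lC (≈-units p uS) (subst (2 ≤_) (≈-sz p) big))
    where
    lC : sz C ≤ h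
    lC = subst (_≤ h) (≈-sz p) l
    d = detectOf n0 h C can lC
    open Parity d
    lem : ∀ x y → x ⊹ y · (1ℤ · 1ℤ) ≡ x ⊹ y
    lem = solve-∀
    go : ∃[ u ] (u ≡ 1ℤ ⊎ u ≡ -1ℤ) × (∀ k → φ C k ≡ 1ℤ ⊹ u · at k) → ⊥
    go (u , uu , e) = no-linear-term (isP-const 1ℤ) (isP-const 1ℤ) refl u 1ℤ uu
      (≡₂-trans (≡₂-refl (λ k → trans (cong (λ z → 1ℤ ⊹ u · z) (ℤₚ.*-identityʳ (at k))) (trans (sym (e k)) (sym (φ-≈ p k)))))
        (≡₂-trans (φ-parity S uS l) (pp _ d)))

  -- A `pos` tree would be betrayed by its own detector. For a `neg` tree the sum is congruent to
  -- the square of the sum of a half, and square roots of 1 modulo 2 are 1.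
  PP-step : (S : Tr V₀) → Units S → sz S ≤ h → PP Λ h S → 2 ≤ sz S →
            ∃[ s ] ∃[ A ] ∃[ B ] (S ≈ join s A B) × κ A ≡ κ B × PP Λ h A × PP Λ h B
  PP-step S uS l pp big with canon S
  ... | pos C p c = contradiction pp (pos-not-PP S C p c uS l big)
  ... | neg s A B p e = s , A , B , p , e , ppA , ppB
    where
    ppA : PP Λ h A
    ppA _ d = half-odd A B s (≈-units p uS) e (subst (_≤ h) (≈-sz p) l)
        (≡₂-trans (≡₂-refl (λ k → sym (φ-≈ p k))) (≡₂-trans (φ-parity S uS l) (pp _ d)))
      where open Parity d
    ppB : PP Λ h B
    ppB _ d = ≡₂-trans (≡₂-refl (λ k → trans (φ-def (sk B) k) (trans (κ≡⇒hs≡ 1ℤ (kern d k) B A (sym e)) (sym (φ-def (sk A) k))))) (ppA _ d)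
      where open Phi d

  halves-size : (S A B : Tr V₀) → ∀ {s} → S ≈ join s A B → κ A ≡ κ B → sz S ≡ 2 * sz A
  halves-size S A B p e = trans (≈-sz p) (cong (sz A ℕ.+_) (trans (sym (κ≡⇒sz≡ A B e)) (sym (ℕₚ.+-identityʳ (sz A)))))

  -- The exponent drives the recursion of `independence`, where all sizes are halved until the total
  -- is 1.
  PP-size : (S : Tr V₀) → Units S → sz S ≤ h → PP Λ h S → ∃[ r ] sz S ≡ 2 ^ r
  PP-size S uS l pp = go S uS l pp (<-wellFounded (sz S))
    where
    go : (S : Tr V₀) → Units S → sz S ≤ h → PP Λ h S → Acc _<_ (sz S) → ∃[ r ] sz S ≡ 2 ^ r
    go S uS l pp (acc rec) with 2 ℕ.≤? sz S
    ... | no k = 0 , ℕₚ.≤-antisym (ℕₚ.≤-pred (ℕₚ.≰⇒> k)) (sz>0 S)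
    ... | yes big with PP-step S uS l pp big
    ...   | s , A , B , p , e , ppA , _ with ≈-units p uS
    ...     | join _ uA uB with go A uA (≤-trans (ℕₚ.m≤m+n _ _) (subst (_≤ h) (≈-sz p) l)) ppA
                               (rec (subst (sz A <_) (sym (≈-sz p)) (sz<joinˡ A B)))
    ...       | r , q = suc r , trans (halves-size S A B p e) (cong (2 *_) q)

-- Trees without repeated branches

∈-ins⁺ : ∀ {x} y l → x ∈ᶜ l → x ∈ᶜ ins y l
∈-ins⁺ y (cons z l) m with cmp y z
... | lt _ = tl m
... | eq _ = tl m
∈-ins⁺ y (cons z l) hd     | gt _ = hd
∈-ins⁺ y (cons z l) (tl m) | gt _ = tl (∈-ins⁺ y l m)

-- Equivalently, the rooted shape has no nontrivial automorphism. The condition depends on the root,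
-- so the induction over halves has to carry `AllRigid`.
Rigid : Tr V₀ → Set
Rigid (leaf _)     = ⊤
Rigid (join _ A B) = Rigid A × Rigid B × ¬ (κ B ∈ᶜ κ A)

≃-rigid : {A B : Tr V₀} → A ≃ B → Rigid A → Rigid B
≃-rigid ≃-refl        r = r
≃-rigid (≃-trans p q) r = ≃-rigid q (≃-rigid p r)
≃-rigid (≃-comm {A = A} {B} {C}) ((a , b , n) , c , m) =
  (a , c , λ k → m (∈-ins⁺ (κ B) (κ A) k)) , b , λ k → [ (λ e → m (subst (_∈ᶜ ins (κ B) (κ A)) e (∈-ins-self (κ B) (κ A)))) , n ] (∈-ins⁻ (κ A) k)
≃-rigid (≃-cong p q) (a , b , n) = ≃-rigid p a , ≃-rigid q b , λ k → n (subst (_ ∈ᶜ_) (sym (≃-κ p)) (subst (_∈ᶜ _) (sym (≃-κ q)) k))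

κ-rigid : (S : Tr V₀) (S′ : Tr W₀) → κ S ≡ κ S′ → Rigid S → Rigid S′
κ-rigid (leaf _) (leaf _) e r = tt
κ-rigid (leaf _) (join _ A B) e r = contradiction e (nil≢ins {κ B} {κ A})
κ-rigid (join s A B) S′ e (a , b , n) with split-of-code {s = s} A B S′ e
... | t , A′ , B′ , p , eA , eB = ≃-rigid (≃-sym p) (κ-rigid A A′ eA a , κ-rigid B B′ eB b ,
      λ k → n (subst (_ ∈ᶜ_) (sym eA) (subst (_∈ᶜ _) (sym eB) k)))

-- Att Y Z Z₁: the tree Z₁ arises from Z by attaching Y to some vertex.
data Att {V : Set} (Y : Tr V) : Tr V → Tr V → Set where
  here : ∀ {s Z} → Att Y Z (join s Z Y)
  inA  : ∀ {s A A₁ B} → Att Y A A₁ → Att Y (join s A B) (join s A₁ B)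
  inB  : ∀ {s A B B₁} → Att Y B B₁ → Att Y (join s A B) (join s A B₁)

att-size : {Y Z Z₁ : Tr V₀} → Att Y Z Z₁ → sz Y < sz Z₁
att-size {Y = Y} (here {Z = Z}) = sz<joinʳ Z Y
att-size (inA a)               = ℕₚ.<-≤-trans (att-size a) (ℕₚ.m≤m+n _ _)
att-size (inB {A = A} a)       = ℕₚ.<-≤-trans (att-size a) (ℕₚ.m≤n+m _ (sz A))

att-kids : ∀ {x} {Y Z Z₁ : Tr V₀} → Att Y Z Z₁ → x ∈ᶜ κ Z₁ → x ∈ᶜ κ Z ⊎ sz Y ≤ csz x
att-kids {Y = Y} (here {Z = Z}) m with ∈-ins⁻ (κ Z) m
... | inj₁ refl = inj₂ (ℕₚ.≤-reflexive (sym (csz-κ Y)))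
... | inj₂ k    = inj₁ k
att-kids (inA {A = A} {A₁} {B} a) m with ∈-ins⁻ (κ A₁) m
... | inj₁ refl = inj₁ (∈-ins-self (κ B) (κ A))
... | inj₂ k with att-kids a k
...   | inj₁ q = inj₁ (∈-ins⁺ (κ B) (κ A) q)
...   | inj₂ q = inj₂ q
att-kids (inB {A = A} {B} {B₁} a) m with ∈-ins⁻ (κ A) m
... | inj₁ refl = inj₂ (ℕₚ.≤-trans (ℕₚ.<⇒≤ (att-size a)) (ℕₚ.≤-reflexive (sym (csz-κ B₁))))
... | inj₂ k    = inj₁ (∈-ins⁺ (κ B) (κ A) k)

-- A branch that contains `Y` is at least as large as `Y`, and every branch of `Z` is smaller than
-- that, so no new coincidence of branches can arise.
att-rigid : {Y Z Z₁ : Tr V₀} → Att Y Z Z₁ → Rigid Z → Rigid Y → sz Z ≤ sz Y → Rigid Z₁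
att-rigid {Y = Y} (here {Z = Z}) rZ rY l = rZ , rY , λ m →
  ℕₚ.<⇒≱ (subst (_< csz (κ Z)) (csz-κ Y) (∈ᶜ⇒csz< m)) (subst (_≤ sz Y) (sym (csz-κ Z)) l)
att-rigid {Y = Y} (inA {A = A} {A₁} {B} a) (rA , rB , n) rY l =
  att-rigid a rA rY (≤-trans (ℕₚ.m≤m+n (sz A) (sz B)) l) , rB , λ m → [ n , (λ q → ℕₚ.<⇒≱ (ℕₚ.<-≤-trans (sz<joinʳ A B) l) (subst (sz Y ≤_) (csz-κ B) q)) ] (att-kids a m)
att-rigid {Y = Y} (inB {A = A} {B} {B₁} a) (rA , rB , n) rY l =
  rA , att-rigid a rB rY (≤-trans (ℕₚ.m≤n+m (sz B) (sz A)) l) , λ m →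
    ℕₚ.<-asym (subst (_< csz (κ A)) (csz-κ B₁) (∈ᶜ⇒csz< m)) (subst (_< sz B₁) (sym (csz-κ A)) (ℕₚ.<-trans (ℕₚ.<-≤-trans (sz<joinˡ A B) l) (att-size a)))

att-merge : {Y E E₁ : Tr V₀} (A : Tr V₀) → Att Y E E₁ → Att Y (merge E A) (merge E₁ A)
att-merge (leaf _)     a = a
att-merge (join s A B) a = inA (att-merge A a)

rer-att : {Y E E₁ B R₁ : Tr V₀} → Att Y E E₁ → Rer E₁ B R₁ → ∃[ R ] Rer E B R × Att Y R R₁
rer-att a stop = _ , stop , a
rer-att a (stay r) with rer-att (inA a) r
... | R , q , b = R , stay q , b
rer-att a (down {A = A} r) with rer-att (inB (att-merge A a)) r
... | R , q , b = R , down q , b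

AllRigid : Tr V₀ → Set
AllRigid S = ∀ R → Reroot S R → Rigid R

allRigid⇒rigid : (S : Tr V₀) → AllRigid S → Rigid S
allRigid⇒rigid S a with reroot-root S
... | R , r , e = κ-rigid R S e (a R r)

-- From a root in one half, the other half is a single branch attached to a rerooting of the first,
-- and the equal sizes allow `att-rigid`.
allRigid-join : ∀ {s} (X Y : Tr V₀) → sz X ≡ sz Y → AllRigid X → AllRigid Y → AllRigid (join s X Y)
allRigid-join X Y e aX aY R₁ (stay r) with rer-att here r
... | R , q , b = att-rigid b (aX R q) (allRigid⇒rigid Y aY) (ℕₚ.≤-reflexive (trans (sym (≈-sz (reroot-≈ q))) e))
allRigid-join X Y e aX aY R₁ (down r) with rer-att here r
... | R , q , b = att-rigid b (aY R q) (subst Rigid (sym (merge-root X)) (allRigid⇒rigid X aX))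
      (ℕₚ.≤-reflexive (trans (sym (≈-sz (reroot-≈ q))) (trans (sym e) (sym (cong sz (merge-root X))))))

-- Rerootings of `S` and `J` at the same vertex have the same edges, hence the same code.
allRigid-≈ : (S J : Tr ℕ) → Unique (verts S) → Units S → S ≈ J → AllRigid J → AllRigid S
allRigid-≈ S J u un p aJ R₀ r₀
  with reroot-at J (∈-resp-↭ (↭-trans (↭-sym (≈-verts (reroot-≈ r₀))) (≈-verts p)) (rt∈verts R₀))
... | R₁ , r₁ , e = κ-rigid R₁ R₀ (sym (proj₁ (same-edges⇒same-code R₀ R₁ u₁ (↭-trans (↭-sym (≈-verts S≈R₀)) (≈-verts S≈R₁)) (sym e) nz))) (aJ R₁ r₁)
  where
  S≈R₀ = reroot-≈ r₀
  S≈R₁ = ≈-trans p (reroot-≈ r₁)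
  u₁ = unique-↭ (≈-verts S≈R₁) u
  u₀ = unique-↭ (≈-verts S≈R₀) u
  nz : ep (adj R₁) R₀ ≢ 0ℤ
  nz = subst (_≢ 0ℤ) (sym (trans (ep-cong R₀ (λ {x} {y} _ _ → trans (sym (≈-adj S≈R₁ x y)) (≈-adj S≈R₀ x y))) (ep-self R₀ u₀)))
    (unit-≢0 (wt-unit (≈-units S≈R₀ un)))

PP⇒allRigid : ∀ {Λ} (n0 : Λ ≢ 0ℤ) h (S : Tr ℕ) → Unique (verts S) → Units S → sz S ≤ h → PP Λ h S → AllRigid S
PP⇒allRigid {Λ} n0 h S u un l pp = go S u un l pp (<-wellFounded (sz S))
  where
  go : (S : Tr ℕ) → Unique (verts S) → Units S → sz S ≤ h → PP Λ h S → Acc _<_ (sz S) → AllRigid S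
  go S u un l pp (acc rec) with 2 ℕ.≤? sz S
  ... | no k with sz1⇒leaf S (ℕₚ.≤-pred (ℕₚ.≰⇒> k))
  ...   | x , refl = λ { R stop → tt }
  go S u un l pp (acc rec) | yes big with PP-step n0 h S un l pp big
  ... | s , A , B , p , e , ppA , ppB with ≈-units p un | unique-++⁻ (verts A) (unique-↭ (≈-verts p) u) | subst (_≤ h) (≈-sz p) l
  ...   | join _ uA uB | vA , vB , _ | lj = allRigid-≈ S (join s A B) u un p (allRigid-join A B (κ≡⇒sz≡ A B e)
      (go A vA uA (≤-trans (ℕₚ.m≤m+n _ _) lj) ppA (rec (subst (sz A <_) (sym (≈-sz p)) (sz<joinˡ A B))))
      (go B vB uB (≤-trans (ℕₚ.m≤n+m _ (sz A)) lj) ppB (rec (subst (sz B <_) (sym (≈-sz p)) (sz<joinʳ A B)))))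

-- Cuts of a rigid tree at branches of equal size leave trees with different codes.

comp : Ctx ⊤ → Ctx ⊤ → Ctx ⊤
comp top           C = C
comp (left s B D)  C = left s B (comp D C)
comp (right s A D) C = right s A (comp D C)

plug-comp : ∀ D C Z → plug (comp D C) Z ≡ plug C (plug D Z)
plug-comp top           C Z = refl
plug-comp (left s B D)  C Z = plug-comp D C (join s Z B)
plug-comp (right s A D) C Z = plug-comp D C (join s A Z)

cuts-comp : ∀ D C (Z Z′ : Tr V₀) → cuts (comp D C) Z Z′ ≡ map (λ (F , G) → plug C F , G) (cuts D Z Z′)
cuts-comp D C (leaf _)     (leaf _)     = refl
cuts-comp D C (leaf _)     (join _ _ _) = refl
cuts-comp D C (join _ _ _) (leaf _)     = refl
cuts-comp D C (join s A B) (join s′ A′ B′) = trans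
  (cong₂ (λ x y → x ++ (y ++ _)) (cuts-comp (left 1ℤ (sk B) D) C A A′) (cuts-comp (right 1ℤ (sk A) D) C B B′))
  (trans (cong (λ z → map _ (cuts (left 1ℤ (sk B) D) A A′) ++ (map _ (cuts (right 1ℤ (sk A) D) B B′) ++ z)) (last ⌊ s ℤ.≟ s′ ⌋))
    (sym (trans (Listₚ.map-++ _ (cuts (left 1ℤ (sk B) D) A A′) _)
      (cong (map _ (cuts (left 1ℤ (sk B) D) A A′) ++_) (Listₚ.map-++ _ (cuts (right 1ℤ (sk A) D) B B′) _)))))
  where
  last : ∀ b → (if b then [] else (plug (comp D C) (sk A) , sk B) ∷ []) ≡
               map (λ (F , G) → plug C F , G) (if b then [] else (plug D (sk A) , sk B) ∷ [])
  last true  = refl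
  last false = cong (λ z → (z , sk B) ∷ []) (plug-comp D C (sk A))

Sep : Tr ⊤ × Tr ⊤ → Tr ⊤ × Tr ⊤ → Set
Sep (F , G) (F′ , G′) = sz G ≡ sz G′ → κ F ≢ κ F′

record CutOf (N : ℕ) (FG : Tr ⊤ × Tr ⊤) : Set where
  constructor cutOf
  field
    total : sz (proj₁ FG) + sz (proj₂ FG) ≡ N
    unitF : Units (proj₁ FG)
    unitG : Units (proj₂ FG)

cuts-of : (Z Z′ : Tr V₀) → All (CutOf (sz Z)) (cuts top Z Z′)
cuts-of (leaf _)     (leaf _)     = []
cuts-of (leaf _)     (join _ _ _) = []
cuts-of (join _ _ _) (leaf _)     = []
cuts-of (join s A B) (join s′ A′ B′)
  rewrite cuts-comp top (left 1ℤ (sk B) top) A A′ | cuts-comp top (right 1ℤ (sk A) top) B B′ =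
  Allₚ.++⁺ (Allₚ.map⁺ (All.map (λ { {F , G} (cutOf e uF uG) → cutOf (sumA F G e) (join (inj₁ refl) uF (units-sk B)) uG }) (cuts-of A A′)))
    (Allₚ.++⁺ (Allₚ.map⁺ (All.map (λ { {F , G} (cutOf e uF uG) → cutOf (sumB F G e) (join (inj₁ refl) (units-sk A) uF) uG }) (cuts-of B B′)))
      (last ⌊ s ℤ.≟ s′ ⌋))
  where
  sumA : ∀ F G → sz F + sz G ≡ sz A → sz F + sz (sk B) + sz G ≡ sz A + sz B
  sumA F G e rewrite sz-sk B = trans (ℕₚ.+-assoc (sz F) (sz B) (sz G)) (trans (cong (sz F ℕ.+_) (ℕₚ.+-comm (sz B) (sz G)))
    (trans (sym (ℕₚ.+-assoc (sz F) (sz G) (sz B))) (cong (_+ sz B) e)))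
  sumB : ∀ F G → sz F + sz G ≡ sz B → sz (sk A) + sz F + sz G ≡ sz A + sz B
  sumB F G e rewrite sz-sk A = trans (ℕₚ.+-assoc (sz A) (sz F) (sz G)) (cong (sz A ℕ.+_) e)
  last : ∀ b → All (CutOf (sz A + sz B)) (if b then [] else (sk A , sk B) ∷ [])
  last true  = []
  last false = cutOf (cong₂ _+_ (sz-sk A) (sz-sk B)) (units-sk A) (units-sk B) ∷ []

cut-F< : ∀ {N F G} → CutOf N (F , G) → sz F < N
cut-F< {F = F} {G} (cutOf e _ _) = subst (sz F <_) e (sz<joinˡ F G)

cut-G< : ∀ {N F G} → CutOf N (F , G) → sz G < N
cut-G< {F = F} {G} (cutOf e _ _) = subst (sz G <_) e (sz<joinʳ F G)

-- Two cuts inside the same part are separated by induction after cancelling the other part. A cut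
-- inside `A` and one inside `B` or at the bridge could agree only if `B` were a branch of `A`,
-- against rigidity. The bridge and the cuts inside `B` differ in size.
cuts-sep : (Z Z′ : Tr V₀) → Rigid Z → AllPairs Sep (cuts top Z Z′)
cuts-sep (leaf _)     (leaf _)     r = []
cuts-sep (leaf _)     (join _ _ _) r = []
cuts-sep (join _ _ _) (leaf _)     r = []
cuts-sep (join s A B) (join s′ A′ B′) (rA , rB , n)
  rewrite cuts-comp top (left 1ℤ (sk B) top) A A′ | cuts-comp top (right 1ℤ (sk A) top) B B′ =
  AllPairsₚ.++⁺ (AllPairsₚ.map⁺ (AllPairs.map (λ {x} {y} sep e q → sep e (ins-cancelˡ (κ (sk B)) q)) (cuts-sep A A′ rA)))
    (AllPairsₚ.++⁺ (AllPairsₚ.map⁺ (AllPairs.map (λ {x} {y} sep e q → sep e (ins-cancelʳ (κ (sk A)) q)) (cuts-sep B B′ rB)))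
      (single ⌊ s ℤ.≟ s′ ⌋)
      (Allₚ.map⁺ (All.map (λ {x} c → BZ x c ⌊ s ℤ.≟ s′ ⌋) (cuts-of B B′))))
    (Allₚ.map⁺ (All.tabulate (λ {x} _ → Allₚ.++⁺ (Allₚ.map⁺ (All.map (λ {y} c → AB x y c) (cuts-of B B′))) (AZ x ⌊ s ℤ.≟ s′ ⌋))))
  where
  κB∉ : ¬ (κ (sk B) ∈ᶜ κ (sk A))
  κB∉ m = n (subst (_∈ᶜ κ A) (κ-sk B) (subst (κ (sk B) ∈ᶜ_) (κ-sk A) m))
  single : ∀ b → AllPairs Sep (if b then [] else (sk A , sk B) ∷ [])
  single true  = []
  single false = [] ∷ []
  AB : ∀ x y → CutOf (sz B) y → Sep (join 1ℤ (proj₁ x) (sk B) , proj₂ x) (join 1ℤ (sk A) (proj₁ y) , proj₂ y)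
  AB (F , G) (F′ , G′) c _ q = κB∉ (∈-ins-other (κ F) (κ (sk A)) q (λ e →
    ℕₚ.<⇒≢ (cut-F< c) (trans (κ≡⇒sz≡ F′ (sk B) (sym e)) (sz-sk B))))
  AZ : ∀ x b → All (Sep (join 1ℤ (proj₁ x) (sk B) , proj₂ x)) (if b then [] else (sk A , sk B) ∷ [])
  AZ (F , G) true  = []
  AZ (F , G) false = (λ _ q → κB∉ (subst (κ (sk B) ∈ᶜ_) q (∈-ins-self (κ (sk B)) (κ F)))) ∷ []
  BZ : ∀ x → CutOf (sz B) x → ∀ b → All (Sep (join 1ℤ (sk A) (proj₁ x) , proj₂ x)) (if b then [] else (sk A , sk B) ∷ [])
  BZ (F , G) c true  = []
  BZ (F , G) c false = (λ e _ → ℕₚ.<⇒≢ (cut-G< c) (trans e (sz-sk B))) ∷ []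

-- Independence modulo 2 of products of tree sums

product-of-squares : ∀ a b → a · a · (b · b) ≡ a · b · (a · b)
product-of-squares = solve-∀

odd-times-square : ∀ a u x b → (a · a ⊹ u · (x · (a · a))) · (b · b) ≡ a · b · (a · b) ⊹ u · (x · (a · b · (a · b)))
odd-times-square = solve-∀

sum-of-two-squares : ∀ a b → a · a ⊹ b · b ≡ (a ⊹ b) · (a ⊹ b) ⊹ (+ 2) · (⊖ (a · b))
sum-of-two-squares = solve-∀

move-last : ∀ a b r → (a · a ⊹ r) ⊹ b · b ≡ (a · a ⊹ b · b) ⊹ r
move-last = solve-∀

IsNeg : {S : Tr ⊤} → Canon S → Set
IsNeg (pos _ _ _)     = ⊥
IsNeg (neg _ _ _ _ _) = ⊤

neg-collide : {S S′ : Tr ⊤} (c : Canon S) (c′ : Canon S′) → IsNeg c → IsNeg c′ → Collide c c′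
neg-collide (neg _ _ _ _ _) (neg _ _ _ _ _) _ _ = tt

collide-sym : {S S′ : Tr ⊤} (c : Canon S) (c′ : Canon S′) → Collide c c′ → Collide c′ c
collide-sym (pos _ _ _)     (pos _ _ _)     e = sym e
collide-sym (neg _ _ _ _ _) (neg _ _ _ _ _) e = e

Hit : {S : Tr ⊤} → Canon S → Code → Set
Hit (pos C _ _)     k = κ C ≡ k
Hit (neg _ _ _ _ _) k = ⊥

module Stage {Λ : ℤ} {h : ℕ} {C₀ : Tr ℕ} (d : Detect Λ h C₀) where
  open Parity d public

  -- `root0` keeps the constant term of the root odd. It is what lets the linear coefficient of an
  -- `Odd` factor survive multiplication by squares.
  record Sq (F : ℕ → ℤ) : Set where
    constructor sq
    field
      root  : ℕ → ℤ
      rootP : IsP root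
      root0 : root 0 ≡ 1ℤ
      eqv   : F ≡₂ (λ n → root n · root n)

  record Odd (F : ℕ → ℤ) : Set where
    constructor odd
    field
      lin   : ℤ
      unit  : lin ≡ 1ℤ ⊎ lin ≡ -1ℤ
      root  : ℕ → ℤ
      rootP : IsP root
      root0 : root 0 ≡ 1ℤ
      eqv   : F ≡₂ (λ n → root n · root n ⊹ lin · (at n · (root n · root n)))

  sq-1 : ∀ {F} → (∀ n → F n ≡ 1ℤ) → Sq F
  sq-1 e = sq (λ _ → 1ℤ) (isP-const 1ℤ) refl (≡₂-refl e)

  sq-· : ∀ {F G} → IsP G → Sq F → Sq G → Sq (λ n → F n · G n)
  sq-· pG (sq a aP a0 aE) (sq b bP b0 bE) = sq (λ n → a n · b n) (isP-· aP bP) (cong₂ _·_ a0 b0)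
    (≡₂-trans (≡₂-· (isP-· aP aP) pG aE bE) (≡₂-refl (λ n → product-of-squares (a n) (b n))))

  at-isP : IsP at
  at-isP = (0ℤ ∷ 1ℤ ∷ []) , λ n → sym (trans (ev-∷ (at n) 0ℤ (1ℤ ∷ [])) (trans (ℤₚ.+-identityˡ _) (trans (cong (at n ·_) (ev-1 (at n))) (ℤₚ.*-identityʳ (at n)))))

  odd-· : ∀ {F G} → IsP G → Odd F → Sq G → Odd (λ n → F n · G n)
  odd-· pG (odd u uu a aP a0 aE) (sq b bP b0 bE) = odd u uu (λ n → a n · b n) (isP-· aP bP) (cong₂ _·_ a0 b0)
    (≡₂-trans (≡₂-· (isP-+ (isP-· aP aP) (isP-· (isP-const u) (isP-· at-isP (isP-· aP aP)))) pG aE bE)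
      (≡₂-refl (λ n → odd-times-square (a n) u (at n) (b n))))

  odd-ext : ∀ {F G} → (∀ n → G n ≡ F n) → Odd F → Odd G
  odd-ext e (odd u uu a aP a0 aE) = odd u uu a aP a0 (≡₂-trans (≡₂-refl e) aE)

  add-squares : ∀ {a b} → IsP a → IsP b → (λ n → a n · a n ⊹ b n · b n) ≡₂ (λ n → (a n ⊹ b n) · (a n ⊹ b n))
  add-squares {a} {b} aP bP = even⇒≡₂ (λ n → ⊖ (a n · b n)) (isP-neg (isP-· aP bP)) (λ n → sum-of-two-squares (a n) (b n))

  sum-squares : {X : Set} (xs : List X) (F : X → ℕ → ℤ) → All (λ x → Sq (F x)) xs →
                ∃[ Q ] IsP Q × ((λ n → ∑ xs (λ x → F x n)) ≡₂ (λ n → Q n · Q n))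
  sum-squares []       F []                     = (λ _ → 0ℤ) , isP-const 0ℤ , ≡₂-refl (λ _ → refl)
  sum-squares (x ∷ xs) F (sq a aP _ aE ∷ ss) with sum-squares xs F ss
  ... | Q , QP , QE = (λ n → a n ⊹ Q n) , isP-+ aP QP , ≡₂-trans (≡₂-+ aE QE) (add-squares aP QP)

  one-odd-term : {X : Set} (xs : List X) (F : X → ℕ → ℤ) (G : ℕ → ℤ) (c : ℤ) → All (λ x → Sq (F x)) xs → Odd G →
                 ¬ ((λ n → G n ⊹ ∑ xs (λ x → F x n)) ≡₂ (λ _ → c))
  one-odd-term xs F G c ss (odd u uu a aP a0 aE) e with sum-squares xs F ss
  ... | Q , QP , QE = no-linear-term (isP-+ aP QP) aP a0 u c uu
    (≡₂-trans (≡₂-sym (≡₂-trans (≡₂-+ aE QE) (≡₂-trans (≡₂-refl (λ n → move-last (a n) (Q n) (u · (at n · (a n · a n)))))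
      (≡₂-+ (add-squares aP QP) (≡₂-refl (λ n → refl)))))) e)

  neg⇒sq : (Z : Tr ⊤) (c : Canon Z) → IsNeg c → Units Z → sz Z ≤ h → Sq (φ Z)
  neg⇒sq Z (neg s A B p e) _ uZ l = sq (φ (sk A)) (φ-isP (sk A) lA) (φ-0 (sk A) lA)
    (≡₂-trans (≡₂-refl (φ-≈ p)) (mirror-square s A B (≈-units p uZ) e lj))
    where
    lj : sz A + sz B ≤ h
    lj = subst (_≤ h) (≈-sz p) l
    lA : sz (sk A) ≤ h
    lA = subst (_≤ h) (sym (sz-sk A)) (≤-trans (ℕₚ.m≤m+n (sz A) (sz B)) lj)

  -- Trees smaller than the detected one have sum 1, larger ones are symmetric by assumption, and at
  -- equal size a tree that is neither symmetric nor undetected has the canonical code of the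
  -- detected one.
  classify : CanC (κ C₀) → 2 ≤ sz C₀ → (Z : Tr ⊤) (c : Canon Z) → Units Z → sz Z ≤ h → (sz C₀ < sz Z → IsNeg c) →
             Sq (φ Z) ⊎ (sz Z ≡ sz C₀ × Hit c (κ C₀))
  classify can₀ big Z c uZ l neg-above with <-cmp (sz Z) (sz C₀)
  ... | tri< a _ _ = inj₁ (sq-1 (φ-low Z a l))
  ... | tri> _ _ a = inj₁ (neg⇒sq Z c (neg-above a) uZ l)
  ... | tri≈ _ e _ = same c
    where
    same : (c : Canon Z) → Sq (φ Z) ⊎ (sz Z ≡ sz C₀ × Hit c (κ C₀))
    same c@(neg _ _ _ _ _) = inj₁ (neg⇒sq Z c tt uZ l)
    same (pos (leaf x) p can) = contradiction (subst (2 ≤_) (trans (sym e) (≈-sz p)) big) (λ { (s≤s ()) })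
    same (pos C@(join s A B) p can) with χ d (sk C) ℤ.≟ 0ℤ
    ... | yes z = inj₁ (sq-1 (λ n → trans (φ-≈ p n) (trans (φ-top s A B (ℕₚ.≤-reflexive (trans (sym (≈-sz p)) e)) (subst (_≤ h) (≈-sz p) l) n)
          (trans (cong (λ y → 1ℤ ⊹ wt C · (at n · y)) z) (trans (cong (λ y → 1ℤ ⊹ wt C · y) (ℤₚ.*-zeroʳ (at n))) (cong (1ℤ ⊹_) (ℤₚ.*-zeroʳ (wt C))))))))
    ... | no k with χ-iso d (sk C) k
    ...   | _ , R , r , q = inj₂ (e , trans (sym (trans q (κ-sk C)))
            (proj₂ (canonical-root-unique C₀ R r can₀ (subst CanC (sym (κ-sk C)) can) q)))

pairs-with : {X : Set} {R : X → X → Set} → (∀ {x y} → R x y → R y x) → ∀ as {e bs} → AllPairs R (as ++ e ∷ bs) → All (R e) (as ++ bs)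
pairs-with sm []       (p ∷ _) = p
pairs-with sm (a ∷ as) (p ∷ q) = sm (All.lookup p (∈-insert as)) ∷ pairs-with sm as q

module Independence {Λ : ℤ} (n0 : Λ ≢ 0ℤ) (h : ℕ) where

  -- `canX` is stored because `Apart` is first established for the canonical forms found by
  -- `attach-canon`, not for those of `canon`. As the total is fixed, `less` makes every `P` smaller
  -- than every `X`, also across entries (`P<X`).
  record Entry (N : ℕ) : Set where
    constructor entry
    field
      P X   : Tr ⊤
      unitP : Units P
      unitX : Units X
      canX  : Canon X
      less  : sz P < sz X
      total : sz P + sz X ≡ N
  open Entry

  Rel : ∀ {N} → List (Entry N) → Set₁
  Rel es = ∀ C₀ (d : Detect Λ h C₀) → Mod2._≡₂_ (M d) (M≢0 d)
    (λ n → ∑ es (λ e → Phi.φ d (P e) n · Phi.φ d (X e) n)) (λ _ → + length es)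

  Apart : ∀ {N} → Entry N → Entry N → Set
  Apart e e′ = sz (P e) ≡ sz (P e′) → ¬ Collide (canX e) (canX e′)

  apart-sym : ∀ {N} {e e′ : Entry N} → Apart e e′ → Apart e′ e
  apart-sym {e = e} {e′} a q k = a (sym q) (collide-sym (canX e′) (canX e) k)

  -- A single vertex is never `neg`, whence the side condition on `P`; an `X` always has at least
  -- two vertices.
  NegFrom : ∀ {N} → ℕ → Entry N → Set
  NegFrom m e = (m ≤ sz (X e) → IsNeg (canX e)) × (m ≤ sz (P e) → 2 ≤ sz (P e) → IsNeg (canon (P e)))

  module _ {N : ℕ} (N≤h : N ≤ h) (es : List (Entry N)) (rel : Rel es) (apart : AllPairs Apart es) where

    X≤N : (e : Entry N) → sz (X e) ≤ N
    X≤N e = subst (sz (X e) ≤_) (total e) (ℕₚ.m≤n+m _ _)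

    P≤N : (e : Entry N) → sz (P e) ≤ N
    P≤N e = subst (sz (P e) ≤_) (total e) (ℕₚ.m≤m+n _ _)

    P<X : (e e′ : Entry N) → sz (P e) < sz (X e′)
    P<X e e′ = ℕₚ.≰⇒> λ l → ℕₚ.<-irrefl (trans (total e′) (sym (total e)))
      (ℕₚ.+-mono-< (ℕₚ.<-≤-trans (less e′) l) (ℕₚ.≤-<-trans l (less e)))

    X≡⇒P≡ : (e e′ : Entry N) → sz (X e′) ≡ sz (X e) → sz (P e) ≡ sz (P e′)
    X≡⇒P≡ e e′ q = ℕₚ.+-cancelʳ-≡ (sz (X e)) (sz (P e)) (sz (P e′)) (trans (total e) (trans (sym (total e′)) (cong (sz (P e′) ℕ.+_) q)))

    -- The term of e would be the only one with a linear coefficient.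
    only-odd : ∀ {C₀} (d : Detect Λ h C₀) as e bs → es ≡ as ++ e ∷ bs → let open Stage d in
               Odd (λ n → φ (P e) n · φ (X e) n) → (∀ e′ → e′ ∈ as ++ bs → Apart e e′ → Sq (λ n → φ (P e′) n · φ (X e′) n)) → ⊥
    only-odd d as e bs refl o squares = one-odd-term (as ++ bs) (λ e′ n → φ (P e′) n · φ (X e′) n) (λ n → φ (P e) n · φ (X e) n)
      (+ length es) (All.tabulate (λ {e′} m → squares e′ m (All.lookup (pairs-with (λ {x} {y} → apart-sym {e = x} {y}) as apart) m))) o
      (≡₂-trans (≡₂-refl (λ n → sym (∑-↭ (shift e as bs) (λ e′ → φ (P e′) n · φ (X e′) n)))) (rel _ d))
      where open Stage d

    module _ (m : ℕ) (above : ∀ e → e ∈ es → NegFrom (suc m) e) where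

      -- Suppose `X e` is `pos` and use its detector. All `P` are too small to be seen, larger `X`
      -- are squares by `above`, and another `X` that is hit would collide with `X e`. Exactly one
      -- term would have a linear coefficient.
      X-step : ∀ e → e ∈ es → sz (X e) ≡ m → (c : Canon (X e)) → c ≡ canX e → IsNeg c
      X-step e e∈ q (neg _ _ _ _ _) _ = tt
      X-step e e∈ q (pos C p can) ce with ∈-∃++ e∈
      ... | as , bs , split = only-odd d as e bs split
            (odd-ext (λ n → ℤₚ.*-comm (φ (P e) n) (φ (X e) n))
              (odd-· (φ-isP (P e) (≤-trans (P≤N e) N≤h)) self (sq-1 (φ-low (P e) (subst (sz (P e) <_) (trans q (sym size-C)) (less e)) (≤-trans (P≤N e) N≤h)))))
            other
        where
        lC : sz C ≤ h
        lC = subst (_≤ h) (≈-sz p) (≤-trans (X≤N e) N≤h)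
        big : 2 ≤ sz C
        big = subst (2 ≤_) (≈-sz p) (≤-trans (s≤s (sz>0 (P e))) (less e))
        d = detectOf n0 h C can lC
        open Stage d
        size-C : sz (lab 0 C) ≡ m
        size-C = trans (lab-sz 0 C) (trans (sym (≈-sz p)) q)
        self : Odd (φ (X e))
        self with φ-canonical n0 h C can lC (≈-units p (unitX e)) big
        ... | u , uu , v = odd u uu (λ _ → 1ℤ) (isP-const 1ℤ) refl (≡₂-refl (λ n → trans (φ-≈ p n) (trans (v n)
                (cong (λ z → 1ℤ ⊹ u · z) (sym (ℤₚ.*-identityʳ (at n)))))))
        can₀ : CanC (κ (lab 0 C))
        can₀ = subst CanC (sym (lab-κ 0 C)) can
        other : ∀ e′ → e′ ∈ as ++ bs → Apart e e′ → Sq (λ n → φ (P e′) n · φ (X e′) n)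
        other e′ m′ ap = sq-· {φ (P e′)} {φ (X e′)} (φ-isP (X e′) (≤-trans (X≤N e′) N≤h))
          (sq-1 (φ-low (P e′) (subst (sz (P e′) <_) (trans q (sym size-C)) (P<X e′ e)) (≤-trans (P≤N e′) N≤h)))
          ([_,_] {C = λ _ → Sq (φ (X e′))} (λ s → s) (λ (a , hit) → contradiction (collide (canX e′) hit) (ap (X≡⇒P≡ e e′ (trans a (trans size-C (sym q))))))
            (classify can₀ (subst (2 ≤_) (sym (lab-sz 0 C)) big) (X e′) (canX e′) (unitX e′) (≤-trans (X≤N e′) N≤h)
              (λ l → proj₁ (above e′ e′∈) (subst (_< sz (X e′)) size-C l))))
          where
          e′∈ : e′ ∈ es
          e′∈ = subst (e′ ∈_) (sym split) (∈-resp-↭ (↭-sym (shift e as bs)) (there m′))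
          collide : (c′ : Canon (X e′)) → Hit c′ (κ (lab 0 C)) → Collide (canX e) c′
          collide (pos C′ _ _) hit = subst (λ z → Collide z (pos C′ _ _)) ce (sym (trans hit (lab-κ 0 C)))

      P-step : ∀ e → e ∈ es → sz (P e) ≡ m → 2 ≤ sz (P e) → (c : Canon (P e)) → IsNeg c
      P-step e e∈ q big (neg _ _ _ _ _) = tt
      P-step e e∈ q big (pos C p can) with ∈-∃++ e∈
      ... | as , bs , split = only-odd d as e bs split (odd-· (φ-isP (X e) (≤-trans (X≤N e) N≤h)) self (X-square e e∈)) other
        where
        lC : sz C ≤ h
        lC = subst (_≤ h) (≈-sz p) (≤-trans (P≤N e) N≤h)
        bigC : 2 ≤ sz C
        bigC = subst (2 ≤_) (≈-sz p) big
        d = detectOf n0 h C can lC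
        open Stage d
        size-C : sz (lab 0 C) ≡ m
        size-C = trans (lab-sz 0 C) (trans (sym (≈-sz p)) q)
        self : Odd (φ (P e))
        self with φ-canonical n0 h C can lC (≈-units p (unitP e)) bigC
        ... | u , uu , v = odd u uu (λ _ → 1ℤ) (isP-const 1ℤ) refl (≡₂-refl (λ n → trans (φ-≈ p n) (trans (v n)
                (cong (λ z → 1ℤ ⊹ u · z) (sym (ℤₚ.*-identityʳ (at n)))))))
        X-neg : ∀ e′ → e′ ∈ es → IsNeg (canX e′)
        X-neg e′ m′ = proj₁ (above e′ m′) (subst (_< sz (X e′)) q (P<X e e′))
        X-square : ∀ e′ → e′ ∈ es → Sq (φ (X e′))
        X-square e′ m′ = neg⇒sq (X e′) (canX e′) (X-neg e′ m′) (unitX e′) (≤-trans (X≤N e′) N≤h)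
        other : ∀ e′ → e′ ∈ as ++ bs → Apart e e′ → Sq (λ n → φ (P e′) n · φ (X e′) n)
        other e′ m′ ap = sq-· {φ (P e′)} {φ (X e′)} (φ-isP (X e′) (≤-trans (X≤N e′) N≤h))
          ([_,_] {C = λ _ → Sq (φ (P e′))} (λ s → s) (λ (a , hit) → contradiction (neg-collide (canX e) (canX e′) (X-neg e e∈) (X-neg e′ e′∈))
                            (ap (trans q (trans (sym size-C) (sym a)))))
            (classify (subst CanC (sym (lab-κ 0 C)) can) (subst (2 ≤_) (sym (lab-sz 0 C)) bigC) (P e′) (canon (P e′)) (unitP e′) (≤-trans (P≤N e′) N≤h)
              (λ l → proj₂ (above e′ e′∈) (subst (_< sz (P e′)) size-C l)
                       (≤-trans big (ℕₚ.<⇒≤ (subst (_< sz (P e′)) (trans size-C (sym q)) l))))))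
          (X-square e′ e′∈)
          where
          e′∈ : e′ ∈ es
          e′∈ = subst (e′ ∈_) (sym split) (∈-resp-↭ (↭-sym (shift e as bs)) (there m′))

      neg-step : ∀ e → e ∈ es → NegFrom m e
      neg-step e e∈ = (λ l → [ (λ lt → proj₁ (above e e∈) lt) , (λ q → X-step e e∈ (sym q) (canX e) refl) ] (ℕₚ.m≤n⇒m<n∨m≡n l)) ,
                      (λ l b → [ (λ lt → proj₂ (above e e∈) lt b) , (λ q → P-step e e∈ (sym q) b (canon (P e))) ] (ℕₚ.m≤n⇒m<n∨m≡n l))

    descend : ∀ m → (∀ e → e ∈ es → NegFrom m e) → ∀ e → e ∈ es → NegFrom 0 e
    descend zero    a = a
    descend (suc m) a = descend m (neg-step m a)

    all-neg : ∀ e → e ∈ es → NegFrom 0 e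
    all-neg = descend (suc N) (λ e _ → (λ l → contradiction (X≤N e) (ℕₚ.<⇒≱ l)) , (λ l _ → contradiction (P≤N e) (ℕₚ.<⇒≱ l)))

  record Half {N : ℕ} (N′ : ℕ) (e : Entry N) : Set₁ where
    field
      half   : Entry N′
      square : ∀ C₀ (d : Detect Λ h C₀) → Mod2._≡₂_ (M d) (M≢0 d) (λ n → Phi.φ d (P e) n · Phi.φ d (X e) n)
                 (λ n → Phi.φ d (P half) n · Phi.φ d (X half) n · (Phi.φ d (P half) n · Phi.φ d (X half) n))
      twice  : sz (P e) ≡ 2 * sz (P half)
      negX   : IsNeg (canX e)
  open Half

  even≢odd : ∀ a b → suc (2 * a) ≢ 2 * b
  even≢odd a (suc b) e = even≢odd′ a b (trans (ℕₚ.suc-injective e) (ℕₚ.+-suc b (b + 0)))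
    where
    even≢odd′ : ∀ a b → 2 * a ≢ suc (2 * b)
    even≢odd′ (suc a) b e = even≢odd a b (trans (sym (ℕₚ.+-suc a (a + 0))) (ℕₚ.suc-injective e))

  halve-entry : ∀ {r} → 2 * 2 ^ r ≤ h → (e : Entry (2 * 2 ^ r)) → IsNeg (canX e) → (2 ≤ sz (P e) → IsNeg (canon (P e))) → Half (2 ^ r) e
  halve-entry {r} l e nX nP = go (canX e) refl nX (2 ℕ.≤? sz (P e))
    where
    lX : sz (X e) ≤ h
    lX = ≤-trans (subst (sz (X e) ≤_) (total e) (ℕₚ.m≤n+m _ _)) l
    lP : sz (P e) ≤ h
    lP = ≤-trans (subst (sz (P e) ≤_) (total e) (ℕₚ.m≤m+n _ _)) l
    build : (c : Canon (X e)) → c ≡ canX e → IsNeg c → (c′ : Canon (P e)) → IsNeg c′ → Half (2 ^ r) e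
    build (neg s A B p q) ce _ (neg s′ A′ B′ p′ q′) _ = record
      { half = entry (sk A′) (sk A) (units-sk A′) (units-sk A) (canon (sk A))
          (subst (_< sz (sk A)) (sym (sz-sk A′)) (subst (sz A′ <_) (sym (sz-sk A)) (ℕₚ.*-cancelˡ-< 2 _ _ (subst (_< 2 * sz A) sP (subst (sz (P e) <_) sX (less e))))))
          (trans (cong₂ _+_ (sz-sk A′) (sz-sk A)) (ℕₚ.*-cancelˡ-≡ (sz A′ + sz A) (2 ^ r) 2 (trans (ℕₚ.*-distribˡ-+ 2 (sz A′) (sz A))
            (trans (sym (cong₂ _+_ sP sX)) (total e)))))
      ; square = λ C₀ d → squares C₀ d
      ; twice = trans sP (cong (2 *_) (sym (sz-sk A′)))
      ; negX = subst IsNeg ce tt }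
      where
      sX : sz (X e) ≡ 2 * sz A
      sX = halves-size n0 h (X e) A B p q
      sP : sz (P e) ≡ 2 * sz A′
      sP = halves-size n0 h (P e) A′ B′ p′ q′
      squares : ∀ C₀ (d : Detect Λ h C₀) → Mod2._≡₂_ (M d) (M≢0 d) (λ n → Phi.φ d (P e) n · Phi.φ d (X e) n)
                 (λ n → Phi.φ d (sk A′) n · Phi.φ d (sk A) n · (Phi.φ d (sk A′) n · Phi.φ d (sk A) n))
      squares C₀ d = ≡₂-trans (≡₂-· (isP-· pA′ pA′) (φ-isP (X e) lX)
          (≡₂-trans (≡₂-refl (φ-≈ p′)) (mirror-square s′ A′ B′ (≈-units p′ (unitP e)) q′ (subst (_≤ h) (≈-sz p′) lP)))
          (≡₂-trans (≡₂-refl (φ-≈ p)) (mirror-square s A B (≈-units p (unitX e)) q (subst (_≤ h) (≈-sz p) lX))))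
        (≡₂-refl (λ n → product-of-squares (φ (sk A′) n) (φ (sk A) n)))
        where
        open Parity d
        pA′ = φ-isP (sk A′) (subst (_≤ h) (sym (sz-sk A′)) (≤-trans (ℕₚ.m≤m+n _ _) (subst (_≤ h) (≈-sz p′) lP)))
    go : (c : Canon (X e)) → c ≡ canX e → IsNeg c → Dec (2 ≤ sz (P e)) → Half (2 ^ r) e
    go c ce n (yes big) = build c ce n (canon (P e)) (nP big)
    -- A single vertex as `P` would leave an odd number of vertices for `X`, but a `neg` tree has an
    -- even number.
    go (neg s A B p q) ce n (no small) = contradiction
      (trans (cong₂ _+_ (ℕₚ.≤-antisym (sz>0 (P e)) (ℕₚ.≤-pred (ℕₚ.≰⇒> small))) (sym (halves-size n0 h (X e) A B p q))) (total e)) (even≢odd (sz A) (2 ^ r))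

  halves : ∀ {N N′} (es : List (Entry N)) → (∀ e → e ∈ es → Half N′ e) → List (Entry N′)
  halves []       H = []
  halves (e ∷ es) H = half (H e (here refl)) ∷ halves es (λ e′ m → H e′ (there m))

  halves-length : ∀ {N N′} (es : List (Entry N)) (H : ∀ e → e ∈ es → Half N′ e) → length (halves es H) ≡ length es
  halves-length []       H = refl
  halves-length (e ∷ es) H = cong suc (halves-length es (λ e′ m → H e′ (there m)))

  -- The `X` before halving are all `neg` and so collide as soon as the sizes agree. Hence different
  -- entries have different sizes, before and after halving.
  halves-apart : ∀ {N N′} (es : List (Entry N)) (H : ∀ e → e ∈ es → Half N′ e) → AllPairs Apart es → AllPairs Apart (halves es H)
  halves-apart []       H []       = []
  halves-apart {N} {N′} (e ∷ es) H (a ∷ as) = heads es (λ e′ m → H e′ (there m)) a ∷ halves-apart es (λ e′ m → H e′ (there m)) as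
    where
    H₀ = H e (here refl)
    heads : ∀ es (H : ∀ e′ → e′ ∈ es → Half N′ e′) → All (Apart e) es → All (Apart (half H₀)) (halves es H)
    heads []        H []      = []
    heads (e′ ∷ es) H (b ∷ bs) = (λ q _ → b (trans (twice H₀) (trans (cong (2 *_) q) (sym (twice (H e′ (here refl))))))
        (neg-collide (canX e) (canX e′) (negX H₀) (negX (H e′ (here refl))))) ∷ heads es (λ x m → H x (there m)) bs

  -- Modulo 2 a sum of squares is a square and a constant is congruent to its square, so both sides
  -- of the relation have a root, and `≡₂-sqrt` extracts it.
  halves-rel : ∀ {N N′} → N′ ≤ h → (es : List (Entry N)) (H : ∀ e → e ∈ es → Half N′ e) → Rel es → Rel (halves es H)
  halves-rel {N} {N′} N′≤h es H rel C₀ d = subst (λ z → F (halves es H) ≡₂ (λ _ → + z)) (sym (halves-length es H))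
      (≡₂-sqrt (F-isP (halves es H)) (+ length es) (≡₂-trans (≡₂-sym (squares es H)) (≡₂-trans (rel C₀ d) (const-sq (+ length es)))))
    where
    open Stage d
    F : ∀ {K} → List (Entry K) → ℕ → ℤ
    F es n = ∑ es (λ e → φ (P e) n · φ (X e) n)
    F-isP : (es : List (Entry N′)) → IsP (F es)
    F-isP es = isP-∑ es (λ e _ → isP-· (φ-isP (P e) (≤-trans (subst (sz (P e) ≤_) (total e) (ℕₚ.m≤m+n _ _)) N′≤h))
                                      (φ-isP (X e) (≤-trans (subst (sz (X e) ≤_) (total e) (ℕₚ.m≤n+m _ _)) N′≤h)))
    const-sq : ∀ c → (λ _ → c) ≡₂ (λ _ → c · c)
    const-sq c = ≡₂-sym (even⇒≡₂ (λ _ → proj₁ (sq-parity c)) (isP-const _) (λ _ → proj₂ (sq-parity c)))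
    squares : (es : List (Entry N)) (H : ∀ e → e ∈ es → Half N′ e) → F es ≡₂ (λ n → F (halves es H) n · F (halves es H) n)
    squares []       H = ≡₂-refl (λ _ → refl)
    squares (e ∷ es) H = ≡₂-trans (≡₂-+ (square (H e (here refl)) C₀ d) (squares es (λ e′ m → H e′ (there m))))
      (add-squares (isP-· (φ-isP (P (half H₀)) (≤-trans (subst (sz (P (half H₀)) ≤_) (total (half H₀)) (ℕₚ.m≤m+n _ _)) N′≤h))
                          (φ-isP (X (half H₀)) (≤-trans (subst (sz (X (half H₀)) ≤_) (total (half H₀)) (ℕₚ.m≤n+m _ _)) N′≤h)))
        (F-isP (halves es (λ e′ m → H e′ (there m)))))
      where
      H₀ = H e (here refl)

  -- Once all trees are known to be symmetric they can be halved together. At total size 1 there is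
  -- no room for two trees, so the list was empty from the start.
  independence : ∀ r (es : List (Entry (2 ^ r))) → 2 ^ r ≤ h → Rel es → AllPairs Apart es → es ≡ []
  independence zero    []       l rel ap = refl
  independence zero    (e ∷ es) l rel ap = contradiction (ℕₚ.+-mono-≤ (sz>0 (P e)) (sz>0 (X e)))
    (ℕₚ.<⇒≱ (s≤s (ℕₚ.≤-reflexive (total e))))
  independence (suc r) es l rel ap = empty es H (independence r (halves es H) lr (halves-rel lr es H rel) (halves-apart es H ap))
    where
    lr : 2 ^ r ≤ h
    lr = ≤-trans (ℕₚ.m≤m+n (2 ^ r) (2 ^ r + 0)) l
    H : ∀ e → e ∈ es → Half (2 ^ r) e
    H e m = halve-entry {r} l e (proj₁ (all-neg l es rel ap e m) z≤n) (proj₂ (all-neg l es rel ap e m) z≤n)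
    empty : ∀ (es : List (Entry (2 ^ suc r))) (H : ∀ e → e ∈ es → Half (2 ^ r) e) → halves es H ≡ [] → es ≡ []
    empty [] H _ = refl

-- Equality of the two halves

κ-erase : (S : Tr V₀) → κ (erase S) ≡ κ S
κ-erase S = trans (sym (κ-sk (erase S))) (trans (cong κ (sk-erase S)) (κ-sk S))

attach-≃ : (T A : Tr V₀) → join 1ℤ T A ≃ merge (join 1ℤ (leaf (rt T)) A) T
attach-≃ T A = subst (λ z → join 1ℤ z A ≃ merge (join 1ℤ (leaf (rt T)) A) T) (merge-root T) (merge-join 1ℤ (leaf (rt T)) A T)

opaque
  -- The walk starts with the attached branch `A` as the accumulated part and goes through `T`. For
  -- different branches the part ahead is thus the same, as `walk-injective` requires.
  attach-canon : ∀ n (T A : Tr V₀) → n ≡ sz T + sz A → sz A < sz T → Canon (join 1ℤ T A)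
  attach-canon n T A e l = canon-≈ (≈-of (attach-≃ T A))
    (walk n (join 1ℤ (leaf (rt T)) A) T (trans e (≃-sz (attach-≃ T A)))
      (light-single {s = 1ℤ} {rt T} A (subst (2 * sz A <_) (sym e)
        (subst (_< sz T + sz A) (cong (sz A ℕ.+_) (sym (ℕₚ.+-identityʳ (sz A)))) (ℕₚ.+-monoˡ-< (sz A) l)))))

  attach-collide : ∀ {n n′} → n ≡ n′ → (T A A′ : Tr V₀) (e : n ≡ sz T + sz A) (e′ : n′ ≡ sz T + sz A′) (l : sz A < sz T) (l′ : sz A′ < sz T) →
                   Collide (attach-canon n T A e l) (attach-canon n′ T A′ e′ l′) → κ A ≡ κ A′
  attach-collide {n = n} refl T A A′ e e′ l l′ k = ins-cancelʳ nil (walk-injective n (join 1ℤ (leaf (rt T)) A) (join 1ℤ (leaf (rt T)) A′) T _ _ _ _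
    (collide-≈ (walk n _ T _ _) (walk n _ T _ _) k))

cuts-[] : ∀ C (Z Z′ : Tr ⊤) → sk Z ≡ sk Z′ → cuts C Z Z′ ≡ [] → Z ≡ Z′
cuts-[] C (leaf tt) (leaf tt) e c = refl
cuts-[] C (join s A B) (join s′ A′ B′) e c = join-≡ (last (s ℤ.≟ s′) (Listₚ.++-conicalʳ (cuts (right 1ℤ (sk A) C) B B′) _ c₂))
    (cuts-[] (left 1ℤ (sk B) C) A A′ (proj₁ (join-inj e)) (Listₚ.++-conicalˡ (cuts (left 1ℤ (sk B) C) A A′) _ c))
    (cuts-[] (right 1ℤ (sk A) C) B B′ (proj₂ (join-inj e)) (Listₚ.++-conicalˡ (cuts (right 1ℤ (sk A) C) B B′) _ c₂))
  where
  c₂ = Listₚ.++-conicalʳ (cuts (left 1ℤ (sk B) C) A A′) _ c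
  last : (d : Dec (s ≡ s′)) → (if ⌊ d ⌋ then [] else (plug C (sk A) , sk B) ∷ []) ≡ [] → s ≡ s′
  last (yes q) _ = q
  last (no _) ()
  join-≡ : ∀ {s s′} {A A′ B B′ : Tr ⊤} → s ≡ s′ → A ≡ A′ → B ≡ B′ → join s A B ≡ join s′ A′ B′
  join-≡ refl refl refl = refl

module Halves {Λ : ℤ} (n0 : Λ ≢ 0ℤ) (h : ℕ) where
  open Independence n0 h
  open Entry

  module _ (T : Tr ⊤) (N : ℕ) (T≡N : sz T ≡ N) where

    cut-small : ∀ {F G} → CutOf N (F , G) → sz F < sz (sk T)
    cut-small {F} c = subst (sz F <_) (sym (trans (sz-sk T) T≡N)) (cut-F< c)

    -- What remains of the whole tree after a cut inside the second half: `F` is still attached to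
    -- the first half `T`, and `G` has been cut off.
    cut-entry : ∀ FG → CutOf N FG → Entry (2 * N)
    cut-entry (F , G) c@(cutOf e uF uG) = entry G (join 1ℤ (sk T) F) uG (join (inj₁ refl) (units-sk T) uF)
      (attach-canon (sz (sk T) + sz F) (sk T) F refl (cut-small c))
      (ℕₚ.<-≤-trans (subst (sz G <_) (sym sT) (cut-G< c)) (ℕₚ.m≤m+n _ _))
      (trans (ℕₚ.+-comm (sz G) (sz (sk T) + sz F)) (trans (ℕₚ.+-assoc (sz (sk T)) (sz F) (sz G)) (cong₂ _+_ sT (trans e (sym (ℕₚ.+-identityʳ N))))))
      where
      sT : sz (sk T) ≡ N
      sT = trans (sz-sk T) T≡N

    cut-entries : ∀ xs → All (CutOf N) xs → List (Entry (2 * N))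
    cut-entries []       []       = []
    cut-entries (x ∷ xs) (c ∷ cs) = cut-entry x c ∷ cut-entries xs cs

    cut-entries-[] : ∀ xs cs → cut-entries xs cs ≡ [] → xs ≡ []
    cut-entries-[] [] [] e = refl

    cut-entries-length : ∀ xs cs → length (cut-entries xs cs) ≡ length xs
    cut-entries-length []       []       = refl
    cut-entries-length (x ∷ xs) (c ∷ cs) = cong suc (cut-entries-length xs cs)

    cut-entries-∑ : ∀ xs cs (Ψ : Tr ⊤ → ℤ) → ∑ (cut-entries xs cs) (λ e → Ψ (P e) · Ψ (X e)) ≡ ∑ xs (λ (F , G) → Ψ (join 1ℤ (sk T) F) · Ψ G)
    cut-entries-∑ []             []       Ψ = refl
    cut-entries-∑ ((F , G) ∷ xs) (c ∷ cs) Ψ = cong₂ _⊹_ (ℤₚ.*-comm (Ψ G) (Ψ (join 1ℤ (sk T) F))) (cut-entries-∑ xs cs Ψ)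

    cut-entry-apart : ∀ x y c c′ → Sep x y → Apart (cut-entry x c) (cut-entry y c′)
    cut-entry-apart (F , G) (F′ , G′) c@(cutOf e _ _) c′@(cutOf e′ _ _) sep q k = sep q
      (attach-collide (cong (sz (sk T) ℕ.+_) (ℕₚ.+-cancelʳ-≡ (sz G) (sz F) (sz F′) (trans e (trans (sym e′) (cong (sz F′ ℕ.+_) (sym q))))))
        (sk T) F F′ refl refl (cut-small c) (cut-small c′) k)

    cut-entries-apart : ∀ xs cs → AllPairs Sep xs → AllPairs Apart (cut-entries xs cs)
    cut-entries-apart []       []       []       = []
    cut-entries-apart (x ∷ xs) (c ∷ cs) (p ∷ ps) = heads xs cs p ∷ cut-entries-apart xs cs ps
      where
      heads : ∀ ys cs → All (Sep x) ys → All (Apart (cut-entry x c)) (cut-entries ys cs)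
      heads []       []        []       = []
      heads (y ∷ ys) (c′ ∷ cs) (p ∷ ps) = cut-entry-apart x y c c′ p ∷ heads ys cs ps

  -- Every edge of disagreement contributes an entry to a relation that `independence` shows to be
  -- empty.
  equal-halves : ∀ r s (T₁ T₂ : Tr ⊤) → Units (join s T₁ T₂) → sk T₁ ≡ sk T₂ → sz (join s T₁ T₂) ≤ h → sz T₁ ≡ 2 ^ r → Rigid T₂ →
                 (∀ {C₀} (d : Detect Λ h C₀) n → Phi.φ d (join s T₁ T₂) n ≡ 1ℤ) → T₁ ≡ T₂
  equal-halves r s T₁ T₂ u e l size rigid one = sym (cuts-[] top T₂ T₁ (sym e) (cut-entries-[] T₁ (2 ^ r) size xs cs
      (independence (suc r) es (subst (_≤ h) (cong₂ _+_ size (trans size₂ (sym (ℕₚ.+-identityʳ (2 ^ r))))) l) related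
        (cut-entries-apart T₁ (2 ^ r) size xs cs (cuts-sep T₂ T₁ rigid)))))
    where
    size₂ : sz T₂ ≡ 2 ^ r
    size₂ = trans (sym (sk⇒sz T₁ T₂ e)) size
    xs = cuts top T₂ T₁
    cs : All (CutOf (2 ^ r)) xs
    cs = subst (λ N → All (CutOf N) xs) size₂ (cuts-of T₂ T₁)
    es = cut-entries T₁ (2 ^ r) size xs cs
    shifted : cuts (right 1ℤ (sk T₁) top) T₂ T₁ ≡ map (λ (F , G) → join 1ℤ (sk T₁) F , G) xs
    shifted = cuts-comp top (right 1ℤ (sk T₁) top) T₂ T₁
    related : Rel es
    related C₀ d = subst (λ k → (λ n → ∑ es (λ e → φ (P e) n · φ (X e) n)) ≡₂ (λ _ → + k))
        (trans (cong length shifted) (trans (Listₚ.length-map _ xs) (sym (cut-entries-length T₁ (2 ^ r) size xs cs))))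
        (≡₂-trans (≡₂-refl (λ n → trans (cut-entries-∑ T₁ (2 ^ r) size xs cs (λ Z → φ Z n))
            (trans (sym (∑-map (λ (F , G) → join 1ℤ (sk T₁) F , G) xs (λ (F , G) → φ F n · φ G n)))
              (cong (λ z → ∑ z (λ (F , G) → φ F n · φ G n)) (sym shifted)))))
          (cut-relation s T₁ T₂ u e l (one d)))
      where open Parity d

-- Values modulo Λ and the structure of impartial trees

term-mod-Λ : ∀ Λ v s c q → v · ((1ℤ ⊹ s · (Λ · c)) · (1ℤ ⊹ Λ · q)) ≡ v ⊹ Λ · (v · (s · c ⊹ q ⊹ s · c · (Λ · q)))
term-mod-Λ = solve-∀

product-mod-Λ : ∀ Λ a b → (1ℤ ⊹ Λ · a) · (1ℤ ⊹ Λ · b) ≡ 1ℤ ⊹ Λ · (a ⊹ b ⊹ a · (Λ · b))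
product-mod-Λ = solve-∀

weight-mod-Λ : ∀ Λ v q → v · (1ℤ ⊹ Λ · q) ≡ v ⊹ Λ · (v · q)
weight-mod-Λ = solve-∀

module _ {Λ : ℤ} (K : Kernel) (div : ∀ x y → ∃[ c ] f K x y ≡ Λ · c) (m1 : mass K ≡ 1ℤ) where

  gs≡1 : (S : Tr V₀) → ∀ x → ∃[ q ] gs 1ℤ K S x ≡ 1ℤ ⊹ Λ · q
  gs≡1 (leaf _)     x = 0ℤ , sym (cong (1ℤ ⊹_) (ℤₚ.*-zeroʳ Λ))
  gs≡1 (join s A B) x = proj₁ (gs≡1 A x) ⊹ Q ⊹ proj₁ (gs≡1 A x) · (Λ · Q) ,
      trans (cong₂ _·_ (proj₂ (gs≡1 A x)) branch) (product-mod-Λ Λ (proj₁ (gs≡1 A x)) Q)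
    where
    q : Ω K → ℤ
    q y = w K y · (s · proj₁ (div x y) ⊹ proj₁ (gs≡1 B y) ⊹ s · proj₁ (div x y) · (Λ · proj₁ (gs≡1 B y)))
    Q : ℤ
    Q = ∑ (pts K) q
    branch : br 1ℤ K s B x ≡ 1ℤ ⊹ Λ · Q
    branch = trans (∑-cong (pts K) (λ y → trans (cong₂ (λ a b → w K y · ((1ℤ ⊹ s · a) · b)) (proj₂ (div x y)) (proj₂ (gs≡1 B y)))
        (term-mod-Λ Λ (w K y) s (proj₁ (div x y)) (proj₁ (gs≡1 B y)))))
      (trans (∑-+ (pts K) (w K) (λ y → Λ · q y)) (cong₂ _⊹_ m1 (∑-* (pts K) Λ q)))

  opaque
    Φ≡1 : (S : Tr V₀) → ∃[ q ] Φ K S ≡ 1ℤ ⊹ Λ · q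
    Φ≡1 S = ∑ (pts K) (λ x → w K x · proj₁ (gs≡1 S x)) , trans (∑-cong (pts K) (λ x → trans (cong (w K x ·_) (proj₂ (gs≡1 S x)))
        (weight-mod-Λ Λ (w K x) (proj₁ (gs≡1 S x))))) (trans (∑-+ (pts K) (w K) _) (cong₂ _⊹_ m1 (∑-* (pts K) Λ _)))

·≡0 : ∀ a b → a · b ≡ 0ℤ → a ≡ 0ℤ ⊎ b ≡ 0ℤ
·≡0 a b = ℤₚ.i*j≡0⇒i≡0∨j≡0 a

square-1 : ∀ a → a · a ≡ 1ℤ → a ≡ 1ℤ ⊎ a ≡ -1ℤ
square-1 a e with ·≡0 (a ⊹ -1ℤ) (a ⊹ 1ℤ) (trans (lem a) (cong (_⊹ -1ℤ) e))
  where
  lem : ∀ a → (a ⊹ -1ℤ) · (a ⊹ 1ℤ) ≡ a · a ⊹ -1ℤ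
  lem = solve-∀
... | inj₁ z = inj₁ (trans (lem a) (cong (_⊹ 1ℤ) z))
  where
  lem : ∀ a → a ≡ a ⊹ -1ℤ ⊹ 1ℤ
  lem = solve-∀
... | inj₂ z = inj₂ (trans (lem a) (cong (_⊹ -1ℤ) z))
  where
  lem : ∀ a → a ≡ a ⊹ 1ℤ ⊹ -1ℤ
  lem = solve-∀

-- Equality after `erase` compares shapes and orientations exactly. Weight 1 on the bridge is no
-- restriction, since `≈-rot` exchanges the halves.
data Mirrored : Tr ℕ → Set where
  single : ∀ {x} → Mirrored (leaf x)
  mirrored : ∀ {S A B} → S ≈ join 1ℤ A B → erase A ≡ erase B → Mirrored A → Mirrored S

1+a≡-1 : ∀ a y → y ≡ 1ℤ ⊹ a → y ≡ -1ℤ → a ≡ -[1+ 1 ]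
1+a≡-1 a y e p = trans (lem a) (cong (_⊹ -1ℤ) (trans (sym e) p))
  where
  lem : ∀ a → a ≡ (1ℤ ⊹ a) ⊹ -1ℤ
  lem = solve-∀

ImpT-half : ∀ {Λ s} → (∀ q → Λ · q ≢ -[1+ 1 ]) → (A B : Tr V₀) → erase A ≡ erase B → ImpT Λ (join s A B) → ImpT Λ A
ImpT-half {Λ = Λ} {s = s} nd A B e imp K div m1 = [ id , minus ] (square-1 (Φ K A) square)
  where
  square : Φ K A · Φ K A ≡ 1ℤ
  square = trans (sym (cong₂ _·_ (hs-erase 1ℤ K A) (hs-erase 1ℤ K A)))
    (trans (sym (Φ-square K s (erase A))) (trans (cong (λ z → Φ K (join s (erase A) z)) e)
      (trans (hs-erase 1ℤ K (join s A B)) (imp K div m1))))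
  minus : Φ K A ≡ -1ℤ → Φ K A ≡ 1ℤ
  minus p = contradiction (1+a≡-1 (Λ · proj₁ (Φ≡1 {Λ = Λ} K div m1 A)) (Φ K A) (proj₂ (Φ≡1 {Λ = Λ} K div m1 A)) p) (nd (proj₁ (Φ≡1 {Λ = Λ} K div m1 A)))

module _ {Λ : ℤ} (n0 : Λ ≢ 0ℤ) (nd : ∀ q → Λ · q ≢ -[1+ 1 ]) (h : ℕ) where

  ImpT⇒PP : (S : Tr V₀) → Units S → sz S ≤ h → ImpT Λ S → PP Λ h S
  ImpT⇒PP S u l imp _ d = ≡₂-trans {G = φ S} (≡₂-sym {φ S} (φ-parity S u l)) one
    where
    open Parity d
    pointwise : ∀ n → φ S n ≡ 1ℤ
    pointwise n = trans (φ-def S n) (imp (kern d n) (kdiv d n) (kmass d n))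
    one : φ S ≡₂ (λ _ → 1ℤ)
    one = ≡₂-refl pointwise

  -- The second half is reordered so that its shape agrees with that of the first.
  equal-halves-of : (S : Tr ℕ) → Unique (verts S) → ImpT Λ S → ∀ {s} (A B B″ : Tr ℕ) → S ≈ join s A B → κ A ≡ κ B → PP Λ h A → PP Λ h B →
                    B ≃ B″ → sk B″ ≡ sk A → Units (join s A B) → sz A + sz B ≤ h → erase A ≡ erase B″
  equal-halves-of S un imp {s} A B B″ p e ppA ppB q k (join us uA uB) l = result (PP-size n0 h A uA (≤-trans (ℕₚ.m≤m+n _ _) l) ppA)
    where
    p′ : S ≈ join s A B″
    p′ = ≈-trans p (≈-of (≃-cong ≃-refl q))
    rigid : Rigid (erase B″)
    rigid = κ-rigid B (erase B″) (trans (≃-κ q) (sym (κ-erase B″))) (allRigid⇒rigid B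
      (PP⇒allRigid n0 h B (proj₁ (proj₂ (unique-++⁻ (verts A) (unique-↭ (≈-verts p) un)))) uB (≤-trans (ℕₚ.m≤n+m _ (sz A)) l) ppB))
    one : ∀ {C₀} (d : Detect Λ h C₀) n → Phi.φ d (join s (erase A) (erase B″)) n ≡ 1ℤ
    one d n = trans (Phi.φ-def d (join s (erase A) (erase B″)) n) (trans (hs-erase 1ℤ (kern d n) (join s A B″))
            (trans (sym (≈-hs 1ℤ (kern d n) p′)) (imp (kern d n) (kdiv d n) (kmass d n))))
    size″ : sz (join s (erase A) (erase B″)) ≤ h
    size″ = subst (_≤ h) (trans (cong (sz A ℕ.+_) (≃-sz q)) (sym (sz-erase (join s A B″)))) l
    result : ∃[ r ] sz A ≡ 2 ^ r → erase A ≡ erase B″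
    result (r , size) = Halves.equal-halves n0 h r s (erase A) (erase B″) (units-erase (join us uA (≃-units q uB)))
      (trans (sk-erase A) (trans (sym k) (sym (sk-erase B″)))) size″ (trans (sz-erase A) size) rigid one

  ImpT⇒equal-halves : (S : Tr ℕ) → Unique (verts S) → Units S → sz S ≤ h → ImpT Λ S → 2 ≤ sz S →
                      ∃[ s ] ∃[ A ] ∃[ B ] (S ≈ join s A B) × erase A ≡ erase B
  ImpT⇒equal-halves S un u l imp big = from (PP-step n0 h S u l (ImpT⇒PP S u l imp) big)
    where
    from : ∃[ s ] ∃[ A ] ∃[ B ] (S ≈ join s A B) × κ A ≡ κ B × PP Λ h A × PP Λ h B → ∃[ s ] ∃[ A ] ∃[ B ] (S ≈ join s A B) × erase A ≡ erase B
    from (s , A , B , p , e , ppA , ppB) = from′ (decode A B e)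
      where
      from′ : ∃[ B″ ] (B ≃ B″) × sk B″ ≡ sk A → ∃[ s ] ∃[ A ] ∃[ B ] (S ≈ join s A B) × erase A ≡ erase B
      from′ (B″ , q , k) = s , A , B″ , ≈-trans p (≈-of (≃-cong ≃-refl q)) ,
        equal-halves-of S un imp A B B″ p e ppA ppB q k (≈-units p u) (subst (_≤ h) (≈-sz p) l)

  ImpT⇒Mirrored : (S : Tr ℕ) → Unique (verts S) → Units S → sz S ≤ h → ImpT Λ S → Mirrored S
  ImpT⇒Mirrored S un u l imp = go S un u l imp (<-wellFounded (sz S))
    where
    go : (S : Tr ℕ) → Unique (verts S) → Units S → sz S ≤ h → ImpT Λ S → Acc _<_ (sz S) → Mirrored S
    half : (S : Tr ℕ) → Unique (verts S) → Units S → sz S ≤ h → ImpT Λ S → Acc _<_ (sz S) →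
           (A B : Tr ℕ) → S ≈ join 1ℤ A B → erase A ≡ erase B → Mirrored S
    half S un u l imp (acc rec) A B p e = mirrored p e
        (go A (proj₁ (unique-++⁻ (verts A) (unique-↭ (≈-verts p) un))) (first (≈-units p u)) (≤-trans (ℕₚ.m≤m+n _ _) (subst (_≤ h) (≈-sz p) l))
          (ImpT-half {Λ = Λ} {s = 1ℤ} nd A B e moved) (rec (subst (sz A <_) (sym (≈-sz p)) (sz<joinˡ A B))))
      where
      first : Units (join 1ℤ A B) → Units A
      first (join _ a _) = a
      moved : ImpT Λ (join 1ℤ A B)
      moved K dv m = trans (sym (≈-hs 1ℤ K p)) (imp K dv m)
    go S un u l imp ac = small (2 ℕ.≤? sz S)
      where
      orient : ∀ s A B → S ≈ join s A B → erase A ≡ erase B → Units (join s A B) → Mirrored S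
      orient s A B p e (join (inj₁ refl) _ _) = half S un u l imp ac A B p e
      orient s A B p e (join (inj₂ refl) _ _) = half S un u l imp ac B A (≈-trans p ≈-rot) (sym e)
      large : ∃[ s ] ∃[ A ] ∃[ B ] (S ≈ join s A B) × erase A ≡ erase B → Mirrored S
      large (s , A , B , p , e) = orient s A B p e (≈-units p u)
      leaf-case : ∃[ x ] S ≡ leaf x → Mirrored S
      leaf-case (x , e) = subst Mirrored (sym e) single
      small : Dec (2 ≤ sz S) → Mirrored S
      small (no k)    = leaf-case (sz1⇒leaf S (ℕₚ.≤-pred (ℕₚ.≰⇒> k)))
      small (yes big) = large (ImpT⇒equal-halves S un u l imp big)

-- Weighted sums over maps

private variable
  Ω₁ Ω₂ : Set

infixr 5 _◂_
_◂_ : ∀ {k} → Ω₁ → (Fin k → Ω₁) → Fin (suc k) → Ω₁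
(x ◂ φ) zero    = x
(x ◂ φ) (suc i) = φ i

Sum : List Ω₁ → (Ω₁ → ℤ) → ∀ k → ((Fin k → Ω₁) → ℤ) → ℤ
Sum pts w zero    G = G (λ ())
Sum pts w (suc k) G = ∑ pts (λ x → w x · Sum pts w k (λ φ → G (x ◂ φ)))

-- Maps are compared pointwise throughout, so an integrand has to be known to respect pointwise
-- equality.
Ext : ∀ {k} → ((Fin k → Ω₁) → ℤ) → Set
Ext G = ∀ {φ ψ} → (∀ i → φ i ≡ ψ i) → G φ ≡ G ψ

Inj : ∀ {a b} → (Fin a → Fin b) → Set
Inj φ = ∀ i j → φ i ≡ φ j → i ≡ j

◂-cong : ∀ {k} (x : Ω₁) {φ ψ : Fin k → Ω₁} → (∀ i → φ i ≡ ψ i) → ∀ i → (x ◂ φ) i ≡ (x ◂ ψ) i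
◂-cong x e zero    = refl
◂-cong x e (suc i) = e i

module _ (pts : List Ω₁) (w : Ω₁ → ℤ) where

  Sum-cong : ∀ k {F G : (Fin k → Ω₁) → ℤ} → (∀ φ → F φ ≡ G φ) → Sum pts w k F ≡ Sum pts w k G
  Sum-cong zero    e = e _
  Sum-cong (suc k) e = ∑-cong pts (λ x → cong (w x ·_) (Sum-cong k (λ φ → e _)))

  Sum-+ : ∀ k (F G : (Fin k → Ω₁) → ℤ) → Sum pts w k (λ φ → F φ ⊹ G φ) ≡ Sum pts w k F ⊹ Sum pts w k G
  Sum-+ zero    F G = refl
  Sum-+ (suc k) F G = trans (∑-cong pts (λ x → trans (cong (w x ·_) (Sum-+ k _ _)) (ℤₚ.*-distribˡ-+ (w x) _ _))) (∑-+ pts _ _)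

  Sum-* : ∀ k c (F : (Fin k → Ω₁) → ℤ) → Sum pts w k (λ φ → c · F φ) ≡ c · Sum pts w k F
  Sum-* zero    c F = refl
  Sum-* (suc k) c F = trans (∑-cong pts (λ x → trans (cong (w x ·_) (Sum-* k c _)) (lem (w x) c (Sum pts w k (λ φ → F (x ◂ φ)))))) (∑-* pts c _)
    where
    lem : ∀ v c s → v · (c · s) ≡ c · (v · s)
    lem = solve-∀

  Sum-0 : ∀ k → Sum pts w k (λ _ → 0ℤ) ≡ 0ℤ
  Sum-0 zero    = refl
  Sum-0 (suc k) = ∑-vanish pts (λ x _ → trans (cong (w x ·_) (Sum-0 k)) (ℤₚ.*-zeroʳ (w x)))

  Sum-const : ∀ k c → Sum pts w k (λ _ → c) ≡ pow (∑ pts w) k · c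
  Sum-const zero    c = sym (ℤₚ.*-identityˡ c)
  Sum-const (suc k) c = trans (∑-cong pts (λ x → cong (w x ·_) (Sum-const k c)))
    (trans (∑-*ʳ pts _ w) (sym (ℤₚ.*-assoc (∑ pts w) (pow (∑ pts w) k) c)))

  ∑-Sum : ∀ k (xs : List Ω₂) (F : Ω₂ → (Fin k → Ω₁) → ℤ) → ∑ xs (λ y → Sum pts w k (F y)) ≡ Sum pts w k (λ φ → ∑ xs (λ y → F y φ))
  ∑-Sum zero    xs F = refl
  ∑-Sum (suc k) xs F = trans (∑-swap xs pts _) (∑-cong pts (λ x → trans (∑-* xs (w x) _) (cong (w x ·_) (∑-Sum k xs (λ y φ → F y (x ◂ φ))))))

  Sum-split : ∀ a b {F : (Fin (a + b) → Ω₁) → ℤ} → Ext F →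
              Sum pts w (a + b) F ≡ Sum pts w a (λ φ → Sum pts w b (λ ψ → F ([ φ , ψ ] ∘ splitAt a)))
  Sum-split zero    b     ext = refl
  Sum-split (suc a) b {F} ext = ∑-cong pts (λ x → cong (w x ·_) (trans (Sum-split a b (λ e → ext (◂-cong x e)))
    (Sum-cong a (λ φ → Sum-cong b (λ ψ → ext (glue x φ ψ))))))
    where
    glue : ∀ x φ ψ i → (x ◂ ([ φ , ψ ] ∘ splitAt a)) i ≡ [ x ◂ φ , ψ ] (splitAt (suc a) i)
    glue x φ ψ zero    = refl
    glue x φ ψ (suc i) with splitAt a i
    ... | inj₁ _ = refl
    ... | inj₂ _ = refl

  put : ∀ {k} → Fin (suc k) → Ω₁ → (Fin k → Ω₁) → Fin (suc k) → Ω₁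
  put zero            x ψ = x ◂ ψ
  put {suc k} (suc j) x ψ = ψ zero ◂ put j x (ψ ∘ suc)

  put-at : ∀ {k} (j : Fin (suc k)) x ψ → put j x ψ j ≡ x
  put-at zero            x ψ = refl
  put-at {suc k} (suc j) x ψ = put-at j x (ψ ∘ suc)

  put-in : ∀ {k} (j : Fin (suc k)) x ψ i → put j x ψ (punchIn j i) ≡ ψ i
  put-in zero            x ψ i       = refl
  put-in {suc k} (suc j) x ψ zero    = refl
  put-in {suc k} (suc j) x ψ (suc i) = put-in j x (ψ ∘ suc) i

  Sum-put : ∀ {k} (j : Fin (suc k)) {G : (Fin (suc k) → Ω₁) → ℤ} → Ext G →
            Sum pts w (suc k) G ≡ ∑ pts (λ x → w x · Sum pts w k (λ ψ → G (put j x ψ)))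
  Sum-put zero ext = refl
  Sum-put {suc k} (suc j) {G} ext = trans (∑-cong pts (λ y → trans (cong (w y ·_) (Sum-put j {λ φ → G (y ◂ φ)} (λ e → ext (◂-cong y e)))) (sym (∑-* pts (w y) _))))
    (trans (∑-swap pts pts _) (∑-cong pts (λ x → trans (∑-cong pts (λ y → lem (w y) (w x) (Sum pts w k (λ ψ → G (y ◂ put j x ψ))))) (∑-* pts (w x) _))))
    where
    lem : ∀ a b c → a · (b · c) ≡ b · (a · c)
    lem = solve-∀

  -- The `b ∸ a` coordinates outside the image are free, and each contributes the total weight. The
  -- induction singles out the coordinate `φ zero` and renumbers the others by `punchOut`.
  Sum-injection : ∀ a b (φ : Fin a → Fin b) → Inj φ → {G : (Fin a → Ω₁) → ℤ} → Ext G →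
                  Sum pts w b (λ ρ → G (ρ ∘ φ)) ≡ pow (∑ pts w) (b ∸ a) · Sum pts w a G
  Sum-injection zero    b       φ inj {G} ext = trans (Sum-cong b (λ ρ → ext (λ ()))) (Sum-const b (G (λ ())))
  Sum-injection (suc a) zero    φ inj     ext with φ zero
  ... | ()
  Sum-injection (suc a) (suc b) φ inj {G} ext = trans (Sum-put j {λ ρ → G (ρ ∘ φ)} (λ e → ext (λ i → e (φ i))))
    (trans (∑-cong pts (λ x → trans (cong (w x ·_) (trans (Sum-cong b (λ ψ → ext (shape x ψ)))
        (Sum-injection a b φ′ inj′ (λ e → ext (◂-cong x e))))) (lem (w x) (pow (∑ pts w) (b ∸ a)) (Sum pts w a (λ ψ → G (x ◂ ψ))))))
      (∑-* pts (pow (∑ pts w) (b ∸ a)) _))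
    where
    j = φ zero
    j≢ : ∀ i → j ≢ φ (suc i)
    j≢ i e with inj zero (suc i) e
    ... | ()
    φ′ : Fin a → Fin b
    φ′ i = punchOut (j≢ i)
    inj′ : Inj φ′
    inj′ i i′ e = Finₚ.suc-injective (inj (suc i) (suc i′) (Finₚ.punchOut-injective (j≢ i) (j≢ i′) e))
    shape : ∀ x ψ i → put j x ψ (φ i) ≡ (x ◂ (ψ ∘ φ′)) i
    shape x ψ zero    = put-at j x ψ
    shape x ψ (suc i) = trans (cong (put j x ψ) (sym (Finₚ.punchIn-punchOut (j≢ i)))) (put-in j x ψ (φ′ i))
    lem : ∀ v p s → v · (p · s) ≡ p · (v · s)
    lem = solve-∀

Sum-swap : ∀ (pts : List Ω₁) w (qts : List Ω₂) v k l (F : (Fin k → Ω₁) → (Fin l → Ω₂) → ℤ) →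
           Sum pts w k (λ φ → Sum qts v l (F φ)) ≡ Sum qts v l (λ ψ → Sum pts w k (λ φ → F φ ψ))
Sum-swap pts w qts v zero    l F = refl
Sum-swap pts w qts v (suc k) l F = trans (∑-cong pts (λ x → trans (cong (w x ·_) (Sum-swap pts w qts v k l (λ φ → F (x ◂ φ)))) (sym (Sum-* qts v l (w x) _))))
  (∑-Sum qts v l pts (λ x ψ → w x · Sum pts w k (λ φ → F (x ◂ φ) ψ)))

one : Ω₁ → ℤ
one _ = 1ℤ

pow-1 : ∀ n → pow 1ℤ n ≡ 1ℤ
pow-1 zero    = refl
pow-1 (suc n) = trans (ℤₚ.*-identityˡ (pow 1ℤ n)) (pow-1 n)

Sum-through : ∀ {h n} (φ₀ : Fin h → Fin n) → Inj φ₀ → ∀ k {F : (Fin k → Fin n) → ℤ} → (∀ φ i → (∀ m → φ₀ m ≢ φ i) → F φ ≡ 0ℤ) → Ext F →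
              Sum (allFin n) one k F ≡ Sum (allFin h) one k (λ α → F (φ₀ ∘ α))
Sum-through φ₀ inj zero    van ext = ext (λ ())
Sum-through {h} {n} φ₀ inj (suc k) {F} van ext = trans (∑-↭ (proj₂ split) g) (trans (∑-++ (map φ₀ (allFin h)) zs g)
    (trans (cong₂ _⊹_ (∑-map φ₀ (allFin h) g) (∑-vanish zs outside)) (trans (ℤₚ.+-identityʳ _) (∑-cong (allFin h) inside))))
  where
  g : Fin n → ℤ
  g x = 1ℤ · Sum (allFin n) one k (λ φ → F (x ◂ φ))
  um : Unique (map φ₀ (allFin h))
  um = Uniqueₚ.map⁺ (λ {i} {j} → inj i j) (Uniqueₚ.allFin⁺ h)
  split = unique-⊆-split {ys = allFin n} um (λ {x} _ → ∈-allFin x)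
  zs = proj₁ split
  outside : ∀ x → x ∈ zs → g x ≡ 0ℤ
  outside x m = trans (ℤₚ.*-identityˡ _) (trans (Sum-cong (allFin n) one k (λ φ → van (x ◂ φ) zero not-hit)) (Sum-0 (allFin n) one k))
    where
    not-hit : ∀ m′ → φ₀ m′ ≢ x
    not-hit m′ e = proj₂ (proj₂ (unique-++⁻ (map φ₀ (allFin h)) (unique-↭ (proj₂ split) (Uniqueₚ.allFin⁺ n))))
      (subst (_∈ map φ₀ (allFin h)) e (∈-map⁺ φ₀ (∈-allFin m′))) m
  glue : ∀ i (α : Fin k → Fin h) j → (φ₀ i ◂ (φ₀ ∘ α)) j ≡ φ₀ ((i ◂ α) j)
  glue i α zero    = refl
  glue i α (suc j) = refl
  inside : ∀ i → g (φ₀ i) ≡ 1ℤ · Sum (allFin h) one k (λ α → F (φ₀ ∘ (i ◂ α)))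
  inside i = cong (1ℤ ·_) (trans (Sum-through φ₀ inj k (λ φ j e → van (φ₀ i ◂ φ) (suc j) e) (λ e → ext (◂-cong (φ₀ i) e)))
    (Sum-cong (allFin h) one k (λ α → ext (glue i α))))

∑-allMaps : ∀ k n {F : (Fin k → Fin n) → ℤ} → Ext F → ∑ (allMaps k n) F ≡ Sum (allFin n) one k F
∑-allMaps zero    n {F} ext = trans (ℤₚ.+-identityʳ _) (ext (λ ()))
∑-allMaps (suc k) n {F} ext = trans (∑-concatMap _ (allMaps k n) F) (trans (∑-cong (allMaps k n) (λ φ → trans (∑-map _ (allFin n) F)
    (∑-cong (allFin n) {g = λ a → F (a ◂ φ)} (λ a → ext (λ { zero → refl ; (suc i) → refl })))))
  (trans (∑-swap (allMaps k n) (allFin n) _) (∑-cong (allFin n) (λ a → trans (∑-allMaps k n (λ e → ext (◂-cong a e))) (sym (ℤₚ.*-identityˡ _))))))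

∏-cong : (xs : List Ω₁) {f g : Ω₁ → ℤ} → (∀ x → f x ≡ g x) → ∏ xs f ≡ ∏ xs g
∏-cong xs e = ∏-cong∈ xs (λ x _ → e x)

∏-concatMap : (h : Ω₁ → List Ω₂) (xs : List Ω₁) (f : Ω₂ → ℤ) → ∏ (concatMap h xs) f ≡ ∏ xs (λ x → ∏ (h x) f)
∏-concatMap h []       f = refl
∏-concatMap h (x ∷ xs) f = trans (∏-++ (h x) _ f) (cong (∏ (h x) f ·_) (∏-concatMap h xs f))

∏-· : (xs : List Ω₁) (f g : Ω₁ → ℤ) → ∏ xs (λ x → f x · g x) ≡ ∏ xs f · ∏ xs g
∏-· []       f g = refl
∏-· (x ∷ xs) f g = trans (cong (f x · g x ·_) (∏-· xs f g)) (lem (f x) (g x) (∏ xs f) (∏ xs g))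
  where
  lem : ∀ a b c d → a · b · (c · d) ≡ a · c · (b · d)
  lem = solve-∀

∏-allPairs : ∀ k (g : Fin k → Fin k → ℤ) → ∏ (allPairs k) (λ (i , j) → g i j) ≡ ∏ (allFin k) (λ i → ∏ (allFin k) (g i))
∏-allPairs k g = trans (∏-concatMap _ (allFin k) _) (∏-cong (allFin k) (λ i → ∏-map _ (allFin k) _))

∏-allFin-suc : ∀ k (g : Fin (suc k) → ℤ) → ∏ (allFin (suc k)) g ≡ g zero · ∏ (allFin k) (g ∘ suc)
∏-allFin-suc k g = cong (g zero ·_) (trans (cong (λ xs → ∏ xs g) (sym (Listₚ.map-tabulate id suc))) (∏-map suc (allFin k) g))

∏-allFin-+ : ∀ a b (g : Fin (a + b) → ℤ) → ∏ (allFin (a + b)) g ≡ ∏ (allFin a) (λ i → g (i ↑ˡ b)) · ∏ (allFin b) (λ j → g (a ↑ʳ j))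
∏-allFin-+ zero    b g = sym (ℤₚ.*-identityˡ _)
∏-allFin-+ (suc a) b g = trans (∏-allFin-suc (a + b) g) (trans (cong (g zero ·_) (∏-allFin-+ a b (g ∘ suc)))
  (trans (sym (ℤₚ.*-assoc (g zero) _ _)) (cong (_· ∏ (allFin b) (λ j → g (suc a ↑ʳ j))) (sym (∏-allFin-suc a (λ i → g (i ↑ˡ b)))))))

∏-single : ∀ {k} (r : Fin k) {g : Fin k → ℤ} → (∀ i → i ≢ r → g i ≡ 1ℤ) → ∏ (allFin k) g ≡ g r
∏-single {suc k} zero {g} e = trans (∏-allFin-suc k g) (trans (cong (g zero ·_) (trans (∏-cong (allFin k) (λ i → e (suc i) (λ ()))) (∏-one (allFin k)))) (ℤₚ.*-identityʳ (g zero)))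
∏-single {suc k} (suc r) {g} e = trans (∏-allFin-suc k g) (trans (cong₂ _·_ (e zero (λ ())) (∏-single r (λ i n → e (suc i) (λ q → n (Finₚ.suc-injective q))))) (ℤₚ.*-identityˡ (g (suc r))))

∏-bijection : ∀ {a b} (to : Fin a → Fin b) (from : Fin b → Fin a) → (∀ i → from (to i) ≡ i) → (∀ j → to (from j) ≡ j) →
              (g : Fin b → ℤ) → ∏ (allFin a) (g ∘ to) ≡ ∏ (allFin b) g
∏-bijection {a} {b} to from ft tf g = trans (sym (∏-map to (allFin a) g)) (∏-↭ (↭-sym perm) g)
  where
  um : Unique (map to (allFin a))
  um = Uniqueₚ.map⁺ (λ {i} {j} e → trans (sym (ft i)) (trans (cong from e) (ft j))) (Uniqueₚ.allFin⁺ a)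
  full : ∀ {j} → j ∈ allFin b → j ∈ map to (allFin a)
  full {j} _ = subst (_∈ map to (allFin a)) (tf j) (∈-map⁺ to (∈-allFin (from j)))
  perm : allFin b ↭ map to (allFin a)
  perm = unique-⊆-full⇒↭ um (λ {x} _ → ∈-allFin x) (unique-⊆⇒≤ (Uniqueₚ.allFin⁺ b) full)

-- Edge products of digraphs

fac : Bool → ℤ → ℤ
fac true  x = 1ℤ ⊹ x
fac false x = 1ℤ

fac-cong : ∀ {p q x y} → p ≡ q → x ≡ y → fac p x ≡ fac q y
fac-cong = cong₂ fac

fac-false : ∀ {p} x → p ≡ false → fac p x ≡ 1ℤ
fac-false x refl = refl

fac-true : ∀ {p} x → p ≡ true → fac p x ≡ 1ℤ ⊹ x
fac-true x refl = refl

EP : (H : Digraph) → (Ω₁ → Ω₁ → ℤ) → (Fin (size H) → Ω₁) → ℤ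
EP H X φ = ∏ (allFin (size H)) (λ i → ∏ (allFin (size H)) (λ j → fac (edge H i j) (X (φ i) (φ j))))

EP-ext : ∀ H (X : Ω₁ → Ω₁ → ℤ) → Ext (EP H X)
EP-ext H X e = ∏-cong (allFin (size H)) (λ i → ∏-cong (allFin (size H)) (λ j → cong₂ (λ x y → fac (edge H i j) (X x y)) (e i) (e j)))

Skew : (Ω₁ → Ω₁ → ℤ) → Set
Skew X = ∀ x y → X x y ≡ ⊖ X y x

Inv : ∀ {k} → ((Fin k → Ω₁) → ℤ) → Set
Inv {k = k} Θ = ∀ (π ρ : Fin k → Fin k) → (∀ i → π (ρ i) ≡ i) → (∀ i → ρ (π i) ≡ i) → ∀ ψ → Θ (ψ ∘ π) ≡ Θ ψ

glue : ∀ {a b} → (Fin a → Ω₁) → (Fin b → Ω₁) → Fin (a + b) → Ω₁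
glue {a = a} φ ψ = [ φ , ψ ] ∘ splitAt a

glue-ˡ : ∀ {a b} (φ : Fin a → Ω₁) (ψ : Fin b → Ω₁) i → glue φ ψ (i ↑ˡ b) ≡ φ i
glue-ˡ {a = a} {b} φ ψ i = cong [ φ , ψ ] (Finₚ.splitAt-↑ˡ a i b)

glue-ʳ : ∀ {a b} (φ : Fin a → Ω₁) (ψ : Fin b → Ω₁) j → glue φ ψ (a ↑ʳ j) ≡ ψ j
glue-ʳ {a = a} {b} φ ψ j = cong [ φ , ψ ] (Finₚ.splitAt-↑ʳ a b j)

glue-cong : ∀ {a b} {φ φ′ : Fin a → Ω₁} {ψ ψ′ : Fin b → Ω₁} → (∀ i → φ i ≡ φ′ i) → (∀ j → ψ j ≡ ψ′ j) → ∀ x → glue φ ψ x ≡ glue φ′ ψ′ x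
glue-cong {a = a} e e′ x with splitAt a x
... | inj₁ i = e i
... | inj₂ j = e′ j

glue-unique : ∀ {a b} {φ : Fin a → Ω₁} {ψ : Fin b → Ω₁} (χ : Fin (a + b) → Ω₁) →
              (∀ i → φ i ≡ χ (i ↑ˡ b)) → (∀ j → ψ j ≡ χ (a ↑ʳ j)) → ∀ x → glue φ ψ x ≡ χ x
glue-unique {a = a} {b} {φ} {ψ} χ e e′ x with splitAt a x in q
... | inj₁ i = trans (e i) (cong χ (Finₚ.splitAt⁻¹-↑ˡ q))
... | inj₂ j = trans (e′ j) (cong χ (Finₚ.splitAt⁻¹-↑ʳ q))

both : ∀ {a b} → (Fin a → Fin a) → (Fin b → Fin b) → Fin (a + b) → Fin (a + b)
both {a} {b} π σ = glue (λ i → π i ↑ˡ b) (λ j → a ↑ʳ σ j)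

both-inverse : ∀ {a b} (π π′ : Fin a → Fin a) (σ σ′ : Fin b → Fin b) → (∀ i → π (π′ i) ≡ i) → (∀ j → σ (σ′ j) ≡ j) →
               ∀ x → both π σ (both π′ σ′ x) ≡ x
both-inverse {a} {b} π π′ σ σ′ e e′ x with splitAt a x in q
... | inj₁ i = trans (glue-ˡ (λ i → π i ↑ˡ b) (λ j → a ↑ʳ σ j) (π′ i)) (trans (cong (_↑ˡ b) (e i)) (Finₚ.splitAt⁻¹-↑ˡ q))
... | inj₂ j = trans (glue-ʳ (λ i → π i ↑ˡ b) (λ j → a ↑ʳ σ j) (σ′ j)) (trans (cong (a ↑ʳ_) (e′ j)) (Finₚ.splitAt⁻¹-↑ʳ q))

flip : ∀ {a} → Fin (a + a) → Fin (a + a)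
flip {a} = glue (a ↑ʳ_) (_↑ˡ a)

flip-flip : ∀ {a} (x : Fin (a + a)) → flip {a} (flip {a} x) ≡ x
flip-flip {a} x with splitAt a x in q
... | inj₁ i = trans (glue-ʳ (a ↑ʳ_) (_↑ˡ a) i) (Finₚ.splitAt⁻¹-↑ˡ q)
... | inj₂ j = trans (glue-ˡ (a ↑ʳ_) (_↑ˡ a) j) (Finₚ.splitAt⁻¹-↑ʳ q)

module _ {a b : ℕ} {Θ : (Fin (a + b) → Ω₁) → ℤ} (ext : Ext Θ) (inv : Inv Θ) where

  both-glue : (π : Fin a → Fin a) (σ : Fin b → Fin b) (φ : Fin a → Ω₁) (ψ : Fin b → Ω₁) → ∀ x →
              glue {a = a} {b} (φ ∘ π) (ψ ∘ σ) x ≡ glue {a = a} {b} φ ψ (both π σ x)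
  both-glue π σ φ ψ = glue-unique (glue {a = a} {b} φ ψ ∘ both π σ)
    (λ i → sym (trans (cong (glue {a = a} {b} φ ψ) (glue-ˡ (λ i → π i ↑ˡ b) (λ j → a ↑ʳ σ j) i)) (glue-ˡ φ ψ (π i))))
    (λ j → sym (trans (cong (glue {a = a} {b} φ ψ) (glue-ʳ (λ i → π i ↑ˡ b) (λ j → a ↑ʳ σ j) j)) (glue-ʳ φ ψ (σ j))))

  inv-both : (φ : Fin a → Ω₁) (ψ : Fin b → Ω₁) → ∀ π π′ σ σ′ → (∀ i → π (π′ i) ≡ i) → (∀ i → π′ (π i) ≡ i) → (∀ j → σ (σ′ j) ≡ j) → (∀ j → σ′ (σ j) ≡ j) →
             Θ (glue {a = a} {b} (φ ∘ π) (ψ ∘ σ)) ≡ Θ (glue φ ψ)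
  inv-both φ ψ π π′ σ σ′ e e′ f f′ = trans (ext (both-glue π σ φ ψ))
    (inv (both π σ) (both π′ σ′) (both-inverse π π′ σ σ′ e f) (both-inverse π′ π σ′ σ e′ f′) (glue φ ψ))

  inv-ʳ : (φ : Fin a → Ω₁) → Inv (λ (ψ : Fin b → Ω₁) → Θ (glue φ ψ))
  inv-ʳ φ σ σ′ f f′ ψ = inv-both φ ψ id id σ σ′ (λ _ → refl) (λ _ → refl) f f′

  inv-ˡ : (ψ : Fin b → Ω₁) → Inv (λ (φ : Fin a → Ω₁) → Θ (glue φ ψ))
  inv-ˡ ψ π π′ e e′ φ = inv-both φ ψ π π′ id id e e′ (λ _ → refl) (λ _ → refl)

  ext-ʳ : (φ : Fin a → Ω₁) → Ext (λ (ψ : Fin b → Ω₁) → Θ (glue φ ψ))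
  ext-ʳ φ e = ext (glue-cong {φ = φ} (λ _ → refl) e)

  ext-ˡ : (ψ : Fin b → Ω₁) → Ext (λ (φ : Fin a → Ω₁) → Θ (glue φ ψ))
  ext-ˡ ψ e = ext (glue-cong {ψ = ψ} e (λ _ → refl))

inv-flip : ∀ {a} {Θ : (Fin (a + a) → Ω₁) → ℤ} → Ext Θ → Inv Θ → ∀ φ ψ → Θ (glue ψ φ) ≡ Θ (glue φ ψ)
inv-flip {a = a} {Θ = Θ} ext inv φ ψ = trans (ext (glue-unique (glue φ ψ ∘ flip {a})
    (λ i → sym (trans (cong (glue φ ψ) (glue-ˡ (a ↑ʳ_) (_↑ˡ a) i)) (glue-ʳ φ ψ i)))
    (λ j → sym (trans (cong (glue φ ψ) (glue-ʳ (a ↑ʳ_) (_↑ˡ a) j)) (glue-ˡ φ ψ j)))))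
  (inv (flip {a}) (flip {a}) (flip-flip {a}) (flip-flip {a}) (glue φ ψ))

-- Sufficiency: unions and mirrored digraphs

∏∏-blocks : ∀ a b (g : Fin (a + b) → Fin (a + b) → ℤ) →
            ∏ (allFin (a + b)) (λ i → ∏ (allFin (a + b)) (g i)) ≡
            ∏ (allFin a) (λ i → ∏ (allFin a) (λ j → g (i ↑ˡ b) (j ↑ˡ b))) · ∏ (allFin a) (λ i → ∏ (allFin b) (λ j → g (i ↑ˡ b) (a ↑ʳ j))) ·
            (∏ (allFin b) (λ i → ∏ (allFin a) (λ j → g (a ↑ʳ i) (j ↑ˡ b))) · ∏ (allFin b) (λ i → ∏ (allFin b) (λ j → g (a ↑ʳ i) (a ↑ʳ j))))
∏∏-blocks a b g = trans (∏-allFin-+ a b _) (cong₂ _·_ (half a (_↑ˡ b)) (half b (a ↑ʳ_)))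
  where
  half : ∀ k (f : Fin k → Fin (a + b)) → ∏ (allFin k) (λ i → ∏ (allFin (a + b)) (g (f i))) ≡
         ∏ (allFin k) (λ i → ∏ (allFin a) (λ j → g (f i) (j ↑ˡ b))) · ∏ (allFin k) (λ i → ∏ (allFin b) (λ j → g (f i) (a ↑ʳ j)))
  half k f = trans (∏-cong (allFin k) (λ i → ∏-allFin-+ a b (g (f i)))) (∏-· (allFin k) _ _)

∏∏-one : ∀ {a b} {g : Fin a → Fin b → ℤ} → (∀ i j → g i j ≡ 1ℤ) → ∏ (allFin a) (λ i → ∏ (allFin b) (g i)) ≡ 1ℤ
∏∏-one {a} {b} e = trans (∏-cong (allFin a) (λ i → trans (∏-cong (allFin b) (e i)) (∏-one (allFin b)))) (∏-one (allFin a))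

∏∏-cong : ∀ {a b} {g g′ : Fin a → Fin b → ℤ} → (∀ i j → g i j ≡ g′ i j) → ∏ (allFin a) (λ i → ∏ (allFin b) (g i)) ≡ ∏ (allFin a) (λ i → ∏ (allFin b) (g′ i))
∏∏-cong {a} {b} e = ∏-cong (allFin a) (λ i → ∏-cong (allFin b) (e i))

module _ (G R : Digraph) where
  private
    a = size G
    b = size R

  edge-⊕-ˡˡ : ∀ i j → edge (G ⊕ R) (i ↑ˡ b) (j ↑ˡ b) ≡ edge G i j
  edge-⊕-ˡˡ i j rewrite Finₚ.splitAt-↑ˡ a i b | Finₚ.splitAt-↑ˡ a j b = refl

  edge-⊕-ˡʳ : ∀ i j → edge (G ⊕ R) (i ↑ˡ b) (a ↑ʳ j) ≡ false
  edge-⊕-ˡʳ i j rewrite Finₚ.splitAt-↑ˡ a i b | Finₚ.splitAt-↑ʳ a b j = refl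

  edge-⊕-ʳˡ : ∀ i j → edge (G ⊕ R) (a ↑ʳ i) (j ↑ˡ b) ≡ false
  edge-⊕-ʳˡ i j rewrite Finₚ.splitAt-↑ˡ a j b | Finₚ.splitAt-↑ʳ a b i = refl

  edge-⊕-ʳʳ : ∀ i j → edge (G ⊕ R) (a ↑ʳ i) (a ↑ʳ j) ≡ edge R i j
  edge-⊕-ʳʳ i j rewrite Finₚ.splitAt-↑ʳ a b i | Finₚ.splitAt-↑ʳ a b j = refl

  EP-⊕ : (X : Ω₁ → Ω₁ → ℤ) → ∀ φ ψ → EP (G ⊕ R) X (glue φ ψ) ≡ EP G X φ · EP R X ψ
  EP-⊕ X φ ψ = trans (∏∏-blocks a b (λ i j → fac (edge (G ⊕ R) i j) (X (glue φ ψ i) (glue φ ψ j)))) (trans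
    (cong₂ _·_ (cong₂ _·_ (∏∏-cong (λ i j → fac-cong (edge-⊕-ˡˡ i j) (cong₂ X (glue-ˡ φ ψ i) (glue-ˡ φ ψ j))))
                          (∏∏-one (λ i j → fac-false (X (glue φ ψ (i ↑ˡ b)) (glue φ ψ (a ↑ʳ j))) (edge-⊕-ˡʳ i j))))
               (cong₂ _·_ (∏∏-one (λ i j → fac-false (X (glue φ ψ (a ↑ʳ i)) (glue φ ψ (j ↑ˡ b))) (edge-⊕-ʳˡ i j)))
                          (∏∏-cong (λ i j → fac-cong (edge-⊕-ʳʳ i j) (cong₂ X (glue-ʳ φ ψ i) (glue-ʳ φ ψ j))))))
    (lem (EP G X φ) (EP R X ψ)))
    where
    lem : ∀ x y → x · 1ℤ · (1ℤ · y) ≡ x · y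
    lem = solve-∀

module _ (T : Digraph) (r : Fin (size T)) where
  private
    a = size T

  edge-mirror-ˡˡ : ∀ i j → edge (mirror T r) (i ↑ˡ a) (j ↑ˡ a) ≡ edge T i j
  edge-mirror-ˡˡ i j rewrite Finₚ.splitAt-↑ˡ a i a | Finₚ.splitAt-↑ˡ a j a = refl

  edge-mirror-ˡʳ : ∀ i j → edge (mirror T r) (i ↑ˡ a) (a ↑ʳ j) ≡ ⌊ i Fin.≟ r ⌋ ∧ ⌊ j Fin.≟ r ⌋
  edge-mirror-ˡʳ i j rewrite Finₚ.splitAt-↑ˡ a i a | Finₚ.splitAt-↑ʳ a a j = refl

  edge-mirror-ʳˡ : ∀ i j → edge (mirror T r) (a ↑ʳ i) (j ↑ˡ a) ≡ false
  edge-mirror-ʳˡ i j rewrite Finₚ.splitAt-↑ˡ a j a | Finₚ.splitAt-↑ʳ a a i = refl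

  edge-mirror-ʳʳ : ∀ i j → edge (mirror T r) (a ↑ʳ i) (a ↑ʳ j) ≡ edge T i j
  edge-mirror-ʳʳ i j rewrite Finₚ.splitAt-↑ʳ a a i | Finₚ.splitAt-↑ʳ a a j = refl

  EP-mirror : (X : Ω₁ → Ω₁ → ℤ) → ∀ φ ψ → EP (mirror T r) X (glue φ ψ) ≡ EP T X φ · EP T X ψ ⊹ X (φ r) (ψ r) · (EP T X φ · EP T X ψ)
  EP-mirror X φ ψ = trans (∏∏-blocks a a (λ i j → fac (edge (mirror T r) i j) (X (glue φ ψ i) (glue φ ψ j)))) (trans
    (cong₂ _·_ (cong₂ _·_ (∏∏-cong (λ i j → fac-cong (edge-mirror-ˡˡ i j) (cong₂ X (glue-ˡ φ ψ i) (glue-ˡ φ ψ j))))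
                          bridge)
               (cong₂ _·_ (∏∏-one (λ i j → fac-false (X (glue φ ψ (a ↑ʳ i)) (glue φ ψ (j ↑ˡ a))) (edge-mirror-ʳˡ i j)))
                          (∏∏-cong (λ i j → fac-cong (edge-mirror-ʳʳ i j) (cong₂ X (glue-ʳ φ ψ i) (glue-ʳ φ ψ j))))))
    (lem (EP T X φ) (X (φ r) (ψ r)) (EP T X ψ)))
    where
    lem : ∀ x c y → x · (1ℤ ⊹ c) · (1ℤ · y) ≡ x · y ⊹ c · (x · y)
    lem = solve-∀
    g : Fin a → Fin a → ℤ
    g i j = fac (edge (mirror T r) (i ↑ˡ a) (a ↑ʳ j)) (X (glue φ ψ (i ↑ˡ a)) (glue φ ψ (a ↑ʳ j)))
    off : ∀ i j → i ≢ r ⊎ j ≢ r → g i j ≡ 1ℤ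
    off i j o = fac-false (X (glue φ ψ (i ↑ˡ a)) (glue φ ψ (a ↑ʳ j))) (trans (edge-mirror-ˡʳ i j) (flag o))
      where
      flag : i ≢ r ⊎ j ≢ r → ⌊ i Fin.≟ r ⌋ ∧ ⌊ j Fin.≟ r ⌋ ≡ false
      flag (inj₁ n) = cong (_∧ ⌊ j Fin.≟ r ⌋) (no! (i Fin.≟ r) n)
      flag (inj₂ n) = trans (cong (⌊ i Fin.≟ r ⌋ ∧_) (no! (j Fin.≟ r) n)) (∧-zeroʳ _)
    bridge : ∏ (allFin a) (λ i → ∏ (allFin a) (g i)) ≡ 1ℤ ⊹ X (φ r) (ψ r)
    bridge = trans (∏-single r (λ i n → trans (∏-cong (allFin a) (λ j → off i j (inj₁ n))) (∏-one (allFin a))))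
      (trans (∏-single r (λ j n → off r j (inj₂ n)))
        (trans (fac-true (X (glue φ ψ (r ↑ˡ a)) (glue φ ψ (a ↑ʳ r))) (trans (edge-mirror-ˡʳ r r) (cong₂ _∧_ (yes! (r Fin.≟ r) refl) (yes! (r Fin.≟ r) refl))))
          (cong₂ (λ x y → 1ℤ ⊹ X x y) (glue-ˡ φ ψ r) (glue-ʳ φ ψ r))))

-- Copies are counted by injective maps, and injectivity ties the components together. The symmetric
-- weight `Θ` absorbs such a condition: fixing its values on one part of the vertices leaves a
-- symmetric weight on the other part, so the property passes to unions and mirrored digraphs.
Neutral : Digraph → Set₁
Neutral G = ∀ {Ω : Set} (pts : List Ω) w (X : Ω → Ω → ℤ) → Skew X → {Θ : (Fin (size G) → Ω) → ℤ} → Ext Θ → Inv Θ →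
            Sum pts w (size G) (λ φ → EP G X φ · Θ φ) ≡ Sum pts w (size G) Θ

neutral-edgeless : ∀ G → (∀ i j → edge G i j ≡ false) → Neutral G
neutral-edgeless G e pts w X sk {Θ} ext inv = Sum-cong pts w (size G) (λ φ → trans (cong (_· Θ φ) (∏∏-one (λ i j → fac-false (X (φ i) (φ j)) (e i j)))) (ℤₚ.*-identityˡ (Θ φ)))

module _ {Ω : Set} (pts : List Ω) (w : Ω → ℤ) (X : Ω → Ω → ℤ) (sk : Skew X) where

  neutral-pair : (G R : Digraph) → Neutral G → Neutral R → {Θ : (Fin (size G + size R) → Ω) → ℤ} → Ext Θ → Inv Θ →
                 Sum pts w (size G) (λ φ → Sum pts w (size R) (λ ψ → EP G X φ · EP R X ψ · Θ (glue φ ψ))) ≡ Sum pts w (size G + size R) Θ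
  neutral-pair G R nG nR {Θ} ext inv = trans (Sum-cong pts w a (λ φ → trans (Sum-cong pts w b (λ ψ → ℤₚ.*-assoc (EP G X φ) (EP R X ψ) (Θ (glue φ ψ))))
      (trans (Sum-* pts w b (EP G X φ) _) (trans (cong (EP G X φ ·_) (nR pts w X sk {λ ψ → Θ (glue φ ψ)} (ext-ʳ {a = a} {b} {Θ = Θ} ext inv φ) (inv-ʳ {a = a} {b} {Θ = Θ} ext inv φ)))
        (sym (Sum-* pts w b (EP G X φ) _))))))
    (trans (Sum-swap pts w pts w a b (λ φ ψ → EP G X φ · Θ (glue φ ψ)))
      (trans (Sum-cong pts w b (λ ψ → nG pts w X sk {λ φ → Θ (glue φ ψ)} (ext-ˡ {a = a} {b} {Θ = Θ} ext inv ψ) (inv-ˡ {a = a} {b} {Θ = Θ} ext inv ψ)))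
        (trans (sym (Sum-swap pts w pts w a b (λ φ ψ → Θ (glue φ ψ)))) (sym (Sum-split pts w a b ext)))))
    where
    a = size G
    b = size R

neutral-⊕ : ∀ G R → Neutral G → Neutral R → Neutral (G ⊕ R)
neutral-⊕ G R nG nR pts w X sk {Θ} ext inv = trans (Sum-split pts w (size G) (size R) (λ e → cong₂ _·_ (EP-ext (G ⊕ R) X e) (ext e)))
  (trans (Sum-cong pts w (size G) (λ φ → Sum-cong pts w (size R) (λ ψ → cong (_· Θ (glue φ ψ)) (EP-⊕ G R X φ ψ))))
    (neutral-pair pts w X sk G R nG nR ext inv))

-- Exchanging the halves changes the sign of the contribution of the bridge.
neutral-mirror : ∀ T r → Neutral T → Neutral (mirror T r)
neutral-mirror T r nT pts w X sk {Θ} ext inv = trans (Sum-split pts w a a (λ e → cong₂ _·_ (EP-ext (mirror T r) X e) (ext e)))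
  (trans (Sum-cong pts w a (λ φ → trans (Sum-cong pts w a (λ ψ → trans (cong (_· Θ (glue φ ψ)) (EP-mirror T r X φ ψ))
      (lem (EP T X φ · EP T X ψ) (X (φ r) (ψ r)) (Θ (glue φ ψ))))) (Sum-+ pts w a _ _)))
    (trans (Sum-+ pts w a _ _) (trans (cong₂ _⊹_ (neutral-pair pts w X sk T T nT nT ext inv) (x≡-x⇒0 odd-part)) (ℤₚ.+-identityʳ _))))
  where
  a = size T
  lem : ∀ e x t → (e ⊹ x · e) · t ≡ e · t ⊹ x · e · t
  lem = solve-∀
  Z : (Fin a → _) → (Fin a → _) → ℤ
  Z φ ψ = X (φ r) (ψ r) · (EP T X φ · EP T X ψ) · Θ (glue φ ψ)
  neg-lem : ∀ x e e′ t → (⊖ x) · (e · e′) · t ≡ -1ℤ · (x · (e′ · e) · t)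
  neg-lem = solve-∀
  odd-part : Sum pts w a (λ φ → Sum pts w a (Z φ)) ≡ ⊖ Sum pts w a (λ φ → Sum pts w a (Z φ))
  odd-part = trans (Sum-swap pts w pts w a a Z) (trans (Sum-cong pts w a (λ ψ → trans (Sum-cong pts w a (λ φ →
      trans (cong₂ (λ x t → x · (EP T X φ · EP T X ψ) · t) (sk (φ r) (ψ r)) (inv-flip {a = a} {Θ = Θ} ext inv ψ φ)) (neg-lem (X (ψ r) (φ r)) (EP T X φ) (EP T X ψ) (Θ (glue ψ φ)))))
      (Sum-* pts w a -1ℤ _))) (trans (Sum-* pts w a -1ℤ _) (ℤₚ.-1*i≡-i _)))

neutral-RBM : ∀ {T} → RecBridgeMirrored T → Neutral T
neutral-RBM rbm-single             = neutral-edgeless singleVertex (λ _ _ → refl)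
neutral-RBM (rbm-mirror {T} p r)   = neutral-mirror T r (neutral-RBM p)

neutral-⨁ : ∀ Ts → All RecBridgeMirrored Ts → Neutral (⨁ Ts)
neutral-⨁ []       []       = neutral-edgeless emptyDigraph (λ ())
neutral-⨁ (T ∷ Ts) (p ∷ ps) = neutral-⊕ T (⨁ Ts) (neutral-RBM p) (neutral-⨁ Ts ps)

module _ {H G : Digraph} (iso : H ≅ G) where
  open _≅_ iso

  EP-iso : (X : Ω₁ → Ω₁ → ℤ) → ∀ ρ → EP H X (ρ ∘ to) ≡ EP G X ρ
  EP-iso X ρ = trans (∏∏-cong (λ i j → cong (λ z → fac z (X (ρ (to i)) (ρ (to j)))) (edge-iso i j)))
    (trans (∏-cong (allFin (size H)) (λ i → ∏-bijection to from from∘to to∘from (λ y → fac (edge G (to i) y) (X (ρ (to i)) (ρ y)))))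
      (∏-bijection to from from∘to to∘from (λ x → ∏ (allFin (size G)) (λ y → fac (edge G x y) (X (ρ x) (ρ y))))))

  Sum-iso : (pts : List Ω₁) → ∀ w {F : (Fin (size H) → Ω₁) → ℤ} → Ext F → Sum pts w (size G) (λ ρ → F (ρ ∘ to)) ≡ Sum pts w (size H) F
  Sum-iso pts w {F} ext = trans (Sum-injection pts w (size H) (size G) to (λ i j e → trans (sym (from∘to i)) (trans (cong from e) (from∘to j))) ext)
    (trans (cong (λ z → pow (∑ pts w) z · Sum pts w (size H) F) (ℕₚ.m≤n⇒m∸n≡0 le)) (ℤₚ.*-identityˡ _))
    where
    le : size G ≤ size H
    le = Finₚ.injective⇒≤ {f = from} (λ {i} {j} e → trans (sym (to∘from i)) (trans (cong to e) (to∘from j)))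

  neutral-iso : Neutral G → Neutral H
  neutral-iso nG pts w X sk {Θ} ext inv = trans (sym (Sum-iso pts w (λ e → cong₂ _·_ (EP-ext H X e) (ext e))))
    (trans (Sum-cong pts w (size G) (λ ρ → cong (_· Θ (ρ ∘ to)) (EP-iso X ρ)))
      (trans (nG pts w X sk (λ e → ext (λ i → e (to i))) inv′) (Sum-iso pts w ext)))
    where
    inv′ : Inv (λ ρ → Θ (ρ ∘ to))
    inv′ π σ e e′ ψ = trans (ext (λ i → cong ψ (sym (to∘from (π (to i)))))) (inv (from ∘ π ∘ to) (from ∘ σ ∘ to)
      (λ i → trans (cong (from ∘ π) (to∘from (σ (to i)))) (trans (cong from (e (to i))) (from∘to i)))
      (λ i → trans (cong (from ∘ σ) (to∘from (π (to i)))) (trans (cong from (e′ (to i))) (from∘to i))) (ψ ∘ to))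

-- Copies and embeddings

all⁻ : (p : X₁ → Bool) (xs : List X₁) → all p xs ≡ true → ∀ {x} → x ∈ xs → p x ≡ true
all⁻ p (x ∷ xs) e m with p x in q
all⁻ p (x ∷ xs) e (here refl) | true = q
all⁻ p (x ∷ xs) e (there m)   | true = all⁻ p xs e m

all⁺ : (p : X₁ → Bool) (xs : List X₁) → (∀ {x} → x ∈ xs → p x ≡ true) → all p xs ≡ true
all⁺ p []       h = refl
all⁺ p (x ∷ xs) h = cong₂ _∧_ (h (here refl)) (all⁺ p xs (λ m → h (there m)))

any⁻ : (p : X₁ → Bool) (xs : List X₁) → any p xs ≡ true → ∃[ x ] p x ≡ true
any⁻ p (x ∷ xs) e with p x in q
... | true  = x , q
... | false = any⁻ p xs e

any⁺ : (p : X₁ → Bool) (xs : List X₁) → ∀ {x} → x ∈ xs → p x ≡ true → any p xs ≡ true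
any⁺ p (x ∷ xs) (here refl) e = cong (_∨ any p xs) e
any⁺ p (x ∷ xs) (there m)   e = trans (cong (p x ∨_) (any⁺ p xs m e)) (∨-zeroʳ (p x))

𝟙-∧ : ∀ a b → 𝟙 (a ∧ b) ≡ 𝟙 a · 𝟙 b
𝟙-∧ true  b = sym (ℤₚ.*-identityˡ (𝟙 b))
𝟙-∧ false b = refl

𝟙-all : (p : X₁ → Bool) (xs : List X₁) → 𝟙 (all p xs) ≡ ∏ xs (λ x → 𝟙 (p x))
𝟙-all p []       = refl
𝟙-all p (x ∷ xs) = trans (𝟙-∧ (p x) (all p xs)) (cong (𝟙 (p x) ·_) (𝟙-all p xs))

∧⁻ : ∀ a {b} → a ∧ b ≡ true → a ≡ true × b ≡ true
∧⁻ true e = refl , e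

bool-ext : ∀ {a b} → (a ≡ true → b ≡ true) → (b ≡ true → a ≡ true) → a ≡ b
bool-ext {true}  {b}     f g = sym (f refl)
bool-ext {false} {false} f g = refl
bool-ext {false} {true}  f g = g refl

∈-allPairs : ∀ {k} (i j : Fin k) → (i , j) ∈ allPairs k
∈-allPairs {k} i j = ∈-concatMap⁺ (λ i → map (i ,_) (allFin k)) (Any.map (λ { refl → ∈-map⁺ (i ,_) (∈-allFin j) }) (∈-allFin i))

implies⁻ : ∀ {a b} → not a ∨ b ≡ true → a ≡ true → b ≡ true
implies⁻ {true} e refl = e

implies⁺ : ∀ {a b} → (a ≡ true → b ≡ true) → not a ∨ b ≡ true
implies⁺ {true}  f = f refl
implies⁺ {false} f = refl

distinct⁻ : ∀ {k n} (φ : Fin k → Fin n) i j → ⌊ i Fin.≟ j ⌋ ∨ not ⌊ φ i Fin.≟ φ j ⌋ ≡ true → φ i ≡ φ j → i ≡ j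
distinct⁻ φ i j e q with i Fin.≟ j | φ i Fin.≟ φ j
... | yes p | _     = p
... | no _  | no n  = contradiction q n
distinct⁻ φ i j () q | no _ | yes _

distinct⁺ : ∀ {k n} (φ : Fin k → Fin n) i j → (φ i ≡ φ j → i ≡ j) → ⌊ i Fin.≟ j ⌋ ∨ not ⌊ φ i Fin.≟ φ j ⌋ ≡ true
distinct⁺ φ i j f with i Fin.≟ j | φ i Fin.≟ φ j
... | yes p | _     = refl
... | no n  | yes q = contradiction (f q) n
... | no _  | no _  = refl

module _ (H : Digraph) where
  private
    h = size H

  Edges : ∀ {n} → Tournament n → (Fin h → Fin n) → Set
  Edges T φ = ∀ i j → edge H i j ≡ true → arc T (φ i) (φ j) ≡ true

  embedding⁻ : ∀ {n} (T : Tournament n) φ → isEmbedding H T φ ≡ true → Inj φ × Edges T φ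
  embedding⁻ T φ e = (λ i j → distinct⁻ φ i j (all⁻ _ (allPairs h) (proj₁ (∧⁻ _ e)) (∈-allPairs i j))) ,
                     (λ i j → implies⁻ (all⁻ _ (allPairs h) (proj₂ (∧⁻ _ e)) (∈-allPairs i j)))

  embedding⁺ : ∀ {n} (T : Tournament n) φ → Inj φ → Edges T φ → isEmbedding H T φ ≡ true
  embedding⁺ T φ inj ed = cong₂ _∧_ (all⁺ _ (allPairs h) (λ { {i , j} _ → distinct⁺ φ i j (inj i j) }))
                                    (all⁺ _ (allPairs h) (λ { {i , j} _ → implies⁺ (ed i j) }))

  embedding-cong : ∀ {n} (T : Tournament n) {φ ψ} → (∀ i → φ i ≡ ψ i) → isEmbedding H T φ ≡ isEmbedding H T ψ
  embedding-cong T {φ} {ψ} e = bool-ext (move e) (move (λ i → sym (e i)))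
    where
    move : ∀ {φ ψ} → (∀ i → φ i ≡ ψ i) → isEmbedding H T φ ≡ true → isEmbedding H T ψ ≡ true
    move {φ} {ψ} e q with embedding⁻ T φ q
    ... | inj , ed = embedding⁺ T ψ (λ i j z → inj i j (trans (e i) (trans z (sym (e j)))))
                                    (λ i j z → trans (sym (cong₂ (arc T) (e i) (e j))) (ed i j z))

  InV : ∀ {n} → (Fin h → Fin n) → Fin n → Set
  InV φ a = Vec.lookup (proj₁ (image H φ)) a ≡ true

  InF : ∀ {n} → (Fin h → Fin n) → Fin n → Fin n → Set
  InF φ a b = Vec.lookup (Vec.lookup (proj₂ (image H φ)) a) b ≡ true

  inV⁻ : ∀ {n} (φ : Fin h → Fin n) a → InV φ a → ∃[ i ] φ i ≡ a
  inV⁻ φ a e with any⁻ _ (allFin h) (trans (sym (Vecₚ.lookup∘tabulate _ a)) e)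
  ... | i , q = i , yes⁻ (φ i Fin.≟ a) q

  inV⁺ : ∀ {n} (φ : Fin h → Fin n) i → InV φ (φ i)
  inV⁺ φ i = trans (Vecₚ.lookup∘tabulate _ (φ i)) (any⁺ _ (allFin h) (∈-allFin i) (yes! (φ i Fin.≟ φ i) refl))

  lookup-F : ∀ {n} (φ : Fin h → Fin n) a b → ∃[ p ] (Vec.lookup (Vec.lookup (proj₂ (image H φ)) a) b ≡ any p (allPairs h)) ×
             (∀ i j → p (i , j) ≡ edge H i j ∧ ⌊ φ i Fin.≟ a ⌋ ∧ ⌊ φ j Fin.≟ b ⌋)
  lookup-F φ a b = _ , trans (cong (λ v → Vec.lookup v b) (Vecₚ.lookup∘tabulate _ a)) (Vecₚ.lookup∘tabulate _ b) , (λ i j → refl)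

  inF⁻ : ∀ {n} (φ : Fin h → Fin n) a b → InF φ a b → ∃[ i ] ∃[ j ] edge H i j ≡ true × φ i ≡ a × φ j ≡ b
  inF⁻ φ a b e with lookup-F φ a b
  ... | p , q , r with any⁻ p (allPairs h) (trans (sym q) e)
  ...   | (i , j) , s with ∧⁻ (edge H i j) (trans (sym (r i j)) s)
  ...     | x , y with ∧⁻ ⌊ φ i Fin.≟ a ⌋ y
  ...       | u , v = i , j , x , yes⁻ (φ i Fin.≟ a) u , yes⁻ (φ j Fin.≟ b) v

  inF⁺ : ∀ {n} (φ : Fin h → Fin n) i j → edge H i j ≡ true → InF φ (φ i) (φ j)
  inF⁺ φ i j e with lookup-F φ (φ i) (φ j)
  ... | p , q , r = trans q (any⁺ p (allPairs h) (∈-allPairs i j) (trans (r i j)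
        (cong₂ _∧_ e (cong₂ _∧_ (yes! (φ i Fin.≟ φ i) refl) (yes! (φ j Fin.≟ φ j) refl)))))

  vec-ext : ∀ {n} {X : Set} (u v : Vec.Vec X n) → (∀ a → Vec.lookup u a ≡ Vec.lookup v a) → u ≡ v
  vec-ext u v e = trans (sym (Vecₚ.tabulate∘lookup u)) (trans (Vecₚ.tabulate-cong e) (Vecₚ.tabulate∘lookup v))

  image-≡ : ∀ {n} (φ ψ : Fin h → Fin n) → (∀ a → InV φ a → InV ψ a) → (∀ a → InV ψ a → InV φ a) →
            (∀ a b → InF φ a b → InF ψ a b) → (∀ a b → InF ψ a b → InF φ a b) → image H φ ≡ image H ψ
  image-≡ φ ψ v v′ f f′ = cong₂ _,_ (vec-ext _ _ (λ a → bool-ext (v a) (v′ a)))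
    (vec-ext _ _ (λ a → vec-ext _ _ (λ b → bool-ext (f a b) (f′ a b))))

  _≟ˢ_ : ∀ {n} → DecidableEquality (Subgraph n)
  _≟ˢ_ = Prodₚ.≡-dec (Vecₚ.≡-dec Boolₚ._≟_) (Vecₚ.≡-dec (Vecₚ.≡-dec Boolₚ._≟_))

  image-cong : ∀ {n} {φ ψ : Fin h → Fin n} → (∀ i → φ i ≡ ψ i) → image H φ ≡ image H ψ
  image-cong {φ = φ} {ψ} e = image-≡ φ ψ (V e) (V (λ i → sym (e i))) (F e) (F (λ i → sym (e i)))
    where
    V : ∀ {φ ψ} → (∀ i → φ i ≡ ψ i) → ∀ a → InV φ a → InV ψ a
    V {φ} {ψ} e a m with inV⁻ φ a m
    ... | i , refl = subst (InV ψ) (sym (e i)) (inV⁺ ψ i)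
    F : ∀ {φ ψ} → (∀ i → φ i ≡ ψ i) → ∀ a b → InF φ a b → InF ψ a b
    F {φ} {ψ} e a b m with inF⁻ φ a b m
    ... | i , j , x , refl , refl = subst (λ z → InF ψ z (φ j)) (sym (e i)) (subst (InF ψ (ψ i)) (sym (e j)) (inF⁺ ψ i j x))

  aut : (Fin h → Fin h) → Bool
  aut α = all (λ p → ⌊ proj₁ p Fin.≟ proj₂ p ⌋ ∨ not ⌊ α (proj₁ p) Fin.≟ α (proj₂ p) ⌋) (allPairs h) ∧
          all (λ p → ⌊ edge H (proj₁ p) (proj₂ p) Boolₚ.≟ edge H (α (proj₁ p)) (α (proj₂ p)) ⌋) (allPairs h)

  automorphisms : ℤ
  automorphisms = Sum (allFin h) one h (λ α → 𝟙 (aut α))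

  module _ {n} (T : Tournament n) (φ₀ : Fin h → Fin n) (e₀ : isEmbedding H T φ₀ ≡ true) where
    private
      inj₀ = proj₁ (embedding⁻ T φ₀ e₀)
      ed₀  = proj₂ (embedding⁻ T φ₀ e₀)

    fibre : (Fin h → Fin n) → Bool
    fibre φ = isEmbedding H T φ ∧ ⌊ image H φ ≟ˢ image H φ₀ ⌋

    fibre⇒aut : ∀ α → fibre (φ₀ ∘ α) ≡ true → aut α ≡ true
    fibre⇒aut α e = cong₂ _∧_
        (all⁺ _ (allPairs h) (λ { {i , j} _ → distinct⁺ α i j (λ q → inj i j (cong φ₀ q)) }))
        (all⁺ _ (allPairs h) (λ { {i , j} _ → yes! (edge H i j Boolₚ.≟ edge H (α i) (α j)) (bool-ext (up i j) (dn i j)) }))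
      where
      inj = proj₁ (embedding⁻ T (φ₀ ∘ α) (proj₁ (∧⁻ _ e)))
      same : image H (φ₀ ∘ α) ≡ image H φ₀
      same = yes⁻ (image H (φ₀ ∘ α) ≟ˢ image H φ₀) (proj₂ (∧⁻ (isEmbedding H T (φ₀ ∘ α)) e))
      up : ∀ i j → edge H i j ≡ true → edge H (α i) (α j) ≡ true
      up i j x with inF⁻ φ₀ (φ₀ (α i)) (φ₀ (α j)) (subst (λ z → Vec.lookup (Vec.lookup (proj₂ z) (φ₀ (α i))) (φ₀ (α j)) ≡ true) same (inF⁺ (φ₀ ∘ α) i j x))
      ... | i′ , j′ , y , p , q = subst (λ z → edge H z (α j) ≡ true) (inj₀ i′ (α i) p) (subst (λ z → edge H i′ z ≡ true) (inj₀ j′ (α j) q) y)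
      dn : ∀ i j → edge H (α i) (α j) ≡ true → edge H i j ≡ true
      dn i j x with inF⁻ (φ₀ ∘ α) (φ₀ (α i)) (φ₀ (α j)) (subst (λ z → Vec.lookup (Vec.lookup (proj₂ z) (φ₀ (α i))) (φ₀ (α j)) ≡ true) (sym same) (inF⁺ φ₀ (α i) (α j) x))
      ... | i′ , j′ , y , p , q = subst (λ z → edge H z j ≡ true) (inj i′ i p) (subst (λ z → edge H i′ z ≡ true) (inj j′ j q) y)

    aut⇒fibre : ∀ α → aut α ≡ true → fibre (φ₀ ∘ α) ≡ true
    aut⇒fibre α e = cong₂ _∧_ (embedding⁺ T (φ₀ ∘ α) (λ i j q → inj i j (inj₀ (α i) (α j) q)) (λ i j x → ed₀ (α i) (α j) (trans (sym (same-edge i j)) x)))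
        (yes! (image H (φ₀ ∘ α) ≟ˢ image H φ₀) (image-≡ (φ₀ ∘ α) φ₀ V V′ F F′))
      where
      inj : Inj α
      inj i j = distinct⁻ α i j (all⁻ _ (allPairs h) (proj₁ (∧⁻ _ e)) (∈-allPairs i j))
      same-edge : ∀ i j → edge H i j ≡ edge H (α i) (α j)
      same-edge i j = yes⁻ (edge H i j Boolₚ.≟ edge H (α i) (α j)) (all⁻ _ (allPairs h) (proj₂ (∧⁻ (all _ (allPairs h)) e)) (∈-allPairs i j))
      onto : ∀ i → ∃[ i′ ] α i′ ≡ i
      onto i = pre (∈-map⁻ α (∈-resp-↭ full (∈-allFin i)))
        where
        full : allFin h ↭ map α (allFin h)
        full = unique-⊆-full⇒↭ (Uniqueₚ.map⁺ (λ {x} {y} → inj x y) (Uniqueₚ.allFin⁺ h)) (λ {x} _ → ∈-allFin x)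
                 (ℕₚ.≤-reflexive (sym (Listₚ.length-map α (allFin h))))
        pre : ∃[ i′ ] i′ ∈ allFin h × i ≡ α i′ → ∃[ i′ ] α i′ ≡ i
        pre (i′ , _ , q) = i′ , sym q
      V : ∀ a → InV (φ₀ ∘ α) a → InV φ₀ a
      V a m with inV⁻ (φ₀ ∘ α) a m
      ... | i , refl = inV⁺ φ₀ (α i)
      V′ : ∀ a → InV φ₀ a → InV (φ₀ ∘ α) a
      V′ a m with inV⁻ φ₀ a m
      ... | i , refl with onto i
      ...   | i′ , refl = inV⁺ (φ₀ ∘ α) i′
      F : ∀ a b → InF (φ₀ ∘ α) a b → InF φ₀ a b
      F a b m with inF⁻ (φ₀ ∘ α) a b m
      ... | i , j , x , refl , refl = inF⁺ φ₀ (α i) (α j) (trans (sym (same-edge i j)) x)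
      F′ : ∀ a b → InF φ₀ a b → InF (φ₀ ∘ α) a b
      F′ a b m with inF⁻ φ₀ a b m
      ... | i , j , x , refl , refl with onto i | onto j
      ...   | i′ , refl | j′ , refl = inF⁺ (φ₀ ∘ α) i′ j′ (trans (same-edge i′ j′) x)

    -- Embeddings with the image of `φ₀` factor uniquely through `φ₀`, and the factors are the
    -- automorphisms of `H`. So all images are hit equally often.
    fibre-count : ∑ (allMaps h n) (λ φ → 𝟙 (fibre φ)) ≡ automorphisms
    fibre-count = trans (∑-allMaps h n ext) (trans (Sum-through φ₀ inj₀ h van ext)
        (Sum-cong (allFin h) one h (λ α → cong 𝟙 (bool-ext (fibre⇒aut α) (aut⇒fibre α)))))
      where
      ext : Ext (λ φ → 𝟙 (fibre φ))
      ext e = cong 𝟙 (cong₂ _∧_ (embedding-cong T e) (cong (λ z → ⌊ z ≟ˢ image H φ₀ ⌋) (image-cong e)))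
      van : ∀ φ i → (∀ m → φ₀ m ≢ φ i) → 𝟙 (fibre φ) ≡ 0ℤ
      van φ i ne = trans (cong (λ b → 𝟙 (isEmbedding H T φ ∧ b)) (no! (image H φ ≟ˢ image H φ₀) diff)) (cong 𝟙 (∧-zeroʳ (isEmbedding H T φ)))
        where
        diff : image H φ ≢ image H φ₀
        diff q with inV⁻ φ₀ (φ i) (subst (λ z → Vec.lookup (proj₁ z) (φ i) ≡ true) q (inV⁺ φ i))
        ... | m , r = ne m r

∑-filter : (p : X₁ → Bool) (xs : List X₁) (f : X₁ → ℤ) → ∑ (filterᵇ p xs) f ≡ ∑ xs (λ x → 𝟙 (p x) · f x)
∑-filter p []       f = refl
∑-filter p (x ∷ xs) f with p x
... | true  = cong₂ _⊹_ (sym (ℤₚ.*-identityˡ (f x))) (∑-filter p xs f)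
... | false = trans (∑-filter p xs f) (sym (ℤₚ.+-identityˡ _))

∈-filterᵇ⁻ : (p : X₁ → Bool) (xs : List X₁) → ∀ {x} → x ∈ filterᵇ p xs → x ∈ xs × p x ≡ true
∈-filterᵇ⁻ p (y ∷ xs) m with p y in q
∈-filterᵇ⁻ p (y ∷ xs) (here refl) | true = here refl , q
∈-filterᵇ⁻ p (y ∷ xs) (there m)   | true = there (proj₁ (∈-filterᵇ⁻ p xs m)) , proj₂ (∈-filterᵇ⁻ p xs m)
∈-filterᵇ⁻ p (y ∷ xs) m           | false = there (proj₁ (∈-filterᵇ⁻ p xs m)) , proj₂ (∈-filterᵇ⁻ p xs m)

∑-count : (xs : List X₁) → ∑ xs (λ _ → 1ℤ) ≡ + length xs
∑-count []       = refl
∑-count (x ∷ xs) = cong (1ℤ ⊹_) (∑-count xs)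

∑-indicator : (_≟′_ : DecidableEquality X₁) (ys : List X₁) → Unique ys → ∀ {v} → v ∈ ys → ∑ ys (λ y → 𝟙 ⌊ v ≟′ y ⌋) ≡ 1ℤ
∑-indicator _≟′_ (y ∷ ys) (a ∷ u) {v} (here refl) = cong₂ _⊹_ (cong 𝟙 (yes! (v ≟′ v) refl))
  (∑-vanish ys (λ z m → cong 𝟙 (no! (v ≟′ z) (λ e → All.lookup a m e))))
∑-indicator _≟′_ (y ∷ ys) (a ∷ u) {v} (there m) = cong₂ _⊹_ (cong 𝟙 (no! (v ≟′ y) (λ e → All.lookup a m (sym e)))) (∑-indicator _≟′_ ys u m)

equal-fibres : (_≟′_ : DecidableEquality X₂) (g : X₁ → X₂) (xs : List X₁) (A : ℤ) →
               (∀ {x₀} → x₀ ∈ xs → ∑ xs (λ x → 𝟙 ⌊ g x ≟′ g x₀ ⌋) ≡ A) → + length xs ≡ (+ length (deduplicate _≟′_ (map g xs))) · A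
equal-fibres _≟′_ g xs A fib = trans (sym (∑-count xs)) (trans (∑-cong∈ xs (λ x m → sym (∑-indicator _≟′_ ys (deduplicate-! _≟′_ (map g xs)) (∈-deduplicate⁺ _≟′_ (∈-map⁺ g m)))))
  (trans (∑-swap xs ys (λ x y → 𝟙 ⌊ g x ≟′ y ⌋)) (trans (∑-cong∈ ys each) (trans (∑-*ʳ ys A (λ _ → 1ℤ)) (cong (_· A) (∑-count ys))))))
  where
  ys = deduplicate _≟′_ (map g xs)
  each : ∀ y → y ∈ ys → ∑ xs (λ x → 𝟙 ⌊ g x ≟′ y ⌋) ≡ 1ℤ · A
  each y m with ∈-map⁻ g (∈-deduplicate⁻ _≟′_ (map g xs) m)
  ... | x₀ , x₀∈ , refl = trans (fib x₀∈) (sym (ℤₚ.*-identityˡ A))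

module _ (H : Digraph) where

  embeddings : ∀ {n} → Tournament n → ℤ
  embeddings {n} T = ∑ (allMaps (size H) n) (λ φ → 𝟙 (isEmbedding H T φ))

  embeddings-length : ∀ {n} (T : Tournament n) → + length (filterᵇ (isEmbedding H T) (allMaps (size H) n)) ≡ embeddings T
  embeddings-length {n} T = trans (sym (∑-count (filterᵇ (isEmbedding H T) (allMaps (size H) n)))) (trans (∑-filter (isEmbedding H T) (allMaps (size H) n) (λ _ → 1ℤ))
    (∑-cong (allMaps (size H) n) (λ φ → ℤₚ.*-identityʳ (𝟙 (isEmbedding H T φ)))))

  embeddings-copies : ∀ {n} (T : Tournament n) → embeddings T ≡ (+ numCopies H T) · automorphisms H
  embeddings-copies {n} T = trans (sym (embeddings-length T)) (equal-fibres (_≟ˢ_ H) (image H) (filterᵇ (isEmbedding H T) (allMaps (size H) n)) (automorphisms H)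
    (λ {φ₀} m → trans (∑-filter (isEmbedding H T) (allMaps (size H) n) _) (trans (∑-cong (allMaps (size H) n) (λ φ → sym (𝟙-∧ (isEmbedding H T φ) _)))
      (fibre-count H T φ₀ (proj₂ (∈-filterᵇ⁻ (isEmbedding H T) (allMaps (size H) n) m))))))

  same-embeddings⇒same-copies : ∀ {n} (T T′ : Tournament n) → embeddings T ≡ embeddings T′ → numCopies H T ≡ numCopies H T′
  same-embeddings⇒same-copies {n} T T′ e with automorphisms H ℤ.≟ 0ℤ
  -- The identity is an automorphism, so this case does not arise; it is closed by noting that there
  -- would be no embeddings at all.
  ... | yes z = trans (none T) (sym (none T′))
    where
    none : ∀ T → numCopies H T ≡ 0
    none T = empty (filterᵇ (isEmbedding H T) (allMaps (size H) n)) (ℤₚ.+-injective (trans (embeddings-length T)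
      (trans (embeddings-copies T) (trans (cong ((+ numCopies H T) ·_) z) (ℤₚ.*-zeroʳ (+ numCopies H T))))))
      where
      empty : ∀ xs → length xs ≡ 0 → length (deduplicate (_≟ˢ_ H) (map (image H) xs)) ≡ 0
      empty [] _ = refl
  ... | no n0 = ℤₚ.+-injective (ℤₚ.*-cancelʳ-≡ (+ numCopies H T) (+ numCopies H T′) (automorphisms H) ⦃ ℤ.≢-nonZero n0 ⦄
      (trans (sym (embeddings-copies T)) (trans e (embeddings-copies T′))))

-- The number of copies as a polynomial in a skew matrix

sgn : ∀ {n} → Tournament n → Fin n → Fin n → ℤ
sgn T a b = 𝟙 (arc T a b) ⊹ ⊖ 𝟙 (arc T b a)

sgn-skew : ∀ {n} (T : Tournament n) → Skew (sgn T)
sgn-skew T a b = lem (𝟙 (arc T a b)) (𝟙 (arc T b a))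
  where
  lem : ∀ x y → x ⊹ ⊖ y ≡ ⊖ (y ⊹ ⊖ x)
  lem = solve-∀

injective? : ∀ {k n} → (Fin k → Fin n) → Bool
injective? {k} φ = all (λ p → ⌊ proj₁ p Fin.≟ proj₂ p ⌋ ∨ not ⌊ φ (proj₁ p) Fin.≟ φ (proj₂ p) ⌋) (allPairs k)

injective⁻ : ∀ {k n} (φ : Fin k → Fin n) → injective? φ ≡ true → Inj φ
injective⁻ {k} φ e i j = distinct⁻ φ i j (all⁻ _ (allPairs k) e (∈-allPairs i j))

injective⁺ : ∀ {k n} (φ : Fin k → Fin n) → Inj φ → injective? φ ≡ true
injective⁺ {k} φ inj = all⁺ _ (allPairs k) (λ {p} _ → distinct⁺ φ (proj₁ p) (proj₂ p) (inj (proj₁ p) (proj₂ p)))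

injective-ext : ∀ {k n} → Ext (λ (φ : Fin k → Fin n) → 𝟙 (injective? φ))
injective-ext {φ = φ} {ψ} e = cong 𝟙 (bool-ext
  (λ q → injective⁺ ψ (λ i j z → injective⁻ φ q i j (trans (e i) (trans z (sym (e j))))))
  (λ q → injective⁺ φ (λ i j z → injective⁻ ψ q i j (trans (sym (e i)) (trans z (e j))))))

injective-inv : ∀ {k n} → Inv (λ (φ : Fin k → Fin n) → 𝟙 (injective? φ))
injective-inv π ρ πρ ρπ φ = cong 𝟙 (bool-ext
  (λ q → injective⁺ φ (λ i j z → trans (sym (πρ i)) (trans (cong π (injective⁻ (φ ∘ π) q (ρ i) (ρ j) (trans (cong φ (πρ i)) (trans z (sym (cong φ (πρ j))))))) (πρ j))))
  (λ q → injective⁺ (φ ∘ π) (λ i j z → trans (sym (ρπ i)) (trans (cong ρ (injective⁻ φ q (π i) (π j) z)) (ρπ j)))))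

∏-≢0 : (xs : List X₁) {f : X₁ → ℤ} → (∀ x → f x ≢ 0ℤ) → ∏ xs f ≢ 0ℤ
∏-≢0 []       n ()
∏-≢0 (x ∷ xs) {f} n = ·-≢0 {f x} (n x) (∏-≢0 xs n)

module _ (H : Digraph) where
  private
    h = size H

  weighted : ∀ {n} → (Fin n → Fin n → ℤ) → (Fin h → Fin n) → ℤ
  weighted X φ = 𝟙 (injective? φ) · EP H X φ

  two : Bool → ℤ
  two b = if b then + 2 else 1ℤ

  two-power : ℤ
  two-power = ∏ (allFin h) (λ i → ∏ (allFin h) (λ j → two (edge H i j)))

  two-power≢0 : two-power ≢ 0ℤ
  two-power≢0 = ∏-≢0 (allFin h) (λ i → ∏-≢0 (allFin h) (λ j → nz (edge H i j)))
    where
    nz : ∀ b → two b ≢ 0ℤ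
    nz true  ()
    nz false ()

  -- At distinct vertices 1 + `sgn` is 2 on an arc and 0 otherwise, so the product over the edges is
  -- a fixed power of 2 on embeddings and 0 on all other injections.
  weighted-sgn : IsOriented H → ∀ {n} (T : Tournament n) φ → weighted (sgn T) φ ≡ two-power · 𝟙 (isEmbedding H T φ)
  weighted-sgn (irr , _) T φ with injective? φ in q
  ... | false = trans (ℤₚ.*-zeroˡ (EP H (sgn T) φ)) (sym (trans (cong (λ b → two-power · 𝟙 b) (bool-ext {isEmbedding H T φ} {false}
          (λ e → trans (sym q) (injective⁺ φ (proj₁ (embedding⁻ H T φ e)))) (λ ()))) (ℤₚ.*-zeroʳ two-power)))
  ... | true = trans (ℤₚ.*-identityˡ (EP H (sgn T) φ)) (trans (∏∏-cong (λ i j → factor i j)) (trans (∏-cong (allFin h) (λ i → ∏-· (allFin h) _ _)) (trans (∏-· (allFin h) _ _)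
          (cong (two-power ·_) (trans (sym (∏-allPairs h (λ i j → 𝟙 (not (edge H i j) ∨ arc T (φ i) (φ j)))))
            (trans (sym (𝟙-all (λ p → not (edge H (proj₁ p) (proj₂ p)) ∨ arc T (φ (proj₁ p)) (φ (proj₂ p))) (allPairs h))) (cong 𝟙 (bool-ext
              (λ e → embedding⁺ H T φ inj (λ i j → implies⁻ (all⁻ _ (allPairs h) e (∈-allPairs i j))))
              (λ e → all⁺ _ (allPairs h) (λ {p} _ → implies⁺ (proj₂ (embedding⁻ H T φ e) (proj₁ p) (proj₂ p))))))))))))
    where
    inj = injective⁻ φ q
    value : ∀ {a b} → a ≢ b → 1ℤ ⊹ sgn T a b ≡ (+ 2) · 𝟙 (arc T a b)
    value {a} {b} n with arc T a b | arc T b a | arc-tot T a b n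
    ... | true  | false | _ = refl
    ... | false | true  | _ = refl
    ... | true  | true  | ()
    ... | false | false | ()
    factor : ∀ i j → fac (edge H i j) (sgn T (φ i) (φ j)) ≡ two (edge H i j) · 𝟙 (not (edge H i j) ∨ arc T (φ i) (φ j))
    factor i j with edge H i j in e
    ... | false = refl
    ... | true  = value (λ z → contradiction (trans (sym e) (subst (λ k → edge H i k ≡ false) (inj i j z) (irr i))) (λ ()))

  total : ∀ {n} → (Fin n → Fin n → ℤ) → ℤ
  total {n} X = Sum (allFin n) one h (weighted X)

  total-sgn : IsOriented H → ∀ {n} (T : Tournament n) → total (sgn T) ≡ two-power · embeddings H T
  total-sgn o {n} T = trans (Sum-cong (allFin n) one h (weighted-sgn o T)) (trans (Sum-* (allFin n) one h two-power _)
    (cong (two-power ·_) (sym (∑-allMaps h n (λ e → cong 𝟙 (embedding-cong H T e))))))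

  -- The indicator of injectivity is the symmetric weight to which neutrality is applied, and the
  -- number of vertices of `H` itself serves as n.
  neutral⇒impartial : IsOriented H → Neutral H → Impartial H
  neutral⇒impartial o nH = h , ≤-refl , λ T T′ → same-embeddings⇒same-copies H T T′
    (ℤₚ.*-cancelˡ-≡ two-power _ _ ⦃ ℤ.≢-nonZero two-power≢0 ⦄ (trans (value T) (sym (value T′))))
    where
    value : ∀ T → two-power · embeddings H T ≡ Sum (allFin h) one h (λ φ → 𝟙 (injective? φ))
    value T = trans (sym (total-sgn o T)) (trans (Sum-cong (allFin h) one h (λ φ → ℤₚ.*-comm (𝟙 (injective? φ)) (EP H (sgn T) φ)))
      (nH (allFin h) one (sgn T) (sgn-skew T) injective-ext injective-inv))

-- Terms of degree at least 2 in `u` contain a product of two different `D` and vanish. The last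
-- component strengthens the induction: what annihilates all `D` annihilates the linear coefficient.
affine-∏ : (xs : List X₁) (A D : X₁ → ℤ) → AllPairs (λ p q → D p · D q ≡ 0ℤ) xs →
           ∃[ B ] (∀ u → ∏ xs (λ p → A p ⊹ u · D p) ≡ ∏ xs A ⊹ u · B) × (∀ z → All (λ q → z · D q ≡ 0ℤ) xs → z · B ≡ 0ℤ)
affine-∏ []       A D []       = 0ℤ , (λ u → cong (1ℤ ⊹_) (sym (ℤₚ.*-zeroʳ u))) , (λ z _ → ℤₚ.*-zeroʳ z)
affine-∏ (x ∷ xs) A D (a ∷ as) with affine-∏ xs A D as
... | B , e , k = D x · ∏ xs A ⊹ A x · B ,
  (λ u → trans (cong ((A x ⊹ u · D x) ·_) (e u)) (trans (lem u (A x) (D x) (∏ xs A) B) (trans (cong (λ z → A x · ∏ xs A ⊹ u · (D x · ∏ xs A ⊹ A x · B) ⊹ u · (u · z)) (k (D x) a))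
     (lem0 u (A x · ∏ xs A ⊹ u · (D x · ∏ xs A ⊹ A x · B)))))) ,
  (λ { z (zx ∷ zs) → trans (lem′ z (D x) (∏ xs A) (A x) B) (trans (cong₂ (λ s t → s · ∏ xs A ⊹ A x · t) zx (k z zs)) (lem1 (∏ xs A) (A x))) })
  where
  lem : ∀ u a d p b → (a ⊹ u · d) · (p ⊹ u · b) ≡ a · p ⊹ u · (d · p ⊹ a · b) ⊹ u · (u · (d · b))
  lem = solve-∀
  lem0 : ∀ u y → y ⊹ u · (u · 0ℤ) ≡ y
  lem0 = solve-∀
  lem′ : ∀ z d p a b → z · (d · p ⊹ a · b) ≡ z · d · p ⊹ a · (z · b)
  lem′ = solve-∀
  lem1 : ∀ p a → 0ℤ · p ⊹ a · 0ℤ ≡ 0ℤ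
  lem1 = solve-∀

concatMap-pairs : ∀ {X : Set} (xs ys : List X) → concatMap (λ i → map (i ,_) ys) xs ≡ cartesianProduct xs ys
concatMap-pairs []       ys = refl
concatMap-pairs (x ∷ xs) ys = cong (map (x ,_) ys ++_) (concatMap-pairs xs ys)

allPairs-unique : ∀ k → Unique (allPairs k)
allPairs-unique k = subst Unique (sym (concatMap-pairs (allFin k) (allFin k))) (Uniqueₚ.cartesianProduct⁺ (Uniqueₚ.allFin⁺ k) (Uniqueₚ.allFin⁺ k))

module _ {n : ℕ} (a b : Fin n) where

  at? : Fin n → Fin n → Fin n → Fin n → ℤ
  at? a b x y = 𝟙 (⌊ x Fin.≟ a ⌋ ∧ ⌊ y Fin.≟ b ⌋)

  -- The elementary skew matrix: for distinct `a` and `b` it has 1 at (a,b), -1 at (b,a) and 0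
  -- elsewhere.
  bump : Fin n → Fin n → ℤ
  bump x y = at? a b x y ⊹ ⊖ at? a b y x

  at?-≢0 : ∀ x y → at? a b x y ≢ 0ℤ → x ≡ a × y ≡ b
  at?-≢0 x y ne with x Fin.≟ a | y Fin.≟ b
  ... | yes p | yes q = p , q
  ... | yes _ | no _  = contradiction refl ne
  ... | no _  | _     = contradiction refl ne

  at?-0 : ∀ x y → ¬ (x ≡ a × y ≡ b) → at? a b x y ≡ 0ℤ
  at?-0 x y ne with x Fin.≟ a | y Fin.≟ b
  ... | yes p | yes q = contradiction (p , q) ne
  ... | yes _ | no _  = refl
  ... | no _  | _     = refl

  bump-≢0 : ∀ x y → bump x y ≢ 0ℤ → (x ≡ a × y ≡ b) ⊎ (y ≡ a × x ≡ b)
  bump-≢0 x y ne with at? a b x y ℤ.≟ 0ℤ | at? a b y x ℤ.≟ 0ℤ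
  ... | no k  | _     = inj₁ (at?-≢0 x y k)
  ... | yes _ | no k  = inj₂ (at?-≢0 y x k)
  ... | yes p | yes q = contradiction (cong₂ (λ s t → s ⊹ ⊖ t) p q) ne

  bump-skew : Skew bump
  bump-skew x y = lem (at? a b x y) (at? a b y x)
    where
    lem : ∀ s t → s ⊹ ⊖ t ≡ ⊖ (t ⊹ ⊖ s)
    lem = solve-∀

  bump-one : a ≢ b → bump a b ≡ 1ℤ
  bump-one ne = cong₂ (λ s t → s ⊹ ⊖ t) (cong 𝟙 (cong₂ _∧_ (yes! (a Fin.≟ a) refl) (yes! (b Fin.≟ b) refl))) (at?-0 b a (λ { (e , _) → ne (sym e) }))

module _ (H : Digraph) (orient : IsOriented H) {n : ℕ} where
  private
    h = size H

  shifted : (Fin n → Fin n → ℤ) → Fin n → Fin n → ℤ → Fin n → Fin n → ℤ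
  shifted X a b u x y = X x y ⊹ u · bump a b x y

  coefficient : Fin n → Fin n → (Fin h → Fin n) → Fin h × Fin h → ℤ
  coefficient a b φ (i , j) = 𝟙 (edge H i j) · bump a b (φ i) (φ j)

  coefficient-≢0 : ∀ a b φ p → coefficient a b φ p ≢ 0ℤ → edge H (proj₁ p) (proj₂ p) ≡ true × bump a b (φ (proj₁ p)) (φ (proj₂ p)) ≢ 0ℤ
  coefficient-≢0 a b φ (i , j) ne with edge H i j
  ... | true  = refl , λ z → ne (trans (ℤₚ.*-identityˡ (bump a b (φ i) (φ j))) z)
  ... | false = contradiction refl ne

  -- An injective map of an oriented graph sends at most one edge to {a,b}.
  coefficient-orthogonal : ∀ a b φ → Inj φ → ∀ {p q} → p ≢ q → coefficient a b φ p · coefficient a b φ q ≡ 0ℤ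
  coefficient-orthogonal a b φ inj {p} {q} ne = go (coefficient a b φ p ℤ.≟ 0ℤ) (coefficient a b φ q ℤ.≟ 0ℤ)
    where
    clash : ∀ i j i′ j′ → (i , j) ≢ (i′ , j′) → edge H i j ≡ true → edge H i′ j′ ≡ true →
            (φ i ≡ a × φ j ≡ b) ⊎ (φ j ≡ a × φ i ≡ b) → (φ i′ ≡ a × φ j′ ≡ b) ⊎ (φ j′ ≡ a × φ i′ ≡ b) → ⊥
    same : ∀ i j i′ j′ → (i , j) ≢ (i′ , j′) → φ i ≡ φ i′ → φ j ≡ φ j′ → ⊥
    same i j i′ j′ d e e′ = d (cong₂ _,_ (inj i i′ e) (inj j j′ e′))
    opposite : ∀ i j i′ j′ → edge H i j ≡ true → edge H i′ j′ ≡ true → φ i ≡ φ j′ → φ j ≡ φ i′ → ⊥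
    opposite i j i′ j′ x y e e′ = contradiction (trans (sym y) (subst (λ k → edge H k j′ ≡ false) (inj j i′ e′)
      (subst (λ k → edge H j k ≡ false) (inj i j′ e) (proj₂ orient i j x)))) (λ ())
    clash i j i′ j′ d x y (inj₁ (e , f)) (inj₁ (e′ , f′)) = same i j i′ j′ d (trans e (sym e′)) (trans f (sym f′))
    clash i j i′ j′ d x y (inj₂ (e , f)) (inj₂ (e′ , f′)) = same i j i′ j′ d (trans f (sym f′)) (trans e (sym e′))
    clash i j i′ j′ d x y (inj₁ (e , f)) (inj₂ (e′ , f′)) = opposite i j i′ j′ x y (trans e (sym e′)) (trans f (sym f′))
    clash i j i′ j′ d x y (inj₂ (e , f)) (inj₁ (e′ , f′)) = opposite i j i′ j′ x y (trans f (sym f′)) (trans e (sym e′))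
    go : Dec (coefficient a b φ p ≡ 0ℤ) → Dec (coefficient a b φ q ≡ 0ℤ) → coefficient a b φ p · coefficient a b φ q ≡ 0ℤ
    go (yes z) _       = trans (cong (_· coefficient a b φ q) z) (ℤₚ.*-zeroˡ (coefficient a b φ q))
    go (no _)  (yes z) = trans (cong (coefficient a b φ p ·_) z) (ℤₚ.*-zeroʳ (coefficient a b φ p))
    go (no k)  (no l)  = ⊥-elim (clash (proj₁ p) (proj₂ p) (proj₁ q) (proj₂ q) ne (proj₁ (coefficient-≢0 a b φ p k)) (proj₁ (coefficient-≢0 a b φ q l))
      (bump-≢0 a b _ _ (proj₂ (coefficient-≢0 a b φ p k))) (bump-≢0 a b _ _ (proj₂ (coefficient-≢0 a b φ q l))))

  EP-pairs : ∀ X (φ : Fin h → Fin n) → EP H X φ ≡ ∏ (allPairs h) (λ p → fac (edge H (proj₁ p) (proj₂ p)) (X (φ (proj₁ p)) (φ (proj₂ p))))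
  EP-pairs X φ = sym (∏-allPairs h (λ i j → fac (edge H i j) (X (φ i) (φ j))))

  affine : ∀ X a b (φ : Fin h → Fin n) → ∃[ β ] (∀ u → weighted H (shifted X a b u) φ ≡ weighted H X φ ⊹ u · β)
  affine X a b φ with injective? φ in q
  ... | false = 0ℤ , λ u → lem (EP H (shifted X a b u) φ) (EP H X φ) u
    where
    lem : ∀ x y u → 0ℤ · x ≡ 0ℤ · y ⊹ u · 0ℤ
    lem = solve-∀
  ... | true = proj₁ main , λ u → trans (ℤₚ.*-identityˡ (EP H (shifted X a b u) φ)) (trans (trans (EP-pairs (shifted X a b u) φ) (∏-cong (allPairs h) (λ p → split u (edge H (proj₁ p) (proj₂ p)) (X (φ (proj₁ p)) (φ (proj₂ p))) (bump a b (φ (proj₁ p)) (φ (proj₂ p))))))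
          (trans (proj₁ (proj₂ main) u) (cong (_⊹ u · proj₁ main) (trans (sym (EP-pairs X φ)) (sym (ℤₚ.*-identityˡ (EP H X φ)))))))
    where
    main = affine-∏ (allPairs h) (λ p → fac (edge H (proj₁ p) (proj₂ p)) (X (φ (proj₁ p)) (φ (proj₂ p)))) (coefficient a b φ)
      (AllPairs.map (λ {p} {q′} ne → coefficient-orthogonal a b φ (injective⁻ φ q) ne) (allPairs-unique h))
    split : ∀ u e x d → fac e (x ⊹ u · d) ≡ fac e x ⊹ u · (𝟙 e · d)
    split u true  x d = lem x u d
      where
      lem : ∀ x u d → 1ℤ ⊹ (x ⊹ u · d) ≡ 1ℤ ⊹ x ⊹ u · (1ℤ · d)
      lem = solve-∀
    split u false x d = sym (cong (1ℤ ⊹_) (trans (cong (u ·_) (ℤₚ.*-zeroˡ d)) (ℤₚ.*-zeroʳ u)))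

  total-affine : ∀ X a b → ∃[ β ] (∀ u → total H (shifted X a b u) ≡ total H X ⊹ u · β)
  total-affine X a b = Sum (allFin n) one h (λ φ → proj₁ (affine X a b φ)) , λ u →
    trans (Sum-cong (allFin n) one h (λ φ → proj₂ (affine X a b φ) u)) (trans (Sum-+ (allFin n) one h (weighted H X) _)
      (cong (total H X ⊹_) (Sum-* (allFin n) one h u _)))

  total-cong : ∀ {X Y : Fin n → Fin n → ℤ} → (∀ x y → X x y ≡ Y x y) → total H X ≡ total H Y
  total-cong e = Sum-cong (allFin n) one h (λ φ → cong (𝟙 (injective? φ) ·_) (∏∏-cong (λ i j → cong (fac (edge H i j)) (e (φ i) (φ j)))))

  SignOff : List (Fin n × Fin n) → (Fin n → Fin n → ℤ) → Set
  SignOff L X = ∀ x y → x ≢ y → (X x y ≡ 1ℤ ⊎ X x y ≡ -1ℤ) ⊎ ((x , y) ∈ L ⊎ (y , x) ∈ L)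

  module _ (c : ℤ) (const : ∀ T → total H (sgn {n} T) ≡ c) where

    total-signs : ∀ X → Skew X → SignOff [] X → total H X ≡ c
    total-signs X sk sign = trans (total-cong same) (const tour)
      where
      units : ∀ x y → x ≢ y → X x y ≡ 1ℤ ⊎ X x y ≡ -1ℤ
      units x y ne with sign x y ne
      ... | inj₁ u         = u
      ... | inj₂ (inj₁ ())
      ... | inj₂ (inj₂ ())
      arc-value : ∀ x y → x ≢ y → (⌊ X x y ℤ.≟ 1ℤ ⌋ ≡ true × ⌊ X y x ℤ.≟ 1ℤ ⌋ ≡ false × X x y ≡ 1ℤ) ⊎
                                  (⌊ X x y ℤ.≟ 1ℤ ⌋ ≡ false × ⌊ X y x ℤ.≟ 1ℤ ⌋ ≡ true × X x y ≡ -1ℤ)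
      arc-value x y ne with units x y ne
      ... | inj₁ p = inj₁ (yes! (X x y ℤ.≟ 1ℤ) p , no! (X y x ℤ.≟ 1ℤ) (λ q → contradiction (trans (sym q) (trans (sk y x) (cong ⊖_ p))) (λ ())) , p)
      ... | inj₂ p = inj₂ (no! (X x y ℤ.≟ 1ℤ) (λ q → contradiction (trans (sym q) p) (λ ())) , yes! (X y x ℤ.≟ 1ℤ) (trans (sk y x) (cong ⊖_ p)) , p)
      tour : Tournament n
      tour = record { arc = λ x y → ⌊ X x y ℤ.≟ 1ℤ ⌋
                 ; arc-irr = λ x → no! (X x x ℤ.≟ 1ℤ) (λ q → contradiction (trans (sym (x≡-x⇒0 (sk x x))) q) (λ ()))
                 ; arc-tot = λ x y ne → [ (λ (p , q , _) → trans p (cong not (sym q))) , (λ (p , q , _) → trans p (cong not (sym q))) ] (arc-value x y ne) }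
      same : ∀ x y → X x y ≡ sgn tour x y
      same x y with x Fin.≟ y
      ... | yes refl = trans (x≡-x⇒0 (sk x x)) (sym (x≡-x⇒0 (sgn-skew tour x x)))
      ... | no ne    = [ (λ (p , q , v) → trans v (sym (cong₂ (λ s t → 𝟙 s ⊹ ⊖ 𝟙 t) p q))) , (λ (p , q , v) → trans v (sym (cong₂ (λ s t → 𝟙 s ⊹ ⊖ 𝟙 t) p q))) ] (arc-value x y ne)

    -- `L` lists the positions whose entries need not be 1 or -1. In one such entry the sum is
    -- affine; it equals `c` when the entry is replaced by 1 and by -1, so its slope is 0.
    total-constant : ∀ L X → Skew X → SignOff L X → total H X ≡ c
    total-constant []            X sk sign = total-signs X sk sign
    total-constant ((a , b) ∷ L) X sk sign with a Fin.≟ b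
    ... | yes refl = total-constant L X sk (λ x y ne → drop x y ne (sign x y ne))
      where
      drop : ∀ x y → x ≢ y → (X x y ≡ 1ℤ ⊎ X x y ≡ -1ℤ) ⊎ ((x , y) ∈ (a , a) ∷ L ⊎ (y , x) ∈ (a , a) ∷ L) →
             (X x y ≡ 1ℤ ⊎ X x y ≡ -1ℤ) ⊎ ((x , y) ∈ L ⊎ (y , x) ∈ L)
      drop x y ne (inj₁ u)                  = inj₁ u
      drop x y ne (inj₂ (inj₁ (here refl))) = contradiction refl ne
      drop x y ne (inj₂ (inj₁ (there m)))   = inj₂ (inj₁ m)
      drop x y ne (inj₂ (inj₂ (here refl))) = contradiction refl ne
      drop x y ne (inj₂ (inj₂ (there m)))   = inj₂ (inj₂ m)
    ... | no a≢b = solve (proj₁ (total-affine X a b)) (X a b) (total H X)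
        (trans (sym (proj₂ (total-affine X a b) (1ℤ ⊹ ⊖ X a b))) (IH 1ℤ (inj₁ refl)))
        (trans (sym (proj₂ (total-affine X a b) (-1ℤ ⊹ ⊖ X a b))) (IH -1ℤ (inj₂ refl)))
      where
      shifted-skew : ∀ u → Skew (shifted X a b u)
      shifted-skew u x y = trans (cong₂ (λ s t → s ⊹ u · t) (sk x y) (bump-skew a b x y)) (lem (X y x) u (bump a b y x))
        where
        lem : ∀ s u t → ⊖ s ⊹ u · ⊖ t ≡ ⊖ (s ⊹ u · t)
        lem = solve-∀
      at-ab : ∀ e → shifted X a b (e ⊹ ⊖ X a b) a b ≡ e
      at-ab e = trans (cong (λ z → X a b ⊹ (e ⊹ ⊖ X a b) · z) (bump-one a b a≢b)) (lem (X a b) e)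
        where
        lem : ∀ x e → x ⊹ (e ⊹ ⊖ x) · 1ℤ ≡ e
        lem = solve-∀
      sign′ : ∀ e → e ≡ 1ℤ ⊎ e ≡ -1ℤ → SignOff L (shifted X a b (e ⊹ ⊖ X a b))
      sign′ e ue x y ne = by (bump a b x y ℤ.≟ 0ℤ)
        where
        u = e ⊹ ⊖ X a b
        by : Dec (bump a b x y ≡ 0ℤ) → _
        by (no k) with bump-≢0 a b x y k
        ... | inj₁ (refl , refl) = inj₁ (subst (λ z → z ≡ 1ℤ ⊎ z ≡ -1ℤ) (sym (at-ab e)) ue)
        ... | inj₂ (refl , refl) = inj₁ (subst (λ z → z ≡ 1ℤ ⊎ z ≡ -1ℤ) (sym (trans (shifted-skew u x y) (cong ⊖_ (at-ab e)))) (unit-neg ue))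
        by (yes z) = keep (sign x y ne)
          where
          unchanged : shifted X a b u x y ≡ X x y
          unchanged = trans (cong (λ t → X x y ⊹ u · t) z) (trans (cong (X x y ⊹_) (ℤₚ.*-zeroʳ u)) (ℤₚ.+-identityʳ (X x y)))
          keep : (X x y ≡ 1ℤ ⊎ X x y ≡ -1ℤ) ⊎ ((x , y) ∈ (a , b) ∷ L ⊎ (y , x) ∈ (a , b) ∷ L) →
                 (shifted X a b u x y ≡ 1ℤ ⊎ shifted X a b u x y ≡ -1ℤ) ⊎ ((x , y) ∈ L ⊎ (y , x) ∈ L)
          keep (inj₁ v)                  = inj₁ (subst (λ t → t ≡ 1ℤ ⊎ t ≡ -1ℤ) (sym unchanged) v)
          keep (inj₂ (inj₁ (here refl))) = contradiction (trans (sym (bump-one a b a≢b)) z) (λ ())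
          keep (inj₂ (inj₁ (there m)))   = inj₂ (inj₁ m)
          keep (inj₂ (inj₂ (here refl))) = contradiction (trans (sym (bump-one a b a≢b)) (trans (bump-skew a b a b) (cong ⊖_ z))) (λ ())
          keep (inj₂ (inj₂ (there m)))   = inj₂ (inj₂ m)
      IH : ∀ e → e ≡ 1ℤ ⊎ e ≡ -1ℤ → total H (shifted X a b (e ⊹ ⊖ X a b)) ≡ c
      IH e ue = total-constant L (shifted X a b (e ⊹ ⊖ X a b)) (shifted-skew (e ⊹ ⊖ X a b)) (sign′ e ue)
      solve : ∀ β x p → p ⊹ (1ℤ ⊹ ⊖ x) · β ≡ c → p ⊹ (-1ℤ ⊹ ⊖ x) · β ≡ c → p ≡ c
      solve β x p e₁ e₂ = trans (sym (trans (cong (λ z → p ⊹ (1ℤ ⊹ ⊖ x) · z) β≡0) (trans (cong (p ⊹_) (ℤₚ.*-zeroʳ (1ℤ ⊹ ⊖ x))) (ℤₚ.+-identityʳ p)))) e₁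
        where
        lem : ∀ β x p → (+ 2) · β ≡ (p ⊹ (1ℤ ⊹ ⊖ x) · β) ⊹ ⊖ (p ⊹ (-1ℤ ⊹ ⊖ x) · β)
        lem = solve-∀
        β≡0 : β ≡ 0ℤ
        β≡0 = ·-cancelˡ0 (+ 2) (λ ()) (trans (lem β x p) (trans (cong₂ (λ s t → s ⊹ ⊖ t) e₁ e₂) (ℤₚ.+-inverseʳ c)))

-- Homomorphism sums of impartial digraphs

∑-nonneg : (xs : List X₁) (f : X₁ → ℤ) → (∀ x → ∃[ m ] f x ≡ + m) → ∃[ m ] ∑ xs f ≡ + m
∑-nonneg []       f h = 0 , refl
∑-nonneg (x ∷ xs) f h with h x | ∑-nonneg xs f h
... | m , e | n , q = m + n , cong₂ _⊹_ e q

∑-positive : (xs : List X₁) (f : X₁ → ℤ) → (∀ x → ∃[ m ] f x ≡ + m) → ∀ {x} → x ∈ xs → ∃[ m ] f x ≡ + suc m → ∃[ m ] ∑ xs f ≡ + suc m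
∑-positive (x ∷ xs) f h (here refl) (m , e) with ∑-nonneg xs f h
... | n , q = m + n , cong₂ _⊹_ e q
∑-positive (x ∷ xs) f h (there k) p with h x | ∑-positive xs f h k p
... | m , e | n , q = m + n , trans (cong₂ _⊹_ e q) (cong +_ (ℕₚ.+-suc m n))

Sum-nonneg : ∀ {n} k (F : (Fin k → Fin n) → ℤ) → (∀ φ → ∃[ m ] F φ ≡ + m) → ∃[ m ] Sum (allFin n) one k F ≡ + m
Sum-nonneg zero    F h = h _
Sum-nonneg {n} (suc k) F h = ∑-nonneg (allFin n) _ (λ x → let m , e = Sum-nonneg k (λ φ → F (x ◂ φ)) (λ φ → h _) in m , trans (ℤₚ.*-identityˡ _) e)

Sum-positive : ∀ {n} k (F : (Fin k → Fin n) → ℤ) → Ext F → (∀ φ → ∃[ m ] F φ ≡ + m) → ∀ φ → ∃[ m ] F φ ≡ + suc m → ∃[ m ] Sum (allFin n) one k F ≡ + suc m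
Sum-positive zero    F ext h φ (m , e) = m , trans (ext (λ ())) e
Sum-positive {n} (suc k) F ext h φ (m , e) = ∑-positive (allFin n) _ (λ x → let m , e = Sum-nonneg k (λ φ → F (x ◂ φ)) (λ φ → h _) in m , trans (ℤₚ.*-identityˡ _) e)
  (∈-allFin (φ zero)) (let m′ , e′ = Sum-positive k (λ ψ → F (φ zero ◂ ψ)) (λ e → ext (◂-cong (φ zero) e)) (λ ψ → h _) (φ ∘ suc) (m , trans (ext (λ { zero → refl ; (suc i) → refl })) e)
    in m′ , trans (ℤₚ.*-identityˡ _) e′)

injections : ∀ {h n} → h ≤ n → ∃[ m ] Sum (allFin n) one h (λ φ → 𝟙 (injective? φ)) ≡ + suc m
injections {h} {n} l = Sum-positive h (λ φ → 𝟙 (injective? φ)) injective-ext (λ φ → nat (injective? φ)) (λ i → Fin.inject≤ i l)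
  (0 , cong 𝟙 (injective⁺ (λ i → Fin.inject≤ i l) (λ i j → Finₚ.inject≤-injective l l i j)))
  where
  nat : ∀ b → ∃[ m ] 𝟙 b ≡ + m
  nat true  = 1 , refl
  nat false = 0 , refl

transitive : ∀ n → Tournament n
transitive n = record
  { arc     = λ x y → ⌊ Fin.toℕ x ℕ.<? Fin.toℕ y ⌋
  ; arc-irr = λ x → no! (Fin.toℕ x ℕ.<? Fin.toℕ x) (<-irrefl refl)
  ; arc-tot = tot }
  where
  tot : (x y : Fin n) → x ≢ y → ⌊ Fin.toℕ x ℕ.<? Fin.toℕ y ⌋ ≡ not ⌊ Fin.toℕ y ℕ.<? Fin.toℕ x ⌋
  tot x y ne with <-cmp (Fin.toℕ x) (Fin.toℕ y)
  ... | tri< a _ b = trans (yes! (Fin.toℕ x ℕ.<? Fin.toℕ y) a) (cong not (sym (no! (Fin.toℕ y ℕ.<? Fin.toℕ x) b)))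
  ... | tri≈ _ e _ = contradiction (Finₚ.toℕ-injective e) ne
  ... | tri> b _ a = trans (no! (Fin.toℕ x ℕ.<? Fin.toℕ y) b) (cong not (sym (yes! (Fin.toℕ y ℕ.<? Fin.toℕ x) a)))

hom : Kernel → Digraph → ℤ
hom K H = Sum (pts K) (w K) (size H) (EP H (f K))

-- The polynomial counting copies is constant; average it over the skew matrices obtained from K by choosing n points.
impartial⇒hom : ∀ H → IsOriented H → Impartial H → ∀ K → mass K ≢ 0ℤ → hom K H ≡ pow (mass K) (size H)
impartial⇒hom H o (n , h≤n , same) K m0 = ℤₚ.*-cancelˡ-≡ (pow (mass K) (n ∸ h)) _ _ ⦃ ℤ.≢-nonZero (pow-≢0 (n ∸ h) m0) ⦄
    (ℤₚ.*-cancelˡ-≡ N _ _ ⦃ ℤ.≢-nonZero N≢0 ⦄ (trans (sym averaged) (trans direct (cong (N ·_) (trans (cong (pow (mass K)) (sym (ℕₚ.m∸n+n≡m h≤n))) (pow-+ (mass K) (n ∸ h) h))))))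
  where
  h = size H
  c = total H (sgn (transitive n))
  -- Every position is listed as exempt from being a sign, so only skewness of `X` is assumed.
  constant : ∀ X → Skew X → total H {n} X ≡ c
  constant X sk = total-constant H o c (λ T → trans (total-sgn H o T) (trans (cong (two-power H ·_)
      (trans (embeddings-copies H T) (trans (cong (λ k → (+ k) · automorphisms H) (same T (transitive n))) (sym (embeddings-copies H (transitive n))))))
      (sym (total-sgn H o (transitive n))))) (allPairs n) X sk (λ x y _ → inj₂ (inj₁ (∈-allPairs x y)))
  N : ℤ
  N = Sum (allFin n) one h (λ φ → 𝟙 (injective? φ))
  N≢0 : N ≢ 0ℤ
  N≢0 e = contradiction (trans (sym (proj₂ (injections h≤n))) e) (λ ())
  -- The zero matrix is also skew. There all edge factors are 1, so the constant is the number of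
  -- injections.
  c≡N : c ≡ N
  c≡N = trans (sym (constant (λ _ _ → 0ℤ) (λ _ _ → refl))) (Sum-cong (allFin n) one h (λ φ → trans (cong (𝟙 (injective? φ) ·_)
    (∏∏-one (λ i j → zero-fac (edge H i j)))) (ℤₚ.*-identityʳ (𝟙 (injective? φ)))))
    where
    zero-fac : ∀ b → fac b 0ℤ ≡ 1ℤ
    zero-fac true  = refl
    zero-fac false = refl
  average : ℤ
  average = Sum (pts K) (w K) n (λ ρ → total H (λ a b → f K (ρ a) (ρ b)))
  direct : average ≡ N · pow (mass K) n
  direct = trans (Sum-cong (pts K) (w K) n (λ ρ → trans (constant (λ a b → f K (ρ a) (ρ b)) (λ a b → skew K (ρ a) (ρ b))) c≡N))
    (trans (Sum-const (pts K) (w K) n N) (ℤₚ.*-comm (pow (mass K) n) N))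
  averaged : average ≡ N · (pow (mass K) (n ∸ h) · hom K H)
  averaged = trans (Sum-swap (pts K) (w K) (allFin n) one n h (λ ρ φ → 𝟙 (injective? φ) · EP H (f K) (ρ ∘ φ)))
    (trans (Sum-cong (allFin n) one h each) (trans (Sum-cong (allFin n) one h (λ φ → ℤₚ.*-comm (𝟙 (injective? φ)) C))
      (trans (Sum-* (allFin n) one h C _) (ℤₚ.*-comm C N))))
    where
    C : ℤ
    C = pow (mass K) (n ∸ h) · hom K H
    each : ∀ φ → Sum (pts K) (w K) n (λ ρ → 𝟙 (injective? φ) · EP H (f K) (ρ ∘ φ)) ≡ 𝟙 (injective? φ) · C
    each φ = trans (Sum-* (pts K) (w K) n (𝟙 (injective? φ)) _) (by (injective? φ) refl)
      where
      by : ∀ b → injective? φ ≡ b → 𝟙 (injective? φ) · Sum (pts K) (w K) n (λ ρ → EP H (f K) (ρ ∘ φ)) ≡ 𝟙 (injective? φ) · C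
      by true  e = cong (𝟙 (injective? φ) ·_) (Sum-injection (pts K) (w K) h n φ (injective⁻ φ e) (EP-ext H (f K)))
      by false e = trans (cong (λ b → 𝟙 b · Sum (pts K) (w K) n (λ ρ → EP H (f K) (ρ ∘ φ))) e)
        (trans (ℤₚ.*-zeroˡ (Sum (pts K) (w K) n (λ ρ → EP H (f K) (ρ ∘ φ)))) (sym (trans (cong (λ b → 𝟙 b · C) e) (ℤₚ.*-zeroˡ C))))

-- Homomorphism sums of labelled graphs

-- Assignments of points to the vertices in a list, the other vertices keeping the values given by a.

set : {Ω : Set} → (ℕ → Ω) → ℕ → Ω → ℕ → Ω
set a v x z = if ⌊ z ℕ.≟ v ⌋ then x else a z

set-hit : {Ω : Set} (a : ℕ → Ω) → ∀ v x → set a v x v ≡ x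
set-hit a v x = cong (λ b → if b then x else a v) (yes! (v ℕ.≟ v) refl)

set-miss : {Ω : Set} (a : ℕ → Ω) → ∀ {v z} x → z ≢ v → set a v x z ≡ a z
set-miss a {v} {z} x n = cong (λ b → if b then x else a z) (no! (z ℕ.≟ v) n)

module Labelled (K : Kernel) where

  Asg : Set
  Asg = ℕ → Ω K

  -- The labelled form of `Sum`. With natural numbers as names of the vertices, parts of a graph and
  -- permuted vertex lists need no reindexing.
  LS : List ℕ → (Asg → ℤ) → Asg → ℤ
  LS []       G a = G a
  LS (v ∷ vs) G a = ∑ (pts K) (λ x → w K x · LS vs G (set a v x))

  LS-cong∈ : ∀ vs {F G : Asg → ℤ} a → (∀ b → (∀ z → z ∉ vs → b z ≡ a z) → F b ≡ G b) → LS vs F a ≡ LS vs G a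
  LS-cong∈ []       a h = h a (λ _ _ → refl)
  LS-cong∈ (v ∷ vs) a h = ∑-cong (pts K) (λ x → cong (w K x ·_) (LS-cong∈ vs (set a v x) (λ b e → h b (λ z n →
    trans (e z (λ m → n (there m))) (set-miss a x (λ q → n (here q)))))))

  LS-cong : ∀ vs {F G : Asg → ℤ} a → (∀ b → F b ≡ G b) → LS vs F a ≡ LS vs G a
  LS-cong vs a h = LS-cong∈ vs a (λ b _ → h b)

  LS-++ : ∀ xs ys G a → LS (xs ++ ys) G a ≡ LS xs (LS ys G) a
  LS-++ []       ys G a = refl
  LS-++ (x ∷ xs) ys G a = ∑-cong (pts K) (λ p → cong (w K p ·_) (LS-++ xs ys G (set a x p)))

  LS-* : ∀ vs c G a → LS vs (λ b → c · G b) a ≡ c · LS vs G a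
  LS-* []       c G a = refl
  LS-* (v ∷ vs) c G a = trans (∑-cong (pts K) (λ x → trans (cong (w K x ·_) (LS-* vs c G (set a v x))) (lem (w K x) c (LS vs G (set a v x))))) (∑-* (pts K) c _)
    where
    lem : ∀ v c s → v · (c · s) ≡ c · (v · s)
    lem = solve-∀

  LS-*ʳ : ∀ vs c G a → LS vs (λ b → G b · c) a ≡ LS vs G a · c
  LS-*ʳ vs c G a = trans (LS-cong vs a (λ b → ℤₚ.*-comm (G b) c)) (trans (LS-* vs c G a) (ℤₚ.*-comm c (LS vs G a)))

  LS-+ : ∀ vs F G a → LS vs (λ b → F b ⊹ G b) a ≡ LS vs F a ⊹ LS vs G a
  LS-+ []       F G a = refl
  LS-+ (v ∷ vs) F G a = trans (∑-cong (pts K) (λ x → trans (cong (w K x ·_) (LS-+ vs F G (set a v x))) (ℤₚ.*-distribˡ-+ (w K x) (LS vs F (set a v x)) (LS vs G (set a v x))))) (∑-+ (pts K) _ _)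

  LS-const : ∀ vs c a → LS vs (λ _ → c) a ≡ pow (mass K) (length vs) · c
  LS-const []       c a = sym (ℤₚ.*-identityˡ c)
  LS-const (v ∷ vs) c a = trans (∑-cong (pts K) (λ x → cong (w K x ·_) (LS-const vs c (set a v x)))) (trans (∑-*ʳ (pts K) (pow (mass K) (length vs) · c) (w K))
    (sym (ℤₚ.*-assoc (mass K) (pow (mass K) (length vs)) c)))

  LS-local : ∀ vs (P : ℕ → Set) {G : Asg → ℤ} → (∀ c d → (∀ z → z ∈ vs ⊎ P z → c z ≡ d z) → G c ≡ G d) →
             ∀ a b → (∀ z → P z → a z ≡ b z) → LS vs G a ≡ LS vs G b
  LS-local []       P h a b e = h a b (λ { z (inj₂ p) → e z p })
  LS-local (v ∷ vs) P h a b e = ∑-cong (pts K) (λ x → cong (w K x ·_) (LS-local vs (λ z → z ≡ v ⊎ P z)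
    (λ c d k → h c d (λ { z (inj₁ (here q)) → k z (inj₂ (inj₁ q)) ; z (inj₁ (there m)) → k z (inj₁ m) ; z (inj₂ p) → k z (inj₂ (inj₂ p)) }))
    (set a v x) (set b v x) (agree x)))
    where
    agree : ∀ x z → z ≡ v ⊎ P z → set a v x z ≡ set b v x z
    agree x z p with z ℕ.≟ v | p
    ... | yes _ | _      = refl
    ... | no n  | inj₁ q = contradiction q n
    ... | no n  | inj₂ q = e z q

  AExt : (Asg → ℤ) → Set
  AExt G = ∀ a b → (∀ z → a z ≡ b z) → G a ≡ G b

  LS-ext : ∀ vs {G} → AExt G → AExt (LS vs G)
  LS-ext vs {G} h a b e = LS-local vs (λ _ → ⊤) (λ c d k → h c d (λ z → k z (inj₂ tt))) a b (λ z _ → e z)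

  set-set : ∀ (a : Asg) u v (x y : Ω K) → u ≢ v → ∀ z → set (set a u x) v y z ≡ set (set a v y) u x z
  set-set a u v x y n z with z ℕ.≟ v | z ℕ.≟ u
  ... | yes p | yes q = contradiction (trans (sym q) p) n
  ... | yes p | no _  = refl
  ... | no _  | yes _ = refl
  ... | no _  | no _  = refl

  LS-↭ : ∀ {vs us} → vs ↭ us → Unique vs → ∀ {G} → AExt G → ∀ a → LS vs G a ≡ LS us G a
  LS-↭ _↭_.refl           u         h a = refl
  LS-↭ (_↭_.prep v p)     (_ ∷ u)   h a = ∑-cong (pts K) (λ x → cong (w K x ·_) (LS-↭ p u h (set a v x)))
  LS-↭ (_↭_.swap {xs} {ys} v v′ p) ((n ∷ _) ∷ (_ ∷ u)) {G} h a =
    trans (∑-cong (pts K) (λ x → trans (sym (∑-* (pts K) (w K x) _)) (∑-cong (pts K) (λ y → trans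
        (lem (w K x) (w K y) (LS xs G (set (set a v x) v′ y))) (cong (λ s → w K y · (w K x · s)) (trans (LS-↭ p u h (set (set a v x) v′ y)) (LS-ext ys h _ _ (set-set a v v′ x y n))))))))
      (trans (∑-swap (pts K) (pts K) _) (∑-cong (pts K) (λ y → ∑-* (pts K) (w K y) _)))
    where
    lem : ∀ a b c → a · (b · c) ≡ b · (a · c)
    lem = solve-∀
  LS-↭ (_↭_.trans p q)    u         h a = trans (LS-↭ p u h a) (LS-↭ q (unique-↭ p u) h a)

  Sum-LS : ∀ k (l : Fin k → ℕ) → (∀ i j → l i ≡ l j → i ≡ j) → {G : (Fin k → Ω K) → ℤ} → Ext G → ∀ a → Sum (pts K) (w K) k G ≡ LS (tabulate l) (λ b → G (b ∘ l)) a
  Sum-LS zero    l inj ext a = ext (λ ())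
  Sum-LS (suc k) l inj {G} ext a = ∑-cong (pts K) (λ x → cong (w K x ·_) (trans
      (Sum-LS k (l ∘ suc) (λ i j e → Finₚ.suc-injective (inj (suc i) (suc j) e)) (λ e → ext (◂-cong x e)) (set a (l zero) x))
      (LS-cong∈ (tabulate (l ∘ suc)) (set a (l zero) x) (λ b e → ext (λ { zero → sym (trans (e (l zero) fresh) (set-hit a (l zero) x)) ; (suc i) → refl })))))
    where
    fresh : l zero ∉ tabulate (l ∘ suc)
    fresh m with ∈-tabulate⁻ m
    ... | i , e = contradiction (inj zero (suc i) e) (λ ())

  EdgeP : List (ℕ × ℕ) → Asg → ℤ
  EdgeP E b = ∏ E (λ e → 1ℤ ⊹ f K (b (proj₁ e)) (b (proj₂ e)))

  EdgeP-local : ∀ E {b c : Asg} → (∀ {e} → e ∈ E → b (proj₁ e) ≡ c (proj₁ e) × b (proj₂ e) ≡ c (proj₂ e)) → EdgeP E b ≡ EdgeP E c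
  EdgeP-local E h = ∏-cong∈ E (λ e m → cong₂ (λ x y → 1ℤ ⊹ f K x y) (proj₁ (h m)) (proj₂ (h m)))

  homL : List ℕ → List (ℕ × ℕ) → Asg → ℤ
  homL vs E = LS vs (EdgeP E)

  homL-↭ : ∀ {vs us E F} → vs ↭ us → E ↭ F → Unique vs → ∀ a → homL vs E a ≡ homL us F a
  homL-↭ {vs} {us} {E} {F} p q u a = trans (LS-cong vs a (λ b → ∏-↭ q (λ e → 1ℤ ⊹ f K (b (proj₁ e)) (b (proj₂ e)))))
    (LS-↭ p u (λ b c e → EdgeP-local F (λ {x} _ → e (proj₁ x) , e (proj₂ x))) a)

  Within : List ℕ → List (ℕ × ℕ) → Set
  Within vs E = ∀ {e} → e ∈ E → proj₁ e ∈ vs × proj₂ e ∈ vs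

  homL-split : ∀ xs ys {E F} → Unique (xs ++ ys) → Within xs E → Within ys F → ∀ a → homL (xs ++ ys) (E ++ F) a ≡ homL xs E a · homL ys F a
  homL-split xs ys {E} {F} u wE wF a = trans (LS-++ xs ys (EdgeP (E ++ F)) a) (trans (LS-cong xs a inner) (LS-*ʳ xs (homL ys F a) (EdgeP E) a))
    where
    apart : ∀ {z} → z ∈ xs → z ∉ ys
    apart = proj₂ (proj₂ (unique-++⁻ xs u))
    inner : ∀ b → LS ys (EdgeP (E ++ F)) b ≡ EdgeP E b · homL ys F a
    inner b = trans (LS-cong∈ ys b (λ c e → trans (∏-++ E F _) (cong (_· EdgeP F c)
        (EdgeP-local E (λ {x} m → e (proj₁ x) (apart (proj₁ (wE m))) , e (proj₂ x) (apart (proj₂ (wE m))))))))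
      (trans (LS-* ys (EdgeP E b) (EdgeP F) b) (cong (EdgeP E b ·_) (LS-local ys (λ _ → ⊥)
        (λ c d k → EdgeP-local F (λ {x} m → k (proj₁ x) (inj₁ (proj₁ (wF m))) , k (proj₂ x) (inj₁ (proj₂ (wF m))))) b a (λ _ ()))))

  module _ {Λ : ℤ} (div : ∀ x y → ∃[ c ] f K x y ≡ Λ · c) where

    EdgeP≡1 : ∀ E b → ∃[ q ] EdgeP E b ≡ 1ℤ ⊹ Λ · q
    EdgeP≡1 []      b = 0ℤ , sym (cong (1ℤ ⊹_) (ℤₚ.*-zeroʳ Λ))
    EdgeP≡1 (e ∷ E) b = let c , p = div (b (proj₁ e)) (b (proj₂ e)) ; q , r = EdgeP≡1 E b in
      c ⊹ q ⊹ c · (Λ · q) , trans (cong₂ (λ s t → (1ℤ ⊹ s) · t) p r) (product-mod-Λ Λ c q)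

    opaque
      homL≡pow : ∀ vs E a → ∃[ q ] homL vs E a ≡ pow (mass K) (length vs) ⊹ Λ · q
      homL≡pow vs E a = LS vs (λ b → proj₁ (EdgeP≡1 E b)) a , trans (LS-cong vs a (λ b → proj₂ (EdgeP≡1 E b)))
        (trans (LS-+ vs (λ _ → 1ℤ) (λ b → Λ · proj₁ (EdgeP≡1 E b)) a) (cong₂ _⊹_ (trans (LS-const vs 1ℤ a) (ℤₚ.*-identityʳ (pow (mass K) (length vs)))) (LS-* vs Λ _ a)))

open Labelled

∏-fac-filter : {X : Set} (q : X → Bool) (g : X → ℤ) (xs : List X) → ∏ xs (λ p → fac (q p) (g p)) ≡ ∏ (filterᵇ q xs) (λ p → 1ℤ ⊹ g p)
∏-fac-filter q g []       = refl
∏-fac-filter q g (x ∷ xs) with q x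
... | true  = cong ((1ℤ ⊹ g x) ·_) (∏-fac-filter q g xs)
... | false = trans (ℤₚ.*-identityˡ _) (∏-fac-filter q g xs)

pow-ℕ : ∀ m n → pow (+ m) n ≡ + (m ^ n)
pow-ℕ m zero    = refl
pow-ℕ m (suc n) = trans (cong ((+ m) ·_) (pow-ℕ m n)) (sym (ℤₚ.pos-* m (m ^ n)))

label : {k : ℕ} → Fin k × Fin k → ℕ × ℕ
label (i , j) = Fin.toℕ i , Fin.toℕ j

labels : Digraph → List ℕ
labels H = tabulate {n = size H} Fin.toℕ

arcs : Digraph → List (ℕ × ℕ)
arcs H = map label (filterᵇ (λ p → edge H (proj₁ p) (proj₂ p)) (allPairs (size H)))

hom-labelled : ∀ K H a → hom K H ≡ homL K (labels H) (arcs H) a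
hom-labelled K H a = trans (Sum-LS K (size H) Fin.toℕ (λ i j → Finₚ.toℕ-injective) (EP-ext H (f K)) a)
  (LS-cong K (labels H) a (λ b → trans (sym (∏-allPairs (size H) (λ i j → fac (edge H i j) (f K (b (Fin.toℕ i)) (b (Fin.toℕ j))))))
    (trans (∏-fac-filter (λ p → edge H (proj₁ p) (proj₂ p)) (λ p → f K (b (Fin.toℕ (proj₁ p))) (b (Fin.toℕ (proj₂ p)))) (allPairs (size H)))
      (sym (∏-map label (filterᵇ (λ p → edge H (proj₁ p) (proj₂ p)) (allPairs (size H))) _)))))

-- Passage to components

-- The modulus Λ exceeds twice every value that can occur.
module Scale (h₀ : ℕ) (h₀>0 : 0 < h₀) where

  bound : ℕ
  bound = h₀ ^ h₀

  Λ : ℤ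
  Λ = + suc (2 * bound)

  Λ≢0 : Λ ≢ 0ℤ
  Λ≢0 ()

  bound>0 : 0 < bound
  bound>0 = ℕₚ.m^n>0 h₀ ⦃ ℕ.>-nonZero h₀>0 ⦄ h₀

  Λ∤2 : ∀ q → Λ · q ≢ -[1+ 1 ]
  Λ∤2 q e = by ℤ.∣ q ∣ (trans (sym (ℤₚ.abs-* Λ q)) (cong ℤ.∣_∣ e))
    where
    by : ∀ n → suc (2 * bound) * n ≡ 2 → ⊥
    by zero    p = contradiction (trans (sym p) (ℕₚ.*-zeroʳ (suc (2 * bound)))) (λ ())
    by (suc n) p = ℕₚ.<⇒≱ (s≤s (ℕₚ.*-monoʳ-≤ 2 bound>0)) (≤-trans (ℕₚ.m≤m*n (suc (2 * bound)) (suc n)) (ℕₚ.≤-reflexive p))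

  power≤bound : ∀ {m a} → m ≤ h₀ → a ≤ h₀ → m ^ a ≤ bound
  power≤bound {m} {a} m≤ a≤ = ≤-trans (ℕₚ.^-monoˡ-≤ a m≤) (ℕₚ.^-monoʳ-≤ h₀ ⦃ ℕ.>-nonZero h₀>0 ⦄ a≤)

  -- `P` divides a power of `m` that is at most `bound`, so `P` and the power with exponent `a`
  -- differ by at most twice `bound`. Being congruent modulo the larger number Λ, they are equal.
  divisor≡power : ∀ {m} a b P Q p → 0 < m → m ≤ h₀ → a + b ≤ h₀ → P · Q ≡ pow (+ m) (a + b) → P ≡ pow (+ m) a ⊹ Λ · p → P ≡ pow (+ m) a
  divisor≡power {m} a b P Q p m>0 m≤ ab≤ e c = trans c (trans (cong (λ z → pow (+ m) a ⊹ Λ · z) p≡0) (trans (cong (pow (+ m) a ⊹_) (ℤₚ.*-zeroʳ Λ)) (ℤₚ.+-identityʳ (pow (+ m) a))))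
    where
    PQ : ℤ.∣ P ∣ * ℤ.∣ Q ∣ ≡ m ^ (a + b)
    PQ = trans (sym (ℤₚ.abs-* P Q)) (trans (cong ℤ.∣_∣ e) (cong ℤ.∣_∣ (pow-ℕ m (a + b))))
    Q≢0 : ℤ.∣ Q ∣ ≢ 0
    Q≢0 z = ℕₚ.m<n⇒n≢0 (ℕₚ.m^n>0 m ⦃ ℕ.>-nonZero m>0 ⦄ (a + b)) (trans (sym PQ) (trans (cong (ℤ.∣ P ∣ *_) z) (ℕₚ.*-zeroʳ ℤ.∣ P ∣)))
    P≤ : ℤ.∣ P ∣ ≤ bound
    P≤ = ≤-trans (ℕₚ.m≤m*n ℤ.∣ P ∣ ℤ.∣ Q ∣ ⦃ ℕ.≢-nonZero Q≢0 ⦄) (≤-trans (ℕₚ.≤-reflexive PQ) (power≤bound m≤ ab≤))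
    lem : ∀ x y → y ≡ (x ⊹ y) ⊹ ⊖ x
    lem = solve-∀
    Λp : Λ · p ≡ P ⊹ ⊖ (+ (m ^ a))
    Λp = trans (lem (pow (+ m) a) (Λ · p)) (cong₂ (λ x y → x ⊹ ⊖ y) (sym c) (pow-ℕ m a))
    Λp≤ : suc (2 * bound) * ℤ.∣ p ∣ ≤ 2 * bound
    Λp≤ = ≤-trans (ℕₚ.≤-reflexive (trans (sym (ℤₚ.abs-* Λ p)) (cong ℤ.∣_∣ Λp))) (≤-trans (ℤₚ.∣i+j∣≤∣i∣+∣j∣ P (⊖ (+ (m ^ a))))
      (≤-trans (ℕₚ.+-mono-≤ P≤ (≤-trans (ℕₚ.≤-reflexive (ℤₚ.∣-i∣≡∣i∣ (+ (m ^ a)))) (power≤bound m≤ (≤-trans (ℕₚ.m≤m+n a b) ab≤))))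
        (ℕₚ.≤-reflexive (cong (bound ℕ.+_) (sym (ℕₚ.+-identityʳ bound))))))
    p≡0 : p ≡ 0ℤ
    p≡0 = ℤₚ.∣i∣≡0⇒i≡0 (by ℤ.∣ p ∣ Λp≤)
      where
      by : ∀ n → suc (2 * bound) * n ≤ 2 * bound → n ≡ 0
      by zero    _ = refl
      by (suc n) l = contradiction (≤-trans (ℕₚ.m≤m*n (suc (2 * bound)) (suc n)) l) ℕₚ.1+n≰n

  Divisible : Kernel → Set
  Divisible K = ∀ x y → ∃[ c ] f K x y ≡ Λ · c

  -- Mass 1 serves the trees, and the further masses are those of the masked kernels in `few-edges`.
  -- Mass 0 is excluded because `impartial⇒hom` cancels a power of the mass.
  ImpL : List ℕ → List (ℕ × ℕ) → Set₁
  ImpL vs E = ∀ K → Divisible K → ∀ m → 0 < m → m ≤ h₀ → mass K ≡ + m → ∀ a → homL K vs E a ≡ pow (+ m) (length vs)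

  ImpL-↭ : ∀ {vs us E F} → vs ↭ us → E ↭ F → Unique vs → ImpL vs E → ImpL us F
  ImpL-↭ p q u imp K dv m m>0 m≤ e a = trans (sym (homL-↭ K p q u a)) (trans (imp K dv m m>0 m≤ e a) (cong (pow (+ m)) (↭-length p)))

  homL≡pow-m : ∀ K → Divisible K → ∀ m → mass K ≡ + m → ∀ vs E a → ∃[ q ] homL K vs E a ≡ pow (+ m) (length vs) ⊹ Λ · q
  homL≡pow-m K dv m e vs E a = proj₁ (homL≡pow K {Λ} dv vs E a) , trans (proj₂ (homL≡pow K {Λ} dv vs E a))
    (cong (λ z → pow z (length vs) ⊹ Λ · proj₁ (homL≡pow K {Λ} dv vs E a)) e)

  module _ (xs ys : List ℕ) {E F : List (ℕ × ℕ)} (u : Unique (xs ++ ys)) (small : length xs + length ys ≤ h₀)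
           (wE : ∀ {e} → e ∈ E → proj₁ e ∈ xs × proj₂ e ∈ xs) (wF : ∀ {e} → e ∈ F → proj₁ e ∈ ys × proj₂ e ∈ ys)
           (imp : ImpL (xs ++ ys) (E ++ F)) where

    product : ∀ K → Divisible K → ∀ m → 0 < m → m ≤ h₀ → mass K ≡ + m → ∀ a → homL K xs E a · homL K ys F a ≡ pow (+ m) (length xs + length ys)
    product K dv m m>0 m≤ e a = trans (sym (homL-split K xs ys u wE wF a)) (trans (imp K dv m m>0 m≤ e a) (cong (pow (+ m)) (Listₚ.length-++ xs)))

    ImpL-ˡ : ImpL xs E
    ImpL-ˡ K dv m m>0 m≤ e a = divisor≡power (length xs) (length ys) (homL K xs E a) (homL K ys F a) (proj₁ (homL≡pow-m K dv m e xs E a)) m>0 m≤ small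
      (product K dv m m>0 m≤ e a) (proj₂ (homL≡pow-m K dv m e xs E a))

    ImpL-ʳ : ImpL ys F
    ImpL-ʳ K dv m m>0 m≤ e a = divisor≡power (length ys) (length xs) (homL K ys F a) (homL K xs E a) (proj₁ (homL≡pow-m K dv m e ys F a)) m>0 m≤
      (subst (_≤ h₀) (ℕₚ.+-comm (length xs) (length ys)) small)
      (trans (ℤₚ.*-comm (homL K ys F a) (homL K xs E a)) (trans (product K dv m m>0 m≤ e a) (cong (pow (+ m)) (ℕₚ.+-comm (length xs) (length ys)))))
      (proj₂ (homL≡pow-m K dv m e ys F a))

  impartial⇒ImpL : ∀ H → IsOriented H → Impartial H → ImpL (labels H) (arcs H)
  impartial⇒ImpL H o imp K dv m m>0 m≤ e a = trans (sym (hom-labelled K H a)) (trans (impartial⇒hom H o imp K (λ z → ℕₚ.m<n⇒n≢0 m>0 (ℤₚ.+-injective (trans (sym e) z))))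
    (cong₂ pow e (sym (Listₚ.length-tabulate {n = size H} Fin.toℕ))))

-- The power of 2 in a factorial

halves-of : ∀ n → ∃[ m ] (n ≡ m + m ⊎ n ≡ suc (m + m))
halves-of zero    = 0 , inj₁ refl
halves-of (suc n) with halves-of n
... | m , inj₁ e = m , inj₂ (cong suc e)
... | m , inj₂ e = suc m , inj₁ (cong suc (trans e (sym (ℕₚ.+-suc m m))))

odd≢even : ∀ a b → suc (a + a) ≢ b + b
odd≢even a       zero    ()
odd≢even zero    (suc b) e = contradiction (trans (ℕₚ.suc-injective e) (ℕₚ.+-suc b b)) (λ ())
odd≢even (suc a) (suc b) e = odd≢even a b (ℕₚ.suc-injective (trans (sym (ℕₚ.+-suc (suc a) a)) (trans (ℕₚ.suc-injective e) (ℕₚ.+-suc b b))))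

odd-cancel : ∀ m x y q → x * suc (y + y) ≡ 2 ^ m * q → ∃[ q′ ] x ≡ 2 ^ m * q′
odd-cancel zero    x y q e = x , sym (ℕₚ.+-identityʳ x)
odd-cancel (suc m) x y q e with halves-of x
... | x′ , inj₂ refl = contradiction (trans (sym (lem x′ y)) (trans e (lem′ (2 ^ m) q))) (odd≢even (x′ + y + (x′ * y + x′ * y)) (2 ^ m * q))
  where
  lem : ∀ a b → suc (a + a) * suc (b + b) ≡ suc ((a + b + (a * b + a * b)) + (a + b + (a * b + a * b)))
  lem = ℕ-solve
  lem′ : ∀ a b → 2 * a * b ≡ a * b + a * b
  lem′ = ℕ-solve
... | x′ , inj₁ refl = let q′ , r = odd-cancel m x′ y q (ℕₚ.*-cancelˡ-≡ (x′ * suc (y + y)) (2 ^ m * q) 2 (trans (lem x′ (suc (y + y))) (trans e (lem′ (2 ^ m) q)))) in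
    q′ , trans (cong₂ _+_ r r) (lem″ (2 ^ m) q′)
  where
  lem : ∀ a b → 2 * (a * b) ≡ (a + a) * b
  lem = ℕ-solve
  lem′ : ∀ a b → 2 * a * b ≡ 2 * (a * b)
  lem′ = ℕ-solve
  lem″ : ∀ a b → a * b + a * b ≡ 2 * a * b
  lem″ = ℕ-solve

-- The even factors of (2m)! give 2 ^ m times m!, and the odd ones an odd number. The witness comes
-- from (2m + 1)(2a + 1) = 2(m + a + 2ma) + 1.
factorial-double : ∀ m → ∃[ a ] (m + m) ℕ.! ≡ 2 ^ m * (m ℕ.! * suc (a + a))
factorial-double zero    = 0 , refl
factorial-double (suc m) = let a , e = factorial-double m in m + a + (m * a + m * a) ,
    trans (cong (λ k → suc k ℕ.!) (ℕₚ.+-suc m m)) (trans (cong (λ z → suc (suc (m + m)) * (suc (m + m) * z)) e) (lem m a (2 ^ m) (m ℕ.!)))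
  where
  lem : ∀ m a p f → suc (suc (m + m)) * (suc (m + m) * (p * (f * suc (a + a)))) ≡ 2 * p * (suc m * f * suc ((m + a + (m * a + m * a)) + (m + a + (m * a + m * a))))
  lem = ℕ-solve

-- Let m be half of k, rounded down. By `factorial-double` and cancellation of odd factors,
-- divisibility of k! by 2 ^ k descends to divisibility of m! by 2 ^ m, and it fails at k = 1.
2^k∤k! : ∀ k → 0 < k → ∀ q → k ℕ.! ≢ 2 ^ k * q
2^k∤k! k = go k (<-wellFounded k)
  where
  go : ∀ k → Acc _<_ k → 0 < k → ∀ q → k ℕ.! ≢ 2 ^ k * q
  even : ∀ m → Acc _<_ (m + m) → 0 < m + m → ∀ q → (m + m) ℕ.! ≢ 2 ^ (m + m) * q
  even zero    ac        () q e
  even (suc m) (acc rec) _  q e = go (suc m) (rec (ℕₚ.m<m+n (suc m) (s≤s z≤n))) (s≤s z≤n) (proj₁ cancelled) (proj₂ cancelled)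
    where
    p = 2 ^ suc m
    d = factorial-double (suc m)
    cancelled : ∃[ q′ ] suc m ℕ.! ≡ p * q′
    cancelled = odd-cancel (suc m) (suc m ℕ.!) (proj₁ d) q (ℕₚ.*-cancelˡ-≡ _ _ p ⦃ ℕₚ.m^n≢0 2 (suc m) ⦄
      (trans (sym (proj₂ d)) (trans e (trans (cong (_* q) (ℕₚ.^-distribˡ-+-* 2 (suc m) (suc m))) (ℕₚ.*-assoc p p q)))))
  odd : ∀ m → Acc _<_ (suc (m + m)) → ∀ q → suc (m + m) ℕ.! ≢ 2 ^ suc (m + m) * q
  odd zero    ac        q e = odd≢even 0 q (trans e (cong (q ℕ.+_) (ℕₚ.+-identityʳ q)))
  odd (suc m) (acc rec) q e = go (suc m) (rec (s≤s (ℕₚ.m≤m+n (suc m) (suc m)))) (s≤s z≤n) (proj₁ cancelled) (proj₂ cancelled)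
    where
    p = 2 ^ suc m
    d = factorial-double (suc m)
    x = proj₁ d
    lem : ∀ p m a f → p * (f * suc ((m + a + (m * a + m * a)) + (m + a + (m * a + m * a)))) ≡ suc (m + m) * (p * (f * suc (a + a)))
    lem = ℕ-solve
    lem′ : ∀ p q → 2 * (p * p) * q ≡ p * (p * (2 * q))
    lem′ = ℕ-solve
    cancelled : ∃[ q′ ] suc m ℕ.! ≡ p * q′
    cancelled = odd-cancel (suc m) (suc m ℕ.!) (suc m + x + (suc m * x + suc m * x)) (2 * q) (ℕₚ.*-cancelˡ-≡ _ _ p ⦃ ℕₚ.m^n≢0 2 (suc m) ⦄
      (trans (lem p (suc m) x (suc m ℕ.!)) (trans (cong (suc (suc m + suc m) *_) (sym (proj₂ d))) (trans e
        (trans (cong (λ z → 2 * z * q) (ℕₚ.^-distribˡ-+-* 2 (suc m) (suc m))) (lem′ p q))))))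
  go k ac k>0 q e = by (halves-of k)
    where
    by : ∃[ m ] (k ≡ m + m ⊎ k ≡ suc (m + m)) → ⊥
    by (m , inj₁ refl) = even m ac k>0 q e
    by (m , inj₂ refl) = odd m ac q e

-- Iterated differences

Δ : ℕ → (ℤ → ℤ) → ℤ → ℤ
Δ zero    g x = g x
Δ (suc n) g x = Δ n g (x ⊹ 1ℤ) ⊹ ⊖ Δ n g x

Δ-product : ∀ n g x → Δ (suc n) (λ y → y · g y) x ≡ (x ⊹ + suc n) · Δ (suc n) g x ⊹ (+ suc n) · Δ n g x
Δ-product zero    g x = lem x (g (x ⊹ 1ℤ)) (g x)
  where
  lem : ∀ x a b → (x ⊹ 1ℤ) · a ⊹ ⊖ (x · b) ≡ (x ⊹ 1ℤ) · (a ⊹ ⊖ b) ⊹ 1ℤ · b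
  lem = solve-∀
Δ-product (suc n) g x = trans (cong₂ (λ s t → s ⊹ ⊖ t) (Δ-product n g (x ⊹ 1ℤ)) (Δ-product n g x))
  (lem x (+ suc n) (Δ n g (x ⊹ 1ℤ ⊹ 1ℤ)) (Δ n g (x ⊹ 1ℤ)) (Δ n g x))
  where
  lem : ∀ x n a b c → ((x ⊹ 1ℤ ⊹ n) · (a ⊹ ⊖ b) ⊹ n · b) ⊹ ⊖ ((x ⊹ n) · (b ⊹ ⊖ c) ⊹ n · c)
      ≡ (x ⊹ (1ℤ ⊹ n)) · ((a ⊹ ⊖ b) ⊹ ⊖ (b ⊹ ⊖ c)) ⊹ (1ℤ ⊹ n) · (b ⊹ ⊖ c)
  lem = solve-∀

Δ-const : ∀ n c x → Δ (suc n) (λ _ → c) x ≡ 0ℤ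
Δ-const zero    c x = ℤₚ.+-inverseʳ c
Δ-const (suc n) c x = cong₂ (λ s t → s ⊹ ⊖ t) (Δ-const n c (x ⊹ 1ℤ)) (Δ-const n c x)

Δ-zero : ∀ i j → i ≤ j → ∀ x → Δ (suc j) (λ y → pow y i) x ≡ 0ℤ
Δ-zero zero    j       l       x = Δ-const j 1ℤ x
Δ-zero (suc i) (suc j) (s≤s l) x = trans (Δ-product (suc j) (λ y → pow y i) x) (trans
  (cong₂ (λ s t → (x ⊹ + suc (suc j)) · s ⊹ (+ suc (suc j)) · t) (Δ-zero i (suc j) (ℕₚ.m≤n⇒m≤1+n l) x) (Δ-zero i j l x))
  (lem (x ⊹ + suc (suc j)) (+ suc (suc j))))
  where
  lem : ∀ a b → a · 0ℤ ⊹ b · 0ℤ ≡ 0ℤ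
  lem = solve-∀

Δ-factorial : ∀ n x → Δ n (λ y → pow y n) x ≡ + (n ℕ.!)
Δ-factorial zero    x = refl
Δ-factorial (suc n) x = trans (Δ-product n (λ y → pow y n) x) (trans
  (cong₂ (λ s t → (x ⊹ + suc n) · s ⊹ (+ suc n) · t) (Δ-zero n n ≤-refl x) (Δ-factorial n x))
  (trans (cong (_⊹ (+ suc n) · (+ (n ℕ.!))) (ℤₚ.*-zeroʳ (x ⊹ + suc n))) (trans (ℤₚ.+-identityˡ _) (sym (ℤₚ.pos-* (suc n) (n ℕ.!))))))

-- Arc lists and spanning trees

dir : ℤ → ℕ → ℕ → ℕ × ℕ
dir s a b = if ⌊ s ℤ.≟ 1ℤ ⌋ then (a , b) else (b , a)

arcsT : Tr ℕ → List (ℕ × ℕ)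
arcsT (leaf _)     = []
arcsT (join s A B) = dir s (rt A) (rt B) ∷ (arcsT A ++ arcsT B)

arcsT-within : ∀ S {e} → e ∈ arcsT S → proj₁ e ∈ verts S × proj₂ e ∈ verts S
arcsT-within (join s A B) (here refl) = go ⌊ s ℤ.≟ 1ℤ ⌋
  where
  go : ∀ b → proj₁ (if b then (rt A , rt B) else (rt B , rt A)) ∈ verts A ++ verts B × proj₂ (if b then (rt A , rt B) else (rt B , rt A)) ∈ verts A ++ verts B
  go true  = ∈-++⁺ˡ (rt∈verts A) , ∈-++⁺ʳ (verts A) (rt∈verts B)
  go false = ∈-++⁺ʳ (verts A) (rt∈verts B) , ∈-++⁺ˡ (rt∈verts A)
arcsT-within (join s A B) (there m) with ∈-++⁻ (arcsT A) m
... | inj₁ k = ∈-++⁺ˡ (proj₁ (arcsT-within A k)) , ∈-++⁺ˡ (proj₂ (arcsT-within A k))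
... | inj₂ k = ∈-++⁺ʳ (verts A) (proj₁ (arcsT-within B k)) , ∈-++⁺ʳ (verts A) (proj₂ (arcsT-within B k))

arcsT-≃ : {A B : Tr ℕ} → A ≃ B → arcsT A ↭ arcsT B
arcsT-≃ ≃-refl        = ↭-refl
arcsT-≃ (≃-trans p q) = ↭-trans (arcsT-≃ p) (arcsT-≃ q)
arcsT-≃ (≃-comm {s} {t} {A} {B} {C}) = ↭-swap (dir s (rt A) (rt C)) (dir t (rt A) (rt B))
  (↭-trans (↭-reflexive (Listₚ.++-assoc (arcsT A) (arcsT B) (arcsT C))) (↭-trans (++⁺ˡ (arcsT A) (++-comm (arcsT B) (arcsT C)))
    (↭-reflexive (sym (Listₚ.++-assoc (arcsT A) (arcsT C) (arcsT B))))))
arcsT-≃ (≃-cong {s} {A} {A′} {B} {B′} p q) = ↭-trans (↭-reflexive (cong₂ (λ x y → dir s x y ∷ (arcsT A ++ arcsT B)) (≃-rt p) (≃-rt q)))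
  (↭-prep _ (++⁺↭ (arcsT-≃ p) (arcsT-≃ q)))

arcsT-≈ : {A B : Tr ℕ} → Units A → A ≈ B → arcsT A ↭ arcsT B
arcsT-≈ u (≈-of p)      = arcsT-≃ p
arcsT-≈ u (≈-trans p q) = ↭-trans (arcsT-≈ u p) (arcsT-≈ (≈-units p u) q)
arcsT-≈ (join us _ _) (≈-rot {s} {A} {B}) = ↭-trans (↭-reflexive (cong (_∷ (arcsT A ++ arcsT B)) (turn us))) (↭-prep _ (++-comm (arcsT A) (arcsT B)))
  where
  turn : s ≡ 1ℤ ⊎ s ≡ -1ℤ → dir s (rt A) (rt B) ≡ dir (⊖ s) (rt B) (rt A)
  turn (inj₁ refl) = refl
  turn (inj₂ refl) = refl

arcsT-length : ∀ S → suc (length (arcsT S)) ≡ sz S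
arcsT-length (leaf _)     = refl
arcsT-length (join s A B) = trans (cong (λ z → suc (suc z)) (Listₚ.length-++ (arcsT A))) (trans (sym (cong suc (ℕₚ.+-suc (length (arcsT A)) (length (arcsT B)))))
  (cong₂ _+_ (arcsT-length A) (arcsT-length B)))

arcsT-unique : ∀ S → Unique (verts S) → Unique (arcsT S)
arcsT-unique (leaf _)     u = []
arcsT-unique (join s A B) u with unique-++⁻ (verts A) u
... | uA , uB , d = All.tabulate (λ m e → bridge m (sym e)) ∷ unique-++ (arcsT-unique A uA) (arcsT-unique B uB) (λ p q → d (proj₁ (arcsT-within A p)) (proj₁ (arcsT-within B q)))
  where
  ends : ∀ {e} → e ≡ dir s (rt A) (rt B) → e ≡ (rt A , rt B) ⊎ e ≡ (rt B , rt A)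
  ends = go ⌊ s ℤ.≟ 1ℤ ⌋
    where
    go : ∀ b {e} → e ≡ (if b then (rt A , rt B) else (rt B , rt A)) → e ≡ (rt A , rt B) ⊎ e ≡ (rt B , rt A)
    go true  = inj₁
    go false = inj₂
  bridge : ∀ {e} → e ∈ arcsT A ++ arcsT B → e ≡ dir s (rt A) (rt B) → ⊥
  bridge m q with ∈-++⁻ (arcsT A) m | ends q
  ... | inj₁ k | inj₁ refl = d (proj₂ (arcsT-within A k)) (rt∈verts B)
  ... | inj₁ k | inj₂ refl = d (proj₁ (arcsT-within A k)) (rt∈verts B)
  ... | inj₂ k | inj₁ refl = d (rt∈verts A) (proj₁ (arcsT-within B k))
  ... | inj₂ k | inj₂ refl = d (rt∈verts A) (proj₂ (arcsT-within B k))

module _ (K : Kernel) where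

  -- As in `∑-rel`, the factor `ψ` at the root stands for the edge to the parent.
  homL-rooted : ∀ S → Unique (verts S) → Units S → (ψ : Ω K → ℤ) → ∀ a →
                LS K (verts S) (λ b → EdgeP K (arcsT S) b · ψ (b (rt S))) a ≡ ∑ (pts K) (λ x → w K x · (gs 1ℤ K S x · ψ x))
  homL-rooted (leaf v)     u un ψ a = ∑-cong (pts K) (λ x → cong (λ y → w K x · (1ℤ · ψ y)) (set-hit a v x))
  homL-rooted (join s A B) u (join us uA uB) ψ a = trans (LS-++ K (verts A) (verts B) _ a) (trans (LS-cong K (verts A) a inner)
      (trans (homL-rooted A (proj₁ split) uA (λ x → ψ x · br 1ℤ K s B x) a)
        (∑-cong (pts K) (λ x → cong (w K x ·_) (lem₃ (gs 1ℤ K A x) (ψ x) (br 1ℤ K s B x))))))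
    where
    split = unique-++⁻ (verts A) u
    fr : Asg K → ℤ
    fr c = 1ℤ ⊹ f K (c (proj₁ (dir s (rt A) (rt B)))) (c (proj₂ (dir s (rt A) (rt B))))
    bridge : s ≡ 1ℤ ⊎ s ≡ -1ℤ → ∀ c → fr c ≡ 1ℤ ⊹ s · f K (c (rt A)) (c (rt B))
    bridge (inj₁ refl) c = cong (1ℤ ⊹_) (sym (ℤₚ.*-identityˡ (f K (c (rt A)) (c (rt B)))))
    bridge (inj₂ refl) c = cong (1ℤ ⊹_) (trans (skew K (c (rt B)) (c (rt A))) (sym (ℤₚ.-1*i≡-i (f K (c (rt A)) (c (rt B))))))
    lem₁ : ∀ d x y p → d · (x · y) · p ≡ (x · p) · (y · d)
    lem₁ = solve-∀
    lem₂ : ∀ v g d → v · (g · d) ≡ v · (d · g)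
    lem₂ = solve-∀
    lem₃ : ∀ g p b → g · (p · b) ≡ g · b · p
    lem₃ = solve-∀
    inner : ∀ b → LS K (verts B) (λ c → EdgeP K (arcsT (join s A B)) c · ψ (c (rt A))) b ≡ EdgeP K (arcsT A) b · (ψ (b (rt A)) · br 1ℤ K s B (b (rt A)))
    inner b = trans (LS-cong∈ K (verts B) b (λ c e → trans (cong₂ (λ x y → x · y · ψ (c (rt A))) (bridge us c) (∏-++ (arcsT A) (arcsT B) _))
        (trans (lem₁ (1ℤ ⊹ s · f K (c (rt A)) (c (rt B))) (EdgeP K (arcsT A) c) (EdgeP K (arcsT B) c) (ψ (c (rt A))))
          (cong₂ (λ x y → x · (EdgeP K (arcsT B) c · y))
            (cong₂ _·_ (EdgeP-local K (arcsT A) (λ {x} m → e (proj₁ x) (out (proj₁ (arcsT-within A m))) , e (proj₂ x) (out (proj₂ (arcsT-within A m))))) (cong ψ (e (rt A) (out (rt∈verts A)))))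
            (cong (λ z → 1ℤ ⊹ s · f K z (c (rt B))) (e (rt A) (out (rt∈verts A))))))))
      (trans (LS-* K (verts B) (EdgeP K (arcsT A) b · ψ (b (rt A))) (λ c → EdgeP K (arcsT B) c · (1ℤ ⊹ s · f K (b (rt A)) (c (rt B)))) b)
        (trans (cong (EdgeP K (arcsT A) b · ψ (b (rt A)) ·_) (trans (homL-rooted B (proj₁ (proj₂ split)) uB (λ y → 1ℤ ⊹ s · f K (b (rt A)) y) b)
            (∑-cong (pts K) (λ y → lem₂ (w K y) (gs 1ℤ K B y) (1ℤ ⊹ s · f K (b (rt A)) y)))))
          (ℤₚ.*-assoc (EdgeP K (arcsT A) b) (ψ (b (rt A))) (br 1ℤ K s B (b (rt A))))))
      where
      out : ∀ {z} → z ∈ verts A → z ∉ verts B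
      out = proj₂ (proj₂ split)

  homL-tree : ∀ S → Unique (verts S) → Units S → ∀ a → homL K (verts S) (arcsT S) a ≡ Φ K S
  homL-tree S u un a = trans (LS-cong K (verts S) a (λ b → sym (ℤₚ.*-identityʳ (EdgeP K (arcsT S) b)))) (trans (homL-rooted S u un (λ _ → 1ℤ) a)
    (∑-cong (pts K) (λ x → cong (w K x ·_) (ℤₚ.*-identityʳ (gs 1ℤ K S x)))))

record Spanning (vs : List ℕ) (E : List (ℕ × ℕ)) : Set where
  field
    tree   : Tr ℕ
    unique : Unique (verts tree)
    units  : Units tree
    inside : ∀ {z} → z ∈ verts tree → z ∈ vs
    edges  : ∀ {e} → e ∈ arcsT tree → e ∈ E
    closed : ∀ {e} → e ∈ E → (proj₁ e ∈ verts tree → proj₂ e ∈ verts tree) × (proj₂ e ∈ verts tree → proj₁ e ∈ verts tree)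

module _ (vs : List ℕ) (E : List (ℕ × ℕ)) (within : ∀ {e} → e ∈ E → proj₁ e ∈ vs × proj₂ e ∈ vs) where

  Leaves : Tr ℕ → ℕ × ℕ → Set
  Leaves S e = (proj₁ e ∈ verts S × proj₂ e ∉ verts S) ⊎ (proj₂ e ∈ verts S × proj₁ e ∉ verts S)

  leaves? : ∀ S e → Dec (Leaves S e)
  leaves? S e = (proj₁ e ∈? verts S ×-dec ¬? (proj₂ e ∈? verts S)) ⊎-dec (proj₂ e ∈? verts S ×-dec ¬? (proj₁ e ∈? verts S))

  -- Rerooting the current tree at the known endpoint of a leaving arc allows the new vertex to be
  -- attached as a leaf at the root. The fuel `n` exceeds the number of vertices still missing, so
  -- it cannot run out.
  grow : ∀ n (S : Tr ℕ) → length vs < sz S + n → Unique (verts S) → Units S → (∀ {z} → z ∈ verts S → z ∈ vs) → (∀ {e} → e ∈ arcsT S → e ∈ E) → Spanning vs E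
  grow zero    S l u un ins ed = contradiction (subst (length vs <_) (ℕₚ.+-identityʳ (sz S)) l)
    (ℕₚ.≤⇒≯ (subst (_≤ length vs) (length-verts S) (unique-⊆⇒≤ u ins)))
  grow (suc n) S l u un ins ed = go (Any.any? (leaves? S) E)
    where
    extend : ∀ s x y → s ≡ 1ℤ ⊎ s ≡ -1ℤ → x ∈ verts S → y ∉ verts S → y ∈ vs → dir s x y ∈ E → Spanning vs E
    extend s x y us x∈ y∉ y∈ d with reroot-at S x∈
    ... | R , r , q = grow n (join s R (leaf y))
          (subst (length vs <_) (trans (ℕₚ.+-suc (sz S) n) (cong (_+ n) (trans (ℕₚ.+-comm 1 (sz S)) (cong (_+ 1) (≈-sz (reroot-≈ r)))))) l)
          (unique-++ (unique-↭ perm u) ([] ∷ []) (λ { p (here refl) → y∉ (∈-resp-↭ (↭-sym perm) p) }))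
          (join us (≈-units (reroot-≈ r) un) leaf)
          (λ m → [ (λ k → ins (∈-resp-↭ (↭-sym perm) k)) , (λ { (here refl) → y∈ }) ] (∈-++⁻ (verts R) m))
          (λ { (here refl) → subst (λ z → dir s z y ∈ E) (sym q) d
             ; (there m) → ed (∈-resp-↭ (↭-sym (arcsT-≈ un (reroot-≈ r))) (subst (_ ∈_) (Listₚ.++-identityʳ (arcsT R)) m)) })
      where
      perm : verts S ↭ verts R
      perm = ≈-verts (reroot-≈ r)
    go : Dec (Any (Leaves S) E) → Spanning vs E
    go (yes an) with find an
    ... | e , m , inj₁ (p , q) = extend 1ℤ (proj₁ e) (proj₂ e) (inj₁ refl) p q (proj₂ (within m)) m
    ... | e , m , inj₂ (p , q) = extend -1ℤ (proj₂ e) (proj₁ e) (inj₂ refl) p q (proj₁ (within m)) m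
    go (no none) = record { tree = S ; unique = u ; units = un ; inside = ins ; edges = ed
      ; closed = λ {e} m → (λ p → remain (proj₂ e) (λ k → stuck m (inj₁ (p , k)))) , (λ p → remain (proj₁ e) (λ k → stuck m (inj₂ (p , k)))) }
      where
      stuck : ∀ {e} → e ∈ E → ¬ Leaves S e
      stuck m k = none (Any.map (λ { refl → k }) m)
      remain : ∀ z → ¬ (z ∉ verts S) → z ∈ verts S
      remain z k with z ∈? verts S
      ... | yes p = p
      ... | no n  = contradiction n k

  spanning : ∀ x → x ∈ vs → Spanning vs E
  spanning x m = grow (length vs) (leaf x) ≤-refl ([] ∷ []) leaf (λ { (here refl) → m }) (λ ())

-- A connected graph with more edges than a tree is not impartial: the number of bijections, k!, would be divisible by 2^k.

Alt-cong∈ : ∀ ys {F G : (ℕ → Bool) → ℤ} a → (∀ b → (∀ z → z ∉ ys → b z ≡ a z) → F b ≡ G b) → Alt ys F a ≡ Alt ys G a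
Alt-cong∈ []       a h = h a (λ _ _ → refl)
Alt-cong∈ (y ∷ ys) a h = cong₂ (λ u v → u ⊹ ⊖ v) (step true) (step false)
  where
  step : ∀ t → Alt ys _ (upd a y t) ≡ Alt ys _ (upd a y t)
  step t = Alt-cong∈ ys (upd a y t) (λ b e → h b (λ z n → trans (e z (λ m → n (there m))) (upd-miss a t (λ q → n (here q)))))

weight : List ℕ → (ℕ → Bool) → ℤ
weight ys m = ∑ ys (λ y → 𝟙 (m y))

Alt-weight : ∀ ys → Unique ys → ∀ g c a → Alt ys (λ m → g (c ⊹ weight ys m)) a ≡ Δ (length ys) g c
Alt-weight []       u       g c a = cong g (ℤₚ.+-identityʳ c)
Alt-weight (y ∷ ys) (n ∷ u) g c a = cong₂ (λ s t → s ⊹ ⊖ t)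
  (trans (side true) (Alt-weight ys u g (c ⊹ 1ℤ) (upd a y true)))
  (trans (side false) (trans (cong (λ z → Alt ys (λ m → g (z ⊹ weight ys m)) (upd a y false)) (ℤₚ.+-identityʳ c)) (Alt-weight ys u g c (upd a y false))))
  where
  side : ∀ t → Alt ys (λ m → g (c ⊹ (𝟙 (m y) ⊹ weight ys m))) (upd a y t) ≡ Alt ys (λ m → g (c ⊹ 𝟙 t ⊹ weight ys m)) (upd a y t)
  side t = Alt-cong∈ ys (upd a y t) (λ m e → cong g (trans (cong (λ z → c ⊹ (𝟙 z ⊹ weight ys m)) (trans (e y (λ k → All.lookup n k refl)) (upd-hit a y t)))
    (sym (ℤₚ.+-assoc c (𝟙 t) (weight ys m)))))

weight-ℕ : ∀ ys m → ∃[ n ] weight ys m ≡ + n × n ≤ length ys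
weight-ℕ []       m = 0 , refl , z≤n
weight-ℕ (y ∷ ys) m with weight-ℕ ys m | m y
... | n , e , l | true  = suc n , cong (1ℤ ⊹_) e , s≤s l
... | n , e , l | false = n , trans (ℤₚ.+-identityˡ (weight ys m)) e , ℕₚ.m≤n⇒m≤1+n l

weight-0 : ∀ ys m → weight ys m ≡ 0ℤ → ∀ y → y ∈ ys → 𝟙 (m y) ≡ 0ℤ
weight-0 (y ∷ ys) m e z k with m y in q
... | true  = contradiction (trans (sym (cong (1ℤ ⊹_) (proj₁ (proj₂ (weight-ℕ ys m))))) e) (λ ())
weight-0 (y ∷ ys) m e z (here refl) | false = cong 𝟙 q
weight-0 (y ∷ ys) m e z (there k)   | false = weight-0 ys m (trans (sym (ℤₚ.+-identityˡ (weight ys m))) e) z k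

unique-map : ∀ (a : ℕ → ℕ) xs → Unique (map a xs) → ∀ {u v} → u ∈ xs → v ∈ xs → a u ≡ a v → u ≡ v
unique-map a (x ∷ xs) (n ∷ un) (here refl) (here refl) e = refl
unique-map a (x ∷ xs) (n ∷ un) (here refl) (there q)   e = contradiction e (All.lookup n (∈-map⁺ a q))
unique-map a (x ∷ xs) (n ∷ un) (there p)   (here refl) e = contradiction (sym e) (All.lookup n (∈-map⁺ a p))
unique-map a (x ∷ xs) (n ∷ un) (there p)   (there q)   e = unique-map a xs un p q e

DivBy : ℤ → ℤ → Set
DivBy d x = ∃[ q ] x ≡ d · q

∑-DivBy : {X : Set} (xs : List X) (g : X → ℤ) (d : ℤ) → (∀ x → DivBy d (g x)) → DivBy d (∑ xs g)
∑-DivBy xs g d h = ∑ xs (λ x → proj₁ (h x)) , trans (∑-cong xs (λ x → proj₂ (h x))) (∑-* xs d _)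

∏-even : {X : Set} (xs : List X) (g : X → ℤ) → (∀ x → x ∈ xs → DivBy (+ 2) (g x)) → DivBy (pow (+ 2) (length xs)) (∏ xs g)
∏-even []       g h = 1ℤ , refl
∏-even (x ∷ xs) g h = let p , e = h x (here refl) ; q , r = ∏-even xs g (λ y m → h y (there m)) in
  p · q , trans (cong₂ _·_ e r) (lem (+ 2) p (pow (+ 2) (length xs)) q)
  where
  lem : ∀ t p d q → t · p · (d · q) ≡ t · d · (p · q)
  lem = solve-∀

module Excess (h₀ : ℕ) (h₀>0 : 0 < h₀) (ys : List ℕ) (u : Unique ys) (ys≤ : length ys ≤ h₀) (ys>0 : 0 < length ys) (E : List (ℕ × ℕ))
              (within : ∀ {e} → e ∈ E → proj₁ e ∈ ys × proj₂ e ∈ ys) (irr : ∀ {e} → e ∈ E → proj₁ e ≢ proj₂ e) where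
  open Scale h₀ h₀>0

  -- The sign matrix of a transitive tournament on the labels. As Λ is odd, every edge with distinct
  -- images has an even factor.
  τ : ℕ → ℕ → ℤ
  τ x y = 𝟙 ⌊ x ℕ.<? y ⌋ ⊹ ⊖ 𝟙 ⌊ y ℕ.<? x ⌋

  K[_] : (ℕ → Bool) → Kernel
  K[ m ] = record { Ω = ℕ ; pts = ys ; w = λ x → 𝟙 (m x) ; f = λ x y → Λ · τ x y ; skew = λ x y → lem Λ (𝟙 ⌊ x ℕ.<? y ⌋) (𝟙 ⌊ y ℕ.<? x ⌋) }
    where
    lem : ∀ l a b → l · (a ⊹ ⊖ b) ≡ ⊖ (l · (b ⊹ ⊖ a))
    lem = solve-∀

  product-of : (ℕ → ℕ) → ℤ
  product-of = EdgeP K[ (λ _ → true) ] E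

  even-factor : ∀ x y → x ≢ y → DivBy (+ 2) (1ℤ ⊹ Λ · τ x y)
  even-factor x y n with <-cmp x y
  ... | tri≈ _ e _ = contradiction e n
  ... | tri< a _ b = + suc bound , trans (cong₂ (λ s t → 1ℤ ⊹ Λ · (𝟙 s ⊹ ⊖ 𝟙 t)) (yes! (x ℕ.<? y) a) (no! (y ℕ.<? x) b))
        (trans (cong (λ z → 1ℤ ⊹ (1ℤ ⊹ z) · (1ℤ ⊹ ⊖ 0ℤ)) (ℤₚ.pos-* 2 bound)) (lem (+ bound)))
    where
    lem : ∀ b → 1ℤ ⊹ (1ℤ ⊹ (+ 2) · b) · (1ℤ ⊹ ⊖ 0ℤ) ≡ (+ 2) · (1ℤ ⊹ b)
    lem = solve-∀
  ... | tri> b _ a = ⊖ (+ bound) , trans (cong₂ (λ s t → 1ℤ ⊹ Λ · (𝟙 s ⊹ ⊖ 𝟙 t)) (no! (x ℕ.<? y) b) (yes! (y ℕ.<? x) a))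
        (trans (cong (λ z → 1ℤ ⊹ (1ℤ ⊹ z) · (0ℤ ⊹ ⊖ 1ℤ)) (ℤₚ.pos-* 2 bound)) (lem (+ bound)))
    where
    lem : ∀ b → 1ℤ ⊹ (1ℤ ⊹ (+ 2) · b) · (0ℤ ⊹ ⊖ 1ℤ) ≡ (+ 2) · (⊖ b)
    lem = solve-∀

  D : ℤ
  D = pow (+ 2) (length E)

  bijective-divisible : ∀ b ds → ys ↭ ds → All (_∈ map b ds) ys → DivBy D (product-of b)
  bijective-divisible b ds p cov = ∏-even E _ (λ e m → even-factor (b (proj₁ e)) (b (proj₂ e)) (λ q →
      irr m (unique-map b ds um (∈-resp-↭ p (proj₁ (within m))) (∈-resp-↭ p (proj₂ (within m))) q)))
    where
    um : Unique (map b ds)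
    um = unique-↭ (↭-sym (unique-⊆-full⇒↭ u (All.lookup cov) (ℕₚ.≤-reflexive (trans (Listₚ.length-map b ds) (sym (↭-length p)))))) u

  -- `ds` are the vertices already assigned and `vs` those still to be summed. When `vs` is
  -- exhausted, the alternating sum over masks leaves the bijective assignments, and these have an
  -- even factor for each edge.
  alternating-divisible : ∀ vs ds a → ys ↭ ds ++ vs → Unique (ds ++ vs) →
                          DivBy D (Alt ys (λ m → mono (map a ds) m · LS K[ m ] vs product-of a) (λ _ → true))
  alternating-divisible [] ds a p un = by (covers ys (map a ds)) refl
    where
    value : Alt ys (λ m → mono (map a ds) m · product-of a) (λ _ → true) ≡ 𝟙 ⌊ covers ys (map a ds) ⌋ · product-of a
    value = trans (Alt-*ʳ ys (mono (map a ds)) (product-of a) (λ _ → true)) (cong (_· product-of a) (Alt-mono ys (map a ds) u))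
    by : (c : Dec (All (_∈ map a ds) ys)) → c ≡ covers ys (map a ds) → DivBy D (Alt ys (λ m → mono (map a ds) m · product-of a) (λ _ → true))
    by (yes cov) e = let q , r = bijective-divisible a ds (subst (ys ↭_) (Listₚ.++-identityʳ ds) p) cov in
      q , trans value (trans (cong (λ c → 𝟙 ⌊ c ⌋ · product-of a) (sym e)) (trans (ℤₚ.*-identityˡ (product-of a)) r))
    by (no _)    e = 0ℤ , trans value (trans (cong (λ c → 𝟙 ⌊ c ⌋ · product-of a) (sym e)) (trans (ℤₚ.*-zeroˡ (product-of a)) (sym (ℤₚ.*-zeroʳ D))))
  alternating-divisible (v ∷ vs) ds a p un = let q , r = ∑-DivBy ys (λ x → Alt ys (λ m → mono (map (set a v x) (v ∷ ds)) m · LS K[ m ] vs product-of (set a v x)) (λ _ → true)) D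
                                                            (λ x → alternating-divisible vs (v ∷ ds) (set a v x) (↭-trans p (shift v ds vs)) (unique-↭ (shift v ds vs) un))
    in q , trans (trans (Alt-cong ys distribute (λ _ → true)) (Alt-∑ ys ys _ (λ _ → true))) r
    where
    v∉ : v ∉ ds
    v∉ m = proj₂ (proj₂ (unique-++⁻ ds un)) m (here refl)
    labels-kept : ∀ x → map (set a v x) (v ∷ ds) ≡ x ∷ map a ds
    labels-kept x = cong₂ _∷_ (set-hit a v x) (Listₚ.map-cong-local (All.tabulate (λ {z} m → set-miss a x (λ e → v∉ (subst (_∈ ds) e m)))))
    lem : ∀ m o l → m · (o · l) ≡ o · m · l
    lem = solve-∀
    distribute : ∀ m → mono (map a ds) m · LS K[ m ] (v ∷ vs) product-of a ≡ ∑ ys (λ x → mono (map (set a v x) (v ∷ ds)) m · LS K[ m ] vs product-of (set a v x))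
    distribute m = trans (sym (∑-* ys (mono (map a ds) m) _)) (∑-cong ys (λ x → trans (lem (mono (map a ds) m) (𝟙 (m x)) (LS K[ m ] vs product-of (set a v x)))
      (cong (λ xs → mono xs m · LS K[ m ] vs product-of (set a v x)) (sym (labels-kept x)))))

  -- For k vertices the alternating sum is also the k-th difference of the k-th power, that is k!.
  -- With at least k edges it would be divisible by 2 ^ k.
  few-edges : ImpL ys E → length E < length ys
  few-edges imp = ℕₚ.≰⇒> λ le → 2^k∤k! (length ys) ys>0 _ (abs-form le (alternating-divisible ys [] (λ _ → 0) ↭-refl u))
    where
    hom-value : ∀ m → mono [] m · LS K[ m ] ys product-of (λ _ → 0) ≡ pow (0ℤ ⊹ weight ys m) (length ys)
    hom-value m = trans (ℤₚ.*-identityˡ _) (trans (by (weight-ℕ ys m)) (cong (λ z → pow z (length ys)) (sym (ℤₚ.+-identityˡ (weight ys m)))))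
      where
      by : ∃[ n ] weight ys m ≡ + n × n ≤ length ys → LS K[ m ] ys product-of (λ _ → 0) ≡ pow (weight ys m) (length ys)
      by (suc n , e , l) = trans (imp K[ m ] (λ x y → τ x y , refl) (suc n) (s≤s z≤n) (≤-trans l ys≤) e (λ _ → 0)) (cong (λ z → pow z (length ys)) (sym e))
      -- `ImpL` speaks of positive masses only. A mask of mass 0 has all weights 0, and both sides
      -- vanish because there is at least one vertex.
      by (zero , e , l) = trans (vanish ys ys>0 (λ x k → weight-0 ys m e x k)) (sym (trans (cong (λ z → pow z (length ys)) e) (zero-pow (length ys) ys>0)))
        where
        zero-pow : ∀ n → 0 < n → pow 0ℤ n ≡ 0ℤ
        zero-pow (suc n) _ = ℤₚ.*-zeroˡ (pow 0ℤ n)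
        vanish : ∀ vs → 0 < length vs → (∀ x → x ∈ ys → 𝟙 (m x) ≡ 0ℤ) → LS K[ m ] vs product-of (λ _ → 0) ≡ 0ℤ
        vanish (v ∷ vs) _ z = ∑-vanish ys (λ x k → trans (cong (_· LS K[ m ] vs product-of (set (λ _ → 0) v x)) (z x k)) (ℤₚ.*-zeroˡ (LS K[ m ] vs product-of (set (λ _ → 0) v x))))
    alternating : Alt ys (λ m → mono [] m · LS K[ m ] ys product-of (λ _ → 0)) (λ _ → true) ≡ + (length ys ℕ.!)
    alternating = trans (Alt-cong ys hom-value (λ _ → true)) (trans (Alt-weight ys u (λ x → pow x (length ys)) 0ℤ (λ _ → true)) (Δ-factorial (length ys) 0ℤ))
    abs-form : (le : length ys ≤ length E) → (d : DivBy D (Alt ys (λ m → mono [] m · LS K[ m ] ys product-of (λ _ → 0)) (λ _ → true))) →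
               length ys ℕ.! ≡ 2 ^ length ys * (2 ^ (length E ∸ length ys) * ℤ.∣ proj₁ d ∣)
    abs-form le (q , r) = trans (cong ℤ.∣_∣ (trans (sym alternating) r)) (trans (ℤₚ.abs-* D q) (trans (cong (λ z → ℤ.∣ z ∣ * ℤ.∣ q ∣) (pow-2 (length E)))
      (trans (cong (λ z → 2 ^ z * ℤ.∣ q ∣) (sym (ℕₚ.m+[n∸m]≡n le))) (trans (cong (_* ℤ.∣ q ∣) (ℕₚ.^-distribˡ-+-* 2 (length ys) (length E ∸ length ys)))
        (ℕₚ.*-assoc (2 ^ length ys) (2 ^ (length E ∸ length ys)) ℤ.∣ q ∣)))))

-- Realising trees as digraphs

-- G is the graph with vertices vs and arcs E after renaming its vertices by name.
record Pres (vs : List ℕ) (E : List (ℕ × ℕ)) (G : Digraph) : Set where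
  field
    name   : Fin (size G) → ℕ
    inj   : ∀ i j → name i ≡ name j → i ≡ j
    sound : ∀ i → name i ∈ vs
    cover : ∀ {x} → x ∈ vs → ∃[ i ] name i ≡ x
    edge⁺ : ∀ i j → edge G i j ≡ true → (name i , name j) ∈ E
    edge⁻ : ∀ i j → (name i , name j) ∈ E → edge G i j ≡ true
open Pres

pres-≅ : ∀ {vs E G H} → Pres vs E G → Pres vs E H → G ≅ H
pres-≅ {vs} {E} {G} {H} P Q = record
  { to = λ i → proj₁ (there′ i) ; from = λ j → proj₁ (back j)
  ; from∘to = λ i → inj P _ _ (trans (proj₂ (back (proj₁ (there′ i)))) (proj₂ (there′ i)))
  ; to∘from = λ j → inj Q _ _ (trans (proj₂ (there′ (proj₁ (back j)))) (proj₂ (back j)))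
  ; edge-iso = λ i j → bool-ext
      (λ e → edge⁻ Q _ _ (subst (_∈ E) (sym (cong₂ _,_ (proj₂ (there′ i)) (proj₂ (there′ j)))) (edge⁺ P i j e)))
      (λ e → edge⁻ P i j (subst (_∈ E) (cong₂ _,_ (proj₂ (there′ i)) (proj₂ (there′ j))) (edge⁺ Q _ _ e))) }
  where
  there′ : ∀ i → ∃[ j ] name Q j ≡ name P i
  there′ i = cover Q (sound P i)
  back : ∀ j → ∃[ i ] name P i ≡ name Q j
  back j = cover P (sound Q j)

pres-↭ : ∀ {vs us E F G} → vs ↭ us → E ↭ F → Pres vs E G → Pres us F G
pres-↭ p q P = record { name = name P ; inj = inj P ; sound = λ i → ∈-resp-↭ p (sound P i) ; cover = λ m → cover P (∈-resp-↭ (↭-sym p) m)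
  ; edge⁺ = λ i j e → ∈-resp-↭ q (edge⁺ P i j e) ; edge⁻ = λ i j m → edge⁻ P i j (∈-resp-↭ (↭-sym q) m) }

∈-filterᵇ⁺ : {X : Set} (p : X → Bool) (xs : List X) → ∀ {x} → x ∈ xs → p x ≡ true → x ∈ filterᵇ p xs
∈-filterᵇ⁺ p (y ∷ xs) (here refl) e rewrite e = here refl
∈-filterᵇ⁺ p (y ∷ xs) (there m)   e with p y
... | true  = there (∈-filterᵇ⁺ p xs m e)
... | false = ∈-filterᵇ⁺ p xs m e

pres-labels : ∀ H → Pres (labels H) (arcs H) H
pres-labels H = record { name = Fin.toℕ ; inj = λ i j → Finₚ.toℕ-injective ; sound = λ i → ∈-tabulate⁺ i
  ; cover = λ m → let i , e = ∈-tabulate⁻ m in i , sym e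
  ; edge⁺ = λ i j e → ∈-map⁺ label (∈-filterᵇ⁺ (λ p → edge H (proj₁ p) (proj₂ p)) (allPairs (size H)) (∈-allPairs i j) e)
  ; edge⁻ = back }
  where
  back : ∀ i j → (Fin.toℕ i , Fin.toℕ j) ∈ arcs H → edge H i j ≡ true
  back i j m with ∈-map⁻ label m
  ... | (i′ , j′) , k , e = subst (λ z → edge H z j ≡ true) (Finₚ.toℕ-injective (sym (cong proj₁ e)))
        (subst (λ z → edge H i′ z ≡ true) (Finₚ.toℕ-injective (sym (cong proj₂ e))) (proj₂ (∈-filterᵇ⁻ (λ p → edge H (proj₁ p) (proj₂ p)) (allPairs (size H)) k)))

data Side (a b : ℕ) : Fin (a + b) → Set where
  lft : ∀ i → Side a b (i ↑ˡ b)
  rgt : ∀ j → Side a b (a ↑ʳ j)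

side : ∀ a b x → Side a b x
side a b x with splitAt a x in q
... | inj₁ i = subst (Side a b) (Finₚ.splitAt⁻¹-↑ˡ q) (lft i)
... | inj₂ j = subst (Side a b) (Finₚ.splitAt⁻¹-↑ʳ q) (rgt j)

module _ {xs ys : List ℕ} {E F : List (ℕ × ℕ)} {G R : Digraph} (P : Pres xs E G) (Q : Pres ys F R) (apart : ∀ {z} → z ∈ xs → z ∈ ys → ⊥) where
  private
    a = size G
    b = size R

  glued : Fin (a + b) → ℕ
  glued = glue (name P) (name Q)

  glued-ˡ : ∀ i → glued (i ↑ˡ b) ≡ name P i
  glued-ˡ = glue-ˡ (name P) (name Q)

  glued-ʳ : ∀ j → glued (a ↑ʳ j) ≡ name Q j
  glued-ʳ = glue-ʳ (name P) (name Q)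

  glued-inj : ∀ x y → glued x ≡ glued y → x ≡ y
  glued-inj x y e with side a b x | side a b y
  ... | lft i | lft j = cong (_↑ˡ b) (inj P i j (trans (sym (glued-ˡ i)) (trans e (glued-ˡ j))))
  ... | lft i | rgt j = ⊥-elim (apart (sound P i) (subst (_∈ ys) (sym (trans (sym (glued-ˡ i)) (trans e (glued-ʳ j)))) (sound Q j)))
  ... | rgt i | lft j = ⊥-elim (apart (sound P j) (subst (_∈ ys) (trans (sym (glued-ʳ i)) (trans e (glued-ˡ j))) (sound Q i)))
  ... | rgt i | rgt j = cong (a ↑ʳ_) (inj Q i j (trans (sym (glued-ʳ i)) (trans e (glued-ʳ j))))

  glued-sound : ∀ x → glued x ∈ xs ++ ys
  glued-sound x with side a b x
  ... | lft i = subst (_∈ xs ++ ys) (sym (glued-ˡ i)) (∈-++⁺ˡ (sound P i))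
  ... | rgt j = subst (_∈ xs ++ ys) (sym (glued-ʳ j)) (∈-++⁺ʳ xs (sound Q j))

  glued-cover : ∀ {z} → z ∈ xs ++ ys → ∃[ x ] glued x ≡ z
  glued-cover m with ∈-++⁻ xs m
  ... | inj₁ k = let i , e = cover P k in i ↑ˡ b , trans (glued-ˡ i) e
  ... | inj₂ k = let j , e = cover Q k in a ↑ʳ j , trans (glued-ʳ j) e

  module _ (wE : ∀ {e} → e ∈ E → proj₁ e ∈ xs × proj₂ e ∈ xs) (wF : ∀ {e} → e ∈ F → proj₁ e ∈ ys × proj₂ e ∈ ys) where

    pres-⊕ : Pres (xs ++ ys) (E ++ F) (G ⊕ R)
    pres-⊕ = record { name = glued ; inj = glued-inj ; sound = glued-sound ; cover = glued-cover ; edge⁺ = fwd ; edge⁻ = bwd }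
      where
      fwd : ∀ x y → edge (G ⊕ R) x y ≡ true → (glued x , glued y) ∈ E ++ F
      fwd x y e with side a b x | side a b y
      ... | lft i | lft j = subst (_∈ E ++ F) (sym (cong₂ _,_ (glued-ˡ i) (glued-ˡ j))) (∈-++⁺ˡ (edge⁺ P i j (trans (sym (edge-⊕-ˡˡ G R i j)) e)))
      ... | lft i | rgt j = contradiction (trans (sym e) (edge-⊕-ˡʳ G R i j)) (λ ())
      ... | rgt i | lft j = contradiction (trans (sym e) (edge-⊕-ʳˡ G R i j)) (λ ())
      ... | rgt i | rgt j = subst (_∈ E ++ F) (sym (cong₂ _,_ (glued-ʳ i) (glued-ʳ j))) (∈-++⁺ʳ E (edge⁺ Q i j (trans (sym (edge-⊕-ʳʳ G R i j)) e)))
      inE : ∀ {u v} → (u , v) ∈ E ++ F → u ∈ xs → (u , v) ∈ E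
      inE m u with ∈-++⁻ E m
      ... | inj₁ k = k
      ... | inj₂ k = ⊥-elim (apart u (proj₁ (wF k)))
      inF : ∀ {u v} → (u , v) ∈ E ++ F → u ∈ ys → (u , v) ∈ F
      inF m u with ∈-++⁻ E m
      ... | inj₁ k = ⊥-elim (apart (proj₁ (wE k)) u)
      ... | inj₂ k = k
      bwd : ∀ x y → (glued x , glued y) ∈ E ++ F → edge (G ⊕ R) x y ≡ true
      bwd x y m with side a b x | side a b y
      ... | lft i | lft j = trans (edge-⊕-ˡˡ G R i j) (edge⁻ P i j (inE (subst (_∈ E ++ F) (cong₂ _,_ (glued-ˡ i) (glued-ˡ j)) m) (sound P i)))
      ... | lft i | rgt j = ⊥-elim (apart (proj₂ (wE (inE (subst (_∈ E ++ F) (cong₂ _,_ (glued-ˡ i) (glued-ʳ j)) m) (sound P i)))) (sound Q j))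
      ... | rgt i | lft j = ⊥-elim (apart (sound P j) (proj₂ (wF (inF (subst (_∈ E ++ F) (cong₂ _,_ (glued-ʳ i) (glued-ˡ j)) m) (sound Q i)))))
      ... | rgt i | rgt j = trans (edge-⊕-ʳʳ G R i j) (edge⁻ Q i j (inF (subst (_∈ E ++ F) (cong₂ _,_ (glued-ʳ i) (glued-ʳ j)) m) (sound Q i)))

module _ {xs ys : List ℕ} {E F : List (ℕ × ℕ)} {T : Digraph} (P : Pres xs E T) (Q : Pres ys F T) (apart : ∀ {z} → z ∈ xs → z ∈ ys → ⊥)
         (wE : ∀ {e} → e ∈ E → proj₁ e ∈ xs × proj₂ e ∈ xs) (wF : ∀ {e} → e ∈ F → proj₁ e ∈ ys × proj₂ e ∈ ys) (r : Fin (size T)) where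
  private
    a = size T
    EF : List (ℕ × ℕ)
    EF = (name P r , name Q r) ∷ (E ++ F)
    g = glued P Q apart
    gˡ = glued-ˡ P Q apart
    gʳ = glued-ʳ P Q apart

  pres-mirror : Pres (xs ++ ys) EF (mirror T r)
  pres-mirror = record { name = g ; inj = glued-inj P Q apart ; sound = glued-sound P Q apart ; cover = glued-cover P Q apart ; edge⁺ = fwd ; edge⁻ = bwd }
    where
    fwd : ∀ x y → edge (mirror T r) x y ≡ true → (g x , g y) ∈ EF
    fwd x y e with side a a x | side a a y
    ... | lft i | lft j = there (subst (_∈ E ++ F) (sym (cong₂ _,_ (gˡ i) (gˡ j))) (∈-++⁺ˡ (edge⁺ P i j (trans (sym (edge-mirror-ˡˡ T r i j)) e))))
    ... | rgt i | lft j = contradiction (trans (sym e) (edge-mirror-ʳˡ T r i j)) (λ ())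
    ... | rgt i | rgt j = there (subst (_∈ E ++ F) (sym (cong₂ _,_ (gʳ i) (gʳ j))) (∈-++⁺ʳ E (edge⁺ Q i j (trans (sym (edge-mirror-ʳʳ T r i j)) e))))
    ... | lft i | rgt j with ∧⁻ ⌊ i Fin.≟ r ⌋ (trans (sym (edge-mirror-ˡʳ T r i j)) e)
    ...   | p , q = here (cong₂ _,_ (trans (gˡ i) (cong (name P) (yes⁻ (i Fin.≟ r) p))) (trans (gʳ j) (cong (name Q) (yes⁻ (j Fin.≟ r) q))))
    kinds : ∀ {u v} → (u , v) ∈ EF → (u ≡ name P r × v ≡ name Q r) ⊎ ((u , v) ∈ E ⊎ (u , v) ∈ F)
    kinds (here refl) = inj₁ (refl , refl)
    kinds (there m)   = inj₂ (∈-++⁻ E m)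
    ll : ∀ i j → (name P i , name P j) ∈ EF → edge T i j ≡ true
    ll i j m with kinds m
    ... | inj₁ (_ , e)  = ⊥-elim (apart (sound P j) (subst (_∈ ys) (sym e) (sound Q r)))
    ... | inj₂ (inj₁ k) = edge⁻ P i j k
    ... | inj₂ (inj₂ k) = ⊥-elim (apart (sound P i) (proj₁ (wF k)))
    rr : ∀ i j → (name Q i , name Q j) ∈ EF → edge T i j ≡ true
    rr i j m with kinds m
    ... | inj₁ (e , _)  = ⊥-elim (apart (sound P r) (subst (_∈ ys) e (sound Q i)))
    ... | inj₂ (inj₁ k) = ⊥-elim (apart (proj₁ (wE k)) (sound Q i))
    ... | inj₂ (inj₂ k) = edge⁻ Q i j k
    lr : ∀ i j → (name P i , name Q j) ∈ EF → ⌊ i Fin.≟ r ⌋ ∧ ⌊ j Fin.≟ r ⌋ ≡ true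
    lr i j m with kinds m
    ... | inj₁ (e , e′) = cong₂ _∧_ (yes! (i Fin.≟ r) (inj P i r e)) (yes! (j Fin.≟ r) (inj Q j r e′))
    ... | inj₂ (inj₁ k) = ⊥-elim (apart (proj₂ (wE k)) (sound Q j))
    ... | inj₂ (inj₂ k) = ⊥-elim (apart (sound P i) (proj₁ (wF k)))
    rl : ∀ i j → (name Q i , name P j) ∈ EF → ⊥
    rl i j m with kinds m
    ... | inj₁ (e , _)  = apart (sound P r) (subst (_∈ ys) e (sound Q i))
    ... | inj₂ (inj₁ k) = apart (proj₁ (wE k)) (sound Q i)
    ... | inj₂ (inj₂ k) = apart (sound P j) (proj₂ (wF k))
    bwd : ∀ x y → (g x , g y) ∈ EF → edge (mirror T r) x y ≡ true
    bwd x y m with side a a x | side a a y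
    ... | lft i | lft j = trans (edge-mirror-ˡˡ T r i j) (ll i j (subst (_∈ EF) (cong₂ _,_ (gˡ i) (gˡ j)) m))
    ... | lft i | rgt j = trans (edge-mirror-ˡʳ T r i j) (lr i j (subst (_∈ EF) (cong₂ _,_ (gˡ i) (gʳ j)) m))
    ... | rgt i | lft j = ⊥-elim (rl i j (subst (_∈ EF) (cong₂ _,_ (gʳ i) (gˡ j)) m))
    ... | rgt i | rgt j = trans (edge-mirror-ʳʳ T r i j) (rr i j (subst (_∈ EF) (cong₂ _,_ (gʳ i) (gʳ j)) m))

rename : (ℕ → ℕ) → Tr ℕ → Tr ℕ
rename σ (leaf x)     = leaf (σ x)
rename σ (join s A B) = join s (rename σ A) (rename σ B)

renameE : (ℕ → ℕ) → ℕ × ℕ → ℕ × ℕ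
renameE σ (x , y) = σ x , σ y

rt-rename : ∀ σ A → rt (rename σ A) ≡ σ (rt A)
rt-rename σ (leaf x)     = refl
rt-rename σ (join s A B) = rt-rename σ A

verts-rename : ∀ σ A → verts (rename σ A) ≡ map σ (verts A)
verts-rename σ (leaf x)     = refl
verts-rename σ (join s A B) = trans (cong₂ _++_ (verts-rename σ A) (verts-rename σ B)) (sym (Listₚ.map-++ σ (verts A) (verts B)))

arcsT-rename : ∀ σ A → arcsT (rename σ A) ≡ map (renameE σ) (arcsT A)
arcsT-rename σ (leaf x)     = refl
arcsT-rename σ (join s A B) = cong₂ _∷_ (trans (cong₂ (dir s) (rt-rename σ A) (rt-rename σ B)) (turn ⌊ s ℤ.≟ 1ℤ ⌋))
    (trans (cong₂ _++_ (arcsT-rename σ A) (arcsT-rename σ B)) (sym (Listₚ.map-++ (renameE σ) (arcsT A) (arcsT B))))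
  where
  turn : ∀ b → (if b then (σ (rt A) , σ (rt B)) else (σ (rt B) , σ (rt A))) ≡ renameE σ (if b then (rt A , rt B) else (rt B , rt A))
  turn true  = refl
  turn false = refl

rename-cong : ∀ {σ τ} A → (∀ {x} → x ∈ verts A → σ x ≡ τ x) → rename σ A ≡ rename τ A
rename-cong (leaf x)     h = cong leaf (h (here refl))
rename-cong (join s A B) h = cong₂ (join s) (rename-cong A (λ m → h (∈-++⁺ˡ m))) (rename-cong B (λ m → h (∈-++⁺ʳ (verts A) m)))

-- Since the labels of `A` are distinct, the correspondence of positions is a function of the label.
renaming-of : ∀ A B → erase A ≡ erase B → Unique (verts A) → ∃[ σ ] rename σ A ≡ B
renaming-of (leaf x)     (leaf y)       e u = (λ _ → y) , refl
renaming-of (join s A A′) (join t B B′) e u = combine (renaming-of A B (proj₁ (join-inj e)) (proj₁ (unique-++⁻ (verts A) u)))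
                                                    (renaming-of A′ B′ (proj₂ (join-inj e)) (proj₁ (proj₂ (unique-++⁻ (verts A) u)))) (sign e)
  where
  sign : ∀ {s t} {A A′ B B′ : Tr ⊤} → join s A A′ ≡ join t B B′ → s ≡ t
  sign refl = refl
  combine : ∃[ σ ] rename σ A ≡ B → ∃[ τ ] rename τ A′ ≡ B′ → s ≡ t → ∃[ ρ ] rename ρ (join s A A′) ≡ join t B B′
  combine (σ , p) (τ , q) refl = ρ , cong₂ (join s) (trans (rename-cong A on) p) (trans (rename-cong A′ off) q)
    where
    ρ : ℕ → ℕ
    ρ x = if ⌊ x ∈? verts A ⌋ then σ x else τ x
    on : ∀ {x} → x ∈ verts A → ρ x ≡ σ x
    on {x} m = cong (λ b → if b then σ x else τ x) (yes! (x ∈? verts A) m)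
    off : ∀ {x} → x ∈ verts A′ → ρ x ≡ τ x
    off {x} m = cong (λ b → if b then σ x else τ x) (no! (x ∈? verts A) (λ k → proj₂ (proj₂ (unique-++⁻ (verts A) u)) k m))

pres-rename : ∀ {vs E G} σ → Unique (map σ vs) → (∀ {e} → e ∈ E → proj₁ e ∈ vs × proj₂ e ∈ vs) → Pres vs E G → Pres (map σ vs) (map (renameE σ) E) G
pres-rename {vs} {E} {G} σ u within P = record { name = σ ∘ name P ; inj = λ i j e → inj P i j (unique-map σ vs u (sound P i) (sound P j) e)
  ; sound = λ i → ∈-map⁺ σ (sound P i) ; cover = cov ; edge⁺ = λ i j e → ∈-map⁺ (renameE σ) (edge⁺ P i j e) ; edge⁻ = bwd }
  where
  cov : ∀ {x} → x ∈ map σ vs → ∃[ i ] σ (name P i) ≡ x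
  cov m with ∈-map⁻ σ m
  ... | y , k , refl = let i , e = cover P k in i , cong σ e
  bwd : ∀ i j → (σ (name P i) , σ (name P j)) ∈ map (renameE σ) E → edge G i j ≡ true
  bwd i j m with ∈-map⁻ (renameE σ) m
  ... | (x , y) , k , e = edge⁻ P i j (subst (_∈ E) (cong₂ _,_ (unique-map σ vs u (proj₁ (within k)) (sound P i) (sym (cong proj₁ e)))
                                                             (unique-map σ vs u (proj₂ (within k)) (sound P j) (sym (cong proj₂ e)))) k)

Realised : Tr ℕ → Set
Realised S = ∃[ T ] RecBridgeMirrored T × Pres (verts S) (arcsT S) T

-- Only the first half is realised by induction. The second is presented by the same digraph under a
-- renaming, because `mirror` joins two copies of one digraph at the same root.
mirrored⇒RBM : ∀ {S} → Mirrored S → Unique (verts S) → Units S → Realised S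
mirrored⇒RBM (single {x}) u un = singleVertex , rbm-single , record
  { name = λ _ → x ; inj = λ { zero zero _ → refl } ; sound = λ _ → here refl ; cover = λ { (here refl) → zero , refl } ; edge⁺ = λ i j () ; edge⁻ = λ i j () }
mirrored⇒RBM {S} (mirrored {A = A} {B} p e mA) u un = build (mirrored⇒RBM mA uA (fst (≈-units p un))) (renaming-of A B e uA)
  where
  parts = unique-++⁻ (verts A) (unique-↭ (≈-verts p) u)
  uA = proj₁ parts
  fst : Units (join 1ℤ A B) → Units A
  fst (join _ a _) = a
  build : Realised A → ∃[ σ ] rename σ A ≡ B → Realised S
  build (T , rbm , P) (σ , q) = finish (cover P (rt∈verts A))
    where
    vB : verts B ≡ map σ (verts A)
    vB = trans (cong verts (sym q)) (verts-rename σ A)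
    aB : arcsT B ≡ map (renameE σ) (arcsT A)
    aB = trans (cong arcsT (sym q)) (arcsT-rename σ A)
    Q : Pres (map σ (verts A)) (map (renameE σ) (arcsT A)) T
    Q = pres-rename σ (subst Unique vB (proj₁ (proj₂ parts))) (arcsT-within A) P
    apart : ∀ {z} → z ∈ verts A → z ∈ map σ (verts A) → ⊥
    apart k k′ = proj₂ (proj₂ parts) k (subst (_ ∈_) (sym vB) k′)
    within : ∀ {e} → e ∈ map (renameE σ) (arcsT A) → proj₁ e ∈ map σ (verts A) × proj₂ e ∈ map σ (verts A)
    within m = subst (λ v → _ ∈ v × _ ∈ v) vB (arcsT-within B (subst (_ ∈_) (sym aB) m))
    finish : ∃[ r ] name P r ≡ rt A → Realised S
    finish (r , e′) = mirror T r , rbm-mirror rbm r , pres-↭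
      (↭-trans (↭-reflexive (cong (verts A ++_) (sym vB))) (↭-sym (≈-verts p)))
      (↭-trans (↭-reflexive (cong₂ _∷_ (cong₂ _,_ e′ (trans (cong σ e′) (trans (sym (rt-rename σ A)) (cong rt q)))) (cong (arcsT A ++_) (sym aB)))) (↭-sym (arcsT-≈ un p)))
      (pres-mirror P Q apart (arcsT-within A) within r)

-- Decomposition into components

partition-↭ : {X : Set} (p : X → Bool) (xs : List X) → xs ↭ filterᵇ p xs ++ filterᵇ (not ∘ p) xs
partition-↭ p []       = ↭-refl
partition-↭ p (x ∷ xs) with p x
... | true  = ↭-prep x (partition-↭ p xs)
... | false = ↭-trans (↭-prep x (partition-↭ p xs)) (↭-sym (shift x (filterᵇ p xs) (filterᵇ (not ∘ p) xs)))

-- Supplies the default assignment for labelled sums; mass 1 excludes an empty list of points.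
mass≡1⇒point : ∀ K → mass K ≡ 1ℤ → Ω K
mass≡1⇒point K e = go (pts K) e
  where
  go : ∀ xs → ∑ xs (w K) ≡ 1ℤ → Ω K
  go (x ∷ _) _ = x

module Decompose (h₀ : ℕ) (h₀>0 : 0 < h₀) where
  open Scale h₀ h₀>0

  Union : List ℕ → List (ℕ × ℕ) → Set
  Union vs E = ∃[ Ts ] All RecBridgeMirrored Ts × Pres vs E (⨁ Ts)

  ImpL⇒Realised : ∀ S → Unique (verts S) → Units S → sz S ≤ h₀ → ImpL (verts S) (arcsT S) → Realised S
  ImpL⇒Realised S u un l imp = mirrored⇒RBM (ImpT⇒Mirrored Λ≢0 Λ∤2 h₀ S u un l impT) u un
    where
    impT : ImpT Λ S
    impT K dv m1 = trans (sym (homL-tree K S u un a)) (trans (imp K dv 1 (s≤s z≤n) h₀>0 m1 a) (pow-1 (length (verts S))))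
      where
      a : ℕ → Ω K
      a _ = mass≡1⇒point K m1

  -- The component of the first vertex is split off. It contains the arcs of a spanning tree, and
  -- `few-edges` leaves no room for others.
  decompose : ∀ n vs E → length vs ≤ n → Unique vs → (∀ {e} → e ∈ E → proj₁ e ∈ vs × proj₂ e ∈ vs) → (∀ {e} → e ∈ E → proj₁ e ≢ proj₂ e) →
              length vs ≤ h₀ → ImpL vs E → Union vs E
  decompose n       []         E _ u within irr l imp = [] , [] , record
    { name = λ () ; inj = λ () ; sound = λ () ; cover = λ () ; edge⁺ = λ () ; edge⁻ = λ () }
  decompose (suc n) vs@(x ∷ _) E fuel u within irr l imp = assemble (ImpL⇒Realised S unique units size≤ impT) (decompose n zs E₂ zs≤n uZ within₂ irr₂ (≤-trans (ℕₚ.m≤n+m (length zs) (length (verts S))) small) imp₂)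
    where
    open Spanning (spanning vs E within x (here refl)) renaming (tree to S)
    split = unique-⊆-split {ys = vs} unique inside
    zs = proj₁ split
    p : vs ↭ verts S ++ zs
    p = proj₂ split
    u′ : Unique (verts S ++ zs)
    u′ = unique-↭ p u
    uZ = proj₁ (proj₂ (unique-++⁻ (verts S) u′))
    apart : ∀ {z} → z ∈ verts S → z ∈ zs → ⊥
    apart = proj₂ (proj₂ (unique-++⁻ (verts S) u′))
    total-length : length (verts S) + length zs ≡ length vs
    total-length = trans (sym (Listₚ.length-++ (verts S))) (sym (↭-length p))
    small : length (verts S) + length zs ≤ h₀
    small = subst (_≤ h₀) (sym total-length) l
    size≤ : sz S ≤ h₀
    size≤ = subst (_≤ h₀) (length-verts S) (≤-trans (ℕₚ.m≤m+n (length (verts S)) (length zs)) small)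
    verts>0 : 0 < length (verts S)
    verts>0 = subst (0 <_) (sym (length-verts S)) (sz>0 S)
    zs≤n : length zs ≤ n
    zs≤n = ℕₚ.≤-pred (≤-trans (ℕₚ.+-monoˡ-≤ (length zs) verts>0) (≤-trans (ℕₚ.≤-reflexive total-length) fuel))
    starts : ℕ × ℕ → Bool
    starts e = ⌊ proj₁ e ∈? verts S ⌋
    E₁ = filterᵇ starts E
    E₂ = filterᵇ (not ∘ starts) E
    q : E ↭ E₁ ++ E₂
    q = partition-↭ starts E
    within₁ : ∀ {e} → e ∈ E₁ → proj₁ e ∈ verts S × proj₂ e ∈ verts S
    within₁ {e} m with ∈-filterᵇ⁻ starts E m
    ... | k , t = yes⁻ (proj₁ e ∈? verts S) t , proj₁ (closed k) (yes⁻ (proj₁ e ∈? verts S) t)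
    within₂ : ∀ {e} → e ∈ E₂ → proj₁ e ∈ zs × proj₂ e ∈ zs
    within₂ {e} m with ∈-filterᵇ⁻ (not ∘ starts) E m
    ... | k , t = rest (proj₁ (within k)) out , rest (proj₂ (within k)) (λ z → out (proj₂ (closed k) z))
      where
      out : proj₁ e ∉ verts S
      out z = contradiction (trans (sym t) (cong not (yes! (proj₁ e ∈? verts S) z))) (λ ())
      rest : ∀ {z} → z ∈ vs → z ∉ verts S → z ∈ zs
      rest v o with ∈-++⁻ (verts S) (∈-resp-↭ p v)
      ... | inj₁ k = contradiction k o
      ... | inj₂ k = k
    irr₂ : ∀ {e} → e ∈ E₂ → proj₁ e ≢ proj₂ e
    irr₂ m = irr (proj₁ (∈-filterᵇ⁻ (not ∘ starts) E m))
    imp′ : ImpL (verts S ++ zs) (E₁ ++ E₂)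
    imp′ = ImpL-↭ p q u imp
    imp₁ : ImpL (verts S) E₁
    imp₁ = ImpL-ˡ (verts S) zs u′ small within₁ within₂ imp′
    imp₂ : ImpL zs E₂
    imp₂ = ImpL-ʳ (verts S) zs u′ small within₁ within₂ imp′
    tree-arcs : E₁ ↭ arcsT S
    tree-arcs = unique-⊆-full⇒↭ (arcsT-unique S unique) sub (ℕₚ.≤-pred (≤-trans
      (Excess.few-edges h₀ h₀>0 (verts S) unique (≤-trans (ℕₚ.m≤m+n (length (verts S)) (length zs)) small) verts>0 E₁ within₁ (λ m → irr (proj₁ (∈-filterᵇ⁻ starts E m))) imp₁)
      (ℕₚ.≤-reflexive (trans (length-verts S) (sym (arcsT-length S))))))
      where
      sub : ∀ {e} → e ∈ arcsT S → e ∈ E₁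
      sub {e} m = ∈-filterᵇ⁺ starts E (edges m) (yes! (proj₁ e ∈? verts S) (proj₁ (arcsT-within S m)))
    impT : ImpL (verts S) (arcsT S)
    impT = ImpL-↭ ↭-refl tree-arcs unique imp₁
    assemble : Realised S → Union zs E₂ → Union vs E
    assemble (T , rbm , P) (Ts , rbms , R) = T ∷ Ts , rbm ∷ rbms ,
      pres-↭ (↭-sym p) (↭-sym q) (pres-⊕ (pres-↭ ↭-refl (↭-sym tree-arcs) P) R apart within₁ within₂)

  impartial⇒union : ∀ H → IsOriented H → Impartial H → size H ≤ h₀ → IsDisjointUnionOfRBM H
  impartial⇒union H o imp l = conclude (decompose (size H) (labels H) (arcs H) (ℕₚ.≤-reflexive len) labels-unique within irr
      (≤-trans (ℕₚ.≤-reflexive len) l) (impartial⇒ImpL H o imp))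
    where
    len : length (labels H) ≡ size H
    len = Listₚ.length-tabulate {n = size H} Fin.toℕ
    labels-unique : Unique (labels H)
    labels-unique = Uniqueₚ.tabulate⁺ Finₚ.toℕ-injective
    within : ∀ {e} → e ∈ arcs H → proj₁ e ∈ labels H × proj₂ e ∈ labels H
    within m with ∈-map⁻ label m
    ... | (i , j) , k , refl = ∈-tabulate⁺ i , ∈-tabulate⁺ j
    irr : ∀ {e} → e ∈ arcs H → proj₁ e ≢ proj₂ e
    irr m with ∈-map⁻ label m
    ... | (i , j) , k , refl = λ e → contradiction (trans (sym (proj₂ (∈-filterᵇ⁻ (λ p → edge H (proj₁ p) (proj₂ p)) (allPairs (size H)) k)))
          (subst (λ z → edge H i z ≡ false) (Finₚ.toℕ-injective e) (proj₁ o i))) (λ ())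
    conclude : Union (labels H) (arcs H) → IsDisjointUnionOfRBM H
    conclude (Ts , rbms , P) = Ts , rbms , pres-≅ (pres-labels H) P

theorem1p4 : (H : Digraph) → IsOriented H → (Impartial H ⇔ IsDisjointUnionOfRBM H)
-- The bound is `suc (size H)` so that it is positive for the empty digraph as well.
theorem1p4 H o = mk⇔ (λ imp → Decompose.impartial⇒union (suc (size H)) (s≤s z≤n) H o imp (ℕₚ.n≤1+n (size H)))
  (λ (Ts , rbms , iso) → neutral⇒impartial H o (neutral-iso iso (neutral-⨁ Ts rbms)))
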